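{- Let $d$ be a positive square-free integer, let $\mathcal{O}_d$ denote the ring of integers of $\mathbb{Q}(\sqrt{ -d})$, and let $t\in \mathcal{O}_d$ with $|t|\geq 100$. Then every solution $(x,y)\in\mathcal{O}_d^2$ of the inequality \[ |F_t(x,y)| = |x^4 - t x^3 y - 6 x^2 y^2 + t x y^3 + y^4| \leq 1 \] is trivial, i.e.\ of the shape $(0,0)$, $(\xi,0)$ or $(0,\xi)$, where $\xi$ is a root of unity in $\mathcal{O}_d$.
   Context: $|\cdot|$ denotes the usual complex absolute value. -}

module Defs where

open import Data.Nat as ℕ using (ℕ; zero; suc; _%_; _/_; _≡ᵇ_)
open import Data.Nat.Divisibility using (_∣_)
open import Data.Integer using (ℤ; +_; _+_; _-_; _*_; -_; _≤_)
open import Data.Bool using (if_then_else_)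
open import Data.Product using (∃; _×_)
open import Data.Sum using (_⊎_)
open import Relation.Binary.PropositionalEquality using (_≡_)

SquareFree : ℕ → Set
SquareFree d = ∀ (p : ℕ) → p ℕ.* p ∣ d → p ≡ 1

-- Ring of integers 𝒪_d of ℚ(√-d), d square-free positive, has ℤ-basis {1, ω} with
--   ω = (1 + √-d)/2  if d ≡ 3 (mod 4)   (i.e. -d ≡ 1 mod 4)
--   ω = √-d          otherwise.
-- ω satisfies ω² = tr·ω - nm where tr = ω + ω̄, nm = ω ω̄.
tr : ℕ → ℤ
tr d = if d % 4 ≡ᵇ 3 then + 1 else + 0

nm : ℕ → ℤ
nm d = if d % 4 ≡ᵇ 3 then + ((d ℕ.+ 1) / 4) else + d

record 𝒪 : Set where
  constructor _+_ω
  field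
    re : ℤ
    im : ℤ
open 𝒪 public

zeroO : 𝒪
zeroO = (+ 0) + (+ 0) ω

oneO : 𝒪
oneO = (+ 1) + (+ 0) ω

fromℤ : ℤ → 𝒪
fromℤ n = n + (+ 0) ω

addO : 𝒪 → 𝒪 → 𝒪
addO (a + b ω) (c + e ω) = (a + c) + (b + e) ω

negO : 𝒪 → 𝒪
negO (a + b ω) = (- a) + (- b) ω

subO : 𝒪 → 𝒪 → 𝒪
subO x y = addO x (negO y)

-- (a + bω)(c + eω) = ac + (ae + bc)ω + be ω²,  ω² = tr ω - nm
mulO : ℕ → 𝒪 → 𝒪 → 𝒪
mulO d (a + b ω) (c + e ω) =
  (a * c - b * e * nm d) + (a * e + b * c + b * e * tr d) ω

powO : ℕ → 𝒪 → ℕ → 𝒪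
powO d x zero = oneO
powO d x (suc n) = mulO d x (powO d x n)

-- |a + bω|² = (a + bω)(a + bω̄) = a² + tr·ab + nm·b²  (the complex absolute value squared)
absSq : ℕ → 𝒪 → ℤ
absSq d (a + b ω) = a * a + tr d * a * b + nm d * b * b

RootOfUnity : ℕ → 𝒪 → Set
RootOfUnity d ξ = ∃ λ (n : ℕ) → (1 ℕ.≤ n) × (powO d ξ n ≡ oneO)

F : ℕ → 𝒪 → 𝒪 → 𝒪 → 𝒪
F d t x y =
  addO (subO (subO (powO d x 4) (mulO d t (mulO d (powO d x 3) y)))
             (mulO d (fromℤ (+ 6)) (mulO d (powO d x 2) (powO d y 2))))
       (addO (mulO d t (mulO d x (powO d y 3))) (powO d y 4))

Trivial : ℕ → 𝒪 → 𝒪 → Set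
Trivial d x y =
  (x ≡ zeroO × y ≡ zeroO)
  ⊎ ((RootOfUnity d x × y ≡ zeroO)
  ⊎ (x ≡ zeroO × RootOfUnity d y))

{-# OPTIONS --safe #-}
-- The hypergeometric method, run through a three-term recurrence. Put a = x⁴ − 6x²y² + y⁴ and
-- b = xy(x² − y²), so that F_t(x, y) = a − t b, and let Z₀ = y, Z₁ = b x − a y,
-- Z_{n+2} = (4n+3)(4n+5) b² Z_n − (2n+3) a Z_{n+1}. With u, v = x ± iy and α, γ = ia ± 4b one has
-- X_n(α, γ) v − X_n(γ, α) u = −2i (−8i)ⁿ Z_n, where X_n is the homogeneous Padé numerator for the
-- fourth root. Since α = iv⁴ and γ = iu⁴, the left side vanishes to order 2n + 1 at u = v, which bounds
-- Z_n crudely; among the solutions of the recurrence only a rapidly decaying one obeys this bound for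
-- all n, so Z_n is in fact very small. Running the recurrence instead from a = t, b = 1 gives
-- Y_n ∈ 𝒪_d, no two consecutive ones vanishing, and bⁿ Y_n is close to Z_n because a − t b is small.
-- The coefficients of X_n have a large common factor, which after removal of powers of 2 divides Y_n,
-- so |Y_n| is bounded below when Y_n ≠ 0. An index n chosen according to the size of y gives a
-- contradiction. The symmetries (x, y) ↦ (−y, x) and (x, y) ↦ (x − y, x + y), the latter multiplying
-- F by −4, reduce to the case where x / y is close to t.
module Submission where

-- All sizes are squared absolute values `N`, which are natural numbers, so no real number occurs.
-- Losses are controlled by k N(x + y) ≤ (k + 1)(N x + k N y), with k large when y is only an error.
-- Put U = x² - y² and V = xy. Then a = U² - 4V² and b = UV, so F_t = U² - tUV - 4V². Either U is
-- close to tV, or U is close to -4V/t; the second symmetry sends (U, V) to (-4V, U) and so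
-- exchanges the two cases. The crude bound need not show that Z_n is small. It only has to grow
-- more slowly than the growing solutions of the recurrence, by a factor 4 per step in `N`, and this
-- is where |t| ≥ 100 is almost used up. Up to constants to the power n, an index n is usable when y
-- is small against tⁿ, which makes Z_n negligible, and y³ is large against the (n - 4)-th power of
-- t, which makes bⁿ Y_n - Z_n negligible. Indices are used in pairs n, n + 1 because one of the two
-- Y may vanish, and the ranges of y for these pairs overlap.

module Algebras where
  open import Level using (0ℓ)
  open import Algebra.Bundles using (CommutativeRing)
  open import Algebra.Structures using (IsCommutativeRing)
  open import Data.Maybe.Base using (Maybe; just; nothing)
  open import Data.Nat.Base as ℕ using (ℕ; zero; suc)
  open import Data.Integer.Base as ℤ using (ℤ; +_)
  import Data.Integer.Properties as ℤ
  import Algebra.Solver.Ring as RingSolver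
  open import Algebra.Solver.Ring.AlmostCommutativeRing using (fromCommutativeRing; _-Raw-AlmostCommutative⟶_)
  open import Relation.Nullary using (yes; no)
  open import Relation.Binary.PropositionalEquality

  -- One interface for ℤ, the ring of integers and its extension by i. The ring solver takes its
  -- coefficients from ℤ through `ι`, so integer constants are recognised in each of these rings.
  record ℤAlgebra : Set₁ where
    infixl 6 _+_ _-_
    infixl 7 _*_
    infix 8 -_
    field
      Carrier : Set
      _+_ _*_ : Carrier → Carrier → Carrier
      -_ : Carrier → Carrier
      0# 1# : Carrier
      isCommutativeRing : IsCommutativeRing _≡_ _+_ _*_ -_ 0# 1#
      ι : ℤ → Carrier
      ι-+ : ∀ m n → ι (m ℤ.+ n) ≡ ι m + ι n
      ι-* : ∀ m n → ι (m ℤ.* n) ≡ ι m * ι n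
      ι-neg : ∀ m → ι (ℤ.- m) ≡ - ι m
      ι-0 : ι (+ 0) ≡ 0#
      ι-1 : ι (+ 1) ≡ 1#

    _-_ : Carrier → Carrier → Carrier
    x - y = x + - y

    infixr 8 _^_
    _^_ : Carrier → ℕ → Carrier
    x ^ zero = 1#
    x ^ suc n = x * x ^ n

    commutativeRing : CommutativeRing 0ℓ 0ℓ
    commutativeRing = record { isCommutativeRing = isCommutativeRing }

    open IsCommutativeRing isCommutativeRing public
      using (+-congˡ; +-congʳ; *-congˡ; *-congʳ; +-assoc; +-comm; +-identityˡ; +-identityʳ; *-assoc; *-comm; *-identityˡ; *-identityʳ; distribˡ; distribʳ; zeroˡ; zeroʳ; -‿inverseʳ; -‿inverseˡ)

    private
      morphism : CommutativeRing.rawRing ℤ.+-*-commutativeRing -Raw-AlmostCommutative⟶ fromCommutativeRing commutativeRing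
      morphism = record
        { ⟦_⟧ = ι ; +-homo = ι-+ ; *-homo = ι-* ; -‿homo = ι-neg ; 0-homo = ι-0 ; 1-homo = ι-1 }

      ≟ι : ∀ m n → Maybe (ι m ≡ ι n)
      ≟ι m n with m ℤ.≟ n
      ... | yes eq = just (cong ι eq)
      ... | no _ = nothing

    module Solver = RingSolver (CommutativeRing.rawRing ℤ.+-*-commutativeRing) (fromCommutativeRing commutativeRing) morphism ≟ι

-- Opaque numerals and a semiring solver that computes with them

module Numerals where
  open import Data.Maybe.Base using (Maybe; just; nothing)
  open import Data.Nat.Base
  import Data.Nat.Properties as ℕ
  import Algebra.Solver.Ring as RingSolver
  open import Algebra.Solver.Ring.AlmostCommutativeRing using (fromCommutativeSemiring; _-Raw-AlmostCommutative⟶_; AlmostCommutativeRing)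
  open import Relation.Nullary using (yes; no)
  open import Relation.Binary.PropositionalEquality

  -- Numerals behind an opaque identity, since the type checker would unfold large literals to unary in products.
  opaque
    K : ℕ → ℕ
    K n = n

    K≡ : ∀ n → K n ≡ n
    K≡ n = refl

    K-+ : ∀ m n → K (m + n) ≡ K m + K n
    K-+ m n = refl
    K-* : ∀ m n → K (m * n) ≡ K m * K n
    K-* m n = refl

  private
    R = fromCommutativeSemiring ℕ.+-*-commutativeSemiring
    morphism : AlmostCommutativeRing.rawRing R -Raw-AlmostCommutative⟶ R
    morphism = record
      { ⟦_⟧ = K ; +-homo = K-+ ; *-homo = K-* ; -‿homo = λ _ → refl ; 0-homo = K≡ 0 ; 1-homo = K≡ 1 }
    ≟K : ∀ m n → Maybe (K m ≡ K n)
    ≟K m n with m ℕ.≟ n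
    ... | yes eq = just (cong K eq)
    ... | no _ = nothing

  module KSolver = RingSolver (AlmostCommutativeRing.rawRing R) R morphism ≟K

-- Integral Padé coefficients for the fourth root and their recurrence

module Coefficients where
  open import Data.Nat.Base
  open import Data.Nat.Properties
  open import Data.Nat.Combinatorics using (_C_; nCk≡n!/k![n-k]!; k![n∸k]!∣n!)
  open import Data.Nat.DivMod using (m/n*n≡m)
  open import Data.Nat.Solver using (module +-*-Solver)
  open import Relation.Binary.PropositionalEquality
  open +-*-Solver

  infix 9 _!!
  -- This is 1 · 3 · ... · (2n - 1), the product of the first n odd numbers, and not the usual
  -- double factorial of n.
  _!! : ℕ → ℕ
  zero !! = 1
  suc n !! = suc (2 * n) * n !!

  -- 3 · 7 · ... · (4n - 1) and 5 · 9 · ... · (4n + 1): 4ⁿ times the rising factorials of 3/4 and of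
  -- 5/4.
  prod⁻ prod⁺ : ℕ → ℕ
  prod⁻ zero = 1
  prod⁻ (suc n) = (4 * n + 3) * prod⁻ n
  prod⁺ zero = 1
  prod⁺ (suc n) = (4 * n + 5) * prod⁺ n

  rise⁻ rise⁺ : ℕ → ℕ → ℕ
  rise⁻ k zero = 1
  rise⁻ k (suc l) = (4 * (k + l) + 3) * rise⁻ k l
  rise⁺ l zero = 1
  rise⁺ l (suc k) = (4 * (l + k) + 5) * rise⁺ l k

  -- On the coefficients of a form in x and y these are multiplication by y and by x. A recurrence
  -- between forms can thus be stated coefficient by coefficient in ℕ.
  shiftʳ shiftˡ : (ℕ → ℕ → ℕ) → ℕ → ℕ → ℕ
  shiftʳ c k zero = 0
  shiftʳ c k (suc l) = c k l
  shiftˡ c zero l = 0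
  shiftˡ c (suc k) l = c k l

  -- The factor by which n! · `prod⁻ n` · `prod⁺ n` grows from n to n + 1.
  h : ℕ → ℕ
  h n = suc n * (4 * n + 3) * (4 * n + 5)

  *-nonZero : ∀ {m n} → NonZero m → NonZero n → NonZero (m * n)
  *-nonZero {m} {n} p q = m*n≢0 m n {{p}} {{q}}

  +suc-nonZero : ∀ m {n} → NonZero (m + suc n)
  +suc-nonZero m = ≢-nonZero (m+1+n≢0 m)

  ^-distrib-* : ∀ a b m → (a * b) ^ m ≡ a ^ m * b ^ m
  ^-distrib-* a b zero = refl
  ^-distrib-* a b (suc m) = trans (cong (a * b *_) (^-distrib-* a b m)) (solve 4 (λ a b c d → a :* b :* (c :* d) := a :* c :* (b :* d)) refl a b (a ^ m) (b ^ m))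

  !!-nonZero : ∀ n → NonZero (n !!)
  !!-nonZero zero = _
  !!-nonZero (suc n) = *-nonZero {suc (2 * n)} _ (!!-nonZero n)

  prod⁻-nonZero : ∀ n → NonZero (prod⁻ n)
  prod⁻-nonZero zero = _
  prod⁻-nonZero (suc n) = *-nonZero (+suc-nonZero (4 * n)) (prod⁻-nonZero n)

  prod⁺-nonZero : ∀ n → NonZero (prod⁺ n)
  prod⁺-nonZero zero = _
  prod⁺-nonZero (suc n) = *-nonZero (+suc-nonZero (4 * n)) (prod⁺-nonZero n)

  C-factorial : ∀ k l → ((k + l) C k) * (k ! * l !) ≡ (k + l) !
  C-factorial k l with nCk≡n!/k![n-k]! {k + l} {k} (m≤m+n k l) | k![n∸k]!∣n! {k + l} {k} (m≤m+n k l)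
  ... | eq | dvd rewrite m+n∸m≡n k l = trans (cong (_* (k ! * l !)) eq) (m/n*n≡m {{k !* l !≢0}} dvd)

  prod⁻-rise : ∀ k l → prod⁻ k * rise⁻ k l ≡ prod⁻ (k + l)
  prod⁻-rise k zero rewrite +-identityʳ k = *-identityʳ _
  prod⁻-rise k (suc l) rewrite +-suc k l | sym (prod⁻-rise k l) =
    solve 3 (λ a b c → a :* (b :* c) := b :* (a :* c)) refl (prod⁻ k) (4 * (k + l) + 3) (rise⁻ k l)

  prod⁺-rise : ∀ l k → prod⁺ l * rise⁺ l k ≡ prod⁺ (l + k)
  prod⁺-rise l zero rewrite +-identityʳ l = *-identityʳ _
  prod⁺-rise l (suc k) rewrite +-suc l k | sym (prod⁺-rise l k) =
    solve 3 (λ a b c → a :* (b :* c) := b :* (a :* c)) refl (prod⁺ l) (4 * (l + k) + 5) (rise⁺ l k)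

  opaque
    -- With n = k + l this is 4ⁿ n! times the generalised binomials C(n - 1/4, l) and C(n + 1/4, k),
    -- that is, the Padé coefficients for the exponent 1/4 cleared of denominators. Written as a
    -- product of integers it involves no division.
    coef : ℕ → ℕ → ℕ
    coef k l = ((k + l) C k) * (rise⁻ k l * rise⁺ l k)

    -- Once the denominators are multiplied back in, only k + l remains on the right. Comparing two
    -- such products gives the relations between neighbouring coefficients.
    coef-factorial : ∀ k l → coef k l * (k ! * prod⁻ k * (l ! * prod⁺ l)) ≡ (k + l) ! * prod⁻ (k + l) * prod⁺ (k + l)
    coef-factorial k l = begin
      coef k l * (k ! * prod⁻ k * (l ! * prod⁺ l))
        ≡⟨ solve 7 (λ c a b k! l! p q → c :* (a :* b) :* (k! :* p :* (l! :* q)) := c :* (k! :* l!) :* (p :* a) :* (q :* b)) refl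
            ((k + l) C k) (rise⁻ k l) (rise⁺ l k) (k !) (l !) (prod⁻ k) (prod⁺ l) ⟩
      ((k + l) C k) * (k ! * l !) * (prod⁻ k * rise⁻ k l) * (prod⁺ l * rise⁺ l k)
        ≡⟨ cong₂ _*_ (cong₂ _*_ (C-factorial k l) (prod⁻-rise k l)) (trans (prod⁺-rise l k) (cong prod⁺ (+-comm l k))) ⟩
      (k + l) ! * prod⁻ (k + l) * prod⁺ (k + l) ∎
      where open ≡-Reasoning

    coef-! : ∀ k l → coef k l * (k ! * l !) ≡ (k + l) ! * (rise⁻ k l * rise⁺ l k)
    coef-! k l = trans (solve 3 (λ c r f → c :* r :* f := c :* f :* r) refl ((k + l) C k) (rise⁻ k l * rise⁺ l k) (k ! * l !))
      (cong (_* (rise⁻ k l * rise⁺ l k)) (C-factorial k l))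

  private
    cancel : ∀ k l {a b} → a * (k ! * prod⁻ k * (l ! * prod⁺ l)) ≡ b * (k ! * prod⁻ k * (l ! * prod⁺ l)) → a ≡ b
    cancel k l {a} {b} = *-cancelʳ-≡ a b (k ! * prod⁻ k * (l ! * prod⁺ l))
      {{*-nonZero (*-nonZero (k !≢0) (prod⁻-nonZero k)) (*-nonZero (l !≢0) (prod⁺-nonZero l))}}

  coef-sucˡ : ∀ k l → suc k * (4 * k + 3) * coef (suc k) l ≡ h (k + l) * coef k l
  coef-sucˡ k l = cancel k l (begin
    suc k * (4 * k + 3) * coef (suc k) l * (k ! * prod⁻ k * (l ! * prod⁺ l))
      ≡⟨ solve 6 (λ a b c k! p y → a :* b :* c :* (k! :* p :* y) := c :* (a :* k! :* (b :* p) :* y)) refl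
          (suc k) (4 * k + 3) (coef (suc k) l) (k !) (prod⁻ k) (l ! * prod⁺ l) ⟩
    coef (suc k) l * (suc k ! * prod⁻ (suc k) * (l ! * prod⁺ l))
      ≡⟨ coef-factorial (suc k) l ⟩
    suc (k + l) ! * prod⁻ (suc (k + l)) * prod⁺ (suc (k + l))
      ≡⟨ solve 6 (λ a b c x y z → a :* x :* (b :* y) :* (c :* z) := a :* b :* c :* (x :* y :* z)) refl
           (suc (k + l)) (4 * (k + l) + 3) (4 * (k + l) + 5) ((k + l) !) (prod⁻ (k + l)) (prod⁺ (k + l)) ⟩
    h (k + l) * ((k + l) ! * prod⁻ (k + l) * prod⁺ (k + l))
      ≡⟨ cong (h (k + l) *_) (coef-factorial k l) ⟨
    h (k + l) * (coef k l * (k ! * prod⁻ k * (l ! * prod⁺ l)))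
      ≡⟨ *-assoc (h (k + l)) _ _ ⟨
    h (k + l) * coef k l * (k ! * prod⁻ k * (l ! * prod⁺ l)) ∎)
    where open ≡-Reasoning

  coef-sucʳ : ∀ k l → suc l * (4 * l + 5) * coef k (suc l) ≡ h (k + l) * coef k l
  coef-sucʳ k l = cancel k l (begin
    suc l * (4 * l + 5) * coef k (suc l) * (k ! * prod⁻ k * (l ! * prod⁺ l))
      ≡⟨ solve 6 (λ a b c l! p y → a :* b :* c :* (y :* (l! :* p)) := c :* (y :* (a :* l! :* (b :* p)))) refl
          (suc l) (4 * l + 5) (coef k (suc l)) (l !) (prod⁺ l) (k ! * prod⁻ k) ⟩
    coef k (suc l) * (k ! * prod⁻ k * (suc l ! * prod⁺ (suc l)))
      ≡⟨ coef-factorial k (suc l) ⟩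
    (k + suc l) ! * prod⁻ (k + suc l) * prod⁺ (k + suc l)
      ≡⟨ cong (λ n → n ! * prod⁻ n * prod⁺ n) (+-suc k l) ⟩
    suc (k + l) ! * prod⁻ (suc (k + l)) * prod⁺ (suc (k + l))
      ≡⟨ solve 6 (λ a b c x y z → a :* x :* (b :* y) :* (c :* z) := a :* b :* c :* (x :* y :* z)) refl
           (suc (k + l)) (4 * (k + l) + 3) (4 * (k + l) + 5) ((k + l) !) (prod⁻ (k + l)) (prod⁺ (k + l)) ⟩
    h (k + l) * ((k + l) ! * prod⁻ (k + l) * prod⁺ (k + l))
      ≡⟨ cong (h (k + l) *_) (coef-factorial k l) ⟨
    h (k + l) * (coef k l * (k ! * prod⁻ k * (l ! * prod⁺ l)))
      ≡⟨ *-assoc (h (k + l)) _ _ ⟨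
    h (k + l) * coef k l * (k ! * prod⁻ k * (l ! * prod⁺ l)) ∎)
    where open ≡-Reasoning

  coef-0ˡ : ∀ l → coef 0 l ≡ prod⁻ l
  coef-0ˡ l = *-cancelʳ-≡ _ _ (l ! * prod⁺ l) {{*-nonZero (l !≢0) (prod⁺-nonZero l)}} (begin
    coef 0 l * (l ! * prod⁺ l) ≡⟨ cong (coef 0 l *_) (*-identityˡ _) ⟨
    coef 0 l * (0 ! * prod⁻ 0 * (l ! * prod⁺ l)) ≡⟨ coef-factorial 0 l ⟩
    l ! * prod⁻ l * prod⁺ l ≡⟨ solve 3 (λ a b c → a :* b :* c := b :* (a :* c)) refl (l !) (prod⁻ l) (prod⁺ l) ⟩
    prod⁻ l * (l ! * prod⁺ l) ∎)
    where open ≡-Reasoning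

  coef-0ʳ : ∀ k → coef k 0 ≡ prod⁺ k
  coef-0ʳ k = *-cancelʳ-≡ _ _ (k ! * prod⁻ k) {{*-nonZero (k !≢0) (prod⁻-nonZero k)}} (begin
    coef k 0 * (k ! * prod⁻ k) ≡⟨ cong (coef k 0 *_) (*-identityʳ _) ⟨
    coef k 0 * (k ! * prod⁻ k * (0 ! * prod⁺ 0)) ≡⟨ coef-factorial k 0 ⟩
    (k + 0) ! * prod⁻ (k + 0) * prod⁺ (k + 0) ≡⟨ cong (λ n → n ! * prod⁻ n * prod⁺ n) (+-identityʳ k) ⟩
    k ! * prod⁻ k * prod⁺ k ≡⟨ *-comm _ (prod⁺ k) ⟩
    prod⁺ k * (k ! * prod⁻ k) ∎)
    where open ≡-Reasoning

  coef-shiftʳ : ∀ k l → l * (4 * l + 1) * coef k l ≡ h (pred (k + l)) * shiftʳ coef k l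
  coef-shiftʳ k zero = sym (*-zeroʳ (h (pred (k + 0))))
  coef-shiftʳ k (suc l) = begin
    suc l * (4 * suc l + 1) * coef k (suc l)
      ≡⟨ cong (λ x → suc l * x * coef k (suc l)) (solve 1 (λ l → con 4 :* (con 1 :+ l) :+ con 1 := con 4 :* l :+ con 5) refl l) ⟩
    suc l * (4 * l + 5) * coef k (suc l) ≡⟨ coef-sucʳ k l ⟩
    h (k + l) * coef k l ≡⟨ cong (λ n → h (pred n) * coef k l) (+-suc k l) ⟨
    h (pred (k + suc l)) * coef k l ∎
    where open ≡-Reasoning

  -- k (4k - 1), the truncated subtraction being harmless.
  node⁻ : ℕ → ℕ
  node⁻ zero = 0
  node⁻ (suc k) = suc k * (4 * k + 3)

  coef-shiftˡ : ∀ k l → node⁻ k * coef k l ≡ h (pred (k + l)) * shiftˡ coef k l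
  coef-shiftˡ zero l = sym (*-zeroʳ (h (pred l)))
  coef-shiftˡ (suc k) l = coef-sucˡ k l

  private
    shiftʳʳ : ∀ k l → suc k * (4 * k + 3) * shiftʳ (shiftʳ coef) (suc k) (suc l) ≡ l * (4 * l + 1) * coef k l
    shiftʳʳ k zero = *-zeroʳ (suc k * (4 * k + 3))
    shiftʳʳ k (suc l) = trans (coef-sucˡ k l) (trans (cong (λ n → h (pred n) * coef k l) (sym (+-suc k l))) (sym (coef-shiftʳ k (suc l))))

    shiftˡˡ : ∀ k l → suc l * (4 * l + 5) * shiftˡ (shiftˡ coef) (suc k) (suc l) ≡ node⁻ k * coef k l
    shiftˡˡ zero l = *-zeroʳ (suc l * (4 * l + 5))
    shiftˡˡ (suc k) l = trans (coef-sucʳ k l) (sym (coef-shiftˡ (suc k) l))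

    -- The recurrence at an interior position with denominators cleared and `coef k l` divided out:
    -- all the coefficients in it are rational multiples of that one. The case k = 0 is separate
    -- because `node⁻` is defined by cases.
    node⁻-poly : ∀ k l → h (suc (k + l)) * h (k + l) + (4 * (k + l) + 3) * (4 * (k + l) + 5) *
        (l * (4 * l + 1) * (suc l * (4 * l + 5)) + node⁻ k * (suc k * (4 * k + 3)))
      ≡ 4 * (2 * (k + l) + 3) * h (k + l) * (suc l * (4 * l + 5) + suc k * (4 * k + 3))
        + 2 * ((4 * (k + l) + 3) * (4 * (k + l) + 5)) * (suc k * (4 * k + 3) * (suc l * (4 * l + 5)))
    node⁻-poly zero l = solve 1 (λ l →
        let H = λ n → (con 1 :+ n) :* (con 4 :* n :+ con 3) :* (con 4 :* n :+ con 5) in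
        H (con 1 :+ l) :* H l :+ (con 4 :* l :+ con 3) :* (con 4 :* l :+ con 5) :*
        (l :* (con 4 :* l :+ con 1) :* ((con 1 :+ l) :* (con 4 :* l :+ con 5)) :+ con 0)
      := con 4 :* (con 2 :* l :+ con 3) :* H l :* ((con 1 :+ l) :* (con 4 :* l :+ con 5) :+ con 1 :* con 3)
        :+ con 2 :* ((con 4 :* l :+ con 3) :* (con 4 :* l :+ con 5)) :* (con 1 :* con 3 :* ((con 1 :+ l) :* (con 4 :* l :+ con 5)))) refl l
    node⁻-poly (suc k) l = solve 2 (λ k l →
        let H = λ n → (con 1 :+ n) :* (con 4 :* n :+ con 3) :* (con 4 :* n :+ con 5)
            k′ = con 1 :+ k
            n = con 1 :+ (k :+ l) in
        H (con 1 :+ n) :* H n :+ (con 4 :* n :+ con 3) :* (con 4 :* n :+ con 5) :*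
        (l :* (con 4 :* l :+ con 1) :* ((con 1 :+ l) :* (con 4 :* l :+ con 5)) :+ (k′ :* (con 4 :* k :+ con 3)) :* ((con 1 :+ k′) :* (con 4 :* k′ :+ con 3)))
      := con 4 :* (con 2 :* n :+ con 3) :* H n :* ((con 1 :+ l) :* (con 4 :* l :+ con 5) :+ (con 1 :+ k′) :* (con 4 :* k′ :+ con 3))
        :+ con 2 :* ((con 4 :* n :+ con 3) :* (con 4 :* n :+ con 5)) :* ((con 1 :+ k′) :* (con 4 :* k′ :+ con 3) :* ((con 1 :+ l) :* (con 4 :* l :+ con 5)))) refl k l

  -- Coefficient form of X_{n+2} = 4(2n + 3)(x + y) X_{n+1} - (4n + 3)(4n + 5)(x - y)² X_n, with x²
  -- and y² moved to the left to avoid subtraction. On the boundary only `prod⁻` or `prod⁺` is left;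
  -- inside, everything is reduced to `coef k l`.
  coef-recurrence : ∀ n k l → k + l ≡ 2 + n →
    coef k l + (4 * n + 3) * (4 * n + 5) * (shiftʳ (shiftʳ coef) k l + shiftˡ (shiftˡ coef) k l)
    ≡ 4 * (2 * n + 3) * (shiftʳ coef k l + shiftˡ coef k l)
      + 2 * ((4 * n + 3) * (4 * n + 5)) * shiftˡ (shiftʳ coef) k l
  coef-recurrence n zero (suc (suc l)) refl rewrite coef-0ˡ (suc (suc l)) | coef-0ˡ l | coef-0ˡ (suc l) =
    solve 2 (λ l p →
        (con 4 :* (con 1 :+ l) :+ con 3) :* ((con 4 :* l :+ con 3) :* p) :+ (con 4 :* l :+ con 3) :* (con 4 :* l :+ con 5) :* (p :+ con 0)
      := con 4 :* (con 2 :* l :+ con 3) :* ((con 4 :* l :+ con 3) :* p :+ con 0)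
         :+ con 2 :* ((con 4 :* l :+ con 3) :* (con 4 :* l :+ con 5)) :* con 0) refl l (prod⁻ l)
  coef-recurrence n (suc (suc k)) zero eq with trans (sym (+-identityʳ k)) (suc-injective (suc-injective eq))
  ... | refl rewrite coef-0ʳ (suc (suc k)) | coef-0ʳ k | coef-0ʳ (suc k) =
    solve 2 (λ k p →
        (con 4 :* (con 1 :+ k) :+ con 5) :* ((con 4 :* k :+ con 5) :* p) :+ (con 4 :* k :+ con 3) :* (con 4 :* k :+ con 5) :* (con 0 :+ p)
      := con 4 :* (con 2 :* k :+ con 3) :* (con 0 :+ (con 4 :* k :+ con 5) :* p)
         :+ con 2 :* ((con 4 :* k :+ con 3) :* (con 4 :* k :+ con 5)) :* con 0) refl k (prod⁺ k)
  coef-recurrence n (suc k) (suc l) eq with suc-injective (trans (sym (+-suc k l)) (suc-injective eq))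
  ... | refl = *-cancelˡ-≡ _ _ (a * b) {{*-nonZero a≢0 b≢0}} (begin
    a * b * (coef (suc k) (suc l) + c * (cʳʳ + cˡˡ))
      ≡⟨ solve 6 (λ a b x c y z → a :* b :* (x :+ c :* (y :+ z)) := b :* (a :* x) :+ c :* (b :* (a :* y) :+ a :* (b :* z))) refl
           a b (coef (suc k) (suc l)) c cʳʳ cˡˡ ⟩
    b * (a * coef (suc k) (suc l)) + c * (b * (a * cʳʳ) + a * (b * cˡˡ))
      ≡⟨ cong₂ (λ x y → x + c * y) top (cong₂ _+_ (cong (b *_) (shiftʳʳ k l)) (cong (a *_) (shiftˡˡ k l))) ⟩
    h (suc (k + l)) * (h (k + l) * m) + c * (b * (l * (4 * l + 1) * m) + a * (node⁻ k * m))
      ≡⟨ solve 8 (λ h₁ h₀ m c b l a q → h₁ :* (h₀ :* m) :+ c :* (b :* (l :* m) :+ a :* (q :* m)) := (h₁ :* h₀ :+ c :* (l :* b :+ q :* a)) :* m) refl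
           (h (suc (k + l))) (h (k + l)) m c b (l * (4 * l + 1)) a (node⁻ k) ⟩
    (h (suc (k + l)) * h (k + l) + c * (l * (4 * l + 1) * b + node⁻ k * a)) * m
      ≡⟨ cong (_* m) (node⁻-poly k l) ⟩
    (d * h (k + l) * (b + a) + 2 * c * (a * b)) * m
      ≡⟨ solve 6 (λ d h a b c m → (d :* h :* (b :+ a) :+ con 2 :* c :* (a :* b)) :* m
                    := d :* (b :* (h :* m) :+ a :* (h :* m)) :+ con 2 :* c :* (a :* b :* m)) refl d (h (k + l)) a b c m ⟩
    d * (b * (h (k + l) * m) + a * (h (k + l) * m)) + 2 * c * (a * b * m)
      ≡⟨ cong (λ x → d * x + 2 * c * (a * b * m)) (cong₂ _+_ (cong (b *_) (sym (coef-sucˡ k l))) (cong (a *_) (sym (coef-sucʳ k l)))) ⟩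
    d * (b * (a * coef (suc k) l) + a * (b * coef k (suc l))) + 2 * c * (a * b * m)
      ≡⟨ solve 7 (λ a b d x y c m → d :* (b :* (a :* x) :+ a :* (b :* y)) :+ con 2 :* c :* (a :* b :* m)
                     := a :* b :* (d :* (x :+ y) :+ con 2 :* c :* m)) refl a b d (coef (suc k) l) (coef k (suc l)) c m ⟩
    a * b * (d * (coef (suc k) l + coef k (suc l)) + 2 * c * m) ∎)
    where
    open ≡-Reasoning
    a b c d m cʳʳ cˡˡ : ℕ
    a = suc k * (4 * k + 3)
    b = suc l * (4 * l + 5)
    c = (4 * (k + l) + 3) * (4 * (k + l) + 5)
    d = 4 * (2 * (k + l) + 3)
    m = coef k l
    cʳʳ = shiftʳ (shiftʳ coef) (suc k) (suc l)
    cˡˡ = shiftˡ (shiftˡ coef) (suc k) (suc l)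
    a≢0 : NonZero a
    a≢0 = *-nonZero {suc k} _ (+suc-nonZero (4 * k))
    b≢0 : NonZero b
    b≢0 = *-nonZero {suc l} _ (+suc-nonZero (4 * l))
    top : b * (a * coef (suc k) (suc l)) ≡ h (suc (k + l)) * (h (k + l) * m)
    top = begin
      b * (a * coef (suc k) (suc l)) ≡⟨ cong (b *_) (coef-sucˡ k (suc l)) ⟩
      b * (h (k + suc l) * coef k (suc l)) ≡⟨ cong (λ n → b * (h n * coef k (suc l))) (+-suc k l) ⟩
      b * (h (suc (k + l)) * coef k (suc l))
        ≡⟨ solve 3 (λ b h c → b :* (h :* c) := h :* (b :* c)) refl b (h (suc (k + l))) (coef k (suc l)) ⟩
      h (suc (k + l)) * (b * coef k (suc l)) ≡⟨ cong (h (suc (k + l)) *_) (coef-sucʳ k l) ⟩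
      h (suc (k + l)) * (h (k + l) * m) ∎

-- Homogeneous forms as sums over k + l = n

module DiagonalSums where
  open Algebras
  open Coefficients
  open import Data.Nat.Base as ℕ using (ℕ; zero; suc)
  open import Data.Integer.Base using () renaming (+_ to pos)
  import Data.Integer.Properties as ℤ
  open import Relation.Binary.PropositionalEquality

  module DiagonalSum (A : ℤAlgebra) where
    open ℤAlgebra A
    open Solver
    open ≡-Reasoning

    -- The sum over k + l = n. Recursion on the shifted function avoids writing l as n - k, so no
    -- truncated subtraction enters.
    ∑ : (ℕ → ℕ → Carrier) → ℕ → Carrier
    ∑ f zero = f 0 0
    ∑ f (suc n) = f 0 (suc n) + ∑ (λ k → f (suc k)) n

    ∑-cong : ∀ n {f g} → (∀ k l → k ℕ.+ l ≡ n → f k l ≡ g k l) → ∑ f n ≡ ∑ g n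
    ∑-cong zero eq = eq 0 0 refl
    ∑-cong (suc n) eq = cong₂ _+_ (eq 0 (suc n) refl) (∑-cong n λ k l e → eq (suc k) l (cong suc e))

    ∑-+ : ∀ n f g → ∑ (λ k l → f k l + g k l) n ≡ ∑ f n + ∑ g n
    ∑-+ zero f g = refl
    ∑-+ (suc n) f g = trans (+-congˡ (∑-+ n (λ k → f (suc k)) (λ k → g (suc k))))
      (solve 4 (λ a b c d → a :+ b :+ (c :+ d) := a :+ c :+ (b :+ d)) refl _ _ _ _)

    ∑-* : ∀ n c f → ∑ (λ k l → c * f k l) n ≡ c * ∑ f n
    ∑-* zero c f = refl
    ∑-* (suc n) c f = trans (+-congˡ (∑-* n c (λ k → f (suc k)))) (sym (distribˡ c _ _))

    ∑-comm : ∀ m n (f : ℕ → ℕ → ℕ → ℕ → Carrier) →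
      ∑ (λ k l → ∑ (f k l) n) m ≡ ∑ (λ i j → ∑ (λ k l → f k l i j) m) n
    ∑-comm zero n f = refl
    ∑-comm (suc m) n f = begin
      ∑ (f 0 (suc m)) n + ∑ (λ k l → ∑ (f (suc k) l) n) m
        ≡⟨ +-congˡ (∑-comm m n (λ k → f (suc k))) ⟩
      ∑ (f 0 (suc m)) n + ∑ (λ i j → ∑ (λ k l → f (suc k) l i j) m) n
        ≡⟨ ∑-+ n _ _ ⟨
      ∑ (λ i j → f 0 (suc m) i j + ∑ (λ k l → f (suc k) l i j) m) n ∎

    ∑-sucʳ : ∀ n f → (∀ k → f k 0 ≡ 0#) → ∑ f (suc n) ≡ ∑ (λ k l → f k (suc l)) n
    ∑-sucʳ zero f f0 = trans (+-congˡ (f0 1)) (+-identityʳ _)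
    ∑-sucʳ (suc n) f f0 = +-congˡ (∑-sucʳ n (λ k → f (suc k)) (λ k → f0 (suc k)))

    ∑-sucˡ : ∀ n f → (∀ l → f 0 l ≡ 0#) → ∑ f (suc n) ≡ ∑ (λ k → f (suc k)) n
    ∑-sucˡ n f f0 = trans (+-congʳ (f0 (suc n))) (+-identityˡ _)

    form : (ℕ → ℕ → ℕ) → Carrier → Carrier → ℕ → Carrier
    form c x y = ∑ (λ k l → ι (pos (c k l)) * (x ^ k * y ^ l))

    form-shiftʳ : ∀ c x y n → form (shiftʳ c) x y (suc n) ≡ y * form c x y n
    form-shiftʳ c x y n = begin
      form (shiftʳ c) x y (suc n) ≡⟨ ∑-sucʳ n (λ k l → ι (pos (shiftʳ c k l)) * (x ^ k * y ^ l)) (λ k → trans (*-congʳ ι-0) (zeroˡ _)) ⟩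
      ∑ (λ k l → ι (pos (c k l)) * (x ^ k * (y * y ^ l))) n
        ≡⟨ ∑-cong n (λ k l _ → solve 4 (λ c x y z → c :* (x :* (y :* z)) := y :* (c :* (x :* z))) refl (ι (pos (c k l))) (x ^ k) y (y ^ l)) ⟩
      ∑ (λ k l → y * (ι (pos (c k l)) * (x ^ k * y ^ l))) n ≡⟨ ∑-* n y _ ⟩
      y * form c x y n ∎

    form-shiftˡ : ∀ c x y n → form (shiftˡ c) x y (suc n) ≡ x * form c x y n
    form-shiftˡ c x y n = begin
      form (shiftˡ c) x y (suc n) ≡⟨ ∑-sucˡ n (λ k l → ι (pos (shiftˡ c k l)) * (x ^ k * y ^ l)) (λ l → trans (*-congʳ ι-0) (zeroˡ _)) ⟩
      ∑ (λ k l → ι (pos (c k l)) * (x * x ^ k * y ^ l)) n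
        ≡⟨ ∑-cong n (λ k l _ → solve 4 (λ c x y z → c :* (x :* y :* z) := x :* (c :* (y :* z))) refl (ι (pos (c k l))) x (x ^ k) (y ^ l)) ⟩
      ∑ (λ k l → x * (ι (pos (c k l)) * (x ^ k * y ^ l))) n ≡⟨ ∑-* n x _ ⟩
      x * form c x y n ∎

    form-cong : ∀ n {c c′} x y → (∀ k l → k ℕ.+ l ≡ n → c k l ≡ c′ k l) → form c x y n ≡ form c′ x y n
    form-cong n x y eq = ∑-cong n λ k l e → *-congʳ (cong (λ c → ι (pos c)) (eq k l e))

    form-+ : ∀ n c c′ x y → form (λ k l → c k l ℕ.+ c′ k l) x y n ≡ form c x y n + form c′ x y n
    form-+ n c c′ x y = trans
      (∑-cong n λ k l _ → trans (*-congʳ (ι-+ (pos (c k l)) (pos (c′ k l)))) (distribʳ _ _ _)) (∑-+ n _ _)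

    form-* : ∀ n m c x y → form (λ k l → m ℕ.* c k l) x y n ≡ ι (pos m) * form c x y n
    form-* n m c x y = trans
      (∑-cong n λ k l _ → trans (*-congʳ (trans (cong ι (ℤ.pos-* m (c k l))) (ι-* (pos m) (pos (c k l))))) (*-assoc _ _ _)) (∑-* n _ _)

    X : Carrier → Carrier → ℕ → Carrier
    X = form coef

    X-recurrence : ∀ x y n → X x y (2 ℕ.+ n)
      ≡ ι (pos (4 ℕ.* (2 ℕ.* n ℕ.+ 3))) * (x + y) * X x y (suc n)
        - ι (pos ((4 ℕ.* n ℕ.+ 3) ℕ.* (4 ℕ.* n ℕ.+ 5))) * (x - y) * (x - y) * X x y n
    X-recurrence x y n = begin
      X x y (2 ℕ.+ n)
        ≡⟨ solve 2 (λ a b → a := a :+ b :- b) refl (X x y (2 ℕ.+ n)) (ι (pos c) * (y * (y * p) + x * (x * p))) ⟩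
      X x y (2 ℕ.+ n) + ι (pos c) * (y * (y * p) + x * (x * p)) - ι (pos c) * (y * (y * p) + x * (x * p))
        ≡⟨ +-congʳ key ⟩
      ι (pos d) * (y * q + x * q) + ι (pos (2 ℕ.* c)) * (x * (y * p)) - ι (pos c) * (y * (y * p) + x * (x * p))
        ≡⟨ +-congʳ (+-congˡ (*-congʳ (trans (cong ι (ℤ.pos-* 2 c)) (ι-* (pos 2) (pos c))))) ⟩
      ι (pos d) * (y * q + x * q) + ι (pos 2) * ι (pos c) * (x * (y * p)) - ι (pos c) * (y * (y * p) + x * (x * p))
        ≡⟨ solve 6 (λ d c x y p q → d :* (y :* q :+ x :* q) :+ con (pos 2) :* c :* (x :* (y :* p)) :- c :* (y :* (y :* p) :+ x :* (x :* p))
                     := d :* (x :+ y) :* q :- c :* (x :- y) :* (x :- y) :* p) refl (ι (pos d)) (ι (pos c)) x y p q ⟩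
      ι (pos d) * (x + y) * q - ι (pos c) * (x - y) * (x - y) * p ∎
      where
      p = X x y n
      q = X x y (suc n)
      c = (4 ℕ.* n ℕ.+ 3) ℕ.* (4 ℕ.* n ℕ.+ 5)
      d = 4 ℕ.* (2 ℕ.* n ℕ.+ 3)
      N = 2 ℕ.+ n
      s₁ s₂ : ℕ → ℕ → ℕ
      s₁ k l = shiftʳ coef k l ℕ.+ shiftˡ coef k l
      s₂ k l = shiftʳ (shiftʳ coef) k l ℕ.+ shiftˡ (shiftˡ coef) k l
      eq₁ : form s₁ x y N ≡ y * q + x * q
      eq₁ = trans (form-+ N (shiftʳ coef) (shiftˡ coef) x y) (cong₂ _+_ (form-shiftʳ coef x y (suc n)) (form-shiftˡ coef x y (suc n)))
      eq₂ : form s₂ x y N ≡ y * (y * p) + x * (x * p)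
      eq₂ = trans (form-+ N (shiftʳ (shiftʳ coef)) (shiftˡ (shiftˡ coef)) x y) (cong₂ _+_
               (trans (form-shiftʳ (shiftʳ coef) x y (suc n)) (cong (y *_) (form-shiftʳ coef x y n)))
               (trans (form-shiftˡ (shiftˡ coef) x y (suc n)) (cong (x *_) (form-shiftˡ coef x y n))))
      eq₃ : form (shiftˡ (shiftʳ coef)) x y N ≡ x * (y * p)
      eq₃ = trans (form-shiftˡ (shiftʳ coef) x y (suc n)) (cong (x *_) (form-shiftʳ coef x y n))
      key : X x y N + ι (pos c) * (y * (y * p) + x * (x * p)) ≡ ι (pos d) * (y * q + x * q) + ι (pos (2 ℕ.* c)) * (x * (y * p))
      key = begin
        X x y N + ι (pos c) * (y * (y * p) + x * (x * p))
          ≡⟨ cong (λ z → X x y N + ι (pos c) * z) eq₂ ⟨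
        X x y N + ι (pos c) * form s₂ x y N
          ≡⟨ cong (X x y N +_) (form-* N c s₂ x y) ⟨
        X x y N + form (λ k l → c ℕ.* s₂ k l) x y N
          ≡⟨ form-+ N coef (λ k l → c ℕ.* s₂ k l) x y ⟨
        form (λ k l → coef k l ℕ.+ c ℕ.* s₂ k l) x y N
          ≡⟨ form-cong N x y (coef-recurrence n) ⟩
        form (λ k l → d ℕ.* s₁ k l ℕ.+ 2 ℕ.* c ℕ.* shiftˡ (shiftʳ coef) k l) x y N
          ≡⟨ form-+ N (λ k l → d ℕ.* s₁ k l) (λ k l → 2 ℕ.* c ℕ.* shiftˡ (shiftʳ coef) k l) x y ⟩
        form (λ k l → d ℕ.* s₁ k l) x y N + form (λ k l → 2 ℕ.* c ℕ.* shiftˡ (shiftʳ coef) k l) x y N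
          ≡⟨ cong₂ _+_ (trans (form-* N d s₁ x y) (cong (ι (pos d) *_) eq₁))
               (trans (form-* N (2 ℕ.* c) (shiftˡ (shiftʳ coef)) x y) (cong (ι (pos (2 ℕ.* c)) *_) eq₃)) ⟩
        ι (pos d) * (y * q + x * q) + ι (pos (2 ℕ.* c)) * (x * (y * p)) ∎

-- Adjoining i, and the identity between the forms and Z

module GaussianExtension where
  open Algebras
  open Coefficients
  open DiagonalSums
  open import Algebra.Structures using (IsCommutativeRing)
  open import Relation.Binary.PropositionalEquality.Algebra using (isMagma)
  open import Data.Nat.Base as ℕ using (ℕ; zero; suc)
  open import Data.Integer.Base as ℤ using () renaming (+_ to pos)
  import Data.Integer.Properties as ℤ
  open import Data.Product using (_,_)
  open import Relation.Binary.PropositionalEquality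

  module Adjoin (A : ℤAlgebra) where
    open ℤAlgebra A
    open Solver

    -- A formal extension by pairs, also when the ring already contains a square root of -1. It may
    -- then have zero divisors, but only identities, divisibility and a submultiplicative size are
    -- considered in it.
    record A[i] : Set where
      constructor _+i_
      field
        re im : Carrier
    open A[i] public

    private
      lift₂ : ∀ {a b c d} → a ≡ c → b ≡ d → (a +i b) ≡ (c +i d)
      lift₂ = cong₂ _+i_
      z z1 : ∀ {n} → Polynomial n
      z = con (pos 0)
      z1 = con (pos 1)

    opaque
      _⊕_ _⊗_ : A[i] → A[i] → A[i]
      (a +i b) ⊕ (c +i d) = (a + c) +i (b + d)
      (a +i b) ⊗ (c +i d) = (a * c - b * d) +i (a * d + b * c)
      ⊖_ : A[i] → A[i]
      ⊖ (a +i b) = (- a) +i (- b)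

      ⊕-parts : ∀ x y → x ⊕ y ≡ (re x + re y) +i (im x + im y)
      ⊕-parts x y = refl
      ⊗-parts : ∀ x y → x ⊗ y ≡ (re x * re y - im x * im y) +i (re x * im y + im x * re y)
      ⊗-parts x y = refl
      ⊖-parts : ∀ x → ⊖ x ≡ (- re x) +i (- im x)
      ⊖-parts x = refl

    private
      0i 1i : A[i]
      0i = 0# +i 0#
      1i = 1# +i 0#

    opaque
      unfolding _⊕_

      ⊗-identityˡ : ∀ x → 1i ⊗ x ≡ x
      ⊗-identityˡ (a +i b) rewrite sym ι-0 | sym ι-1 = lift₂
        (solve 2 (λ a b → z1 :* a :- z :* b := a) refl a b)
        (solve 2 (λ a b → z1 :* b :+ z :* a := b) refl a b)

      ⊗-comm : ∀ x y → x ⊗ y ≡ y ⊗ x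
      ⊗-comm (a +i b) (c +i d) = lift₂
        (solve 4 (λ a b c d → a :* c :- b :* d := c :* a :- d :* b) refl a b c d)
        (solve 4 (λ a b c d → a :* d :+ b :* c := c :* b :+ d :* a) refl a b c d)

      ⊗-distribˡ : ∀ x y w → x ⊗ (y ⊕ w) ≡ (x ⊗ y) ⊕ (x ⊗ w)
      ⊗-distribˡ (a +i b) (c +i d) (e +i f) = lift₂
        (solve 6 (λ a b c d e f → a :* (c :+ e) :- b :* (d :+ f) := a :* c :- b :* d :+ (a :* e :- b :* f)) refl a b c d e f)
        (solve 6 (λ a b c d e f → a :* (d :+ f) :+ b :* (c :+ e) := a :* d :+ b :* c :+ (a :* f :+ b :* e)) refl a b c d e f)

      ⊗-assoc : ∀ x y w → (x ⊗ y) ⊗ w ≡ x ⊗ (y ⊗ w)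
      ⊗-assoc (a +i b) (c +i d) (e +i f) = lift₂
        (solve 6 (λ a b c d e f → (a :* c :- b :* d) :* e :- (a :* d :+ b :* c) :* f := a :* (c :* e :- d :* f) :- b :* (c :* f :+ d :* e)) refl a b c d e f)
        (solve 6 (λ a b c d e f → (a :* c :- b :* d) :* f :+ (a :* d :+ b :* c) :* e := a :* (c :* f :+ d :* e) :+ b :* (c :* e :- d :* f)) refl a b c d e f)

      ⊗-isCommutativeRing : IsCommutativeRing _≡_ _⊕_ _⊗_ ⊖_ 0i 1i
      ⊗-isCommutativeRing = record
        { isRing = record
          { +-isAbelianGroup = record
            { isGroup = record
              { isMonoid = record
                { isSemigroup = record
                  { isMagma = isMagma _⊕_
                  ; assoc = λ (a +i b) (c +i d) (e +i f) → lift₂ (+-assoc a c e) (+-assoc b d f) }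
                ; identity = (λ (a +i b) → lift₂ (+-identityˡ a) (+-identityˡ b)) , (λ (a +i b) → lift₂ (+-identityʳ a) (+-identityʳ b)) }
              ; inverse = (λ (a +i b) → lift₂ (-‿inverseˡ a) (-‿inverseˡ b)) , (λ (a +i b) → lift₂ (-‿inverseʳ a) (-‿inverseʳ b))
              ; ⁻¹-cong = cong ⊖_ }
            ; comm = λ (a +i b) (c +i d) → lift₂ (+-comm a c) (+-comm b d) }
          ; *-cong = cong₂ _⊗_
          ; *-assoc = ⊗-assoc
          ; *-identity = ⊗-identityˡ , (λ x → trans (⊗-comm x 1i) (⊗-identityˡ x))
          ; distrib = ⊗-distribˡ , (λ x y w → trans (⊗-comm (y ⊕ w) x) (trans (⊗-distribˡ x y w) (cong₂ _⊕_ (⊗-comm x y) (⊗-comm x w)))) }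
        ; *-comm = ⊗-comm }

      ⟪⟫-+ : ∀ x y → ((x + y) +i 0#) ≡ (x +i 0#) ⊕ (y +i 0#)
      ⟪⟫-+ x y = lift₂ refl (sym (+-identityʳ 0#))

      ⟪⟫-* : ∀ x y → ((x * y) +i 0#) ≡ (x +i 0#) ⊗ (y +i 0#)
      ⟪⟫-* x y rewrite sym ι-0 = lift₂ (solve 2 (λ x y → x :* y := x :* y :- z :* z) refl x y) (solve 2 (λ x y → z := x :* z :+ z :* y) refl x y)

      ⟪⟫-neg : ∀ x → ((- x) +i 0#) ≡ ⊖ (x +i 0#)
      ⟪⟫-neg x rewrite sym ι-0 = lift₂ refl (solve 0 (z := :- z) refl)

      i²≡-1 : (0# +i 1#) ⊗ (0# +i 1#) ≡ ι ℤ.-1ℤ +i 0#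
      i²≡-1 rewrite sym ι-0 | sym ι-1 = lift₂ (solve 0 (z :* z :- z1 :* z1 := con ℤ.-1ℤ) refl) (solve 0 (z :* z1 :+ z1 :* z := z) refl)

    Gaussian : ℤAlgebra
    Gaussian = record
      { Carrier = A[i]
      ; _+_ = _⊕_ ; _*_ = _⊗_ ; -_ = ⊖_ ; 0# = 0i ; 1# = 1i
      ; isCommutativeRing = ⊗-isCommutativeRing
      ; ι = λ n → ι n +i 0#
      ; ι-+ = λ m n → trans (cong (_+i 0#) (ι-+ m n)) (⟪⟫-+ _ _)
      ; ι-* = λ m n → trans (cong (_+i 0#) (ι-* m n)) (⟪⟫-* _ _)
      ; ι-neg = λ m → trans (cong (_+i 0#) (ι-neg m)) (⟪⟫-neg _)
      ; ι-0 = cong (_+i 0#) ι-0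
      ; ι-1 = cong (_+i 0#) ι-1
      }

    module G = ℤAlgebra Gaussian

    ⟪_⟫ : Carrier → A[i]
    ⟪ x ⟫ = x +i 0#

    i# : A[i]
    i# = 0# +i 1#

    ⟪⟫-- : ∀ x y → ⟪ x - y ⟫ ≡ ⟪ x ⟫ G.- ⟪ y ⟫
    ⟪⟫-- x y = trans (⟪⟫-+ x (- y)) (cong (⟪ x ⟫ G.+_) (⟪⟫-neg y))

    Z : (a b x y : Carrier) → ℕ → Carrier
    Z a b x y zero = y
    Z a b x y (suc zero) = b * x - a * y
    Z a b x y (suc (suc n)) =
      ι (pos ((4 ℕ.* n ℕ.+ 3) ℕ.* (4 ℕ.* n ℕ.+ 5))) * (b * b * Z a b x y n)
      - ι (pos (2 ℕ.* n ℕ.+ 3)) * (a * Z a b x y (suc n))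

    open DiagonalSum Gaussian using (X; X-recurrence) public

    κ : ℕ → A[i]
    κ zero = G.ι (ℤ.- pos 2) G.* i#
    κ (suc n) = G.ι (ℤ.- pos 8) G.* i# G.* κ n

    module _ (a b x y : Carrier) where
      α γ u v : A[i]
      α = i# G.* ⟪ a ⟫ G.+ G.ι (pos 4) G.* ⟪ b ⟫
      γ = i# G.* ⟪ a ⟫ G.- G.ι (pos 4) G.* ⟪ b ⟫
      u = ⟪ x ⟫ G.+ i# G.* ⟪ y ⟫
      v = ⟪ x ⟫ G.- i# G.* ⟪ y ⟫

      W : ℕ → A[i]
      W n = X γ α n G.* v G.- X α γ n G.* u

      private
        module S = G.Solver
        X₀ : ∀ p q → X p q 0 ≡ G.ι (pos 1)
        X₀ p q = trans (cong (λ c → G.ι (pos c) G.* (G.1# G.* G.1#)) (coef-0ˡ 0)) (trans (cong (G.ι (pos 1) G.*_) (G.*-identityʳ G.1#)) (G.*-identityʳ _))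
        X₁ : ∀ p q → X p q 1 ≡ G.ι (pos 3) G.* q G.+ G.ι (pos 5) G.* p
        X₁ p q = cong₂ G._+_
          (trans (cong₂ (λ c w → G.ι (pos c) G.* w) (coef-0ˡ 1) (trans (G.*-identityˡ _) (G.*-identityʳ q))) refl)
          (cong₂ (λ c w → G.ι (pos c) G.* w) (coef-0ʳ 1) (trans (G.*-identityʳ _) (G.*-identityʳ p)))

      -- Both sides obey the same recurrence, since α + γ = 2ia and (α - γ)² = 64b²; one step of `κ`
      -- absorbs 8i and two steps absorb -64. The solver knows i only as a variable, so the factor
      -- -1 is kept as a separate coefficient and exchanged for i² by hand.
      W≡κZ : ∀ n → W n ≡ κ n G.* ⟪ Z a b x y n ⟫
      W≡κZ zero = trans (cong₂ (λ p q → p G.* v G.- q G.* u) (X₀ γ α) (X₀ α γ))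
        (S.solve 3 (λ i x y → S.con (pos 1) S.:* (x S.:- i S.:* y) S.:- S.con (pos 1) S.:* (x S.:+ i S.:* y) S.:= S.con (ℤ.- pos 2) S.:* i S.:* y) refl i# ⟪ x ⟫ ⟪ y ⟫)
      W≡κZ (suc zero) = begin
        X γ α 1 G.* v G.- X α γ 1 G.* u ≡⟨ cong₂ (λ p q → p G.* v G.- q G.* u) (X₁ γ α) (X₁ α γ) ⟩
        (G.ι (pos 3) G.* α G.+ G.ι (pos 5) G.* γ) G.* v G.- (G.ι (pos 3) G.* γ G.+ G.ι (pos 5) G.* α) G.* u
          ≡⟨ S.solve 5 (λ i a b x y →
               let α = i S.:* a S.:+ S.con (pos 4) S.:* b
                   γ = i S.:* a S.:- S.con (pos 4) S.:* b
                   u = x S.:+ i S.:* y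
                   v = x S.:- i S.:* y in
               (S.con (pos 3) S.:* α S.:+ S.con (pos 5) S.:* γ) S.:* v S.:- (S.con (pos 3) S.:* γ S.:+ S.con (pos 5) S.:* α) S.:* u
               S.:= S.con (ℤ.- pos 16) S.:* (b S.:* x S.:+ i S.:* i S.:* (a S.:* y))) refl i# ⟪ a ⟫ ⟪ b ⟫ ⟪ x ⟫ ⟪ y ⟫ ⟩
        G.ι (ℤ.- pos 16) G.* (⟪ b ⟫ G.* ⟪ x ⟫ G.+ i# G.* i# G.* (⟪ a ⟫ G.* ⟪ y ⟫))
          ≡⟨ cong (λ j → G.ι (ℤ.- pos 16) G.* (⟪ b ⟫ G.* ⟪ x ⟫ G.+ j G.* (⟪ a ⟫ G.* ⟪ y ⟫))) i²≡-1 ⟩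
        G.ι (ℤ.- pos 16) G.* (⟪ b ⟫ G.* ⟪ x ⟫ G.+ G.ι ℤ.-1ℤ G.* (⟪ a ⟫ G.* ⟪ y ⟫))
          ≡⟨ S.solve 2 (λ p q → S.con (ℤ.- pos 16) S.:* (p S.:+ S.con ℤ.-1ℤ S.:* q) S.:= S.con (pos 16) S.:* S.con ℤ.-1ℤ S.:* (p S.:- q)) refl (⟪ b ⟫ G.* ⟪ x ⟫) (⟪ a ⟫ G.* ⟪ y ⟫) ⟩
        G.ι (pos 16) G.* G.ι ℤ.-1ℤ G.* (⟪ b ⟫ G.* ⟪ x ⟫ G.- ⟪ a ⟫ G.* ⟪ y ⟫)
          ≡⟨ cong₂ (λ j w → G.ι (pos 16) G.* j G.* w) (sym i²≡-1) (sym (trans (⟪⟫-- (b * x) (a * y)) (cong₂ G._-_ (⟪⟫-* b x) (⟪⟫-* a y)))) ⟩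
        G.ι (pos 16) G.* (i# G.* i#) G.* ⟪ b * x - a * y ⟫
          ≡⟨ S.solve 2 (λ i w → S.con (pos 16) S.:* (i S.:* i) S.:* w S.:= S.con (ℤ.- pos 8) S.:* i S.:* (S.con (ℤ.- pos 2) S.:* i) S.:* w) refl i# ⟪ b * x - a * y ⟫ ⟩
        κ 1 G.* ⟪ b * x - a * y ⟫ ∎
        where open ≡-Reasoning
      W≡κZ (suc (suc n)) = begin
        X γ α (2 ℕ.+ n) G.* v G.- X α γ (2 ℕ.+ n) G.* u
          ≡⟨ cong₂ (λ p q → p G.* v G.- q G.* u) (X-recurrence γ α n) (X-recurrence α γ n) ⟩
        (G.ι (pos d) G.* (γ G.+ α) G.* X γ α (suc n) G.- G.ι (pos c) G.* (γ G.- α) G.* (γ G.- α) G.* X γ α n) G.* v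
        G.- (G.ι (pos d) G.* (α G.+ γ) G.* X α γ (suc n) G.- G.ι (pos c) G.* (α G.- γ) G.* (α G.- γ) G.* X α γ n) G.* u
          ≡⟨ S.solve 11 (λ i a b d c p₁ q₁ p q u v →
               let α = i S.:* a S.:+ S.con (pos 4) S.:* b
                   γ = i S.:* a S.:- S.con (pos 4) S.:* b in
               (d S.:* (γ S.:+ α) S.:* p₁ S.:- c S.:* (γ S.:- α) S.:* (γ S.:- α) S.:* p) S.:* v
               S.:- (d S.:* (α S.:+ γ) S.:* q₁ S.:- c S.:* (α S.:- γ) S.:* (α S.:- γ) S.:* q) S.:* u
               S.:= d S.:* S.con (pos 2) S.:* i S.:* a S.:* (p₁ S.:* v S.:- q₁ S.:* u) S.:- S.con (pos 64) S.:* c S.:* (b S.:* b) S.:* (p S.:* v S.:- q S.:* u))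
               refl i# ⟪ a ⟫ ⟪ b ⟫ (G.ι (pos d)) (G.ι (pos c)) (X γ α (suc n)) (X α γ (suc n)) (X γ α n) (X α γ n) u v ⟩
        G.ι (pos d) G.* G.ι (pos 2) G.* i# G.* ⟪ a ⟫ G.* W (suc n) G.- G.ι (pos 64) G.* G.ι (pos c) G.* (⟪ b ⟫ G.* ⟪ b ⟫) G.* W n
          ≡⟨ cong₂ (λ p q → G.ι (pos d) G.* G.ι (pos 2) G.* i# G.* ⟪ a ⟫ G.* p G.- G.ι (pos 64) G.* G.ι (pos c) G.* (⟪ b ⟫ G.* ⟪ b ⟫) G.* q) (W≡κZ (suc n)) (W≡κZ n) ⟩
        G.ι (pos d) G.* G.ι (pos 2) G.* i# G.* ⟪ a ⟫ G.* (κ (suc n) G.* z₁) G.- G.ι (pos 64) G.* G.ι (pos c) G.* (⟪ b ⟫ G.* ⟪ b ⟫) G.* (κ n G.* z₀)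
          ≡⟨ cong (λ w → w G.* G.ι (pos 2) G.* i# G.* ⟪ a ⟫ G.* (κ (suc n) G.* z₁) G.- G.ι (pos 64) G.* G.ι (pos c) G.* (⟪ b ⟫ G.* ⟪ b ⟫) G.* (κ n G.* z₀))
               (trans (cong G.ι (ℤ.pos-* 4 e)) (G.ι-* (pos 4) (pos e))) ⟩
        G.ι (pos 4) G.* G.ι (pos e) G.* G.ι (pos 2) G.* i# G.* ⟪ a ⟫ G.* (κ (suc n) G.* z₁) G.- G.ι (pos 64) G.* G.ι (pos c) G.* (⟪ b ⟫ G.* ⟪ b ⟫) G.* (κ n G.* z₀)
          ≡⟨ S.solve 8 (λ i a b e c k z₁ z₀ →
               S.con (pos 4) S.:* e S.:* S.con (pos 2) S.:* i S.:* a S.:* (S.con (ℤ.- pos 8) S.:* i S.:* k S.:* z₁) S.:- S.con (pos 64) S.:* c S.:* (b S.:* b) S.:* (k S.:* z₀)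
               S.:= S.con (ℤ.- pos 8) S.:* i S.:* (S.con (ℤ.- pos 8) S.:* i S.:* k) S.:* (S.:- (e S.:* (a S.:* z₁))) S.:+ S.con ℤ.-1ℤ S.:* (S.con (pos 64) S.:* k S.:* (c S.:* (b S.:* b S.:* z₀))))
               refl i# ⟪ a ⟫ ⟪ b ⟫ (G.ι (pos e)) (G.ι (pos c)) (κ n) z₁ z₀ ⟩
        κ (2 ℕ.+ n) G.* (G.- (G.ι (pos e) G.* (⟪ a ⟫ G.* z₁))) G.+ G.ι ℤ.-1ℤ G.* (G.ι (pos 64) G.* κ n G.* (G.ι (pos c) G.* (⟪ b ⟫ G.* ⟪ b ⟫ G.* z₀)))
          ≡⟨ cong (λ j → κ (2 ℕ.+ n) G.* (G.- (G.ι (pos e) G.* (⟪ a ⟫ G.* z₁))) G.+ j G.* (G.ι (pos 64) G.* κ n G.* (G.ι (pos c) G.* (⟪ b ⟫ G.* ⟪ b ⟫ G.* z₀)))) (sym i²≡-1) ⟩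
        κ (2 ℕ.+ n) G.* (G.- (G.ι (pos e) G.* (⟪ a ⟫ G.* z₁))) G.+ i# G.* i# G.* (G.ι (pos 64) G.* κ n G.* (G.ι (pos c) G.* (⟪ b ⟫ G.* ⟪ b ⟫ G.* z₀)))
          ≡⟨ S.solve 4 (λ i k p q → S.con (ℤ.- pos 8) S.:* i S.:* (S.con (ℤ.- pos 8) S.:* i S.:* k) S.:* (S.:- p) S.:+ i S.:* i S.:* (S.con (pos 64) S.:* k S.:* q)
                S.:= S.con (ℤ.- pos 8) S.:* i S.:* (S.con (ℤ.- pos 8) S.:* i S.:* k) S.:* (q S.:- p)) refl i# (κ n) (G.ι (pos e) G.* (⟪ a ⟫ G.* z₁)) (G.ι (pos c) G.* (⟪ b ⟫ G.* ⟪ b ⟫ G.* z₀)) ⟩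
        κ (2 ℕ.+ n) G.* (G.ι (pos c) G.* (⟪ b ⟫ G.* ⟪ b ⟫ G.* z₀) G.- G.ι (pos e) G.* (⟪ a ⟫ G.* z₁))
          ≡⟨ cong (κ (2 ℕ.+ n) G.*_) fold ⟨
        κ (2 ℕ.+ n) G.* ⟪ Z a b x y (2 ℕ.+ n) ⟫ ∎
        where
        open ≡-Reasoning
        c e d : ℕ
        c = (4 ℕ.* n ℕ.+ 3) ℕ.* (4 ℕ.* n ℕ.+ 5)
        e = 2 ℕ.* n ℕ.+ 3
        d = 4 ℕ.* e
        z₀ z₁ : A[i]
        z₀ = ⟪ Z a b x y n ⟫
        z₁ = ⟪ Z a b x y (suc n) ⟫
        fold : ⟪ Z a b x y (2 ℕ.+ n) ⟫ ≡ G.ι (pos c) G.* (⟪ b ⟫ G.* ⟪ b ⟫ G.* z₀) G.- G.ι (pos e) G.* (⟪ a ⟫ G.* z₁)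
        fold = trans (⟪⟫-- _ _) (cong₂ G._-_
          (trans (⟪⟫-* _ _) (cong (G.ι (pos c) G.*_) (trans (⟪⟫-* _ _) (cong (G._* z₀) (⟪⟫-* b b)))))
          (trans (⟪⟫-* _ _) (cong (G.ι (pos e) G.*_) (⟪⟫-* _ _))))

-- Odd common factors of the coefficients divide Z

module IntegralMultiples where
  open Algebras
  open Coefficients
  open DiagonalSums
  open GaussianExtension
  open import Data.Nat.Base as ℕ using (ℕ; zero; suc)
  import Data.Nat.Properties as ℕ
  open import Data.Nat.Divisibility using (_∣_; divides)
  open import Data.Integer.Base as ℤ using () renaming (+_ to pos)
  import Data.Integer.Properties as ℤ
  open import Data.Product using (_,_; ∃)
  open import Relation.Binary.PropositionalEquality hiding (J)

  module Divisibility (A : ℤAlgebra) where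
    open ℤAlgebra A
    open Solver
    open DiagonalSum A

    ι-pos-* : ∀ m n → ι (pos (m ℕ.* n)) ≡ ι (pos m) * ι (pos n)
    ι-pos-* m n = trans (cong ι (ℤ.pos-* m n)) (ι-* (pos m) (pos n))

    ∑-divisible : ∀ c n f → (∀ k l → k ℕ.+ l ≡ n → ∃ λ w → f k l ≡ c * w) → ∃ λ w → ∑ f n ≡ c * w
    ∑-divisible c zero f d = d 0 0 refl
    ∑-divisible c (suc n) f d with d 0 (suc n) refl | ∑-divisible c n (λ k → f (suc k)) (λ k l e → d (suc k) l (cong suc e))
    ... | w , eq | w′ , eq′ = w + w′ , trans (cong₂ _+_ eq eq′) (sym (distribˡ c w w′))

    form-divisible : ∀ J n c x y → (∀ k l → k ℕ.+ l ≡ n → J ∣ c k l) → ∃ λ w → form c x y n ≡ ι (pos J) * w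
    form-divisible J n c x y d = ∑-divisible (ι (pos J)) n (λ k l → ι (pos (c k l)) * (x ^ k * y ^ l)) term
      where
      term : ∀ k l → k ℕ.+ l ≡ n → ∃ λ w → ι (pos (c k l)) * (x ^ k * y ^ l) ≡ ι (pos J) * w
      term k l e with d k l e
      ... | divides q eq = ι (pos q) * (x ^ k * y ^ l) , trans (*-congʳ (trans (cong (λ p → ι (pos p)) (trans eq (ℕ.*-comm q J))) (ι-pos-* J q))) (*-assoc _ _ _)

    -- Since 1 = (2m + 1) - 2m, one has z = (2m + 1) z - m (2z), and both terms are multiples of 2m
    -- + 1.
    strip-2 : ∀ m {z w} → ι (pos 2) * z ≡ ι (pos (suc (2 ℕ.* m))) * w → ∃ λ w′ → z ≡ ι (pos (suc (2 ℕ.* m))) * w′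
    strip-2 m {z} {w} eq = z - ι (pos m) * w , (begin
      z
        ≡⟨ solve 2 (λ m z → z := (con (pos 1) :+ con (pos 2) :* m) :* z :- m :* (con (pos 2) :* z)) refl (ι (pos m)) z ⟩
      (ι (pos 1) + ι (pos 2) * ι (pos m)) * z - ι (pos m) * (ι (pos 2) * z)
        ≡⟨ cong₂ (λ o p → o * z - ι (pos m) * p) (sym odd) eq ⟩
      ι (pos (suc (2 ℕ.* m))) * z - ι (pos m) * (ι (pos (suc (2 ℕ.* m))) * w)
        ≡⟨ solve 4 (λ o z m w → o :* z :- m :* (o :* w) := o :* (z :- m :* w)) refl _ z (ι (pos m)) w ⟩
      ι (pos (suc (2 ℕ.* m))) * (z - ι (pos m) * w) ∎)
      where
      open ≡-Reasoning
      odd : ι (pos (suc (2 ℕ.* m))) ≡ ι (pos 1) + ι (pos 2) * ι (pos m)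
      odd = trans (ι-+ (pos 1) (pos (2 ℕ.* m))) (cong (ι (pos 1) +_) (ι-pos-* 2 m))

    strip-2^ : ∀ m K {z w} → ι (pos (2 ℕ.^ K)) * z ≡ ι (pos (suc (2 ℕ.* m))) * w → ∃ λ w′ → z ≡ ι (pos (suc (2 ℕ.* m))) * w′
    strip-2^ m zero {z} {w} eq = w , trans (sym (trans (*-congʳ ι-1) (*-identityˡ z))) eq
    strip-2^ m (suc K) {z} {w} eq with strip-2 m {ι (pos (2 ℕ.^ K)) * z} {w} (trans (sym (trans (*-congʳ (ι-pos-* 2 (2 ℕ.^ K))) (*-assoc _ _ _))) eq)
    ... | w′ , eq′ = strip-2^ m K eq′

    combine : ∀ J {z x y u v r p q} → (x * v - y * u) * r ≡ z → x ≡ J * p → y ≡ J * q →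
      z ≡ J * ((p * v - q * u) * r)
    combine J {z} {x} {y} {u} {v} {r} {p} {q} eq eqp eqq = begin
      z ≡⟨ eq ⟨
      (x * v - y * u) * r ≡⟨ cong₂ (λ p q → (p * v - q * u) * r) eqp eqq ⟩
      (J * p * v - J * q * u) * r ≡⟨ solve 6 (λ k x v y u r → k :* ((x :* v :- y :* u) :* r) := (k :* x :* v :- k :* y :* u) :* r) refl J p v q u r ⟨
      J * ((p * v - q * u) * r) ∎
      where open ≡-Reasoning

  module Integrality (A : ℤAlgebra) where
    open ℤAlgebra A
    open Adjoin A
    open Divisibility Gaussian using (form-divisible; combine)
    open Divisibility A using (strip-2^)
    private module S = G.Solver

    -- The power of i that turns `κ n` into a positive integer, so that Z_n can be read off from the
    -- first coordinate.
    ρ : ℕ → A[i]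
    ρ zero = i#
    ρ (suc n) = i# G.* ρ n

    κρ : ∀ n → κ n G.* ρ n ≡ G.ι (pos (2 ℕ.* 8 ℕ.^ n))
    κρ zero = trans (G.*-assoc _ _ _) (trans (cong (G.ι (ℤ.- pos 2) G.*_) i²≡-1) (sym (G.ι-* (ℤ.- pos 2) ℤ.-1ℤ)))
    κρ (suc n) = begin
      κ (suc n) G.* (i# G.* ρ n)
        ≡⟨ S.solve 3 (λ i k r → S.con (ℤ.- pos 8) S.:* i S.:* k S.:* (i S.:* r) S.:= S.con (ℤ.- pos 8) S.:* (i S.:* i) S.:* (k S.:* r)) refl i# (κ n) (ρ n) ⟩
      G.ι (ℤ.- pos 8) G.* (i# G.* i#) G.* (κ n G.* ρ n)
        ≡⟨ cong₂ (λ j r → G.ι (ℤ.- pos 8) G.* j G.* r) i²≡-1 (κρ n) ⟩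
      G.ι (ℤ.- pos 8) G.* G.ι ℤ.-1ℤ G.* G.ι (pos (2 ℕ.* 8 ℕ.^ n))
        ≡⟨ cong (G._* G.ι (pos (2 ℕ.* 8 ℕ.^ n))) (G.ι-* (ℤ.- pos 8) ℤ.-1ℤ) ⟨
      G.ι (pos 8) G.* G.ι (pos (2 ℕ.* 8 ℕ.^ n)) ≡⟨ G.ι-* (pos 8) (pos (2 ℕ.* 8 ℕ.^ n)) ⟨
      G.ι (pos 8 ℤ.* pos (2 ℕ.* 8 ℕ.^ n)) ≡⟨ cong G.ι (ℤ.pos-* 8 (2 ℕ.* 8 ℕ.^ n)) ⟨
      G.ι (pos (8 ℕ.* (2 ℕ.* 8 ℕ.^ n))) ≡⟨ cong (λ m → G.ι (pos m)) (swap (8 ℕ.^ n)) ⟩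
      G.ι (pos (2 ℕ.* 8 ℕ.^ suc n)) ∎
      where
      open ≡-Reasoning
      swap : ∀ x → 8 ℕ.* (2 ℕ.* x) ≡ 2 ℕ.* (8 ℕ.* x)
      swap x = trans (sym (ℕ.*-assoc 8 2 x)) (trans (cong (ℕ._* x) (ℕ.*-comm 8 2)) (ℕ.*-assoc 2 8 x))

    ⟪κρZ⟫ : ∀ a b x y n → W a b x y n G.* ρ n ≡ ⟪ ι (pos (2 ℕ.* 8 ℕ.^ n)) * Z a b x y n ⟫
    ⟪κρZ⟫ a b x y n = begin
      W a b x y n G.* ρ n ≡⟨ cong (G._* ρ n) (W≡κZ a b x y n) ⟩
      κ n G.* ⟪ Z a b x y n ⟫ G.* ρ n ≡⟨ S.solve 3 (λ k z r → k S.:* z S.:* r S.:= k S.:* r S.:* z) refl (κ n) ⟪ Z a b x y n ⟫ (ρ n) ⟩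
      κ n G.* ρ n G.* ⟪ Z a b x y n ⟫ ≡⟨ cong (G._* ⟪ Z a b x y n ⟫) (κρ n) ⟩
      G.ι (pos (2 ℕ.* 8 ℕ.^ n)) G.* ⟪ Z a b x y n ⟫ ≡⟨ ⟪⟫-* _ _ ⟨
      ⟪ ι (pos (2 ℕ.* 8 ℕ.^ n)) * Z a b x y n ⟫ ∎
      where open ≡-Reasoning

    2*8^ : ∀ n → 2 ℕ.* 8 ℕ.^ n ≡ 2 ℕ.^ (1 ℕ.+ 3 ℕ.* n)
    2*8^ n = cong (2 ℕ.*_) (ℕ.^-*-assoc 2 3 n)

    re-multiple : ∀ J x w → ⟪ x ⟫ ≡ G.ι (pos J) G.* w → x ≡ ι (pos J) * re w
    re-multiple J x w eq = begin
      x ≡⟨ cong re (trans eq (⊗-parts _ w)) ⟩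
      ι (pos J) * re w - 0# * im w ≡⟨ cong (λ j → ι (pos J) * re w - j) (zeroˡ (im w)) ⟩
      ι (pos J) * re w - 0# ≡⟨ cong (λ j → ι (pos J) * re w - j) (sym ι-0) ⟩
      ι (pos J) * re w - ι (pos 0) ≡⟨ solve 1 (λ x → x :- con (pos 0) := x) refl (ι (pos J) * re w) ⟩
      ι (pos J) * re w ∎
      where
      open ≡-Reasoning
      open Solver

    -- The common factor first appears in the extension by i, where 2 · 8ⁿ Z_n is i to the power n +
    -- 1 times `W n`. Comparing first coordinates brings it back to the base ring, and there the
    -- power 2 · 8ⁿ of 2 can be stripped because the factor is odd.
    Z-divisible : ∀ m n → (∀ k l → k ℕ.+ l ≡ n → suc (2 ℕ.* m) ∣ coef k l) →
      ∀ a b x y → ∃ λ w → Z a b x y n ≡ ι (pos (suc (2 ℕ.* m))) * w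
    Z-divisible m n dvd a b x y
      with form-divisible (suc (2 ℕ.* m)) n coef (γ a b x y) (α a b x y) dvd
         | form-divisible (suc (2 ℕ.* m)) n coef (α a b x y) (γ a b x y) dvd
    ... | p , eqp | q , eqq = strip-2^ m (1 ℕ.+ 3 ℕ.* n) (trans
        (cong (λ e → ι (pos e) * Z a b x y n) (sym (2*8^ n)))
        (re-multiple (suc (2 ℕ.* m)) _ _ (combine (G.ι (pos (suc (2 ℕ.* m)))) (⟪κρZ⟫ a b x y n) eqp eqq)))

-- Vanishing of the approximating form to order 2n + 1 at u = v

module VanishingOrder where
  open Algebras
  open Coefficients
  open DiagonalSums
  open import Data.Nat.Base as ℕ using (ℕ; zero; suc; _≤_; z≤n; s≤s)
  import Data.Nat.Properties as ℕ
  open import Data.Nat.Combinatorics using (_C_; nCn≡1; nC1≡n; nCk≡nC[n∸k]; k>n⇒nCk≡0; nCk+nC[k+1]≡[n+1]C[k+1])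
  open import Data.Integer.Base as ℤ using (ℤ; _+_; _*_; _-_; -_) renaming (+_ to pos)
  import Data.Integer.Properties as ℤ
  open import Relation.Binary.PropositionalEquality

  ℤA : ℤAlgebra
  ℤA = record
    { Carrier = ℤ ; _+_ = ℤ._+_ ; _*_ = ℤ._*_ ; -_ = ℤ.-_ ; 0# = pos 0 ; 1# = pos 1
    ; isCommutativeRing = ℤ.+-*-isCommutativeRing
    ; ι = λ n → n ; ι-+ = λ _ _ → refl ; ι-* = λ _ _ → refl ; ι-neg = λ _ → refl ; ι-0 = refl ; ι-1 = refl }

  ∑ℕ : (ℕ → ℕ → ℕ) → ℕ → ℕ
  ∑ℕ f zero = f 0 0
  ∑ℕ f (suc n) = f 0 (suc n) ℕ.+ ∑ℕ (λ k → f (suc k)) n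

  nC0≡1 : ∀ n → n C 0 ≡ 1
  nC0≡1 n = trans (nCk≡nC[n∸k] {0} {n} z≤n) (nCn≡1 n)

  nCk≤2^n : ∀ n k → n C k ≤ 2 ℕ.^ n
  nCk≤2^n n zero = ℕ.≤-trans (ℕ.≤-reflexive (nC0≡1 n)) (ℕ.m^n>0 2 n)
  nCk≤2^n zero (suc k) = ℕ.≤-trans (ℕ.≤-reflexive (k>n⇒nCk≡0 {0} {suc k} (s≤s z≤n))) z≤n
  nCk≤2^n (suc n) (suc k) = ℕ.≤-trans (ℕ.≤-reflexive (sym (nCk+nC[k+1]≡[n+1]C[k+1] n k)))
    (ℕ.+-mono-≤ (nCk≤2^n n k) (ℕ.≤-trans (nCk≤2^n n (suc k)) (ℕ.≤-reflexive (sym (ℕ.+-identityʳ _)))))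

  module Vanishing where
    open DiagonalSum ℤA
    open ℤAlgebra ℤA using (module Solver)
    open Solver
    open ≡-Reasoning

    -- Stated over ℤ because n - m is negative for m > n; both binomials are zero then.
    absorption : ∀ n m → pos (suc m) * pos (n C suc m) ≡ (pos n - pos m) * pos (n C m)
    absorption zero zero = refl
    absorption zero (suc m) = begin
      pos (2 ℕ.+ m) * pos (0 C (2 ℕ.+ m)) ≡⟨ cong (λ c → pos (2 ℕ.+ m) * pos c) (k>n⇒nCk≡0 {0} {2 ℕ.+ m} (s≤s z≤n)) ⟩
      pos (2 ℕ.+ m) * pos 0 ≡⟨ ℤ.*-zeroʳ (pos (2 ℕ.+ m)) ⟩
      pos 0 ≡⟨ ℤ.*-zeroʳ (pos 0 - pos (suc m)) ⟨
      (pos 0 - pos (suc m)) * pos 0 ≡⟨ cong (λ c → (pos 0 - pos (suc m)) * pos c) (k>n⇒nCk≡0 {0} {suc m} (s≤s z≤n)) ⟨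
      (pos 0 - pos (suc m)) * pos (0 C suc m) ∎
    absorption (suc n) zero = begin
      pos 1 * pos (suc n C 1) ≡⟨ cong (λ c → pos 1 * pos c) (nC1≡n (suc n)) ⟩
      pos 1 * pos (suc n) ≡⟨ solve 1 (λ n → con (pos 1) :* n := (n :- con (pos 0)) :* con (pos 1)) refl (pos (suc n)) ⟩
      (pos (suc n) - pos 0) * pos 1 ≡⟨ cong (λ c → (pos (suc n) - pos 0) * pos c) (nC0≡1 (suc n)) ⟨
      (pos (suc n) - pos 0) * pos (suc n C 0) ∎
    absorption (suc n) (suc m) = begin
      pos (2 ℕ.+ m) * pos (suc n C (2 ℕ.+ m)) ≡⟨ cong (λ c → pos (2 ℕ.+ m) * pos c) (nCk+nC[k+1]≡[n+1]C[k+1] n (suc m)) ⟨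
      pos (2 ℕ.+ m) * (pos c₁ + pos c₂) ≡⟨ ℤ.*-distribˡ-+ (pos (2 ℕ.+ m)) (pos c₁) (pos c₂) ⟩
      pos (2 ℕ.+ m) * pos c₁ + pos (2 ℕ.+ m) * pos c₂ ≡⟨ cong (pos (2 ℕ.+ m) * pos c₁ +_) (absorption n (suc m)) ⟩
      (pos 2 + pos m) * pos c₁ + (pos n - (pos 1 + pos m)) * pos c₁
        ≡⟨ solve 3 (λ n m c → (con (pos 2) :+ m) :* c :+ (n :- (con (pos 1) :+ m)) :* c := (con (pos 1) :+ m) :* c :+ (n :- m) :* c) refl (pos n) (pos m) (pos c₁) ⟩
      pos (suc m) * pos c₁ + (pos n - pos m) * pos c₁ ≡⟨ cong (_+ (pos n - pos m) * pos c₁) (absorption n m) ⟩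
      (pos n - pos m) * pos c₀ + (pos n - pos m) * pos c₁
        ≡⟨ solve 4 (λ n m c d → (n :- m) :* c :+ (n :- m) :* d := (con (pos 1) :+ n :- (con (pos 1) :+ m)) :* (c :+ d)) refl (pos n) (pos m) (pos c₀) (pos c₁) ⟩
      (pos (suc n) - pos (suc m)) * (pos c₀ + pos c₁) ≡⟨ cong (λ c → (pos (suc n) - pos (suc m)) * pos c) (nCk+nC[k+1]≡[n+1]C[k+1] n m) ⟩
      (pos (suc n) - pos (suc m)) * pos (suc n C suc m) ∎
      where
      c₀ c₁ c₂ : ℕ
      c₀ = n C m
      c₁ = n C suc m
      c₂ = n C (2 ℕ.+ m)

    e₁ e₀ : ℕ → ℕ → ℤ
    e₁ n m = pos (suc m) * ((pos (suc m) - pos 4 * pos n) + (pos m - (pos 4 * pos n + pos 1)))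
    e₀ n m = (pos m - (pos 4 * pos n + pos 1)) * (pos m - pos 4 * pos n)

    -- Two uses of `absorption` re-expand a quadratic multiple of a binomial in the basis of
    -- binomials. The roots 4n and 4n + 1 of the quadratic are the two largest exponents of u in the
    -- form of degree n.
    two-nodes : ∀ n m z → (pos z - pos 4 * pos n) * (pos z - (pos 4 * pos n + pos 1)) * pos (z C m)
      ≡ pos (suc m) * pos (suc (suc m)) * pos (z C suc (suc m)) + (e₁ n m * pos (z C suc m) + e₀ n m * pos (z C m))
    two-nodes n m z = begin
      (ζ - a) * (ζ - b) * c₀
        ≡⟨ solve 5 (λ ζ a b c m → (ζ :- a) :* (ζ :- b) :* c := (ζ :- a) :* ((ζ :- m) :* c) :+ (ζ :- a) :* (m :- b) :* c) refl ζ a b c₀ (pos m) ⟩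
      (ζ - a) * ((ζ - pos m) * c₀) + (ζ - a) * (pos m - b) * c₀
        ≡⟨ cong (λ w → (ζ - a) * w + (ζ - a) * (pos m - b) * c₀) (absorption z m) ⟨
      (ζ - a) * (pos (suc m) * c₁) + (ζ - a) * (pos m - b) * c₀
        ≡⟨ solve 7 (λ ζ a b c₀ c₁ m m′ → (ζ :- a) :* (m′ :* c₁) :+ (ζ :- a) :* (m :- b) :* c₀
             := m′ :* ((ζ :- m′) :* c₁) :+ m′ :* (m′ :- a) :* c₁ :+ ((m :- b) :* ((ζ :- m) :* c₀) :+ (m :- b) :* (m :- a) :* c₀)) refl ζ a b c₀ c₁ (pos m) (pos (suc m)) ⟩
      pos (suc m) * ((ζ - pos (suc m)) * c₁) + pos (suc m) * (pos (suc m) - a) * c₁ + ((pos m - b) * ((ζ - pos m) * c₀) + (pos m - b) * (pos m - a) * c₀)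
        ≡⟨ cong₂ (λ p q → pos (suc m) * p + pos (suc m) * (pos (suc m) - a) * c₁ + ((pos m - b) * q + (pos m - b) * (pos m - a) * c₀)) (absorption z (suc m)) (absorption z m) ⟨
      pos (suc m) * (pos (suc (suc m)) * c₂) + pos (suc m) * (pos (suc m) - a) * c₁ + ((pos m - b) * (pos (suc m) * c₁) + (pos m - b) * (pos m - a) * c₀)
        ≡⟨ solve 8 (λ a b c₀ c₁ c₂ m m′ m″ → m′ :* (m″ :* c₂) :+ m′ :* (m′ :- a) :* c₁ :+ ((m :- b) :* (m′ :* c₁) :+ (m :- b) :* (m :- a) :* c₀)
             := m′ :* m″ :* c₂ :+ (m′ :* ((m′ :- a) :+ (m :- b)) :* c₁ :+ (m :- b) :* (m :- a) :* c₀)) refl a b c₀ c₁ c₂ (pos m) (pos (suc m)) (pos (suc (suc m))) ⟩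
      pos (suc m) * pos (suc (suc m)) * c₂ + (e₁ n m * c₁ + e₀ n m * c₀) ∎
      where
      ζ a b c₀ c₁ c₂ : ℤ
      ζ = pos z
      a = pos 4 * pos n
      b = pos 4 * pos n + pos 1
      c₀ = pos (z C m)
      c₁ = pos (z C suc m)
      c₂ = pos (z C suc (suc m))

    τ : ℕ → ℕ → ℕ → ℤ
    τ m k l = pos (coef k l) * (pos ((4 ℕ.* k) C m) - pos (suc (4 ℕ.* l) C m))

    -- The coefficient of δᵐ in the expansion of the approximating form about v.
    ρ : ℕ → ℕ → ℤ
    ρ n m = ∑ (τ m) n

    private
      ∑0 : ∀ n → ∑ (λ _ _ → pos 0) n ≡ pos 0
      ∑0 zero = refl
      ∑0 (suc n) = trans (ℤ.+-identityˡ _) (∑0 n)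

      nodeʳ : ∀ l → pos (l ℕ.* (4 ℕ.* l ℕ.+ 1)) ≡ pos l * (pos 4 * pos l + pos 1)
      nodeʳ l = trans (ℤ.pos-* l _) (cong (λ x → pos l * (x + pos 1)) (ℤ.pos-* 4 l))

      nodeˡ : ∀ k → pos (node⁻ k) ≡ pos k * (pos 4 * pos k - pos 1)
      nodeˡ zero = refl
      nodeˡ (suc k) = trans (ℤ.pos-* (suc k) (4 ℕ.* k ℕ.+ 3)) (cong (pos (suc k) *_)
        (trans (cong (_+ pos 3) (ℤ.pos-* 4 k)) (solve 1 (λ k → con (pos 4) :* k :+ con (pos 3) := con (pos 4) :* (con (pos 1) :+ k) :- con (pos 1)) refl (pos k))))

      shiftʳ-ℤ : ∀ n k l → k ℕ.+ l ≡ suc n → pos l * (pos 4 * pos l + pos 1) * pos (coef k l) ≡ pos (h n) * pos (shiftʳ coef k l)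
      shiftʳ-ℤ n k l e = trans (cong (_* pos (coef k l)) (sym (nodeʳ l))) (trans (sym (ℤ.pos-* (l ℕ.* (4 ℕ.* l ℕ.+ 1)) (coef k l)))
        (trans (cong pos (trans (coef-shiftʳ k l) (cong (λ n → h (ℕ.pred n) ℕ.* shiftʳ coef k l) e))) (ℤ.pos-* (h n) (shiftʳ coef k l))))

      shiftˡ-ℤ : ∀ n k l → k ℕ.+ l ≡ suc n → pos k * (pos 4 * pos k - pos 1) * pos (coef k l) ≡ pos (h n) * pos (shiftˡ coef k l)
      shiftˡ-ℤ n k l e = trans (cong (_* pos (coef k l)) (sym (nodeˡ k))) (trans (sym (ℤ.pos-* (node⁻ k) (coef k l)))
        (trans (cong pos (trans (coef-shiftˡ k l) (cong (λ n → h (ℕ.pred n) ℕ.* shiftˡ coef k l) e))) (ℤ.pos-* (h n) (shiftˡ coef k l))))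

      ∑-shift : ∀ n (f g : ℕ → ℤ) → ∑ (λ k l → pos (shiftʳ coef k l) * f k - pos (shiftˡ coef k l) * g l) (suc n)
        ≡ ∑ (λ k l → pos (coef k l) * (f k - g l)) n
      ∑-shift n f g = begin
        ∑ (λ k l → pos (shiftʳ coef k l) * f k - pos (shiftˡ coef k l) * g l) (suc n)
          ≡⟨ ∑-cong (suc n) (λ k l _ → solve 4 (λ a b c d → a :* b :- c :* d := a :* b :+ con ℤ.-1ℤ :* (c :* d)) refl (pos (shiftʳ coef k l)) (f k) (pos (shiftˡ coef k l)) (g l)) ⟩
        ∑ (λ k l → pos (shiftʳ coef k l) * f k + ℤ.-1ℤ * (pos (shiftˡ coef k l) * g l)) (suc n)
          ≡⟨ ∑-+ (suc n) (λ k l → pos (shiftʳ coef k l) * f k) (λ k l → ℤ.-1ℤ * (pos (shiftˡ coef k l) * g l)) ⟩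
        ∑ (λ k l → pos (shiftʳ coef k l) * f k) (suc n) + ∑ (λ k l → ℤ.-1ℤ * (pos (shiftˡ coef k l) * g l)) (suc n)
          ≡⟨ cong₂ _+_ (∑-sucʳ n (λ k l → pos (shiftʳ coef k l) * f k) (λ _ → refl)) (∑-sucˡ n (λ k l → ℤ.-1ℤ * (pos (shiftˡ coef k l) * g l)) (λ _ → refl)) ⟩
        ∑ (λ k l → pos (coef k l) * f k) n + ∑ (λ k l → ℤ.-1ℤ * (pos (coef k l) * g l)) n
          ≡⟨ ∑-+ n (λ k l → pos (coef k l) * f k) (λ k l → ℤ.-1ℤ * (pos (coef k l) * g l)) ⟨
        ∑ (λ k l → pos (coef k l) * f k + ℤ.-1ℤ * (pos (coef k l) * g l)) n
          ≡⟨ ∑-cong n (λ k l _ → solve 3 (λ c f g → c :* f :+ con ℤ.-1ℤ :* (c :* g) := c :* (f :- g)) refl (pos (coef k l)) (f k) (g l)) ⟩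
        ∑ (λ k l → pos (coef k l) * (f k - g l)) n ∎

    ρ-0 : ∀ n → ρ n 0 ≡ pos 0
    ρ-0 n = trans (∑-cong n λ k l _ → trans (cong (pos (coef k l) *_) (cong₂ (λ c d → pos c - pos d) (nC0≡1 (4 ℕ.* k)) (nC0≡1 (suc (4 ℕ.* l))))) (ℤ.*-zeroʳ (pos (coef k l)))) (∑0 n)

    -- (k + l)(4k - 4l - 1) = k(4k - 1) - l(4l + 1), and each of the two products lowers `coef` to
    -- degree n, so the same sum occurs twice with opposite signs.
    ρ-1 : ∀ n → ρ (suc n) 1 ≡ pos 0
    ρ-1 n = ℤ.*-cancelˡ-≡ (pos (suc n)) (ρ (suc n) 1) (pos 0) (begin
      pos (suc n) * ρ (suc n) 1 ≡⟨ ∑-* (suc n) (pos (suc n)) (τ 1) ⟨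
      ∑ (λ k l → pos (suc n) * τ 1 k l) (suc n) ≡⟨ ∑-cong (suc n) term ⟩
      ∑ (λ k l → pos (h n) * (ℤ.-1ℤ * (pos (shiftʳ coef k l) * pos 1 - pos (shiftˡ coef k l) * pos 1))) (suc n) ≡⟨ ∑-* (suc n) (pos (h n)) (λ k l → ℤ.-1ℤ * (pos (shiftʳ coef k l) * pos 1 - pos (shiftˡ coef k l) * pos 1)) ⟩
      pos (h n) * ∑ (λ k l → ℤ.-1ℤ * (pos (shiftʳ coef k l) * pos 1 - pos (shiftˡ coef k l) * pos 1)) (suc n)
        ≡⟨ cong (pos (h n) *_) (∑-* (suc n) ℤ.-1ℤ (λ k l → pos (shiftʳ coef k l) * pos 1 - pos (shiftˡ coef k l) * pos 1)) ⟩
      pos (h n) * (ℤ.-1ℤ * ∑ (λ k l → pos (shiftʳ coef k l) * pos 1 - pos (shiftˡ coef k l) * pos 1) (suc n))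
        ≡⟨ cong (λ s → pos (h n) * (ℤ.-1ℤ * s)) (trans (∑-shift n (λ _ → pos 1) (λ _ → pos 1)) (trans (∑-cong n (λ k l _ → ℤ.*-zeroʳ (pos (coef k l)))) (∑0 n))) ⟩
      pos (h n) * pos 0 ≡⟨ ℤ.*-zeroʳ (pos (h n)) ⟩
      pos 0 ≡⟨ ℤ.*-zeroʳ (pos (suc n)) ⟨
      pos (suc n) * pos 0 ∎)
      where
      term : ∀ k l → k ℕ.+ l ≡ suc n → pos (suc n) * τ 1 k l ≡ pos (h n) * (ℤ.-1ℤ * (pos (shiftʳ coef k l) * pos 1 - pos (shiftˡ coef k l) * pos 1))
      term k l e = begin
        pos (suc n) * (pos (coef k l) * (pos ((4 ℕ.* k) C 1) - pos (suc (4 ℕ.* l) C 1)))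
          ≡⟨ cong₂ (λ N d → pos N * (pos (coef k l) * d)) (sym e) (cong₂ _-_
               (trans (cong pos (nC1≡n (4 ℕ.* k))) (ℤ.pos-* 4 k))
               (trans (cong pos (nC1≡n (suc (4 ℕ.* l)))) (cong (pos 1 +_) (ℤ.pos-* 4 l)))) ⟩
        (pos k + pos l) * (pos (coef k l) * (pos 4 * pos k - (pos 1 + pos 4 * pos l)))
          ≡⟨ solve 3 (λ k l c → (k :+ l) :* (c :* (con (pos 4) :* k :- (con (pos 1) :+ con (pos 4) :* l)))
               := k :* (con (pos 4) :* k :- con (pos 1)) :* c :- l :* (con (pos 4) :* l :+ con (pos 1)) :* c) refl (pos k) (pos l) (pos (coef k l)) ⟩
        pos k * (pos 4 * pos k - pos 1) * pos (coef k l) - pos l * (pos 4 * pos l + pos 1) * pos (coef k l)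
          ≡⟨ cong₂ _-_ (shiftˡ-ℤ n k l e) (shiftʳ-ℤ n k l e) ⟩
        pos (h n) * pos (shiftˡ coef k l) - pos (h n) * pos (shiftʳ coef k l)
          ≡⟨ solve 3 (λ h a b → h :* a :- h :* b := h :* (con ℤ.-1ℤ :* (b :* con (pos 1) :- a :* con (pos 1)))) refl (pos (h n)) (pos (shiftˡ coef k l)) (pos (shiftʳ coef k l)) ⟩
        pos (h n) * (ℤ.-1ℤ * (pos (shiftʳ coef k l) * pos 1 - pos (shiftˡ coef k l) * pos 1)) ∎

    -- Take the operator that multiplies u^z by (z - 4N)(z - 4N - 1), where N = n + 1. For k + l = N
    -- it multiplies u^(4k) by 4l(4l + 1) and u^(4l+1) by 4k(4k - 1). These factors lower `coef`, so
    -- the form of degree N turns into 4 `h n` times the form of degree n. `two-nodes` expresses the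
    -- same operator on the Taylor coefficients at u = v.
    ρ-step : ∀ n m → pos 4 * (pos (h n) * ρ n m)
      ≡ pos (suc m) * pos (suc (suc m)) * ρ (suc n) (suc (suc m)) + (e₁ (suc n) m * ρ (suc n) (suc m) + e₀ (suc n) m * ρ (suc n) m)
    ρ-step n m = begin
      pos 4 * (pos (h n) * ρ n m) ≡⟨ cong (λ s → pos 4 * (pos (h n) * s)) (∑-shift n f g) ⟨
      pos 4 * (pos (h n) * ∑ F (suc n)) ≡⟨ cong (pos 4 *_) (∑-* (suc n) (pos (h n)) F) ⟨
      pos 4 * ∑ (λ k l → pos (h n) * F k l) (suc n) ≡⟨ ∑-* (suc n) (pos 4) (λ k l → pos (h n) * F k l) ⟨
      ∑ (λ k l → pos 4 * (pos (h n) * F k l)) (suc n) ≡⟨ ∑-cong (suc n) term ⟩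
      ∑ (λ k l → p * τ (suc (suc m)) k l + (e₁ (suc n) m * τ (suc m) k l + e₀ (suc n) m * τ m k l)) (suc n)
        ≡⟨ ∑-+ (suc n) (λ k l → p * τ (suc (suc m)) k l) (λ k l → e₁ (suc n) m * τ (suc m) k l + e₀ (suc n) m * τ m k l) ⟩
      ∑ (λ k l → p * τ (suc (suc m)) k l) (suc n) + ∑ (λ k l → e₁ (suc n) m * τ (suc m) k l + e₀ (suc n) m * τ m k l) (suc n)
        ≡⟨ cong₂ _+_ (∑-* (suc n) p (τ (suc (suc m)))) (trans (∑-+ (suc n) (λ k l → e₁ (suc n) m * τ (suc m) k l) (λ k l → e₀ (suc n) m * τ m k l))
             (cong₂ _+_ (∑-* (suc n) (e₁ (suc n) m) (τ (suc m))) (∑-* (suc n) (e₀ (suc n) m) (τ m)))) ⟩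
      p * ρ (suc n) (suc (suc m)) + (e₁ (suc n) m * ρ (suc n) (suc m) + e₀ (suc n) m * ρ (suc n) m) ∎
      where
      p : ℤ
      p = pos (suc m) * pos (suc (suc m))
      f g : ℕ → ℤ
      f k = pos ((4 ℕ.* k) C m)
      g l = pos (suc (4 ℕ.* l) C m)
      F : ℕ → ℕ → ℤ
      F k l = pos (shiftʳ coef k l) * f k - pos (shiftˡ coef k l) * g l
      node₁ : ∀ k l → k ℕ.+ l ≡ suc n → pos 4 * (pos l * (pos 4 * pos l + pos 1)) * f k
        ≡ p * pos ((4 ℕ.* k) C suc (suc m)) + (e₁ (suc n) m * pos ((4 ℕ.* k) C suc m) + e₀ (suc n) m * f k)
      node₁ k l e = trans (cong (_* f k) (begin
        pos 4 * (pos l * (pos 4 * pos l + pos 1))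
          ≡⟨ solve 2 (λ k l → con (pos 4) :* (l :* (con (pos 4) :* l :+ con (pos 1)))
               := (con (pos 4) :* k :- con (pos 4) :* (k :+ l)) :* (con (pos 4) :* k :- (con (pos 4) :* (k :+ l) :+ con (pos 1)))) refl (pos k) (pos l) ⟩
        (pos 4 * pos k - pos 4 * pos (k ℕ.+ l)) * (pos 4 * pos k - (pos 4 * pos (k ℕ.+ l) + pos 1))
          ≡⟨ cong₂ (λ ζ N → (ζ - pos 4 * pos N) * (ζ - (pos 4 * pos N + pos 1))) (sym (ℤ.pos-* 4 k)) e ⟩
        (pos (4 ℕ.* k) - pos 4 * pos (suc n)) * (pos (4 ℕ.* k) - (pos 4 * pos (suc n) + pos 1)) ∎)) (two-nodes (suc n) m (4 ℕ.* k))
      node₂ : ∀ k l → k ℕ.+ l ≡ suc n → pos 4 * (pos k * (pos 4 * pos k - pos 1)) * g l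
        ≡ p * pos (suc (4 ℕ.* l) C suc (suc m)) + (e₁ (suc n) m * pos (suc (4 ℕ.* l) C suc m) + e₀ (suc n) m * g l)
      node₂ k l e = trans (cong (_* g l) (begin
        pos 4 * (pos k * (pos 4 * pos k - pos 1))
          ≡⟨ solve 2 (λ k l → con (pos 4) :* (k :* (con (pos 4) :* k :- con (pos 1)))
               := (con (pos 1) :+ con (pos 4) :* l :- con (pos 4) :* (k :+ l)) :* (con (pos 1) :+ con (pos 4) :* l :- (con (pos 4) :* (k :+ l) :+ con (pos 1)))) refl (pos k) (pos l) ⟩
        (pos 1 + pos 4 * pos l - pos 4 * pos (k ℕ.+ l)) * (pos 1 + pos 4 * pos l - (pos 4 * pos (k ℕ.+ l) + pos 1))
          ≡⟨ cong₂ (λ ζ N → (ζ - pos 4 * pos N) * (ζ - (pos 4 * pos N + pos 1))) (sym (cong (pos 1 +_) (ℤ.pos-* 4 l))) e ⟩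
        (pos (suc (4 ℕ.* l)) - pos 4 * pos (suc n)) * (pos (suc (4 ℕ.* l)) - (pos 4 * pos (suc n) + pos 1)) ∎)) (two-nodes (suc n) m (suc (4 ℕ.* l)))
      term : ∀ k l → k ℕ.+ l ≡ suc n → pos 4 * (pos (h n) * F k l) ≡ p * τ (suc (suc m)) k l + (e₁ (suc n) m * τ (suc m) k l + e₀ (suc n) m * τ m k l)
      term k l e = begin
        pos 4 * (pos (h n) * F k l)
          ≡⟨ solve 5 (λ h a b f g → con (pos 4) :* (h :* (a :* f :- b :* g)) := con (pos 4) :* (h :* a) :* f :- con (pos 4) :* (h :* b) :* g)
               refl (pos (h n)) (pos (shiftʳ coef k l)) (pos (shiftˡ coef k l)) (f k) (g l) ⟩
        pos 4 * (pos (h n) * pos (shiftʳ coef k l)) * f k - pos 4 * (pos (h n) * pos (shiftˡ coef k l)) * g l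
          ≡⟨ cong₂ (λ a b → pos 4 * a * f k - pos 4 * b * g l) (shiftʳ-ℤ n k l e) (shiftˡ-ℤ n k l e) ⟨
        pos 4 * (N₁ * c) * f k - pos 4 * (N₂ * c) * g l
          ≡⟨ solve 5 (λ N₁ N₂ c f g → con (pos 4) :* (N₁ :* c) :* f :- con (pos 4) :* (N₂ :* c) :* g := c :* (con (pos 4) :* N₁ :* f :- con (pos 4) :* N₂ :* g)) refl N₁ N₂ c (f k) (g l) ⟩
        c * (pos 4 * N₁ * f k - pos 4 * N₂ * g l) ≡⟨ cong₂ (λ a b → c * (a - b)) (node₁ k l e) (node₂ k l e) ⟩
        c * (p * x₂ + (e₁ (suc n) m * x₁ + e₀ (suc n) m * f k) - (p * y₂ + (e₁ (suc n) m * y₁ + e₀ (suc n) m * g l)))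
          ≡⟨ solve 10 (λ c p x₂ e₁ x₁ e₀ f y₂ y₁ g → c :* (p :* x₂ :+ (e₁ :* x₁ :+ e₀ :* f) :- (p :* y₂ :+ (e₁ :* y₁ :+ e₀ :* g)))
               := p :* (c :* (x₂ :- y₂)) :+ (e₁ :* (c :* (x₁ :- y₁)) :+ e₀ :* (c :* (f :- g)))) refl c p x₂ (e₁ (suc n) m) x₁ (e₀ (suc n) m) (f k) y₂ y₁ (g l) ⟩
        p * (c * (x₂ - y₂)) + (e₁ (suc n) m * (c * (x₁ - y₁)) + e₀ (suc n) m * (c * (f k - g l))) ∎
        where
        c N₁ N₂ x₁ x₂ y₁ y₂ : ℤ
        c = pos (coef k l)
        N₁ = pos l * (pos 4 * pos l + pos 1)
        N₂ = pos k * (pos 4 * pos k - pos 1)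
        x₁ = pos ((4 ℕ.* k) C suc m)
        x₂ = pos ((4 ℕ.* k) C suc (suc m))
        y₁ = pos (suc (4 ℕ.* l) C suc m)
        y₂ = pos (suc (4 ℕ.* l) C suc (suc m))

    -- `ρ-step` reaches order m + 2 in degree n + 1 from the orders m and m + 1 in that degree and
    -- the order m in degree n; each degree therefore gains two orders.
    ρ-vanishes : ∀ n m → m ≤ 2 ℕ.* n → ρ n m ≡ pos 0
    ρ-vanishes n zero _ = ρ-0 n
    ρ-vanishes (suc n) (suc zero) _ = ρ-1 n
    ρ-vanishes (suc n) (suc (suc m)) m≤ = ℤ.*-cancelˡ-≡ (pos (suc m) * pos (suc (suc m))) _ (pos 0) (begin
      q * ρ (suc n) (suc (suc m))
        ≡⟨ solve 3 (λ a b c → a := a :+ (b :* con (pos 0) :+ c :* con (pos 0))) refl (q * ρ (suc n) (suc (suc m))) (e₁ (suc n) m) (e₀ (suc n) m) ⟩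
      q * ρ (suc n) (suc (suc m)) + (e₁ (suc n) m * pos 0 + e₀ (suc n) m * pos 0)
        ≡⟨ cong₂ (λ x y → q * ρ (suc n) (suc (suc m)) + (e₁ (suc n) m * x + e₀ (suc n) m * y))
             (ρ-vanishes (suc n) (suc m) (ℕ.≤-trans (ℕ.n≤1+n (suc m)) m≤)) (ρ-vanishes (suc n) m (ℕ.≤-trans (ℕ.m≤n+m m 2) m≤)) ⟨
      q * ρ (suc n) (suc (suc m)) + (e₁ (suc n) m * ρ (suc n) (suc m) + e₀ (suc n) m * ρ (suc n) m) ≡⟨ ρ-step n m ⟨
      pos 4 * (pos (h n) * ρ n m) ≡⟨ cong (λ r → pos 4 * (pos (h n) * r)) (ρ-vanishes n m m≤2n) ⟩
      pos 4 * (pos (h n) * pos 0) ≡⟨ cong (pos 4 *_) (ℤ.*-zeroʳ (pos (h n))) ⟩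
      pos 0 ≡⟨ ℤ.*-zeroʳ q ⟨
      q * pos 0 ∎)
      where
      q : ℤ
      q = pos (suc m) * pos (suc (suc m))
      m≤2n : m ≤ 2 ℕ.* n
      m≤2n = ℕ.+-cancelˡ-≤ 2 m (2 ℕ.* n) (ℕ.≤-trans m≤ (ℕ.≤-reflexive (ℕ.*-suc 2 n)))

-- Squared absolute values and a bound for the approximating form

module CoefficientBounds where
  open Algebras
  open Coefficients
  open DiagonalSums
  open GaussianExtension
  open VanishingOrder
  open import Data.Nat.Base as ℕ using (ℕ; zero; suc; _≤_; z≤n; s≤s)
  import Data.Nat.Properties as ℕ
  open import Data.Nat.Solver using (module +-*-Solver)
  open import Data.Nat.Combinatorics using (_C_; k>n⇒nCk≡0; nCk+nC[k+1]≡[n+1]C[k+1])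
  open import Data.Integer.Base as ℤ using (ℤ; ∣_∣) renaming (+_ to pos)
  import Data.Integer.Properties as ℤ
  open import Data.Product using (_,_)
  open import Relation.Nullary using (yes; no)
  open import Relation.Binary.PropositionalEquality

  -- `N` plays the squared absolute value. `N-triangle` is |x + y|² ≤ (1 + 1/k)|x|² + (1 + k)|y|²
  -- multiplied by k; for large k the main term x loses almost nothing. This replaces square roots
  -- throughout.
  record Norm (A : ℤAlgebra) : Set where
    open ℤAlgebra A
    field
      N : Carrier → ℕ
      N-* : ∀ x y → N (x * y) ≡ N x ℕ.* N y
      N-ι : ∀ n → N (ι n) ≡ ∣ n ∣ ℕ.* ∣ n ∣
      N-neg : ∀ x → N (- x) ≡ N x
      N≡0⇒≡0 : ∀ x → N x ≡ 0 → x ≡ 0#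
      N-triangle : ∀ k x y → k ℕ.* N (x + y) ≤ suc k ℕ.* (N x ℕ.+ k ℕ.* N y)

    N-0 : N 0# ≡ 0
    N-0 = trans (cong N (sym ι-0)) (N-ι (pos 0))

  module CoefficientSum where
    open DiagonalSum ℤA
    open ≡-Reasoning

    ∑-pos : ∀ n f → pos (∑ℕ f n) ≡ ∑ (λ k l → pos (f k l)) n
    ∑-pos zero f = refl
    ∑-pos (suc n) f = trans (ℤ.pos-+ (f 0 (suc n)) _) (cong (λ s → pos (f 0 (suc n)) ℤ.+ s) (∑-pos n (λ k → f (suc k))))

    private
      X1 : ∀ n → X (pos 1) (pos 1) n ≡ pos (8 ℕ.^ n ℕ.* n !!)
      X1 zero = cong (λ c → pos c ℤ.* pos 1) (coef-0ˡ 0)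
      X1 (suc zero) = cong₂ (λ c d → pos c ℤ.* pos 1 ℤ.+ pos d ℤ.* pos 1) (coef-0ˡ 1) (coef-0ʳ 1)
      X1 (suc (suc n)) = begin
        X (pos 1) (pos 1) (suc (suc n)) ≡⟨ X-recurrence (pos 1) (pos 1) n ⟩
        d ℤ.* pos 2 ℤ.* X (pos 1) (pos 1) (suc n) ℤ.- c ℤ.* pos 0 ℤ.* pos 0 ℤ.* X (pos 1) (pos 1) n
          ≡⟨ solve 4 (λ d c x y → d :* con (pos 2) :* x :- c :* con (pos 0) :* con (pos 0) :* y := con (pos 2) :* d :* x) refl d c (X (pos 1) (pos 1) (suc n)) (X (pos 1) (pos 1) n) ⟩
        pos 2 ℤ.* d ℤ.* X (pos 1) (pos 1) (suc n) ≡⟨ cong₂ ℤ._*_ (sym (ℤ.pos-* 2 (4 ℕ.* (2 ℕ.* n ℕ.+ 3)))) (X1 (suc n)) ⟩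
        pos (2 ℕ.* (4 ℕ.* (2 ℕ.* n ℕ.+ 3))) ℤ.* pos (8 ℕ.^ suc n ℕ.* suc n !!) ≡⟨ ℤ.pos-* (2 ℕ.* (4 ℕ.* (2 ℕ.* n ℕ.+ 3))) (8 ℕ.^ suc n ℕ.* suc n !!) ⟨
        pos (2 ℕ.* (4 ℕ.* (2 ℕ.* n ℕ.+ 3)) ℕ.* (8 ℕ.^ suc n ℕ.* suc n !!))
          ≡⟨ cong pos (S.solve 3 (λ n e f → S.con 2 S.:* (S.con 4 S.:* (S.con 2 S.:* n S.:+ S.con 3)) S.:* (e S.:* f)
                S.:= S.con 8 S.:* e S.:* ((S.con 1 S.:+ S.con 2 S.:* (S.con 1 S.:+ n)) S.:* f)) refl n (8 ℕ.^ suc n) (suc n !!)) ⟩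
        pos (8 ℕ.^ suc (suc n) ℕ.* suc (suc n) !!) ∎
        where
        open ℤAlgebra.Solver ℤA
        module S = +-*-Solver
        c d : ℤ
        c = pos ((4 ℕ.* n ℕ.+ 3) ℕ.* (4 ℕ.* n ℕ.+ 5))
        d = pos (4 ℕ.* (2 ℕ.* n ℕ.+ 3))

      1^ : ∀ k → ℤAlgebra._^_ ℤA (pos 1) k ≡ pos 1
      1^ zero = refl
      1^ (suc k) = trans (ℤ.*-identityˡ _) (1^ k)

    -- Evaluate the form at x = y = 1: the term with (x - y)² drops out of the recurrence, which
    -- then only multiplies by 8(2n + 3).
    ∑-coef : ∀ n → ∑ℕ coef n ≡ 8 ℕ.^ n ℕ.* n !!
    ∑-coef n = ℤ.+-injective (begin
      pos (∑ℕ coef n) ≡⟨ ∑-pos n coef ⟩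
      ∑ (λ k l → pos (coef k l)) n ≡⟨ ∑-cong n (λ k l _ → trans (cong₂ (λ p q → pos (coef k l) ℤ.* (p ℤ.* q)) (1^ k) (1^ l)) (ℤ.*-identityʳ _)) ⟨
      X (pos 1) (pos 1) n ≡⟨ X1 n ⟩
      pos (8 ℕ.^ n ℕ.* n !!) ∎)

    ∣∑∣-bound : ∀ B n (f : ℕ → ℕ → ℤ) (g : ℕ → ℕ → ℕ) → (∀ k l → k ℕ.+ l ≡ n → ∣ f k l ∣ ≤ g k l ℕ.* B) → ∣ ∑ f n ∣ ≤ ∑ℕ g n ℕ.* B
    ∣∑∣-bound B zero f g le = le 0 0 refl
    ∣∑∣-bound B (suc n) f g le = ℕ.≤-trans (ℤ.∣i+j∣≤∣i∣+∣j∣ (f 0 (suc n)) _) (ℕ.≤-trans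
      (ℕ.+-mono-≤ (le 0 (suc n) refl) (∣∑∣-bound B n (λ k → f (suc k)) (λ k → g (suc k)) (λ k l e → le (suc k) l (cong suc e))))
      (ℕ.≤-reflexive (sym (ℕ.*-distribʳ-+ B (g 0 (suc n)) _))))

    open Vanishing using (ρ; τ)

    ∣ρ∣-bound : ∀ n m → ∣ ρ n m ∣ ≤ 8 ℕ.^ n ℕ.* n !! ℕ.* 2 ℕ.^ suc (4 ℕ.* n)
    ∣ρ∣-bound n m = ℕ.≤-trans (∣∑∣-bound (2 ℕ.^ suc (4 ℕ.* n)) n (τ m) coef term) (ℕ.≤-reflexive (cong (ℕ._* 2 ℕ.^ suc (4 ℕ.* n)) (∑-coef n)))
      where
      ∣-∣-bound : ∀ {a b c} → a ≤ c → b ≤ c → ∣ pos a ℤ.- pos b ∣ ≤ c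
      ∣-∣-bound {a} {b} {c} a≤c b≤c = ℕ.≤-trans (ℕ.≤-reflexive (cong ∣_∣ (ℤ.m-n≡m⊖n a b))) (ℕ.≤-trans (ℤ.∣m⊝n∣≤m⊔n a b) (ℕ.⊔-lub a≤c b≤c))
      2^-mono : ∀ {j n} → j ≤ n → 2 ℕ.^ j ≤ 2 ℕ.^ n
      2^-mono = ℕ.^-monoʳ-≤ 2
      term : ∀ k l → k ℕ.+ l ≡ n → ∣ τ m k l ∣ ≤ coef k l ℕ.* 2 ℕ.^ suc (4 ℕ.* n)
      term k l refl = ℕ.≤-trans (ℕ.≤-reflexive (ℤ.abs-* (pos (coef k l)) _)) (ℕ.*-monoʳ-≤ (coef k l) (∣-∣-bound
        (ℕ.≤-trans (nCk≤2^n (4 ℕ.* k) m) (2^-mono (ℕ.≤-trans (ℕ.*-monoʳ-≤ 4 (ℕ.m≤m+n k l)) (ℕ.n≤1+n _))))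
        (ℕ.≤-trans (nCk≤2^n (suc (4 ℕ.* l)) m) (2^-mono (s≤s (ℕ.*-monoʳ-≤ 4 (ℕ.m≤n+m l k)))))))

  module Expansion (A : ℤAlgebra) where
    open ℤAlgebra A
    open Solver
    open DiagonalSum A
    open ≡-Reasoning
    open Vanishing using (ρ; τ)
    private module Σℤ = DiagonalSum ℤA

    ι-∑ : ∀ n f → ι (Σℤ.∑ f n) ≡ ∑ (λ k l → ι (f k l)) n
    ι-∑ zero f = refl
    ι-∑ (suc n) f = trans (ι-+ _ _) (+-congˡ (ι-∑ n (λ k → f (suc k))))

    ^-+ : ∀ x m n → x ^ (m ℕ.+ n) ≡ x ^ m * x ^ n
    ^-+ x zero n = sym (*-identityˡ _)
    ^-+ x (suc m) n = trans (*-congˡ (^-+ x m n)) (sym (*-assoc _ _ _))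

    private
      ∑0 : ∀ n f → (∀ k l → f k l ≡ 0#) → ∑ f n ≡ 0#
      ∑0 zero f e = e 0 0
      ∑0 (suc n) f e = trans (cong₂ _+_ (e 0 (suc n)) (∑0 n (λ k → f (suc k)) (λ k → e (suc k)))) (+-identityˡ _)

      0C : ∀ δ v m l → ι (pos (0 C suc m)) * (δ ^ suc m * v ^ l) ≡ 0#
      0C δ v m l = trans (*-congʳ (trans (cong (λ c → ι (pos c)) (k>n⇒nCk≡0 {0} {suc m} (s≤s z≤n))) ι-0)) (zeroˡ _)

      0C0 : ∀ δ v l → ι (pos (0 C 0)) * (δ ^ 0 * v ^ l) ≡ v ^ l
      0C0 δ v l = trans (cong₂ _*_ ι-1 (*-identityˡ _)) (*-identityˡ _)

    -- The spare power of v makes the expansions of u^(4k) and u^(4l+1) forms of the same degree 4n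
    -- + 1, so that they can be subtracted term by term.
    binomial : ∀ z j δ v → (v + δ) ^ z * v ^ j ≡ form (λ m _ → z C m) δ v (z ℕ.+ j)
    binomial zero zero δ v = trans (*-identityˡ _) (sym (0C0 δ v 0))
    binomial zero (suc j) δ v = trans (*-identityˡ _) (sym (trans
      (cong₂ _+_ (0C0 δ v (suc j)) (∑0 j (λ m l → ι (pos (0 C suc m)) * (δ ^ suc m * v ^ l)) (λ m l → 0C δ v m l))) (+-identityʳ _)))
    binomial (suc z) j δ v = begin
      (v + δ) * (v + δ) ^ z * v ^ j ≡⟨ *-assoc _ _ _ ⟩
      (v + δ) * ((v + δ) ^ z * v ^ j) ≡⟨ *-congˡ (binomial z j δ v) ⟩
      (v + δ) * form c δ v n ≡⟨ distribʳ _ _ _ ⟩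
      v * form c δ v n + δ * form c δ v n ≡⟨ cong₂ _+_ (form-shiftʳ c δ v n) (form-shiftˡ c δ v n) ⟨
      form (shiftʳ c) δ v (suc n) + form (shiftˡ c) δ v (suc n) ≡⟨ form-+ (suc n) (shiftʳ c) (shiftˡ c) δ v ⟨
      form (λ m l → shiftʳ c m l ℕ.+ shiftˡ c m l) δ v (suc n) ≡⟨ form-cong (suc n) δ v pascal ⟩
      form (λ m _ → suc z C m) δ v (suc n) ∎
      where
      c : ℕ → ℕ → ℕ
      c m _ = z C m
      n : ℕ
      n = z ℕ.+ j
      pascal : ∀ m l → m ℕ.+ l ≡ suc n → shiftʳ c m l ℕ.+ shiftˡ c m l ≡ suc z C m
      pascal zero (suc l) e = trans (ℕ.+-identityʳ _) (trans (nC0≡1 z) (sym (nC0≡1 (suc z))))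
      pascal (suc m) (suc l) e = trans (ℕ.+-comm (z C suc m) (z C m)) (nCk+nC[k+1]≡[n+1]C[k+1] z m)
      -- The last coefficient: here m ≥ z, so the neighbour absent from the sum is C(z, m + 1) = 0.
      pascal (suc m) zero e = trans (sym (ℕ.+-identityʳ _)) (trans (cong (z C m ℕ.+_) (sym (k>n⇒nCk≡0 (s≤s z≤m)))) (nCk+nC[k+1]≡[n+1]C[k+1] z m))
        where
        z≤m : z ≤ m
        z≤m = ℕ.≤-trans (ℕ.m≤m+n z j) (ℕ.≤-reflexive (trans (sym (ℕ.suc-injective e)) (ℕ.+-identityʳ m)))

    -- X_n(u⁴, v⁴) v - X_n(v⁴, u⁴) u written out in monomials; see `T-X`.
    T : Carrier → Carrier → ℕ → Carrier
    T u v = ∑ (λ k l → ι (pos (coef k l)) * (u ^ (4 ℕ.* k) * v ^ suc (4 ℕ.* l) - u ^ suc (4 ℕ.* l) * v ^ (4 ℕ.* k)))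

    T-expansion : ∀ δ v n → T (v + δ) v n ≡ ∑ (λ m j → ι (ρ n m) * (δ ^ m * v ^ j)) (suc (4 ℕ.* n))
    T-expansion δ v n = begin
      T (v + δ) v n ≡⟨ ∑-cong n term ⟩
      ∑ (λ k l → ∑ (λ m j → ι (τ m k l) * (δ ^ m * v ^ j)) M) n ≡⟨ ∑-comm n M (λ k l m j → ι (τ m k l) * (δ ^ m * v ^ j)) ⟩
      ∑ (λ m j → ∑ (λ k l → ι (τ m k l) * (δ ^ m * v ^ j)) n) M ≡⟨ ∑-cong M (λ m j _ → begin
        ∑ (λ k l → ι (τ m k l) * (δ ^ m * v ^ j)) n ≡⟨ ∑-cong n (λ k l _ → *-comm (ι (τ m k l)) (δ ^ m * v ^ j)) ⟩
        ∑ (λ k l → (δ ^ m * v ^ j) * ι (τ m k l)) n ≡⟨ ∑-* n (δ ^ m * v ^ j) (λ k l → ι (τ m k l)) ⟩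
        (δ ^ m * v ^ j) * ∑ (λ k l → ι (τ m k l)) n ≡⟨ *-congˡ (ι-∑ n (τ m)) ⟨
        (δ ^ m * v ^ j) * ι (ρ n m) ≡⟨ *-comm _ _ ⟩
        ι (ρ n m) * (δ ^ m * v ^ j) ∎) ⟩
      ∑ (λ m j → ι (ρ n m) * (δ ^ m * v ^ j)) M ∎
      where
      M : ℕ
      M = suc (4 ℕ.* n)
      expand : ∀ z j → z ℕ.+ j ≡ M → (v + δ) ^ z * v ^ j ≡ form (λ m _ → z C m) δ v M
      expand z j e = trans (binomial z j δ v) (cong (form (λ m _ → z C m) δ v) e)
      total : ∀ k l → k ℕ.+ l ≡ n → 4 ℕ.* k ℕ.+ suc (4 ℕ.* l) ≡ M
      total k l refl = trans (ℕ.+-suc (4 ℕ.* k) (4 ℕ.* l)) (cong suc (sym (ℕ.*-distribˡ-+ 4 k l)))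
      term : ∀ k l → k ℕ.+ l ≡ n →
        ι (pos (coef k l)) * ((v + δ) ^ (4 ℕ.* k) * v ^ suc (4 ℕ.* l) - (v + δ) ^ suc (4 ℕ.* l) * v ^ (4 ℕ.* k))
        ≡ ∑ (λ m j → ι (τ m k l) * (δ ^ m * v ^ j)) M
      term k l e = begin
        c * ((v + δ) ^ (4 ℕ.* k) * v ^ suc (4 ℕ.* l) - (v + δ) ^ suc (4 ℕ.* l) * v ^ (4 ℕ.* k))
          ≡⟨ cong₂ (λ p q → c * (p - q)) (expand (4 ℕ.* k) (suc (4 ℕ.* l)) (total k l e))
               (expand (suc (4 ℕ.* l)) (4 ℕ.* k) (trans (ℕ.+-comm (suc (4 ℕ.* l)) (4 ℕ.* k)) (total k l e))) ⟩
        c * (∑ F M - ∑ G M) ≡⟨ solve 3 (λ c f g → c :* (f :- g) := c :* f :+ (:- c) :* g) refl c (∑ F M) (∑ G M) ⟩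
        c * ∑ F M + (- c) * ∑ G M ≡⟨ cong₂ _+_ (∑-* M c F) (∑-* M (- c) G) ⟨
        ∑ (λ m j → c * F m j) M + ∑ (λ m j → (- c) * G m j) M ≡⟨ ∑-+ M (λ m j → c * F m j) (λ m j → (- c) * G m j) ⟨
        ∑ (λ m j → c * F m j + (- c) * G m j) M ≡⟨ ∑-cong M (λ m j _ → begin
          c * (ι (f m) * w m j) + (- c) * (ι (g m) * w m j)
            ≡⟨ solve 4 (λ c f g w → c :* (f :* w) :+ (:- c) :* (g :* w) := c :* (f :- g) :* w) refl c (ι (f m)) (ι (g m)) (w m j) ⟩
          c * (ι (f m) - ι (g m)) * w m j
            ≡⟨ *-congʳ (trans (ι-* (pos (coef k l)) _) (*-congˡ (trans (ι-+ (f m) _) (+-congˡ (ι-neg (g m)))))) ⟨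
          ι (τ m k l) * w m j ∎) ⟩
        ∑ (λ m j → ι (τ m k l) * (δ ^ m * v ^ j)) M ∎
        where
        c : Carrier
        c = ι (pos (coef k l))
        f g : ℕ → ℤ
        f m = pos ((4 ℕ.* k) C m)
        g m = pos (suc (4 ℕ.* l) C m)
        w F G : ℕ → ℕ → Carrier
        w m j = δ ^ m * v ^ j
        F m j = ι (f m) * w m j
        G m j = ι (g m) * w m j

  module GaussianNorm (A : ℤAlgebra) (𝒩 : Norm A) where
    open ℤAlgebra A using (Carrier; ι; 0#; 1#; ι-0; +-identityˡ; +-identityʳ; *-identityˡ; zeroˡ) renaming (_+_ to _⊹_; _*_ to _·_; -_ to ⁻_)
    open Norm 𝒩
    open Adjoin A
    open DiagonalSum Gaussian using (∑)
    open +-*-Solver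

    -- Twice the sum of the squared absolute values of the parts: the factor 2 makes it submultiplicative.
    ν : A[i] → ℕ
    ν z = 2 ℕ.* (N (re z) ℕ.+ N (im z))

    N-+≤ : ∀ x y → N (x ⊹ y) ≤ 2 ℕ.* (N x ℕ.+ N y)
    N-+≤ x y = subst₂ (λ p q → p ≤ 2 ℕ.* (N x ℕ.+ q)) (ℕ.*-identityˡ _) (ℕ.*-identityˡ _) (N-triangle 1 x y)

    ν-* : ∀ z w → ν (z G.* w) ≤ ν z ℕ.* ν w
    ν-* z w rewrite ⊗-parts z w = begin
      2 ℕ.* (N (a ·  c ⊹ ⁻ (b · d)) ℕ.+ N (a · d ⊹ b · c))
        ≤⟨ ℕ.*-monoʳ-≤ 2 (ℕ.+-mono-≤ (N-+≤ (a · c) (⁻ (b · d))) (N-+≤ (a · d) (b · c))) ⟩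
      2 ℕ.* (2 ℕ.* (N (a · c) ℕ.+ N (⁻ (b · d))) ℕ.+ 2 ℕ.* (N (a · d) ℕ.+ N (b · c)))
        ≡⟨ cong₂ (λ p q → 2 ℕ.* (2 ℕ.* p ℕ.+ 2 ℕ.* q))
             (cong₂ ℕ._+_ (N-* a c) (trans (N-neg (b · d)) (N-* b d))) (cong₂ ℕ._+_ (N-* a d) (N-* b c)) ⟩
      2 ℕ.* (2 ℕ.* (N a ℕ.* N c ℕ.+ N b ℕ.* N d) ℕ.+ 2 ℕ.* (N a ℕ.* N d ℕ.+ N b ℕ.* N c))
        ≡⟨ solve 4 (λ a b c d → con 2 :* (con 2 :* (a :* c :+ b :* d) :+ con 2 :* (a :* d :+ b :* c)) := con 2 :* (a :+ b) :* (con 2 :* (c :+ d))) refl (N a) (N b) (N c) (N d) ⟩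
      ν z ℕ.* ν w ∎
      where
      open ℕ.≤-Reasoning

      a b c d : Carrier
      a = re z
      b = im z
      c = re w
      d = im w

    ν-triangle : ∀ k z w → k ℕ.* ν (z G.+ w) ≤ suc k ℕ.* (ν z ℕ.+ k ℕ.* ν w)
    ν-triangle k z w rewrite ⊕-parts z w = begin
      k ℕ.* (2 ℕ.* (N (re z ⊹ re w) ℕ.+ N (im z ⊹ im w)))
        ≡⟨ solve 3 (λ k p q → k :* (con 2 :* (p :+ q)) := con 2 :* (k :* p :+ k :* q)) refl k (N (re z ⊹ re w)) (N (im z ⊹ im w)) ⟩
      2 ℕ.* (k ℕ.* N (re z ⊹ re w) ℕ.+ k ℕ.* N (im z ⊹ im w))
        ≤⟨ ℕ.*-monoʳ-≤ 2 (ℕ.+-mono-≤ (N-triangle k (re z) (re w)) (N-triangle k (im z) (im w))) ⟩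
      2 ℕ.* (suc k ℕ.* (N (re z) ℕ.+ k ℕ.* N (re w)) ℕ.+ suc k ℕ.* (N (im z) ℕ.+ k ℕ.* N (im w)))
        ≡⟨ solve 5 (λ k a b c d → con 2 :* ((con 1 :+ k) :* (a :+ k :* c) :+ (con 1 :+ k) :* (b :+ k :* d))
             := (con 1 :+ k) :* (con 2 :* (a :+ b) :+ k :* (con 2 :* (c :+ d)))) refl k (N (re z)) (N (im z)) (N (re w)) (N (im w)) ⟩
      suc k ℕ.* (ν z ℕ.+ k ℕ.* ν w) ∎
      where open ℕ.≤-Reasoning

    ν-ι : ∀ n z → ν (G.ι n G.* z) ≡ ∣ n ∣ ℕ.* ∣ n ∣ ℕ.* ν z
    ν-ι n z rewrite ⊗-parts (G.ι n) z = begin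
      2 ℕ.* (N (ι n · re z ⊹ ⁻ (0# · im z)) ℕ.+ N (ι n · im z ⊹ 0# · re z))
        ≡⟨ cong₂ (λ p q → 2 ℕ.* (N p ℕ.+ N q)) e₁ (trans (cong (ι n · im z ⊹_) (zeroˡ (re z))) (+-identityʳ _)) ⟩
      2 ℕ.* (N (ι n · re z) ℕ.+ N (ι n · im z)) ≡⟨ cong₂ (λ p q → 2 ℕ.* (p ℕ.+ q)) (trans (N-* _ _) (cong (ℕ._* N (re z)) (N-ι n))) (trans (N-* _ _) (cong (ℕ._* N (im z)) (N-ι n))) ⟩
      2 ℕ.* (m ℕ.* N (re z) ℕ.+ m ℕ.* N (im z)) ≡⟨ solve 3 (λ m a b → con 2 :* (m :* a :+ m :* b) := m :* (con 2 :* (a :+ b))) refl m (N (re z)) (N (im z)) ⟩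
      m ℕ.* ν z ∎
      where
      open ≡-Reasoning
      m : ℕ
      m = ∣ n ∣ ℕ.* ∣ n ∣
      module S = ℤAlgebra.Solver A
      e₁ : ι n · re z ⊹ ⁻ (0# · im z) ≡ ι n · re z
      e₁ = trans (cong (λ o → ι n · re z ⊹ ⁻ o) (trans (zeroˡ (im z)) (sym ι-0))) (S.solve 1 (λ x → x S.:- S.con (pos 0) S.:= x) refl (ι n · re z))

    ν-i : ∀ z → ν (i# G.* z) ≡ ν z
    ν-i z rewrite ⊗-parts i# z = begin
      2 ℕ.* (N (0# · re z ⊹ ⁻ (1# · im z)) ℕ.+ N (0# · im z ⊹ 1# · re z))
        ≡⟨ cong₂ (λ p q → 2 ℕ.* (N p ℕ.+ N q)) (trans (cong₂ (λ p q → p ⊹ ⁻ q) (zeroˡ (re z)) (*-identityˡ (im z))) (+-identityˡ _)) (trans (cong₂ _⊹_ (zeroˡ (im z)) (*-identityˡ (re z))) (+-identityˡ _)) ⟩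
      2 ℕ.* (N (⁻ im z) ℕ.+ N (re z)) ≡⟨ cong (λ p → 2 ℕ.* (p ℕ.+ N (re z))) (N-neg (im z)) ⟩
      2 ℕ.* (N (im z) ℕ.+ N (re z)) ≡⟨ cong (2 ℕ.*_) (ℕ.+-comm (N (im z)) (N (re z))) ⟩
      ν z ∎
      where open ≡-Reasoning

    ν-⟪⟫ : ∀ x → ν ⟪ x ⟫ ≡ 2 ℕ.* N x
    ν-⟪⟫ x = cong (2 ℕ.*_) (trans (cong (N x ℕ.+_) N-0) (ℕ.+-identityʳ _))

    -- The Cauchy-Schwarz bound, obtained by adding one term at a time with weight equal to the
    -- number of terms already summed.
    ν-∑ : ∀ B n f → (∀ k l → k ℕ.+ l ≡ n → ν (f k l) ≤ B) → ν (∑ f n) ≤ suc n ℕ.* suc n ℕ.* B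
    ν-∑ B zero f le = ℕ.≤-trans (le 0 0 refl) (ℕ.≤-reflexive (sym (ℕ.+-identityʳ B)))
    ν-∑ B (suc n) f le = ℕ.*-cancelˡ-≤ (suc n) (begin
      suc n ℕ.* ν (f 0 (suc n) G.+ ∑ (λ k → f (suc k)) n) ≡⟨ cong (λ z → suc n ℕ.* ν z) (G.+-comm (f 0 (suc n)) (∑ (λ k → f (suc k)) n)) ⟩
      suc n ℕ.* ν (∑ (λ k → f (suc k)) n G.+ f 0 (suc n)) ≤⟨ ν-triangle (suc n) (∑ (λ k → f (suc k)) n) (f 0 (suc n)) ⟩
      suc (suc n) ℕ.* (ν (∑ (λ k → f (suc k)) n) ℕ.+ suc n ℕ.* ν (f 0 (suc n)))
        ≤⟨ ℕ.*-monoʳ-≤ (suc (suc n)) (ℕ.+-mono-≤ (ν-∑ B n (λ k → f (suc k)) (λ k l e → le (suc k) l (cong suc e))) (ℕ.*-monoʳ-≤ (suc n) (le 0 (suc n) refl))) ⟩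
      suc (suc n) ℕ.* (suc n ℕ.* suc n ℕ.* B ℕ.+ suc n ℕ.* B)
        ≡⟨ solve 2 (λ n B → (con 2 :+ n) :* ((con 1 :+ n) :* (con 1 :+ n) :* B :+ (con 1 :+ n) :* B) := (con 1 :+ n) :* ((con 2 :+ n) :* (con 2 :+ n) :* B)) refl n B ⟩
      suc n ℕ.* (suc (suc n) ℕ.* suc (suc n) ℕ.* B) ∎)
      where open ℕ.≤-Reasoning

    -- The first exponent is positive because ν(1) = 2: an empty product would cost a factor 2.
    ν-^-* : ∀ z w m j → ν (z G.^ suc m G.* w G.^ j) ≤ ν z ℕ.^ suc m ℕ.* ν w ℕ.^ j
    ν-^-* z w m zero = ℕ.≤-trans (ℕ.≤-reflexive (cong ν (G.*-identityʳ _))) (ℕ.≤-trans (pow m) (ℕ.≤-reflexive (sym (ℕ.*-identityʳ _))))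
      where
      pow : ∀ m → ν (z G.^ suc m) ≤ ν z ℕ.^ suc m
      pow zero = ℕ.≤-reflexive (trans (cong ν (G.*-identityʳ z)) (sym (ℕ.*-identityʳ (ν z))))
      pow (suc m) = ℕ.≤-trans (ν-* z (z G.^ suc m)) (ℕ.*-monoʳ-≤ (ν z) (pow m))
    ν-^-* z w m (suc j) = begin
      ν (z G.^ suc m G.* (w G.* w G.^ j)) ≡⟨ cong ν (S.solve 3 (λ a b c → a S.:* (b S.:* c) S.:= b S.:* (a S.:* c)) refl (z G.^ suc m) w (w G.^ j)) ⟩
      ν (w G.* (z G.^ suc m G.* w G.^ j)) ≤⟨ ν-* w _ ⟩
      ν w ℕ.* ν (z G.^ suc m G.* w G.^ j) ≤⟨ ℕ.*-monoʳ-≤ (ν w) (ν-^-* z w m j) ⟩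
      ν w ℕ.* (ν z ℕ.^ suc m ℕ.* ν w ℕ.^ j) ≡⟨ solve 3 (λ a b c → b :* (a :* c) := a :* (b :* c)) refl (ν z ℕ.^ suc m) (ν w) (ν w ℕ.^ j) ⟩
      ν z ℕ.^ suc m ℕ.* (ν w ℕ.* ν w ℕ.^ j) ∎
      where
      open ℕ.≤-Reasoning
      module S = G.Solver

    open Expansion Gaussian
    open Vanishing using (ρ; ρ-vanishes)

    -- Only the orders m > 2n survive. There the factors δ beyond 2n + 1 are exchanged for v by
    -- means of ν δ ≤ ν v, which gives all 4n + 2 terms one common bound.
    T-bound : ∀ δ v n → ν δ ≤ ν v → ν (T (v G.+ δ) v n) ≤
      suc (suc (4 ℕ.* n)) ℕ.* suc (suc (4 ℕ.* n)) ℕ.*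
      ((8 ℕ.^ n ℕ.* n !! ℕ.* 2 ℕ.^ suc (4 ℕ.* n)) ℕ.* (8 ℕ.^ n ℕ.* n !! ℕ.* 2 ℕ.^ suc (4 ℕ.* n)) ℕ.* (ν δ ℕ.^ suc (2 ℕ.* n) ℕ.* ν v ℕ.^ (2 ℕ.* n)))
    T-bound δ v n δ≤v = ℕ.≤-trans (ℕ.≤-reflexive (cong ν (T-expansion δ v n))) (ν-∑ _ (suc (4 ℕ.* n)) (λ m j → G.ι (ρ n m) G.* (δ G.^ m G.* v G.^ j)) term)
      where
      open ℕ.≤-Reasoning
      R : ℕ
      R = 8 ℕ.^ n ℕ.* n !! ℕ.* 2 ℕ.^ suc (4 ℕ.* n)
      split : ∀ m j e → m ≡ suc (2 ℕ.* n) ℕ.+ e → m ℕ.+ j ≡ suc (4 ℕ.* n) → 2 ℕ.* n ≡ j ℕ.+ e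
      split m j e refl eq = ℕ.+-cancelˡ-≡ (suc (2 ℕ.* n)) _ _ (trans
        (solve 1 (λ n → con 1 :+ con 2 :* n :+ con 2 :* n := con 1 :+ con 4 :* n) refl n)
        (trans (sym eq) (solve 3 (λ n e j → con 1 :+ con 2 :* n :+ e :+ j := con 1 :+ con 2 :* n :+ (j :+ e)) refl n e j)))
      monomial : ∀ e j → 2 ℕ.* n ≡ j ℕ.+ e → ν (δ G.^ (suc (2 ℕ.* n) ℕ.+ e) G.* v G.^ j) ≤ ν δ ℕ.^ suc (2 ℕ.* n) ℕ.* ν v ℕ.^ (2 ℕ.* n)
      monomial e j eq = begin
        ν (δ G.^ suc (2 ℕ.* n ℕ.+ e) G.* v G.^ j) ≤⟨ ν-^-* δ v (2 ℕ.* n ℕ.+ e) j ⟩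
        ν δ ℕ.^ (suc (2 ℕ.* n) ℕ.+ e) ℕ.* ν v ℕ.^ j ≡⟨ cong (ℕ._* ν v ℕ.^ j) (ℕ.^-distribˡ-+-* (ν δ) (suc (2 ℕ.* n)) e) ⟩
        ν δ ℕ.^ suc (2 ℕ.* n) ℕ.* ν δ ℕ.^ e ℕ.* ν v ℕ.^ j ≤⟨ ℕ.*-monoˡ-≤ (ν v ℕ.^ j) (ℕ.*-monoʳ-≤ (ν δ ℕ.^ suc (2 ℕ.* n)) (ℕ.^-monoˡ-≤ e δ≤v)) ⟩
        ν δ ℕ.^ suc (2 ℕ.* n) ℕ.* ν v ℕ.^ e ℕ.* ν v ℕ.^ j ≡⟨ ℕ.*-assoc (ν δ ℕ.^ suc (2 ℕ.* n)) _ _ ⟩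
        ν δ ℕ.^ suc (2 ℕ.* n) ℕ.* (ν v ℕ.^ e ℕ.* ν v ℕ.^ j) ≡⟨ cong (ν δ ℕ.^ suc (2 ℕ.* n) ℕ.*_) (trans (sym (ℕ.^-distribˡ-+-* (ν v) e j)) (cong (ν v ℕ.^_) (trans (ℕ.+-comm e j) (sym eq)))) ⟩
        ν δ ℕ.^ suc (2 ℕ.* n) ℕ.* ν v ℕ.^ (2 ℕ.* n) ∎
      term : ∀ m j → m ℕ.+ j ≡ suc (4 ℕ.* n) → ν (G.ι (ρ n m) G.* (δ G.^ m G.* v G.^ j)) ≤ R ℕ.* R ℕ.* (ν δ ℕ.^ suc (2 ℕ.* n) ℕ.* ν v ℕ.^ (2 ℕ.* n))
      term m j eq with m ℕ.≤? 2 ℕ.* n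
      ... | yes m≤2n = ℕ.≤-trans (ℕ.≤-reflexive (trans (ν-ι (ρ n m) _) (cong (λ r → ∣ r ∣ ℕ.* ∣ r ∣ ℕ.* ν (δ G.^ m G.* v G.^ j)) (ρ-vanishes n m m≤2n)))) z≤n
      ... | no m≰2n with ℕ.m≤n⇒∃[o]m+o≡n (ℕ.≰⇒> m≰2n)
      ...   | e , refl = ℕ.≤-trans (ℕ.≤-reflexive (ν-ι (ρ n m) _))
        (ℕ.*-mono-≤ (ℕ.*-mono-≤ (CoefficientSum.∣ρ∣-bound n m) (CoefficientSum.∣ρ∣-bound n m)) (monomial e j (split m j e refl eq)))

-- The crude bound for Z

module CrudeBound where
  open Algebras
  open Numerals
  open Coefficients
  open DiagonalSums
  open GaussianExtension
  open IntegralMultiples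
  open CoefficientBounds
  open import Data.Nat.Base as ℕ using (ℕ; zero; suc; _≤_)
  import Data.Nat.Properties as ℕ
  open import Data.Nat.Solver using (module +-*-Solver)
  open import Data.Integer.Base as ℤ using () renaming (+_ to pos)
  open import Relation.Binary.PropositionalEquality

  module Homogeneous (A : ℤAlgebra) where
    open ℤAlgebra A
    open Solver
    open DiagonalSum A
    open Expansion A using (^-+; T)
    open ≡-Reasoning

    ^-*-distrib : ∀ x y n → (x * y) ^ n ≡ x ^ n * y ^ n
    ^-*-distrib x y zero = sym (*-identityˡ _)
    ^-*-distrib x y (suc n) = trans (*-congˡ (^-*-distrib x y n)) (solve 4 (λ a b c d → a :* b :* (c :* d) := a :* c :* (b :* d)) refl x y (x ^ n) (y ^ n))

    ^-4* : ∀ x n → (x ^ 4) ^ n ≡ x ^ (4 ℕ.* n)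
    ^-4* x zero = refl
    ^-4* x (suc n) = trans (*-congˡ (^-4* x n)) (trans (sym (^-+ x 4 (4 ℕ.* n))) (cong (x ^_) (sym (ℕ.*-suc 4 n))))

    X-scale : ∀ i p q n → X (i * p) (i * q) n ≡ i ^ n * X p q n
    X-scale i p q n = trans (∑-cong n term) (∑-* n (i ^ n) (λ k l → ι (pos (coef k l)) * (p ^ k * q ^ l)))
      where
      term : ∀ k l → k ℕ.+ l ≡ n → ι (pos (coef k l)) * ((i * p) ^ k * (i * q) ^ l) ≡ i ^ n * (ι (pos (coef k l)) * (p ^ k * q ^ l))
      term k l refl = begin
        ι (pos (coef k l)) * ((i * p) ^ k * (i * q) ^ l) ≡⟨ cong₂ (λ a b → ι (pos (coef k l)) * (a * b)) (^-*-distrib i p k) (^-*-distrib i q l) ⟩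
        ι (pos (coef k l)) * (i ^ k * p ^ k * (i ^ l * q ^ l))
          ≡⟨ solve 5 (λ c a b d e → c :* (a :* b :* (d :* e)) := a :* d :* (c :* (b :* e))) refl (ι (pos (coef k l))) (i ^ k) (p ^ k) (i ^ l) (q ^ l) ⟩
        i ^ k * i ^ l * (ι (pos (coef k l)) * (p ^ k * q ^ l)) ≡⟨ *-congʳ (^-+ i k l) ⟨
        i ^ (k ℕ.+ l) * (ι (pos (coef k l)) * (p ^ k * q ^ l)) ∎

    T-X : ∀ u v n → X (u ^ 4) (v ^ 4) n * v - X (v ^ 4) (u ^ 4) n * u ≡ T u v n
    T-X u v n = begin
      ∑ F n * v - ∑ G n * u ≡⟨ solve 4 (λ f v g u → f :* v :- g :* u := v :* f :+ (:- u) :* g) refl (∑ F n) v (∑ G n) u ⟩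
      v * ∑ F n + (- u) * ∑ G n ≡⟨ cong₂ _+_ (∑-* n v F) (∑-* n (- u) G) ⟨
      ∑ (λ k l → v * F k l) n + ∑ (λ k l → (- u) * G k l) n ≡⟨ ∑-+ n (λ k l → v * F k l) (λ k l → (- u) * G k l) ⟨
      ∑ (λ k l → v * F k l + (- u) * G k l) n ≡⟨ ∑-cong n (λ k l _ → trans
         (cong₂ _+_ (cong₂ (λ a b → v * (ι (pos (coef k l)) * (a * b))) (^-4* u k) (^-4* v l)) (cong₂ (λ a b → (- u) * (ι (pos (coef k l)) * (a * b))) (^-4* v k) (^-4* u l)))
         (solve 7 (λ c u v uk vl vk ul → v :* (c :* (uk :* vl)) :+ (:- u) :* (c :* (vk :* ul)) := c :* (uk :* (v :* vl) :- u :* ul :* vk)) refl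
            (ι (pos (coef k l))) u v (u ^ (4 ℕ.* k)) (v ^ (4 ℕ.* l)) (v ^ (4 ℕ.* k)) (u ^ (4 ℕ.* l)))) ⟩
      T u v n ∎
      where
      F G : ℕ → ℕ → Carrier
      F k l = ι (pos (coef k l)) * ((u ^ 4) ^ k * (v ^ 4) ^ l)
      G k l = ι (pos (coef k l)) * ((v ^ 4) ^ k * (u ^ 4) ^ l)

  module ExactParameter (A : ℤAlgebra) (𝒩 : Norm A) where
    open ℤAlgebra A
    open Norm 𝒩
    open Adjoin A
    open GaussianNorm A 𝒩
    open Integrality A using (ρ; ⟪κρZ⟫)
    private module S = G.Solver
    open Homogeneous Gaussian

    -- F(x, y) = quartic x y - t * cross x y.
    quartic cross : Carrier → Carrier → Carrier
    quartic x y = x * x * x * x - ι (pos 6) * (x * x * (y * y)) + y * y * y * y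
    cross x y = x * y * (x * x - y * y)

    module _ (x y : Carrier) where
      private
        a b : Carrier
        a = quartic x y
        b = cross x y
        U V p q : A[i]
        U = u a b x y
        V = v a b x y
        p = ⟪ x ⟫
        q = ⟪ y ⟫

        -- The solver treats i as a free variable, so identities resting on i² = -1 are proved with
        -- an explicit multiple c of i² + 1.
        i⁴-reduce : ∀ {z w c} → z ≡ w G.+ (i# G.* i# G.+ G.ι (pos 1)) G.* c → z ≡ w
        i⁴-reduce {z} {w} {c} eq = trans eq (trans (cong (λ j → w G.+ (j G.+ G.ι (pos 1)) G.* c) i²≡-1)
          (S.solve 2 (λ w c → w S.:+ (S.con ℤ.-1ℤ S.:+ S.con (pos 1)) S.:* c S.:= w) refl w c))

        ⟪a⟫ : ⟪ a ⟫ ≡ p G.* p G.* p G.* p G.- G.ι (pos 6) G.* (p G.* p G.* (q G.* q)) G.+ q G.* q G.* q G.* q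
        ⟪a⟫ = trans (⟪⟫-+ _ _) (cong₂ G._+_ (trans (⟪⟫-- _ _) (cong₂ G._-_ (⁴ x) (trans (⟪⟫-* _ _) (cong (G.ι (pos 6) G.*_) (trans (⟪⟫-* _ _) (cong₂ G._*_ (⟪⟫-* x x) (⟪⟫-* y y))))))) (⁴ y))
          where
          ⁴ : ∀ x → ⟪ x * x * x * x ⟫ ≡ ⟪ x ⟫ G.* ⟪ x ⟫ G.* ⟪ x ⟫ G.* ⟪ x ⟫
          ⁴ x = trans (⟪⟫-* _ _) (cong (G._* ⟪ x ⟫) (trans (⟪⟫-* _ _) (cong (G._* ⟪ x ⟫) (⟪⟫-* _ _))))

        ⟪b⟫ : ⟪ b ⟫ ≡ p G.* q G.* (p G.* p G.- q G.* q)
        ⟪b⟫ = trans (⟪⟫-* _ _) (cong₂ G._*_ (⟪⟫-* x y) (trans (⟪⟫-- _ _) (cong₂ G._-_ (⟪⟫-* x x) (⟪⟫-* y y))))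

        ^4 : ∀ z → i# G.* z G.^ 4 ≡ i# G.* (z G.* (z G.* (z G.* z)))
        ^4 z = cong (λ w → i# G.* (z G.* (z G.* (z G.* w)))) (G.*-identityʳ z)

        v⁴ : α a b x y ≡ i# G.* V G.^ 4
        v⁴ = trans (cong₂ (λ a b → i# G.* a G.+ G.ι (pos 4) G.* b) ⟪a⟫ ⟪b⟫) (trans (i⁴-reduce (S.solve 3 (λ i p q →
          let a = p S.:* p S.:* p S.:* p S.:- S.con (pos 6) S.:* (p S.:* p S.:* (q S.:* q)) S.:+ q S.:* q S.:* q S.:* q
              b = p S.:* q S.:* (p S.:* p S.:- q S.:* q)
              v = p S.:- i S.:* q in
          i S.:* a S.:+ S.con (pos 4) S.:* b
          S.:= i S.:* (v S.:* (v S.:* (v S.:* v))) S.:+ (i S.:* i S.:+ S.con (pos 1)) S.:*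
            (S.con (pos 4) S.:* p S.:* p S.:* p S.:* q S.:- S.con (pos 6) S.:* i S.:* p S.:* p S.:* q S.:* q S.:- S.con (pos 4) S.:* p S.:* q S.:* q S.:* q S.:+ S.con (pos 4) S.:* i S.:* i S.:* p S.:* q S.:* q S.:* q S.:+ i S.:* q S.:* q S.:* q S.:* q S.:- i S.:* i S.:* i S.:* q S.:* q S.:* q S.:* q)) refl i# p q)) (sym (^4 V)))

        u⁴ : γ a b x y ≡ i# G.* U G.^ 4
        u⁴ = trans (cong₂ (λ a b → i# G.* a G.- G.ι (pos 4) G.* b) ⟪a⟫ ⟪b⟫) (trans (i⁴-reduce (S.solve 3 (λ i p q →
          let a = p S.:* p S.:* p S.:* p S.:- S.con (pos 6) S.:* (p S.:* p S.:* (q S.:* q)) S.:+ q S.:* q S.:* q S.:* q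
              b = p S.:* q S.:* (p S.:* p S.:- q S.:* q)
              v = p S.:+ i S.:* q in
          i S.:* a S.:- S.con (pos 4) S.:* b
          S.:= i S.:* (v S.:* (v S.:* (v S.:* v))) S.:+ (i S.:* i S.:+ S.con (pos 1)) S.:*
            (S.:- S.con (pos 4) S.:* p S.:* p S.:* p S.:* q S.:- S.con (pos 6) S.:* i S.:* p S.:* p S.:* q S.:* q S.:+ S.con (pos 4) S.:* p S.:* q S.:* q S.:* q S.:- S.con (pos 4) S.:* i S.:* i S.:* p S.:* q S.:* q S.:* q S.:+ i S.:* q S.:* q S.:* q S.:* q S.:- i S.:* i S.:* i S.:* q S.:* q S.:* q S.:* q)) refl i# p q)) (sym (^4 U)))

        i^n : ∀ n z → ν (i# G.^ n G.* z) ≡ ν z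
        i^n zero z = cong ν (G.*-identityˡ z)
        i^n (suc n) z = trans (cong ν (G.*-assoc i# _ z)) (trans (ν-i _) (i^n n z))

        ρ-i : ∀ n → ρ n ≡ i# G.^ suc n
        ρ-i zero = sym (G.*-identityʳ i#)
        ρ-i (suc n) = cong (i# G.*_) (ρ-i n)

        δ : A[i]
        δ = G.ι (pos 2) G.* (i# G.* q)

        U≡V+δ : U ≡ V G.+ δ
        U≡V+δ = S.solve 3 (λ i p q → p S.:+ i S.:* q S.:= p S.:- i S.:* q S.:+ S.con (pos 2) S.:* (i S.:* q)) refl i# p q

        ν-δ : ν δ ≡ 8 ℕ.* N y
        ν-δ = trans (ν-ι (pos 2) _) (trans (cong (4 ℕ.*_) (trans (ν-i q) (ν-⟪⟫ y))) (sym (ℕ.*-assoc 4 2 (N y))))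

        ν-V : ν V ≡ 2 ℕ.* (N x ℕ.+ N y)
        ν-V = trans (cong ν parts) (cong (λ n → 2 ℕ.* (N x ℕ.+ n)) (N-neg y))
          where
          parts : V ≡ x +i (- y)
          parts = trans (⊕-parts p (G.- (i# G.* q))) (cong₂ _+i_
            (trans (cong (λ w → x + re w) (trans (⊖-parts (i# G.* q)) (cong (λ w → (- re w) +i (- im w)) iq))) (trans (cong (λ o → x - o) (sym ι-0)) (solve 1 (λ x → x :- con (pos 0) := x) refl x)))
            (trans (cong (λ w → 0# + im w) (trans (⊖-parts (i# G.* q)) (cong (λ w → (- re w) +i (- im w)) iq))) (+-identityˡ _)))
            where
            open Solver
            iq : i# G.* q ≡ 0# +i y
            iq = trans (⊗-parts i# q) (cong₂ _+i_
              (trans (cong₂ _-_ (zeroˡ y) (zeroʳ 1#)) (-‿inverseʳ 0#)) (trans (cong₂ _+_ (zeroˡ 0#) (*-identityˡ y)) (+-identityˡ y)))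

      -- Multiplication by i preserves `ν`, so the powers of i coming from α = iV⁴, from γ = iU⁴ and
      -- from `ρ` all disappear. The constant is 2 (2 · 8ⁿ)².
      ν-Z : ∀ n → ν (Expansion.T Gaussian U V n) ≡ 8 ℕ.* (8 ℕ.^ n ℕ.* 8 ℕ.^ n) ℕ.* N (Z a b x y n)
      ν-Z n = begin
        ν (Expansion.T Gaussian U V n) ≡⟨ i^n n (Expansion.T Gaussian U V n) ⟨
        ν (i# G.^ n G.* Expansion.T Gaussian U V n) ≡⟨ cong ν W-T ⟨
        ν (W a b x y n) ≡⟨ i^n (suc n) (W a b x y n) ⟨
        ν (i# G.^ suc n G.* W a b x y n) ≡⟨ cong ν (trans (G.*-comm _ _) (cong (W a b x y n G.*_) (sym (ρ-i n)))) ⟩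
        ν (W a b x y n G.* ρ n) ≡⟨ cong ν (⟪κρZ⟫ a b x y n) ⟩
        ν ⟪ ι (pos (2 ℕ.* 8 ℕ.^ n)) * Z a b x y n ⟫ ≡⟨ ν-⟪⟫ _ ⟩
        2 ℕ.* N (ι (pos (2 ℕ.* 8 ℕ.^ n)) * Z a b x y n) ≡⟨ cong (2 ℕ.*_) (trans (N-* _ _) (cong (ℕ._* N (Z a b x y n)) (N-ι (pos (2 ℕ.* 8 ℕ.^ n))))) ⟩
        2 ℕ.* (2 ℕ.* 8 ℕ.^ n ℕ.* (2 ℕ.* 8 ℕ.^ n) ℕ.* N (Z a b x y n))
          ≡⟨ E.solve 2 (λ e z → E.con 2 E.:* (E.con 2 E.:* e E.:* (E.con 2 E.:* e) E.:* z) E.:= E.con 8 E.:* (e E.:* e) E.:* z) refl (8 ℕ.^ n) (N (Z a b x y n)) ⟩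
        8 ℕ.* (8 ℕ.^ n ℕ.* 8 ℕ.^ n) ℕ.* N (Z a b x y n) ∎
        where
        open ≡-Reasoning
        module E = +-*-Solver
        W-T : W a b x y n ≡ i# G.^ n G.* Expansion.T Gaussian U V n
        W-T = begin
          X (γ a b x y) (α a b x y) n G.* V G.- X (α a b x y) (γ a b x y) n G.* U
            ≡⟨ cong₂ (λ c d → X c d n G.* V G.- X d c n G.* U) u⁴ v⁴ ⟩
          X (i# G.* U G.^ 4) (i# G.* V G.^ 4) n G.* V G.- X (i# G.* V G.^ 4) (i# G.* U G.^ 4) n G.* U
            ≡⟨ cong₂ (λ c d → c G.* V G.- d G.* U) (X-scale i# (U G.^ 4) (V G.^ 4) n) (X-scale i# (V G.^ 4) (U G.^ 4) n) ⟩
          i# G.^ n G.* X (U G.^ 4) (V G.^ 4) n G.* V G.- i# G.^ n G.* X (V G.^ 4) (U G.^ 4) n G.* U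
            ≡⟨ S.solve 5 (λ i c v d u → i S.:* c S.:* v S.:- i S.:* d S.:* u S.:= i S.:* (c S.:* v S.:- d S.:* u)) refl (i# G.^ n) (X (U G.^ 4) (V G.^ 4) n) V (X (V G.^ 4) (U G.^ 4) n) U ⟩
          i# G.^ n G.* (X (U G.^ 4) (V G.^ 4) n G.* V G.- X (V G.^ 4) (U G.^ 4) n G.* U) ≡⟨ cong (i# G.^ n G.*_) (T-X U V n) ⟩
          i# G.^ n G.* Expansion.T Gaussian U V n ∎

      -- The hypothesis is equivalent to ν δ ≤ ν V, as ν δ = 8 N y and ν V = 2(N x + N y). The base
      -- 1048576 = 2²⁰ collects powers of 2ⁿ: 4 from the number of terms, 14 from the square of
      -- `∣ρ∣-bound`, 6 from δ and 2 from V, less the 6 in the factor 64ⁿ of `ν-Z`.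
      crude-bound : ∀ n → 3 ℕ.* N y ≤ N x → N (Z a b x y n) ≤
        16 ℕ.* N y ℕ.* (n !! ℕ.* n !!) ℕ.* (K 1048576 ℕ.* (N y ℕ.* N y ℕ.* ((N x ℕ.+ N y) ℕ.* (N x ℕ.+ N y)))) ℕ.^ n
      crude-bound n 3y≤x = ℕ.*-cancelˡ-≤ (8 ℕ.* (8 ℕ.^ n ℕ.* 8 ℕ.^ n)) {{*-nonZero {8} _ (*-nonZero (ℕ.m^n≢0 8 n) (ℕ.m^n≢0 8 n))}} (begin
        8 ℕ.* (8 ℕ.^ n ℕ.* 8 ℕ.^ n) ℕ.* N (Z a b x y n) ≡⟨ ν-Z n ⟨
        ν (Expansion.T Gaussian U V n) ≡⟨ cong (λ w → ν (Expansion.T Gaussian w V n)) U≡V+δ ⟩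
        ν (Expansion.T Gaussian (V G.+ δ) V n) ≤⟨ T-bound δ V n δ≤V ⟩
        M ℕ.* M ℕ.* ((8 ℕ.^ n ℕ.* D ℕ.* 2 ℕ.^ suc (4 ℕ.* n)) ℕ.* (8 ℕ.^ n ℕ.* D ℕ.* 2 ℕ.^ suc (4 ℕ.* n)) ℕ.* (ν δ ℕ.^ suc (2 ℕ.* n) ℕ.* ν V ℕ.^ (2 ℕ.* n)))
          ≤⟨ ℕ.*-monoˡ-≤ _ (ℕ.*-mono-≤ M≤ M≤) ⟩
        2 ℕ.* (P ℕ.* P) ℕ.* (2 ℕ.* (P ℕ.* P)) ℕ.* ((8 ℕ.^ n ℕ.* D ℕ.* 2 ℕ.^ suc (4 ℕ.* n)) ℕ.* (8 ℕ.^ n ℕ.* D ℕ.* 2 ℕ.^ suc (4 ℕ.* n)) ℕ.* (ν δ ℕ.^ suc (2 ℕ.* n) ℕ.* ν V ℕ.^ (2 ℕ.* n)))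
          ≡⟨ cong₂ (λ e f → 2 ℕ.* (P ℕ.* P) ℕ.* (2 ℕ.* (P ℕ.* P)) ℕ.* (e ℕ.* e ℕ.* f)) (cong₂ (λ e f → e ℕ.* D ℕ.* (2 ℕ.* f)) 8^ 16^) (cong₂ ℕ._*_ ν-δ^ ν-V^) ⟩
        2 ℕ.* (P ℕ.* P) ℕ.* (2 ℕ.* (P ℕ.* P)) ℕ.* ((P ℕ.* P ℕ.* P ℕ.* D ℕ.* (2 ℕ.* (P ℕ.* P ℕ.* (P ℕ.* P)))) ℕ.* (P ℕ.* P ℕ.* P ℕ.* D ℕ.* (2 ℕ.* (P ℕ.* P ℕ.* (P ℕ.* P))))
          ℕ.* (8 ℕ.* Y ℕ.* (P ℕ.* P ℕ.* P ℕ.* (P ℕ.* P ℕ.* P) ℕ.* (Yn ℕ.* Yn)) ℕ.* (P ℕ.* P ℕ.* (Sn ℕ.* Sn))))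
          ≡⟨ E.solve 5 (λ P D Y Yn Sn →
               E.con 2 E.:* (P E.:* P) E.:* (E.con 2 E.:* (P E.:* P)) E.:* ((P E.:* P E.:* P E.:* D E.:* (E.con 2 E.:* (P E.:* P E.:* (P E.:* P)))) E.:* (P E.:* P E.:* P E.:* D E.:* (E.con 2 E.:* (P E.:* P E.:* (P E.:* P))))
                 E.:* (E.con 8 E.:* Y E.:* (P E.:* P E.:* P E.:* (P E.:* P E.:* P) E.:* (Yn E.:* Yn)) E.:* (P E.:* P E.:* (Sn E.:* Sn))))
               E.:= E.con 8 E.:* (P E.:* P E.:* P E.:* (P E.:* P E.:* P)) E.:* (E.con 16 E.:* Y E.:* (D E.:* D) E.:* (P E.:^ 20 E.:* (Yn E.:* Yn E.:* (Sn E.:* Sn))))) refl P D Y Yn Sn ⟩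
        8 ℕ.* (P ℕ.* P ℕ.* P ℕ.* (P ℕ.* P ℕ.* P)) ℕ.* (16 ℕ.* Y ℕ.* (D ℕ.* D) ℕ.* (P ℕ.^ 20 ℕ.* (Yn ℕ.* Yn ℕ.* (Sn ℕ.* Sn))))
          ≡⟨ cong₂ (λ e f → 8 ℕ.* (e ℕ.* e) ℕ.* (16 ℕ.* Y ℕ.* (D ℕ.* D) ℕ.* f)) (sym 8^) (sym final) ⟩
        8 ℕ.* (8 ℕ.^ n ℕ.* 8 ℕ.^ n) ℕ.* (16 ℕ.* Y ℕ.* (D ℕ.* D) ℕ.* (K 1048576 ℕ.* (Y ℕ.* Y ℕ.* ((N x ℕ.+ Y) ℕ.* (N x ℕ.+ Y)))) ℕ.^ n) ∎)
        where
        open ℕ.≤-Reasoning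
        module E = +-*-Solver
        M D Y P Yn Sn : ℕ
        M = suc (suc (4 ℕ.* n))
        D = n !!
        Y = N y
        P = 2 ℕ.^ n
        Yn = Y ℕ.^ n
        Sn = (N x ℕ.+ Y) ℕ.^ n
        δ≤V : ν δ ≤ ν V
        δ≤V rewrite ν-δ | ν-V = ℕ.≤-trans (ℕ.≤-reflexive (E.solve 1 (λ y → E.con 8 E.:* y E.:= E.con 2 E.:* (E.con 3 E.:* y E.:+ y)) refl Y)) (ℕ.*-monoʳ-≤ 2 (ℕ.+-monoˡ-≤ Y 3y≤x))
        double : ∀ a m → a ℕ.^ (2 ℕ.* m) ≡ a ℕ.^ m ℕ.* a ℕ.^ m
        double a m = trans (ℕ.^-distribˡ-+-* a m (m ℕ.+ 0)) (cong (λ k → a ℕ.^ m ℕ.* a ℕ.^ k) (ℕ.+-identityʳ m))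
        4^ : 4 ℕ.^ n ≡ P ℕ.* P
        4^ = ^-distrib-* 2 2 n
        8^ : 8 ℕ.^ n ≡ P ℕ.* P ℕ.* P
        8^ = trans (^-distrib-* 4 2 n) (cong (ℕ._* P) 4^)
        16^ : 2 ℕ.^ (4 ℕ.* n) ≡ P ℕ.* P ℕ.* (P ℕ.* P)
        16^ = trans (sym (ℕ.^-*-assoc 2 4 n)) (trans (^-distrib-* 4 4 n) (cong₂ ℕ._*_ 4^ 4^))
        ν-δ^ : ν δ ℕ.^ suc (2 ℕ.* n) ≡ 8 ℕ.* Y ℕ.* (P ℕ.* P ℕ.* P ℕ.* (P ℕ.* P ℕ.* P) ℕ.* (Yn ℕ.* Yn))
        ν-δ^ = trans (cong (ℕ._^ suc (2 ℕ.* n)) ν-δ) (cong (8 ℕ.* Y ℕ.*_) (trans (^-distrib-* 8 Y (2 ℕ.* n)) (cong₂ ℕ._*_ (trans (double 8 n) (cong₂ ℕ._*_ 8^ 8^)) (double Y n))))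
        ν-V^ : ν V ℕ.^ (2 ℕ.* n) ≡ P ℕ.* P ℕ.* (Sn ℕ.* Sn)
        ν-V^ = trans (cong (ℕ._^ (2 ℕ.* n)) ν-V) (trans (^-distrib-* 2 (N x ℕ.+ Y) (2 ℕ.* n)) (cong₂ ℕ._*_ (double 2 n) (double (N x ℕ.+ Y) n)))
        M≤ : M ≤ 2 ℕ.* (P ℕ.* P)
        M≤ = subst (λ e → M ≤ 2 ℕ.* e) 4^ (go n)
          where
          go : ∀ n → suc (suc (4 ℕ.* n)) ≤ 2 ℕ.* 4 ℕ.^ n
          go zero = ℕ.≤-refl
          go (suc n) = ℕ.≤-trans (ℕ.m≤m+n _ (12 ℕ.* n ℕ.+ 2)) (ℕ.≤-trans
            (ℕ.≤-reflexive (E.solve 1 (λ n → E.con 2 E.:+ E.con 4 E.:* (E.con 1 E.:+ n) E.:+ (E.con 12 E.:* n E.:+ E.con 2) E.:= E.con 4 E.:* (E.con 2 E.:+ E.con 4 E.:* n)) refl n))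
            (ℕ.≤-trans (ℕ.*-monoʳ-≤ 4 (go n)) (ℕ.≤-reflexive (E.solve 1 (λ e → E.con 4 E.:* (E.con 2 E.:* e) E.:= E.con 2 E.:* (E.con 4 E.:* e)) refl (4 ℕ.^ n)))))
        final : (K 1048576 ℕ.* (Y ℕ.* Y ℕ.* ((N x ℕ.+ Y) ℕ.* (N x ℕ.+ Y)))) ℕ.^ n ≡ P ℕ.^ 20 ℕ.* (Yn ℕ.* Yn ℕ.* (Sn ℕ.* Sn))
        final = trans (^-distrib-* (K 1048576) _ n) (cong₂ ℕ._*_
          (trans (cong (ℕ._^ n) (K≡ 1048576)) (trans (ℕ.^-*-assoc 2 20 n) (trans (cong (2 ℕ.^_) (ℕ.*-comm 20 n)) (sym (ℕ.^-*-assoc 2 n 20)))))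
          (trans (^-distrib-* (Y ℕ.* Y) _ n) (cong₂ ℕ._*_ (^-distrib-* Y Y n) (^-distrib-* (N x ℕ.+ Y) (N x ℕ.+ Y) n))))

-- Decaying and growing solutions of the recurrence

module Estimates where
  open Numerals
  open Coefficients using (_!!; *-nonZero; ^-distrib-*)
  open import Data.Nat.Base
  open import Data.Nat.Properties
  open import Data.Sum using (inj₁; inj₂)
  open import Data.Empty using (⊥-elim)
  open import Relation.Binary.PropositionalEquality
  open KSolver

  open ≤-Reasoning

  instance
    K-nonZero : ∀ {n} → NonZero (K (suc n))
    K-nonZero {n} = subst NonZero (sym (K≡ (suc n))) _

  K-≤ : ∀ {m n} → m ≤ n → K m ≤ K n
  K-≤ {m} {n} = subst₂ _≤_ (sym (K≡ m)) (sym (K≡ n))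

  -- A certificate for linear arithmetic: the hypotheses, weighted and added up, form a ≤ b, the
  -- slack is e, and what remains is an identity for the solver.
  certify : ∀ {a b l r} e → a ≤ b → l + b + e ≡ r + a → l ≤ r
  certify {a} {b} {l} {r} e a≤b eq = +-cancelʳ-≤ a l r (begin
    l + a ≤⟨ +-monoʳ-≤ l a≤b ⟩
    l + b ≤⟨ m≤m+n (l + b) e ⟩
    l + b + e ≡⟨ eq ⟩
    r + a ∎)

  -- Passing from a x ≤ b z to c x ≤ d z when b / a ≤ d / c.
  ratio : ∀ a b c d {x z} → .{{NonZero (K a)}} → K a * x ≤ K b * z → c * b ≤ d * a → K c * x ≤ K d * z
  ratio a b c d {x} {z} le cb≤da = *-cancelˡ-≤ (K a) (begin
    K a * (K c * x) ≡⟨ solve 3 (λ a c x → a :* (c :* x) := c :* (a :* x)) refl (K a) (K c) x ⟩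
    K c * (K a * x) ≤⟨ *-monoʳ-≤ (K c) le ⟩
    K c * (K b * z) ≡⟨ *-assoc (K c) (K b) z ⟨
    K c * K b * z ≡⟨ cong (_* z) (K-* c b) ⟨
    K (c * b) * z ≤⟨ *-monoˡ-≤ z (K-≤ cb≤da) ⟩
    K (d * a) * z ≡⟨ cong (_* z) (K-* d a) ⟩
    K d * K a * z ≡⟨ solve 3 (λ d a z → d :* a :* z := a :* (d :* z)) refl (K d) (K a) z ⟩
    K a * (K d * z) ∎)

  sq : ∀ {m n} → m ≤ n → m * m ≤ n * n
  sq m≤n = *-mono-≤ m≤n m≤n

  n<4^n : ∀ n → n < 4 ^ n
  n<4^n zero = s≤s z≤n
  n<4^n (suc n) = ≤-trans (s≤s (n<4^n n)) (begin
    suc (4 ^ n) ≤⟨ +-monoˡ-≤ (4 ^ n) (m^n>0 4 n) ⟩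
    4 ^ n + 4 ^ n ≤⟨ +-monoʳ-≤ (4 ^ n) (m≤m+n (4 ^ n) _) ⟩
    4 ^ suc n ∎)

  -- The numerators c n / ((2 n + 1) (2 n + 3)) of the continued fraction.
  c o : ℕ → ℕ
  c n = (4 * n + 3) * (4 * n + 5)
  o n = suc (2 * n)

  o-suc : ∀ n → o (suc n) ≡ 2 * n + 3
  o-suc n = cong suc (trans (*-suc 2 n) (+-comm 2 (2 * n))) ∙ sym (+-suc (2 * n) 2)
    where
    _∙_ : ∀ {x y z : ℕ} → x ≡ y → y ≡ z → x ≡ z
    _∙_ = trans

  -- The quotient of `c n` by `o n * o (suc n)` is 4 + 3/((2n + 1)(2n + 3)), which decreases in n: 5
  -- is its value at 0, and the 143/35 of the next lemma its value at 2.
  c≤5oo : ∀ n → c n ≤ K 5 * (o n * o (suc n))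
  c≤5oo n = begin
    c n ≤⟨ m≤m+n (c n) (4 * n * n + 8 * n) ⟩
    c n + (4 * n * n + 8 * n) ≡⟨ S.solve 1 (λ n → (S.con 4 S.:* n S.:+ S.con 3) S.:* (S.con 4 S.:* n S.:+ S.con 5) S.:+ (S.con 4 S.:* n S.:* n S.:+ S.con 8 S.:* n)
        S.:= S.con 5 S.:* ((S.con 1 S.:+ S.con 2 S.:* n) S.:* (S.con 1 S.:+ S.con 2 S.:* (S.con 1 S.:+ n)))) refl n ⟩
    5 * (o n * o (suc n)) ≡⟨ cong (_* (o n * o (suc n))) (K≡ 5) ⟨
    K 5 * (o n * o (suc n)) ∎
    where
    open import Data.Nat.Solver
    module S = +-*-Solver

  35c≤143oo : ∀ n → K 35 * c (2 + n) ≤ K 143 * (o (2 + n) * o (3 + n))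
  35c≤143oo n rewrite K≡ 35 | K≡ 143 = begin
    35 * c (2 + n) ≤⟨ m≤m+n (35 * c (2 + n)) (12 * n * n + 72 * n) ⟩
    35 * c (2 + n) + (12 * n * n + 72 * n)
      ≡⟨ S.solve 1 (λ n → S.con 35 S.:* ((S.con 4 S.:* (S.con 2 S.:+ n) S.:+ S.con 3) S.:* (S.con 4 S.:* (S.con 2 S.:+ n) S.:+ S.con 5)) S.:+ (S.con 12 S.:* n S.:* n S.:+ S.con 72 S.:* n)
        S.:= S.con 143 S.:* ((S.con 1 S.:+ S.con 2 S.:* (S.con 2 S.:+ n)) S.:* (S.con 1 S.:+ S.con 2 S.:* (S.con 3 S.:+ n)))) refl n ⟩
    143 * (o (2 + n) * o (3 + n)) ∎
    where
    open import Data.Nat.Solver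
    module S = +-*-Solver

  -- All parameters are squared sizes: z of Z, then A, B, y, T of a, b, y, t, while q is the base of
  -- the crude bound. As A dominates B, a solution either grows by about o²A per step or shrinks by
  -- about c²B²/(o²A).
  module Decay (z : ℕ → ℕ) (A B y T q : ℕ) {{_ : NonZero A}} {{_ : NonZero B}} {{_ : NonZero q}}
    (z-0 : z 0 ≡ y)
    (z-recurrence : ∀ k n → k * (o (suc n) * o (suc n) * A * z (suc n)) ≤ suc k * (c n * c n * (B * B) * z n + k * z (suc (suc n))))
    (z-crude : ∀ n → z n ≤ 16 * y * (n !! * n !!) * q ^ n)
    (q-small : K 100 * q ≤ K 6 * A)
    (T-large : K 10000 ≤ T)
    (A-large : K 998 * (T * B) ≤ K 1000 * A)
    where

    private
      9900B≤A : K 9900 * B ≤ K 1 * A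
      9900B≤A = ratio (998 * 10000) 1000 9900 1 (begin
        K (998 * 10000) * B ≡⟨ trans (cong (_* B) (K-* 998 10000)) (*-assoc (K 998) (K 10000) B) ⟩
        K 998 * (K 10000 * B) ≤⟨ *-monoʳ-≤ (K 998) (*-monoˡ-≤ B T-large) ⟩
        K 998 * (T * B) ≤⟨ A-large ⟩
        K 1000 * A ∎) (≤ᵇ⇒≤ _ _ _)

      recurrence : ∀ k n → K k * (o (suc n) * o (suc n) * A * z (suc n)) ≤ K (suc k) * (c n * c n * (B * B) * z n + K k * z (suc (suc n)))
      recurrence k n rewrite K≡ k | K≡ (suc k) = z-recurrence k n

      c² : ∀ n → c n * c n ≤ K 25 * (o n * o n * (o (suc n) * o (suc n)))
      c² n = ≤-trans (sq (c≤5oo n)) (≤-reflexive (solve 2 (λ x y → con 5 :* (x :* y) :* (con 5 :* (x :* y)) := con 25 :* (x :* x :* (y :* y))) refl (o n) (o (suc n))))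

      -- If the step from n to n + 1 is not a decay, the term P with Z_n is at most 25/98.01 of the
      -- middle term E, where 98.01 = 9900²/10⁶. The recurrence with k = 1 leaves the rest to
      -- Z_{n+2}, and 25/6 lies just above 2/(1 - 50/98.01).
      growth-step : ∀ n → o n * o n * A * z n ≤ K 1000000 * z (suc n) →
        K 6 * (o (suc n) * o (suc n) * A * z (suc n)) ≤ K 25 * z (suc (suc n))
      growth-step n h = ratio 48010000 196020000 6 25 (certify (K 0) (+-mono-≤ (*-monoʳ-≤ (K 98010000) (recurrence 1 n)) (*-monoʳ-≤ (K 2) tail))
        (solve 3 (λ E P Z → con 48010000 :* E :+ (con 98010000 :* (con 2 :* (P :+ con 1 :* Z)) :+ con 2 :* (con 25000000 :* E)) :+ con 0
            := con 196020000 :* Z :+ (con 98010000 :* (con 1 :* E) :+ con 2 :* (con 98010000 :* P))) refl E P (z (suc (suc n))))) (≤ᵇ⇒≤ _ _ _)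
        where
        E P e : ℕ
        e = o (suc n)
        E = e * e * A * z (suc n)
        P = c n * c n * (B * B) * z n
        tail : K 98010000 * P ≤ K 25000000 * E
        tail = *-cancelˡ-≤ A (begin
          A * (K 98010000 * (c n * c n * (B * B) * z n))
            ≤⟨ *-monoʳ-≤ A (*-monoʳ-≤ (K 98010000) (*-monoˡ-≤ (z n) (*-monoˡ-≤ (B * B) (c² n)))) ⟩
          A * (K 98010000 * (K 25 * (o n * o n * (e * e)) * (B * B) * z n))
            ≡⟨ solve 5 (λ A o e B z → A :* (con 98010000 :* (con 25 :* (o :* o :* (e :* e)) :* (B :* B) :* z))
                 := con 25 :* (e :* e) :* (con 9900 :* B :* (con 9900 :* B)) :* (o :* o :* A :* z)) refl A (o n) e B (z n) ⟩
          K 25 * (e * e) * (K 9900 * B * (K 9900 * B)) * (o n * o n * A * z n)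
            ≤⟨ *-mono-≤ (*-monoʳ-≤ (K 25 * (e * e)) (sq 9900B≤A)) h ⟩
          K 25 * (e * e) * (K 1 * A * (K 1 * A)) * (K 1000000 * z (suc n))
            ≡⟨ solve 3 (λ A e z → con 25 :* (e :* e) :* (con 1 :* A :* (con 1 :* A)) :* (con 1000000 :* z) := A :* (con 25000000 :* (e :* e :* A :* z))) refl A e (z (suc n)) ⟩
          A * (K 25000000 * E) ∎)

      weaken : ∀ {E Z} → K 6 * E ≤ K 25 * Z → E ≤ K 1000000 * Z
      weaken {E} {Z} le = subst (_≤ K 1000000 * Z) (trans (cong (_* E) (K≡ 1)) (*-identityˡ E)) (ratio 6 25 1 1000000 le (≤ᵇ⇒≤ _ _ _))

      -- The conclusion of `growth-step` is much stronger than its hypothesis at the next index, so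
      -- a single failure of decay is inherited by all later indices.
      persistent-growth : ∀ n → o n * o n * A * z n ≤ K 1000000 * z (suc n) → ∀ j →
        K 6 * (o (j + suc n) * o (j + suc n) * A * z (j + suc n)) ≤ K 25 * z (suc (j + suc n))
      persistent-growth n h zero = growth-step n h
      persistent-growth n h (suc j) = growth-step (j + suc n) (weaken (persistent-growth n h j))

      explosion : ∀ n → o n * o n * A * z n ≤ K 1000000 * z (suc n) → ∀ j →
        (K 6 * A) ^ j * ((j + suc n) !! * (j + suc n) !!) * z (suc n) ≤ K 25 ^ j * (suc n !! * suc n !!) * z (j + suc n)
      explosion n h zero = ≤-refl
      explosion n h (suc j) = begin
        K 6 * A * (K 6 * A) ^ j * (O * D * (O * D)) * z (suc n)
          ≡⟨ solve 5 (λ A p O D z → con 6 :* A :* p :* (O :* D :* (O :* D)) :* z := con 6 :* A :* (O :* O) :* (p :* (D :* D) :* z)) refl A ((K 6 * A) ^ j) O D (z (suc n)) ⟩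
        K 6 * A * (O * O) * ((K 6 * A) ^ j * (D * D) * z (suc n)) ≤⟨ *-monoʳ-≤ (K 6 * A * (O * O)) (explosion n h j) ⟩
        K 6 * A * (O * O) * (K 25 ^ j * (D₀ * D₀) * z (j + suc n))
          ≡⟨ solve 5 (λ A p O D z → con 6 :* A :* (O :* O) :* (p :* (D :* D) :* z) := p :* (D :* D) :* (con 6 :* (O :* O :* A :* z))) refl A (K 25 ^ j) O D₀ (z (j + suc n)) ⟩
        K 25 ^ j * (D₀ * D₀) * (K 6 * (O * O * A * z (j + suc n))) ≤⟨ *-monoʳ-≤ (K 25 ^ j * (D₀ * D₀)) (persistent-growth n h j) ⟩
        K 25 ^ j * (D₀ * D₀) * (K 25 * z (suc (j + suc n)))
          ≡⟨ solve 3 (λ p D z → p :* (D :* D) :* (con 25 :* z) := con 25 :* p :* (D :* D) :* z) refl (K 25 ^ j) D₀ (z (suc (j + suc n))) ⟩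
        K 25 ^ suc j * (D₀ * D₀) * z (suc (j + suc n)) ∎
        where
        O D D₀ : ℕ
        O = o (j + suc n)
        D = (j + suc n) !!
        D₀ = suc n !!

    -- Otherwise z (n + 1) ≥ 1 and growth persists: by `explosion` the sequence gains (6A/25)ʲ in j
    -- steps, while `z-crude` allows only qʲ with 100 q ≤ 6A. The odd factors agree on both sides
    -- and cancel, which leaves 4ʲ ≤ C with C independent of j. This is absurd for j = C.
    decay : ∀ n → K 1000000 * z (suc n) ≤ o n * o n * A * z n
    decay n with ≤-total (K 1000000 * z (suc n)) (o n * o n * A * z n)
    ... | inj₁ le = le
    ... | inj₂ h with z (suc n) in eq
    ...   | zero = subst (_≤ o n * o n * A * z n) (sym (*-zeroʳ (K 1000000))) z≤n
    ...   | suc _ = ⊥-elim (<⇒≱ (n<4^n C) (*-cancelʳ-≤ (4 ^ C) C (K 25 ^ C * q ^ C) {{*-nonZero (m^n≢0 (K 25) C) (m^n≢0 q C)}} (begin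
        4 ^ C * (K 25 ^ C * q ^ C) ≡⟨ trans (sym (*-assoc (4 ^ C) _ _)) (cong (_* q ^ C) (sym (^-distrib-* 4 (K 25) C))) ⟩
        (4 * K 25) ^ C * q ^ C ≡⟨ cong (λ k → k ^ C * q ^ C) (trans (cong (_* K 25) (sym (K≡ 4))) (sym (K-* 4 25))) ⟩
        K 100 ^ C * q ^ C ≡⟨ ^-distrib-* (K 100) q C ⟨
        (K 100 * q) ^ C ≤⟨ ^-monoˡ-≤ C q-small ⟩
        (K 6 * A) ^ C ≤⟨ main ⟩
        C * (K 25 ^ C * q ^ C) ∎)))
      where
      D₀ C D : ℕ
      D₀ = suc n !!
      C = D₀ * D₀ * (16 * y) * q ^ suc n
      D = (C + suc n) !!
      instance
        DD≢0 : NonZero (D * D)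
        DD≢0 = *-nonZero (Coefficients.!!-nonZero (C + suc n)) (Coefficients.!!-nonZero (C + suc n))
      main : (K 6 * A) ^ C ≤ C * (K 25 ^ C * q ^ C)
      main = *-cancelʳ-≤ _ _ (D * D) (begin
        (K 6 * A) ^ C * (D * D) ≡⟨ *-identityʳ _ ⟨
        (K 6 * A) ^ C * (D * D) * 1 ≤⟨ *-monoʳ-≤ ((K 6 * A) ^ C * (D * D)) (subst (1 ≤_) (sym eq) (s≤s z≤n)) ⟩
        (K 6 * A) ^ C * (D * D) * z (suc n) ≤⟨ explosion n (subst (λ w → o n * o n * A * z n ≤ K 1000000 * w) (sym eq) h) C ⟩
        K 25 ^ C * (D₀ * D₀) * z (C + suc n) ≤⟨ *-monoʳ-≤ (K 25 ^ C * (D₀ * D₀)) (z-crude (C + suc n)) ⟩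
        K 25 ^ C * (D₀ * D₀) * (16 * y * (D * D) * q ^ (C + suc n)) ≡⟨ cong (λ e → K 25 ^ C * (D₀ * D₀) * (16 * y * (D * D) * e)) (^-distribˡ-+-* q C (suc n)) ⟩
        K 25 ^ C * (D₀ * D₀) * (16 * y * (D * D) * (q ^ C * q ^ suc n))
          ≡⟨ solve 6 (λ p D₀ y D a b → p :* D₀ :* (y :* D :* (a :* b)) := D₀ :* y :* b :* (p :* a) :* D) refl (K 25 ^ C) (D₀ * D₀) (16 * y) (D * D) (q ^ C) (q ^ suc n) ⟩
        C * (K 25 ^ C * q ^ C) * (D * D) ∎)

    private
      -- By `decay` the last term is at most a millionth of the middle one. The weight 999 balances
      -- the two losses, and 998001 = 999².
      ratio-A : ∀ n → K 998001 * (o (suc n) * o (suc n) * A * z (suc n)) ≤ K 1000000 * (c n * c n * (B * B) * z n)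
      ratio-A n = certify (K 0) (+-mono-≤ (*-monoʳ-≤ (K 1000) (recurrence 999 n)) (*-monoʳ-≤ (K 999) (decay (suc n))))
        (solve 3 (λ E P Z → con 998001 :* E :+ (con 1000 :* (con 1000 :* (P :+ con 999 :* Z)) :+ con 999 :* E) :+ con 0
           := con 1000000 :* P :+ (con 1000 :* (con 999 :* E) :+ con 999 :* (con 1000000 :* Z)))
           refl (o (suc n) * o (suc n) * A * z (suc n)) (c n * c n * (B * B) * z n) (z (suc (suc n))))

    z-ratio : ∀ n → K 200 * (T * (o (suc n) * o (suc n)) * z (suc n)) ≤ K 201 * (c n * c n * B * z n)
    z-ratio n = ratio 996004998 1000000000 200 201 (*-cancelˡ-≤ B (begin
      B * (K 996004998 * (T * (e * e) * z (suc n)))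
        ≡⟨ solve 4 (λ B T e z → B :* (con 996004998 :* (T :* (e :* e) :* z)) := con 998001 :* (e :* e) :* z :* (con 998 :* (T :* B))) refl B T e (z (suc n)) ⟩
      K 998001 * (e * e) * z (suc n) * (K 998 * (T * B)) ≤⟨ *-monoʳ-≤ (K 998001 * (e * e) * z (suc n)) A-large ⟩
      K 998001 * (e * e) * z (suc n) * (K 1000 * A)
        ≡⟨ solve 3 (λ A e z → con 998001 :* (e :* e) :* z :* (con 1000 :* A) := con 1000 :* (con 998001 :* (e :* e :* A :* z))) refl A e (z (suc n)) ⟩
      K 1000 * (K 998001 * (e * e * A * z (suc n))) ≤⟨ *-monoʳ-≤ (K 1000) (ratio-A n) ⟩
      K 1000 * (K 1000000 * (c n * c n * (B * B) * z n))
        ≡⟨ solve 3 (λ c B z → con 1000 :* (con 1000000 :* (c :* c :* (B :* B) :* z)) := B :* (con 1000000000 :* (c :* c :* B :* z))) refl (c n) B (z n) ⟩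
      B * (K 1000000000 * (c n * c n * B * z n)) ∎)) (≤ᵇ⇒≤ _ _ _)
      where
      e : ℕ
      e = o (suc n)

    private
      cancel-o² : ∀ n {x w} → o n * o n * x ≤ o n * o n * w → x ≤ w
      cancel-o² n = *-cancelˡ-≤ (o n * o n) {{*-nonZero {o n} _ _}}

    z-step : ∀ n → T * z (suc n) ≤ K 26 * (o n * o n) * B * z n
    z-step n = cancel-o² (suc n) (*-cancelˡ-≤ (K 200) (begin
      K 200 * (e * e * (T * z (suc n))) ≡⟨ solve 3 (λ e T z → con 200 :* (e :* e :* (T :* z)) := con 200 :* (T :* (e :* e) :* z)) refl e T (z (suc n)) ⟩
      K 200 * (T * (e * e) * z (suc n)) ≤⟨ z-ratio n ⟩
      K 201 * (c n * c n * B * z n) ≤⟨ *-monoʳ-≤ (K 201) (*-monoˡ-≤ (z n) (*-monoˡ-≤ B (c² n))) ⟩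
      K 201 * (K 25 * (o n * o n * (e * e)) * B * z n) ≤⟨ certify (K 175 * (o n * o n * (e * e) * B * z n)) (≤-refl {K 0})
        (solve 4 (λ o e B z → con 201 :* (con 25 :* (o :* o :* (e :* e)) :* B :* z) :+ con 0 :+ con 175 :* (o :* o :* (e :* e) :* B :* z)
          := con 200 :* (e :* e :* (con 26 :* (o :* o) :* B :* z)) :+ con 0) refl (o n) e B (z n)) ⟩
      K 200 * (e * e * (K 26 * (o n * o n) * B * z n)) ∎))
      where
      e : ℕ
      e = o (suc n)

    -- The gain of T per step is given away here: this is the form in which Z enters as an error
    -- term in `w-bound`.
    z-bound : ∀ n → z n ≤ n !! * n !! * B ^ n * y
    z-bound zero = ≤-reflexive (trans z-0 (sym (*-identityˡ y)))
    z-bound (suc n) = *-cancelˡ-≤ (K 26) (begin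
      K 26 * z (suc n) ≤⟨ *-monoˡ-≤ (z (suc n)) (≤-trans (K-≤ {26} {10000} (≤ᵇ⇒≤ _ _ _)) T-large) ⟩
      T * z (suc n) ≤⟨ z-step n ⟩
      K 26 * (o n * o n) * B * z n ≤⟨ *-monoʳ-≤ (K 26 * (o n * o n) * B) (z-bound n) ⟩
      K 26 * (o n * o n) * B * (n !! * n !! * B ^ n * y)
        ≡⟨ solve 5 (λ o B D p y → con 26 :* (o :* o) :* B :* (D :* D :* p :* y) := con 26 :* (o :* D :* (o :* D) :* (B :* p) :* y)) refl (o n) B (n !!) (B ^ n) y ⟩
      K 26 * (suc n !! * suc n !! * B ^ suc n * y) ∎)

    -- The first two quotients are used exactly: (15²/3²)(63²/5²) = 3969, times (201/200)². The
    -- value is rounded up to 4014 = 446 · 9, where 9 is the square of 2 !!, which is the shape in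
    -- which `z-bound-17` starts.
    z-bound-2 : T ^ 2 * z 2 ≤ K 4014 * (B ^ 2 * y)
    z-bound-2 = ≤-trans (≤-reflexive (trans (sym (*-identityˡ _)) (cong (_* (T ^ 2 * z 2)) (sym (K≡ 1))))) (ratio 40000 160351569 1 4014 (begin
      K 40000 * (T ^ 2 * z 2) ≡⟨ cong (λ x → K 40000 * (x * z 2)) (cong (T *_) (*-identityʳ T)) ⟩
      K 40000 * (T * T * z 2) ≡⟨ solve 2 (λ T z → con 40000 :* (T :* T :* z) := con 8 :* T :* (con 200 :* (T :* (con 5 :* con 5) :* z))) refl T (z 2) ⟩
      K 8 * T * (K 200 * (T * (K 5 * K 5) * z 2)) ≡⟨ cong (λ e → K 8 * T * (K 200 * (T * (e * e) * z 2))) (K≡ 5) ⟩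
      K 8 * T * (K 200 * (T * (o 2 * o 2) * z 2)) ≤⟨ *-monoʳ-≤ (K 8 * T) (z-ratio 1) ⟩
      K 8 * T * (K 201 * (c 1 * c 1 * B * z 1)) ≡⟨ cong (λ e → K 8 * T * (K 201 * (e * e * B * z 1))) (K≡ 63) ⟨
      K 8 * T * (K 201 * (K 63 * K 63 * B * z 1)) ≡⟨ solve 3 (λ T B z → con 8 :* T :* (con 201 :* (con 63 :* con 63 :* B :* z)) := con 797769 :* B :* (con 8 :* (T :* z))) refl T B (z 1) ⟩
      K 797769 * B * (K 8 * (T * z 1)) ≤⟨ *-monoʳ-≤ (K 797769 * B) first ⟩
      K 797769 * B * (K 201 * (B * z 0)) ≡⟨ solve 2 (λ B z → con 797769 :* B :* (con 201 :* (B :* z)) := con 160351569 :* (B :* B :* z)) refl B (z 0) ⟩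
      K 160351569 * (B * B * z 0) ≡⟨ cong₂ (λ x w → K 160351569 * (x * w)) (cong (B *_) (sym (*-identityʳ B))) z-0 ⟩
      K 160351569 * (B ^ 2 * y) ∎) (≤ᵇ⇒≤ _ _ _))
      where
      first : K 8 * (T * z 1) ≤ K 201 * (B * z 0)
      first = ratio 1800 45225 8 201 (begin
        K 1800 * (T * z 1) ≡⟨ solve 2 (λ T z → con 1800 :* (T :* z) := con 200 :* (T :* (con 3 :* con 3) :* z)) refl T (z 1) ⟩
        K 200 * (T * (K 3 * K 3) * z 1) ≡⟨ cong (λ e → K 200 * (T * (e * e) * z 1)) (K≡ 3) ⟩
        K 200 * (T * (o 1 * o 1) * z 1) ≤⟨ z-ratio 0 ⟩
        K 201 * (c 0 * c 0 * B * z 0) ≡⟨ cong (λ e → K 201 * (e * e * B * z 0)) (K≡ 15) ⟨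
        K 201 * (K 15 * K 15 * B * z 0) ≡⟨ solve 2 (λ B z → con 201 :* (con 15 :* con 15 :* B :* z) := con 45225 :* (B :* z)) refl B (z 0) ⟩
        K 45225 * (B * z 0) ∎) (≤ᵇ⇒≤ _ _ _)

    -- From index 2 on, (143/35)² · 201/200 is below 17. At index 1 the quotient is 4.2² > 17, hence
    -- the separate start.
    z-step-17 : ∀ n → T * z (3 + n) ≤ K 17 * (o (2 + n) * o (2 + n)) * B * z (2 + n)
    z-step-17 n = cancel-o² (3 + n) (*-cancelˡ-≤ (K 245000) (begin
      K 245000 * (e * e * (T * z (3 + n))) ≡⟨ solve 3 (λ e T z → con 245000 :* (e :* e :* (T :* z)) := con 1225 :* (con 200 :* (T :* (e :* e) :* z))) refl e T (z (3 + n)) ⟩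
      K 1225 * (K 200 * (T * (e * e) * z (3 + n))) ≤⟨ *-monoʳ-≤ (K 1225) (z-ratio (2 + n)) ⟩
      K 1225 * (K 201 * (C * C * B * z (2 + n))) ≡⟨ solve 3 (λ C B z → con 1225 :* (con 201 :* (C :* C :* B :* z)) := con 201 :* (con 35 :* C :* (con 35 :* C)) :* B :* z) refl C B (z (2 + n)) ⟩
      K 201 * (K 35 * C * (K 35 * C)) * B * z (2 + n) ≤⟨ *-monoˡ-≤ (z (2 + n)) (*-monoˡ-≤ B (*-monoʳ-≤ (K 201) (sq (35c≤143oo n)))) ⟩
      K 201 * (K 143 * (f * e) * (K 143 * (f * e))) * B * z (2 + n) ≤⟨ certify (K 54751 * (f * f * (e * e) * B * z (2 + n))) (≤-refl {K 0})
         (solve 4 (λ f e B z → con 201 :* (con 143 :* (f :* e) :* (con 143 :* (f :* e))) :* B :* z :+ con 0 :+ con 54751 :* (f :* f :* (e :* e) :* B :* z)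
            := con 245000 :* (e :* e :* (con 17 :* (f :* f) :* B :* z)) :+ con 0) refl f e B (z (2 + n))) ⟩
      K 245000 * (e * e * (K 17 * (f * f) * B * z (2 + n))) ∎))
      where
      e f C : ℕ
      e = o (3 + n)
      f = o (2 + n)
      C = c (2 + n)

    z-bound-17 : ∀ n → T ^ (2 + n) * z (2 + n) ≤ K 446 * K 17 ^ n * ((2 + n) !! * (2 + n) !!) * B ^ (2 + n) * y
    z-bound-17 zero = ≤-trans z-bound-2 (≤-reflexive (trans
      (solve 2 (λ p y → con 4014 :* (p :* y) := con 446 :* con 1 :* (con 3 :* con 3) :* p :* y) refl (B ^ 2) y)
      (cong₂ (λ a d → K 446 * a * (d * d) * B ^ 2 * y) (K≡ 1) (K≡ 3))))
    z-bound-17 (suc n) = begin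
      T * T ^ (2 + n) * z (3 + n) ≡⟨ solve 3 (λ T p z → T :* p :* z := p :* (T :* z)) refl T (T ^ (2 + n)) (z (3 + n)) ⟩
      T ^ (2 + n) * (T * z (3 + n)) ≤⟨ *-monoʳ-≤ (T ^ (2 + n)) (z-step-17 n) ⟩
      T ^ (2 + n) * (K 17 * (f * f) * B * z (2 + n)) ≡⟨ solve 4 (λ p f B z → p :* (con 17 :* (f :* f) :* B :* z) := con 17 :* (f :* f) :* B :* (p :* z)) refl (T ^ (2 + n)) f B (z (2 + n)) ⟩
      K 17 * (f * f) * B * (T ^ (2 + n) * z (2 + n)) ≤⟨ *-monoʳ-≤ (K 17 * (f * f) * B) (z-bound-17 n) ⟩
      K 17 * (f * f) * B * (K 446 * K 17 ^ n * (D * D) * B ^ (2 + n) * y)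
        ≡⟨ solve 6 (λ f B s D p y → con 17 :* (f :* f) :* B :* (con 446 :* s :* (D :* D) :* p :* y) := con 446 :* (con 17 :* s) :* (f :* D :* (f :* D)) :* (B :* p) :* y) refl f B (K 17 ^ n) D (B ^ (2 + n)) y ⟩
      K 446 * K 17 ^ suc n * ((3 + n) !! * (3 + n) !!) * B ^ (3 + n) * y ∎
      where
      f D : ℕ
      f = o (2 + n)
      D = (2 + n) !!

    module Perturbation (w : ℕ → ℕ) (w-0 : w 0 ≡ 0) (w-1 : w 1 ≤ K 16 * y)
      (w-recurrence : ∀ n → K 100 * w (suc (suc n)) ≤ K 101 * (o (suc n) * o (suc n) * (T * B) * w (suc n)
          + K 100 * (K 2 * (c n * c n * (B * B) * w n + K 16 * (o (suc n) * o (suc n)) * z (suc n)))))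
      where

      -- Here w stands for the squared size of bⁿ Y_n - Z_n, which follows the growing branch with
      -- about o² T B per step. The room 21/20 pays for the weight 101/100, for the term two steps
      -- back and for Z: 2020 + 20 + 41 ≤ 2100.
      w-bound : ∀ n → K 20 ^ n * w (suc n) ≤ suc n !! * suc n !! * (K 16 * y) * (K 21 * (T * B)) ^ n
      private
        -- The term two steps back, with T² inserted. At index 0 it vanishes with w 0; otherwise it
        -- is bounded by `w-bound` at a smaller index, so the two are proved by mutual recursion.
        previous : ∀ n → o (suc n) * o (suc n) * (B * B) * (o n * o n * (K 20 ^ n * (T * T) * w n)) ≤
          o (suc n) * suc n !! * (o (suc n) * suc n !!) * (K 16 * y) * (T * B * (K 21 * (T * B)) ^ n)

      w-bound zero = ≤-trans (≤-reflexive (+-identityʳ (w 1))) (≤-trans w-1 (≤-reflexive (trans (sym (*-identityʳ _)) (cong (_* 1) (sym (*-identityˡ (K 16 * y)))))))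
      w-bound (suc n) = *-cancelˡ-≤ (K 100) (begin
        K 100 * (K 20 * p * w (2 + n)) ≡⟨ solve 2 (λ p w → con 100 :* (con 20 :* p :* w) := con 20 :* p :* (con 100 :* w)) refl p (w (2 + n)) ⟩
        K 20 * p * (K 100 * w (2 + n)) ≤⟨ *-monoʳ-≤ (K 20 * p) (w-recurrence n) ⟩
        K 20 * p * (K 101 * (e * e * (T * B) * w (suc n) + K 100 * (K 2 * (C * C * (B * B) * w n + K 16 * (e * e) * z (suc n)))))
          ≡⟨ solve 8 (λ p e TB w₁ C B w₀ z → con 20 :* p :* (con 101 :* (e :* e :* TB :* w₁ :+ con 100 :* (con 2 :* (C :* C :* (B :* B) :* w₀ :+ con 16 :* (e :* e) :* z))))
               := con 2020 :* (e :* e :* TB :* (p :* w₁)) :+ (con 404000 :* (p :* (C :* C :* (B :* B) :* w₀)) :+ con 404000 :* (p :* (con 16 :* (e :* e) :* z))))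
               refl p e (T * B) (w (suc n)) C B (w n) (z (suc n)) ⟩
        K 2020 * (e * e * (T * B) * (p * w (suc n))) + (K 404000 * (p * (C * C * (B * B) * w n)) + K 404000 * (p * (K 16 * (e * e) * z (suc n))))
          ≤⟨ +-mono-≤ (*-monoʳ-≤ (K 2020) (*-monoʳ-≤ (e * e * (T * B)) (w-bound n))) (+-mono-≤ second third) ⟩
        K 2020 * (e * e * (T * B) * (D * D * Y * r)) + (K 20 * Q + K 41 * Q)
          ≡⟨ solve 5 (λ e TB D Y r → con 2020 :* (e :* e :* TB :* (D :* D :* Y :* r)) :+ (con 20 :* (e :* D :* (e :* D) :* Y :* (TB :* r)) :+ con 41 :* (e :* D :* (e :* D) :* Y :* (TB :* r)))
               := con 2081 :* (e :* D :* (e :* D) :* Y :* (TB :* r))) refl e (T * B) D Y r ⟩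
        K 2081 * Q ≤⟨ *-monoˡ-≤ Q (K-≤ {2081} {2100} (≤ᵇ⇒≤ _ _ _)) ⟩
        K 2100 * Q ≡⟨ solve 5 (λ e TB D Y r → con 2100 :* (e :* D :* (e :* D) :* Y :* (TB :* r)) := con 100 :* (e :* D :* (e :* D) :* Y :* (con 21 :* TB :* r))) refl e (T * B) D Y r ⟩
        K 100 * ((2 + n) !! * (2 + n) !! * (K 16 * y) * (K 21 * (T * B)) ^ suc n) ∎)
        where
        e C D p r Y Q : ℕ
        e = o (suc n)
        C = c n
        D = suc n !!
        p = K 20 ^ n
        r = (K 21 * (T * B)) ^ n
        Y = K 16 * y
        Q = e * D * (e * D) * Y * (T * B * r)
        second : K 404000 * (p * (C * C * (B * B) * w n)) ≤ K 20 * Q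
        second = begin
          K 404000 * (p * (C * C * (B * B) * w n)) ≤⟨ *-monoʳ-≤ (K 404000) (*-monoʳ-≤ p (*-monoˡ-≤ (w n) (*-monoˡ-≤ (B * B) (c² n)))) ⟩
          K 404000 * (p * (K 25 * (o n * o n * (e * e)) * (B * B) * w n))
            ≡⟨ solve 5 (λ p o e B w → con 404000 :* (p :* (con 25 :* (o :* o :* (e :* e)) :* (B :* B) :* w)) := con 10100000 :* (e :* e :* (o :* o :* (B :* B) :* (p :* w)))) refl p (o n) e B (w n) ⟩
          K 10100000 * (e * e * (o n * o n * (B * B) * (p * w n))) ≤⟨ *-monoˡ-≤ _ (≤-trans (K-≤ {10100000} {20 * 10000 * 10000} (≤ᵇ⇒≤ _ _ _))
             (≤-trans (≤-reflexive (trans (K-* (20 * 10000) 10000) (trans (cong (_* K 10000) (K-* 20 10000)) (*-assoc (K 20) _ _)))) (*-monoʳ-≤ (K 20) (sq T-large)))) ⟩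
          K 20 * (T * T) * (e * e * (o n * o n * (B * B) * (p * w n)))
            ≡⟨ solve 6 (λ T e o B p w → con 20 :* (T :* T) :* (e :* e :* (o :* o :* (B :* B) :* (p :* w))) := con 20 :* (e :* e :* (B :* B) :* (o :* o :* (p :* (T :* T) :* w)))) refl T e (o n) B p (w n) ⟩
          K 20 * (e * e * (B * B) * (o n * o n * (p * (T * T) * w n))) ≤⟨ *-monoʳ-≤ (K 20) (previous n) ⟩
          K 20 * Q ∎
        third : K 404000 * (p * (K 16 * (e * e) * z (suc n))) ≤ K 41 * Q
        third = begin
          K 404000 * (p * (K 16 * (e * e) * z (suc n))) ≤⟨ *-monoʳ-≤ (K 404000) (*-monoʳ-≤ p (*-monoʳ-≤ (K 16 * (e * e)) (z-bound (suc n)))) ⟩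
          K 404000 * (p * (K 16 * (e * e) * (D * D * B ^ suc n * y)))
            ≡⟨ solve 6 (λ p e D B b y → con 404000 :* (p :* (con 16 :* (e :* e) :* (D :* D :* (B :* b) :* y))) := con 404000 :* (e :* D :* (e :* D) :* (con 16 :* y) :* (B :* (p :* b)))) refl p e D B (B ^ n) y ⟩
          K 404000 * (e * D * (e * D) * Y * (B * (p * B ^ n)))
            ≤⟨ *-mono-≤ (≤-trans (K-≤ {404000} {41 * 10000} (≤ᵇ⇒≤ _ _ _)) (≤-trans (≤-reflexive (K-* 41 10000)) (*-monoʳ-≤ (K 41) T-large))) (*-monoʳ-≤ (e * D * (e * D) * Y) (*-monoʳ-≤ B 20B)) ⟩
          K 41 * T * (e * D * (e * D) * Y * (B * r))
            ≡⟨ solve 6 (λ T e D Y B r → con 41 :* T :* (e :* D :* (e :* D) :* Y :* (B :* r)) := con 41 :* (e :* D :* (e :* D) :* Y :* (T :* B :* r))) refl T e D Y B r ⟩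
          K 41 * Q ∎
          where
          20B : p * B ^ n ≤ r
          20B = ≤-trans (≤-reflexive (sym (^-distrib-* (K 20) B n))) (^-monoˡ-≤ n (*-mono-≤ (K-≤ {20} {21} (≤ᵇ⇒≤ _ _ _)) (m≤n*m B T {{>-nonZero (≤-trans (subst (_≤ K 10000) (K≡ 1) (K-≤ (≤ᵇ⇒≤ _ _ _))) T-large)}})))

      previous zero rewrite w-0 = ≤-trans (≤-reflexive
        (trans (cong (λ x → o 1 * o 1 * (B * B) * (1 * 1 * x)) (*-zeroʳ (1 * (T * T)))) (*-zeroʳ (o 1 * o 1 * (B * B))))) z≤n
      previous (suc n) = begin
        e * e * (B * B) * (f * f * (K 20 * p * (T * T) * w (suc n)))
          ≡⟨ solve 6 (λ e B f p T w → e :* e :* (B :* B) :* (f :* f :* (con 20 :* p :* (T :* T) :* w)) := con 20 :* (e :* e :* (B :* B) :* (f :* f) :* (T :* T)) :* (p :* w)) refl e B f p T (w (suc n)) ⟩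
        K 20 * (e * e * (B * B) * (f * f) * (T * T)) * (p * w (suc n)) ≤⟨ *-mono-≤ (*-monoˡ-≤ _ (K-≤ {20} {21} (≤ᵇ⇒≤ _ _ _))) (w-bound n) ⟩
        K 21 * (e * e * (B * B) * (f * f) * (T * T)) * (D * D * Y * r)
          ≡⟨ solve 7 (λ e B f T D Y r → con 21 :* (e :* e :* (B :* B) :* (f :* f) :* (T :* T)) :* (D :* D :* Y :* r) := e :* (f :* D) :* (e :* (f :* D)) :* Y :* (T :* B :* (con 21 :* (T :* B) :* r))) refl e B f T D Y r ⟩
        e * (f * D) * (e * (f * D)) * Y * (T * B * (K 21 * (T * B) * r)) ∎
        where
        e f D p r Y : ℕ
        e = o (suc (suc n))
        f = o (suc n)
        D = suc n !!
        p = K 20 ^ n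
        r = (K 21 * (T * B)) ^ n
        Y = K 16 * y

-- Legendre's formula and multiples in arithmetic progressions

module PrimeCounting where
  open import Data.Nat.Base
  open import Data.Nat.Properties
  open import Data.Nat.Divisibility
  open import Data.Nat.Primality
  open import Data.Nat.Primality.Factorisation using (factorise; PrimeFactorisation)
  open import Data.Nat.ListAction using (product)
  open import Data.Nat.DivMod using (m≡m%n+[m/n]*n; m%n<n; [m+kn]%n≡m%n; m<n⇒m%n≡m)
  open import Data.List.Base using ([]; _∷_)
  open import Data.List.Relation.Unary.All using (All; []; _∷_)
  open import Data.Nat.Solver using (module +-*-Solver)
  open import Data.Product using (_×_; _,_; ∃; proj₁; proj₂)
  open import Data.Sum using (_⊎_; inj₁; inj₂)
  open import Data.Empty using (⊥; ⊥-elim)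
  open import Relation.Nullary using (Dec; yes; no; ¬_)
  open import Relation.Binary.Definitions using (tri<; tri≈; tri>)
  open import Relation.Binary.PropositionalEquality hiding ([_])
  open +-*-Solver

  σ Π : (ℕ → ℕ) → ℕ → ℕ
  σ f zero = 0
  σ f (suc n) = σ f n + f n
  Π f zero = 1
  Π f (suc n) = Π f n * f n

  σ-cong : ∀ n {f g} → (∀ i → f i ≡ g i) → σ f n ≡ σ g n
  σ-cong zero eq = refl
  σ-cong (suc n) eq = cong₂ _+_ (σ-cong n eq) (eq n)

  σ-+ : ∀ n f g → σ (λ i → f i + g i) n ≡ σ f n + σ g n
  σ-+ zero f g = refl
  σ-+ (suc n) f g = trans (cong (_+ (f n + g n)) (σ-+ n f g))
    (solve 4 (λ a b c d → a :+ b :+ (c :+ d) := a :+ c :+ (b :+ d)) refl (σ f n) (σ g n) (f n) (g n))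

  σ-swap : ∀ m n (g : ℕ → ℕ → ℕ) → σ (λ i → σ (g i) n) m ≡ σ (λ j → σ (λ i → g i j) m) n
  σ-swap zero n g = sym (zeros n)
    where
    zeros : ∀ n → σ (λ _ → 0) n ≡ 0
    zeros zero = refl
    zeros (suc n) = trans (+-identityʳ _) (zeros n)
  σ-swap (suc m) n g = trans (cong (_+ σ (g m) n) (σ-swap m n g)) (sym (σ-+ n (λ j → σ (λ i → g i j) m) (g m)))

  σ-split : ∀ m n f → σ f (m + n) ≡ σ f m + σ (λ i → f (m + i)) n
  σ-split m zero f = trans (cong (σ f) (+-identityʳ m)) (sym (+-identityʳ _))
  σ-split m (suc n) f rewrite +-suc m n = trans (cong (_+ f (m + n)) (σ-split m n f)) (+-assoc (σ f m) _ _)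

  σ-mono : ∀ n {f g} → (∀ i → f i ≤ g i) → σ f n ≤ σ g n
  σ-mono zero le = z≤n
  σ-mono (suc n) le = +-mono-≤ (σ-mono n le) (le n)

  [_] : ∀ {p} {P : Set p} → Dec P → ℕ
  [ yes _ ] = 1
  [ no _ ] = 0

  []-cong : ∀ {p q} {P : Set p} {Q : Set q} (P? : Dec P) (Q? : Dec Q) → (P → Q) → (Q → P) → [ P? ] ≡ [ Q? ]
  []-cong (yes p) (yes q) f g = refl
  []-cong (yes p) (no ¬q) f g = ⊥-elim (¬q (f p))
  []-cong (no ¬p) (yes q) f g = ⊥-elim (¬p (g q))
  []-cong (no ¬p) (no ¬q) f g = refl

  []-yes : ∀ {p} {P : Set p} (P? : Dec P) → P → [ P? ] ≡ 1
  []-yes (yes _) _ = refl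
  []-yes (no ¬p) p = ⊥-elim (¬p p)

  []-no : ∀ {p} {P : Set p} (P? : Dec P) → ¬ P → [ P? ] ≡ 0
  []-no (yes p) ¬p = ⊥-elim (¬p p)
  []-no (no _) _ = refl

  []≤1 : ∀ {p} {P : Set p} (P? : Dec P) → [ P? ] ≤ 1
  []≤1 (yes _) = ≤-refl
  []≤1 (no _) = z≤n

  module Valuation (p : ℕ) (prime : Prime p) where
    private instance
      p≢0 : NonZero p
      p≢0 = prime⇒nonZero prime

    p∤1 : p ∤ 1
    p∤1 p∣1 = ¬prime[1] (subst Prime (∣1⇒≡1 p∣1) prime)

    -- The p-adic valuation as a relation; the cofactor prime to p excludes a = 0.
    Exactly : ℕ → ℕ → Set
    Exactly a v = ∃ λ u → a ≡ p ^ v * u × p ∤ u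

    Exactly-* : ∀ {a b v w} → Exactly a v → Exactly b w → Exactly (a * b) (v + w)
    Exactly-* {v = v} {w} (s , refl , p∤s) (t , refl , p∤t) = s * t ,
      trans (solve 4 (λ a s b t → a :* s :* (b :* t) := a :* b :* (s :* t)) refl (p ^ v) s (p ^ w) t) (cong (_* (s * t)) (sym (^-distribˡ-+-* p v w))) ,
      λ d → p∤st (euclidsLemma s t prime d)
      where
      p∤st : p ∣ s ⊎ p ∣ t → ⊥
      p∤st (inj₁ d) = p∤s d
      p∤st (inj₂ d) = p∤t d

    p^∣-cancel : ∀ e u x → p ∤ u → p ^ e ∣ u * x → p ^ e ∣ x
    p^∣-cancel zero u x p∤u d = 1∣ x
    p^∣-cancel (suc e) u x p∤u d with p^∣-cancel e u x p∤u (∣-trans (n∣m*n p) d)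
    ... | divides y refl with euclidsLemma u y prime (*-cancelʳ-∣ (p ^ e) {{m^n≢0 p e}} (subst (p * p ^ e ∣_) (sym (*-assoc u y (p ^ e))) d))
    ...   | inj₁ p∣u = ⊥-elim (p∤u p∣u)
    ...   | inj₂ p∣y = *-monoˡ-∣ (p ^ e) p∣y

    Exactly-max : ∀ {a v} e → Exactly a v → p ^ e ∣ a → e ≤ v
    Exactly-max {a} {v} e (u , refl , p∤u) d with ≤-total e v
    ... | inj₁ e≤v = e≤v
    ... | inj₂ v≤e with m≤n⇒∃[o]m+o≡n v≤e
    ...   | zero , refl = ≤-reflexive (+-identityʳ v)
    ...   | suc j , refl = ⊥-elim (p∤u (∣-trans (m∣m*n (p ^ j)) (*-cancelˡ-∣ (p ^ v) {{m^n≢0 p v}} (subst (_∣ p ^ v * u) (^-distribˡ-+-* p v (suc j)) d))))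

    -- Legendre's count of the powers of p that divide a, cut off at H. It is always a lower bound
    -- for the valuation, and equal to it when 0 < a ≤ H.
    count : ℕ → ℕ → ℕ
    count H a = σ (λ e → [ p ^ suc e ∣? a ]) H

    private
      σ-front : ∀ H f → σ f (suc H) ≡ f 0 + σ (λ e → f (suc e)) H
      σ-front H f = σ-split 1 H f

      σ-zero : ∀ H {f} → (∀ e → f e ≡ 0) → σ f H ≡ 0
      σ-zero zero eq = refl
      σ-zero (suc H) eq = cong₂ _+_ (σ-zero H eq) (eq H)

      count-∤ : ∀ H {a} → p ∤ a → count H a ≡ 0
      count-∤ H {a} p∤a = σ-zero H λ e → []-no (p ^ suc e ∣? a) λ d → p∤a (∣-trans (m∣m*n (p ^ e)) d)

      count-suc : ∀ H b → count (suc H) (p * b) ≡ suc (count H b)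
      count-suc H b = trans (σ-front H _) (cong₂ _+_ ([]-yes (p ^ 1 ∣? p * b) (subst (_∣ p * b) (sym (*-identityʳ p)) (m∣m*n b)))
        (σ-cong H λ e → []-cong (p ^ suc (suc e) ∣? p * b) (p ^ suc e ∣? b) (*-cancelˡ-∣ p) (*-monoʳ-∣ p)))

    count-exact : ∀ H a → .{{NonZero a}} → a ≤ H → Exactly a (count H a)
    count-exact zero a a≤0 = ⊥-elim (≢-nonZero⁻¹ a (n≤0⇒n≡0 a≤0))
    count-exact (suc H) a a≤H with p ∣? a
    ... | no p∤a = subst (Exactly a) (sym (count-∤ (suc H) p∤a)) (a , sym (+-identityʳ a) , p∤a)
    ... | yes (divides b eq) rewrite trans eq (*-comm b p) | count-suc H b with count-exact H b {{m*n≢0⇒n≢0 p}} (≤-pred (<-≤-trans b<a a≤H))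
      where
      b<a : b < p * b
      b<a = subst (b <_) (*-comm b p) (m<m*n b p {{m*n≢0⇒n≢0 p}} (nonTrivial⇒n>1 p {{prime⇒nonTrivial prime}}))
    ...   | u , eq′ , p∤u = u , trans (cong (p *_) eq′) (sym (*-assoc p _ u)) , p∤u

    count-∣ : ∀ H a → p ^ count H a ∣ a
    count-∣ zero a = 1∣ a
    count-∣ (suc H) a with p ∣? a
    ... | no p∤a = subst (λ e → p ^ e ∣ a) (sym (count-∤ (suc H) p∤a)) (1∣ a)
    ... | yes (divides b eq) rewrite trans eq (*-comm b p) | count-suc H b = *-monoʳ-∣ p (count-∣ H b)

    Π-exact : ∀ H n f → (∀ i → i < n → NonZero (f i) × f i ≤ H) → Exactly (Π f n) (σ (λ i → count H (f i)) n)
    Π-exact H zero f bd = 1 , refl , p∤1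
    Π-exact H (suc n) f bd = Exactly-* {v = σ (λ i → count H (f i)) n} {w = count H (f n)} (Π-exact H n f (λ i i<n → bd i (m<n⇒m<1+n i<n)))
      (count-exact H (f n) {{proj₁ (bd n ≤-refl)}} (proj₂ (bd n ≤-refl)))

    Π-∣ : ∀ H n f → p ^ σ (λ i → count H (f i)) n ∣ Π f n
    Π-∣ H zero f = 1∣ 1
    Π-∣ H (suc n) f = subst (_∣ Π f n * f n) (sym (^-distribˡ-+-* p (σ (λ i → count H (f i)) n) (count H (f n)))) (*-pres-∣ (Π-∣ H n f) (count-∣ H (f n)))

  ∣-by-prime-powers : ∀ a c → .{{NonZero a}} → (∀ p e → Prime p → p ^ e ∣ a → p ^ e ∣ c) → a ∣ c
  ∣-by-prime-powers a c h = subst (_∣ c) (sym isFactorisation) (go factors c factorsPrime (λ p e pr d → h p e pr (subst (p ^ e ∣_) (sym isFactorisation) d)))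
    where
    open PrimeFactorisation (factorise a)
    go : ∀ ps c → All Prime ps → (∀ p e → Prime p → p ^ e ∣ product ps → p ^ e ∣ c) → product ps ∣ c
    go [] c _ h = 1∣ c
    go (p ∷ ps) c (pr ∷ prs) h with subst (_∣ c) (*-identityʳ p) (h p 1 pr (subst (_∣ p * product ps) (sym (*-identityʳ p)) (m∣m*n (product ps))))
    ... | divides b refl = subst (p * product ps ∣_) (*-comm p b) (*-monoʳ-∣ p (go ps b prs rest))
      where
      instance
        p≢0 : NonZero p
        p≢0 = prime⇒nonZero pr
      rest : ∀ q e → Prime q → q ^ e ∣ product ps → q ^ e ∣ b
      rest q e qr d with q ≟ p
      ... | yes refl = *-cancelˡ-∣ p (subst (p * p ^ e ∣_) (*-comm b p) (h p (suc e) pr (*-monoʳ-∣ p d)))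
      ... | no q≢p = Valuation.p^∣-cancel q qr e p b q∤p (subst (q ^ e ∣_) (*-comm b p) (h q e qr (∣-trans d (n∣m*n p))))
        where
        q∤p : q ∤ p
        q∤p q∣p with prime⇒irreducible pr q∣p
        ... | inj₁ refl = ¬prime[1] qr
        ... | inj₂ q≡p = q≢p q≡p

  -- `cancel` makes a invertible modulo m, so ai + b is divisible by m for exactly one residue of i,
  -- namely r. A range of Qm + R indices then contains Q full periods and one more hit when r < R.
  module Progression (m a b r : ℕ) .{{_ : NonZero m}} (r<m : r < m) (m∣r : m ∣ a * r + b) (cancel : ∀ x → m ∣ a * x → m ∣ x) where
    g : ℕ → ℕ
    g i = [ m ∣? a * i + b ]

    private
      g-period : ∀ i → g (m + i) ≡ g i
      g-period i = []-cong (m ∣? _) (m ∣? _)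
        (λ d → ∣m+n∣m⇒∣n (subst (m ∣_) eq d) (n∣m*n a)) (λ d → subst (m ∣_) (sym eq) (∣m∣n⇒∣m+n (n∣m*n a) d))
        where
        eq : a * (m + i) + b ≡ a * m + (a * i + b)
        eq = trans (cong (_+ b) (*-distribˡ-+ a m i)) (+-assoc (a * m) (a * i) b)

      distance : ∀ i d → m ∣ a * i + b → m ∣ a * (i + d) + b → d < m → d ≡ 0
      distance i d p q d<m with d in eq
      ... | zero = refl
      ... | suc _ = ⊥-elim (>⇒∤ d<m (cancel _ (∣m+n∣m⇒∣n (subst (m ∣_) (solve 4 (λ a i d b → a :* (i :+ d) :+ b := a :* i :+ b :+ a :* d) refl a i _ b) q) p)))

      unique : ∀ i → i < m → m ∣ a * i + b → i ≡ r
      unique i i<m d with ≤-total i r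
      ... | inj₁ i≤r with m≤n⇒∃[o]m+o≡n i≤r
      ...   | j , refl = trans (sym (+-identityʳ i)) (cong (i +_) (sym (distance i j d m∣r (≤-<-trans (m≤n+m j i) r<m))))
      unique i i<m d | inj₂ r≤i with m≤n⇒∃[o]m+o≡n r≤i
      ...   | j , refl = trans (cong (r +_) (distance r j m∣r d (≤-<-trans (m≤n+m j r) i<m))) (+-identityʳ r)

      partial : ∀ R → R ≤ m → σ g R ≡ [ r <? R ]
      partial zero _ = sym ([]-no (r <? 0) λ ())
      partial (suc R) R<m with <-cmp R r
      ... | tri< R<r R≢r _ = trans (cong₂ _+_ (trans (partial R (<⇒≤ R<m)) ([]-no (r <? R) (<-asym R<r))) ([]-no (m ∣? a * R + b) λ d → R≢r (unique R R<m d)))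
                               (sym ([]-no (r <? suc R) λ r<sR → <⇒≱ r<sR R<r))
      ... | tri≈ _ refl _ = trans (cong₂ _+_ (trans (partial R (<⇒≤ R<m)) ([]-no (r <? R) (<-irrefl refl))) ([]-yes (m ∣? a * R + b) m∣r))
                               (sym ([]-yes (r <? suc R) ≤-refl))
      ... | tri> _ R≢r r<R = trans (cong₂ _+_ (trans (partial R (<⇒≤ R<m)) ([]-yes (r <? R) r<R)) ([]-no (m ∣? a * R + b) λ d → R≢r (unique R R<m d)))
                               (sym ([]-yes (r <? suc R) (m<n⇒m<1+n r<R)))

    σ-g : ∀ Q R → R ≤ m → σ g (Q * m + R) ≡ Q + [ r <? R ]
    σ-g zero R R≤m = partial R R≤m
    σ-g (suc Q) R R≤m = begin
      σ g (m + Q * m + R) ≡⟨ cong (σ g) (+-assoc m (Q * m) R) ⟩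
      σ g (m + (Q * m + R)) ≡⟨ σ-split m (Q * m + R) g ⟩
      σ g m + σ (λ i → g (m + i)) (Q * m + R) ≡⟨ cong₂ _+_ (trans (partial m ≤-refl) ([]-yes (r <? m) r<m)) (trans (σ-cong (Q * m + R) g-period) (σ-g Q R R≤m)) ⟩
      suc (Q + [ r <? R ]) ∎
      where open ≡-Reasoning

  private
    certify : ∀ {a b l r} e → a ≤ b → l + b + e ≡ r + a → l ≤ r
    certify {a} {b} {l} {r} e a≤b eq = +-cancelʳ-≤ a l r (begin
      l + a ≤⟨ +-monoʳ-≤ l a≤b ⟩
      l + b ≤⟨ m≤m+n (l + b) e ⟩
      l + b + e ≡⟨ eq ⟩
      r + a ∎)
      where open ≤-Reasoning

    divMod-unique : ∀ m .{{_ : NonZero m}} {Q R Q′ R′} → R < m → R′ < m → R + Q * m ≡ R′ + Q′ * m → Q ≡ Q′ × R ≡ R′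
    divMod-unique m {Q} {R} {Q′} {R′} R<m R′<m eq = *-cancelʳ-≡ Q Q′ m (+-cancelˡ-≡ R _ _ (trans eq (cong (_+ Q′ * m) (sym R≡R′)))) , R≡R′
      where
      R≡R′ : R ≡ R′
      R≡R′ = trans (sym (m<n⇒m%n≡m R<m)) (trans (sym ([m+kn]%n≡m%n R Q m)) (trans (cong (_% m) eq) (trans ([m+kn]%n≡m%n R′ Q′ m) (m<n⇒m%n≡m R′<m))))

  -- For the odd modulus m = 2 r₀ + 1, residues r₀, r₁, r₂ of the zeros of 2i + 1, 4i + 3 and 4i + 5.
  module Residues (r₀ r₁ r₂ : ℕ) (r₁+r₂ : 2 + (r₁ + r₂) ≡ suc (2 * r₀))
    (m∣r₁ : suc (2 * r₀) ∣ 4 * r₁ + 3) (m∣r₂ : suc (2 * r₀) ∣ 4 * r₂ + 5) (r₁≤ : 4 * r₁ + 3 ≤ 3 * suc (2 * r₀)) (r₂≤ : 4 * r₂ + 5 ≤ 3 * suc (2 * r₀)) where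

    private
      m : ℕ
      m = suc (2 * r₀)

      cancel-2 : ∀ x → m ∣ 2 * x → m ∣ x
      cancel-2 x d = ∣m+n∣m⇒∣n (subst (m ∣_) (solve 2 (λ r x → (con 1 :+ con 2 :* r) :* x := r :* (con 2 :* x) :+ x) refl r₀ x) (m∣m*n x)) (∣n⇒∣m*n r₀ d)

      cancel-4 : ∀ x → m ∣ 4 * x → m ∣ x
      cancel-4 x d = cancel-2 x (cancel-2 (2 * x) (subst (m ∣_) (*-assoc 2 2 x) d))

      r₁<m : r₁ < m
      r₁<m = ≤-trans (m≤n+m (suc r₁) (suc r₂)) (≤-reflexive (trans (solve 2 (λ a b → con 1 :+ b :+ (con 1 :+ a) := con 2 :+ (a :+ b)) refl r₁ r₂) r₁+r₂))

      r₂<m : r₂ < m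
      r₂<m = ≤-trans (m≤n+m (suc r₂) (suc r₁)) (≤-reflexive (trans (solve 2 (λ a b → con 1 :+ a :+ (con 1 :+ b) := con 2 :+ (a :+ b)) refl r₁ r₂) r₁+r₂))

      module G₀ = Progression m 2 1 r₀ (s≤s (m≤m+n r₀ _)) (divides 1 (trans (+-comm (2 * r₀) 1) (sym (*-identityˡ m)))) cancel-2
      module G₁ = Progression m 4 3 r₁ r₁<m m∣r₁ cancel-4
      module G₂ = Progression m 4 5 r₂ r₂<m m∣r₂ cancel-4
      module G = Progression m 1 1 (2 * r₀) ≤-refl (divides 1 (trans (+-comm (1 * (2 * r₀)) 1) (cong suc refl))) (λ x → subst (m ∣_) (*-identityˡ x))

      σ-suc : ∀ Q R → R < m → σ (λ i → [ m ∣? suc i ]) (R + Q * m) ≡ Q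
      σ-suc Q R R<m = begin
        σ (λ i → [ m ∣? suc i ]) (R + Q * m) ≡⟨ σ-cong (R + Q * m) (λ i → cong (λ x → [ m ∣? x ]) (solve 1 (λ i → con 1 :+ i := con 1 :* i :+ con 1) refl i)) ⟩
        σ G.g (R + Q * m) ≡⟨ cong (σ G.g) (+-comm R (Q * m)) ⟩
        σ G.g (Q * m + R) ≡⟨ G.σ-g Q R (<⇒≤ R<m) ⟩
        Q + [ 2 * r₀ <? R ] ≡⟨ cong (Q +_) ([]-no (2 * r₀ <? R) (λ lt → <⇒≱ R<m lt)) ⟩
        Q + 0 ≡⟨ +-identityʳ Q ⟩
        Q ∎
        where open ≡-Reasoning

      -- Here s = τ + tm and 3τ + ε = ρ + dm. Beyond the 2t of the full periods, B odd multiples are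
      -- left. B can exceed d only for d = 0 and B = 1; then 2τ + ε > m/2 pushes ρ past 3m/4, above
      -- both r₁ and r₂, and these residues later supply the missing unit.
      odd-count : ∀ τ ε d ρ t → ε ≤ 1 → τ < m → 3 * τ + ε ≡ ρ + d * m → ρ < m →
        ∃ λ B → σ G₀.g (2 * τ + ε + (2 * t) * m) ≡ 2 * t + B × (B ≤ d ⊎ (B ≤ suc d × r₁ < ρ × r₂ < ρ))
      odd-count τ ε d ρ t ε≤1 τ<m eq ρ<m with ≤-total (2 * τ + ε) m
      odd-count τ ε d ρ t ε≤1 τ<m eq ρ<m | inj₁ τ′≤m =
        [ r₀ <? 2 * τ + ε ] , trans (cong (σ G₀.g) (+-comm (2 * τ + ε) _)) (G₀.σ-g (2 * t) (2 * τ + ε) τ′≤m) , bound d eq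
        where
        bound : ∀ d → 3 * τ + ε ≡ ρ + d * m → [ r₀ <? 2 * τ + ε ] ≤ d ⊎ ([ r₀ <? 2 * τ + ε ] ≤ suc d × r₁ < ρ × r₂ < ρ)
        bound (suc _) _ = inj₁ (≤-trans ([]≤1 (r₀ <? 2 * τ + ε)) (s≤s z≤n))
        bound zero eq₀ with r₀ <? 2 * τ + ε
        ... | no _ = inj₁ z≤n
        ... | yes lt = inj₂ (≤-refl , small r₁ (≤-trans (m≤n+m _ 0) r₁≤) , small r₂ (≤-trans (+-monoʳ-≤ (4 * r₂) (s≤s (s≤s (s≤s z≤n)))) r₂≤))
          where
          small : ∀ r → 4 * r + 3 ≤ 3 * m → r < ρ
          small r r≤ = subst (r <_) (trans eq₀ (+-identityʳ ρ)) (*-cancelˡ-≤ 4 (certify 0 (+-mono-≤ (+-mono-≤ r≤ (*-monoʳ-≤ 6 lt)) (*-monoʳ-≤ 2 ε≤1))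
            (solve 4 (λ r r₀ τ ε → con 4 :* (con 1 :+ r) :+ (con 3 :* (con 1 :+ con 2 :* r₀) :+ con 6 :* (con 2 :* τ :+ ε) :+ con 2) :+ con 0
              := con 4 :* (con 3 :* τ :+ ε) :+ (con 4 :* r :+ con 3 :+ con 6 :* (con 1 :+ r₀) :+ con 2 :* ε)) refl r r₀ τ ε)))
      odd-count τ ε d ρ t ε≤1 τ<m eq ρ<m | inj₂ m≤τ′ with m≤n⇒∃[o]m+o≡n m≤τ′
      ... | τ″ , eq″ = suc [ r₀ <? τ″ ] , trans (cong (σ G₀.g) (trans (cong (_+ 2 * t * m) (sym eq″)) (solve 3 (λ m x y → m :+ x :+ y := m :+ y :+ x) refl m τ″ (2 * t * m))))
          (trans (G₀.σ-g (suc (2 * t)) τ″ τ″≤m) (sym (+-suc (2 * t) _))) , bound d eq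
        where
        τ″≤m : τ″ ≤ m
        τ″≤m = +-cancelˡ-≤ m _ _ (≤-trans (≤-reflexive eq″) (≤-trans (+-monoʳ-≤ (2 * τ) ε≤1) (certify 1 (*-monoʳ-≤ 2 τ<m)
          (solve 2 (λ τ m → con 2 :* τ :+ con 1 :+ con 2 :* m :+ con 1 := m :+ m :+ con 2 :* (con 1 :+ τ)) refl τ m))))
        bound : ∀ d → 3 * τ + ε ≡ ρ + d * m → suc [ r₀ <? τ″ ] ≤ d ⊎ (suc [ r₀ <? τ″ ] ≤ suc d × r₁ < ρ × r₂ < ρ)
        bound zero eq₀ = ⊥-elim (<⇒≱ ρ<m (≤-trans m≤τ′ (≤-trans (+-monoˡ-≤ ε (m≤n+m (2 * τ) τ)) (≤-reflexive (trans eq₀ (+-identityʳ ρ))))))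
        bound (suc (suc d)) _ = inj₁ (s≤s (≤-trans ([]≤1 (r₀ <? τ″)) (s≤s z≤n)))
        bound (suc zero) eq₁ with r₀ <? τ″
        ... | no _ = inj₁ ≤-refl
        -- B = 2 would need 2τ + ε > 3m/2 and hence 3τ + ε > 2m, against d = 1.
        ... | yes lt = ⊥-elim (impossible (certify 0
            (+-mono-≤ (+-mono-≤ (+-mono-≤ (+-mono-≤ (*-monoʳ-≤ 6 lt) (*-monoʳ-≤ 4 ρ<m)) (*-monoʳ-≤ 2 ε≤1)) (*-monoʳ-≤ 6 (≤-reflexive eq″))) (*-monoʳ-≤ 4 (≤-reflexive eq₁)))
            (solve 5 (λ r x ρ τ ε → con 6 :+ con 2 :* r :+ (con 6 :* x :+ con 4 :* (con 1 :+ con 2 :* r) :+ con 2 :* con 1 :+ con 6 :* (con 2 :* τ :+ ε) :+ con 4 :* (ρ :+ con 1 :* (con 1 :+ con 2 :* r))) :+ con 0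
               := con 0 :+ (con 6 :* (con 1 :+ r) :+ con 4 :* (con 1 :+ ρ) :+ con 2 :* ε :+ con 6 :* (con 1 :+ con 2 :* r :+ x) :+ con 4 :* (con 3 :* τ :+ ε))) refl r₀ τ″ ρ τ ε)))
          where
          impossible : 6 + 2 * r₀ ≤ 0 → ⊥
          impossible ()

    -- The left side counts the multiples of m among the factors of (2s + ε)!! s! k! l!, the right
    -- side those among the factors of (k + l)! · `rise⁻ k l` · `rise⁺ l k`. A carry in k + l modulo
    -- m gives the right side two extra units, one for each residue. Without a carry κ + λ′ = ρ < m,
    -- and r₁ + r₂ + 2 = m prevents r₁ < κ and r₂ < λ′ from both holding.
    counting : ∀ s ε k l → ε ≤ 1 → k + l ≡ 3 * s + ε →
      σ (λ i → [ m ∣? suc (2 * i) ]) (2 * s + ε) + σ (λ i → [ m ∣? suc i ]) s + σ (λ i → [ m ∣? suc i ]) k + σ (λ i → [ m ∣? suc i ]) l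
      ≤ σ (λ i → [ m ∣? suc i ]) (k + l) + σ (λ i → [ m ∣? 4 * (k + i) + 3 ]) l + σ (λ i → [ m ∣? 4 * (l + i) + 5 ]) k
    counting s ε k l ε≤1 n≡ with odd-count τ ε d ρ t ε≤1 (m%n<n s m) (m≡m%n+[m/n]*n (3 * τ + ε) m) (m%n<n (3 * τ + ε) m)
      where
      t τ d ρ : ℕ
      t = s / m
      τ = s % m
      d = (3 * τ + ε) / m
      ρ = (3 * τ + ε) % m
    ... | B , B-eq , B≤ = subst₂ _≤_ lhs refl main
      where
      t τ d ρ N K L κ λ′ : ℕ
      t = s / m
      τ = s % m
      d = (3 * τ + ε) / m
      ρ = (3 * τ + ε) % m
      N = 3 * t + d
      K = k / m
      κ = k % m
      L = l / m
      λ′ = l % m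
      s-eq : s ≡ τ + t * m
      s-eq = m≡m%n+[m/n]*n s m
      k-eq : k ≡ κ + K * m
      k-eq = m≡m%n+[m/n]*n k m
      l-eq : l ≡ λ′ + L * m
      l-eq = m≡m%n+[m/n]*n l m
      d-eq : 3 * τ + ε ≡ ρ + d * m
      d-eq = m≡m%n+[m/n]*n (3 * τ + ε) m
      open ≡-Reasoning
      n-eq : k + l ≡ ρ + N * m
      n-eq = begin
        k + l ≡⟨ n≡ ⟩
        3 * s + ε ≡⟨ cong (λ x → 3 * x + ε) s-eq ⟩
        3 * (τ + t * m) + ε ≡⟨ solve 4 (λ τ t m ε → con 3 :* (τ :+ t :* m) :+ ε := con 3 :* τ :+ ε :+ con 3 :* t :* m) refl τ t m ε ⟩
        3 * τ + ε + 3 * t * m ≡⟨ cong (_+ 3 * t * m) d-eq ⟩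
        ρ + d * m + 3 * t * m ≡⟨ solve 4 (λ ρ d m t → ρ :+ d :* m :+ con 3 :* t :* m := ρ :+ (con 3 :* t :+ d) :* m) refl ρ d m t ⟩
        ρ + N * m ∎
      σn : σ (λ i → [ m ∣? suc i ]) (k + l) ≡ N
      σn = trans (cong (σ _) n-eq) (σ-suc N ρ (m%n<n (3 * τ + ε) m))
      σh : σ (λ i → [ m ∣? suc (2 * i) ]) (2 * s + ε) ≡ 2 * t + B
      σh = trans (σ-cong (2 * s + ε) (λ i → cong (λ x → [ m ∣? x ]) (+-comm 1 (2 * i))))
        (trans (cong (σ G₀.g) (trans (cong (λ x → 2 * x + ε) s-eq) (solve 4 (λ τ t m ε → con 2 :* (τ :+ t :* m) :+ ε := con 2 :* τ :+ ε :+ con 2 :* t :* m) refl τ t m ε))) B-eq)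
      σs : σ (λ i → [ m ∣? suc i ]) s ≡ t
      σs = trans (cong (σ _) s-eq) (σ-suc t τ (m%n<n s m))
      σk : σ (λ i → [ m ∣? suc i ]) k ≡ K
      σk = trans (cong (σ _) k-eq) (σ-suc K κ (m%n<n k m))
      σl : σ (λ i → [ m ∣? suc i ]) l ≡ L
      σl = trans (cong (σ _) l-eq) (σ-suc L λ′ (m%n<n l m))
      lhs : 2 * t + B + t + K + L ≡ σ (λ i → [ m ∣? suc (2 * i) ]) (2 * s + ε) + σ (λ i → [ m ∣? suc i ]) s + σ (λ i → [ m ∣? suc i ]) k + σ (λ i → [ m ∣? suc i ]) l
      lhs = sym (cong₂ _+_ (cong₂ _+_ (cong₂ _+_ σh σs) σk) σl)
      X Y : ℕ
      X = σ (λ i → [ m ∣? 4 * (k + i) + 3 ]) l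
      Y = σ (λ i → [ m ∣? 4 * (l + i) + 5 ]) k
      X-eq : N + [ r₁ <? ρ ] ≡ K + [ r₁ <? κ ] + X
      X-eq = begin
        N + [ r₁ <? ρ ] ≡⟨ G₁.σ-g N ρ (<⇒≤ (m%n<n (3 * τ + ε) m)) ⟨
        σ G₁.g (N * m + ρ) ≡⟨ cong (σ G₁.g) (trans (+-comm (N * m) ρ) (sym n-eq)) ⟩
        σ G₁.g (k + l) ≡⟨ σ-split k l G₁.g ⟩
        σ G₁.g k + X ≡⟨ cong (_+ X) (trans (cong (σ G₁.g) (trans k-eq (+-comm κ (K * m)))) (G₁.σ-g K κ (<⇒≤ (m%n<n k m)))) ⟩
        K + [ r₁ <? κ ] + X ∎
      Y-eq : N + [ r₂ <? ρ ] ≡ L + [ r₂ <? λ′ ] + Y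
      Y-eq = begin
        N + [ r₂ <? ρ ] ≡⟨ G₂.σ-g N ρ (<⇒≤ (m%n<n (3 * τ + ε) m)) ⟨
        σ G₂.g (N * m + ρ) ≡⟨ cong (σ G₂.g) (trans (+-comm (N * m) ρ) (trans (sym n-eq) (+-comm k l))) ⟩
        σ G₂.g (l + k) ≡⟨ σ-split l k G₂.g ⟩
        σ G₂.g l + Y ≡⟨ cong (_+ Y) (trans (cong (σ G₂.g) (trans l-eq (+-comm λ′ (L * m)))) (G₂.σ-g L λ′ (<⇒≤ (m%n<n l m)))) ⟩
        L + [ r₂ <? λ′ ] + Y ∎
      carry : (N ≡ K + L × ρ ≡ κ + λ′) ⊎ (N ≡ suc (K + L))
      carry with ≤-total m (κ + λ′)
      ... | inj₂ le with m≤n⇒m<n∨m≡n le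
      ...   | inj₁ lt = inj₁ (divMod-unique m (m%n<n (3 * τ + ε) m) lt (trans (sym n-eq) (trans (cong₂ _+_ k-eq l-eq)
                (solve 5 (λ κ K m λ′ L → κ :+ K :* m :+ (λ′ :+ L :* m) := κ :+ λ′ :+ (K :+ L) :* m) refl κ K m λ′ L))))
      ...   | inj₂ eq = inj₂ (proj₁ (divMod-unique m (m%n<n (3 * τ + ε) m) (s≤s z≤n) (trans (sym n-eq) (trans (cong₂ _+_ k-eq l-eq)
                (trans (solve 5 (λ κ K m λ′ L → κ :+ K :* m :+ (λ′ :+ L :* m) := κ :+ λ′ :+ (K :+ L) :* m) refl κ K m λ′ L) (cong (_+ (K + L) * m) eq))))))
      carry | inj₁ le with m≤n⇒∃[o]m+o≡n le
      ...   | x , eq = inj₂ (proj₁ (divMod-unique m (m%n<n (3 * τ + ε) m) x<m (trans (sym n-eq) (trans (cong₂ _+_ k-eq l-eq)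
                (trans (solve 5 (λ κ K m λ′ L → κ :+ K :* m :+ (λ′ :+ L :* m) := κ :+ λ′ :+ (K :+ L) :* m) refl κ K m λ′ L)
                  (trans (cong (_+ (K + L) * m) (sym eq)) (solve 4 (λ m x K L → m :+ x :+ (K :+ L) :* m := x :+ (con 1 :+ (K :+ L)) :* m) refl m x K L)))))))
        where
        x<m : x < m
        x<m = +-cancelˡ-< m x m (<-≤-trans (≤-<-trans (≤-reflexive eq) (+-mono-< (m%n<n k m) (m%n<n l m))) ≤-refl)
      mono : ∀ r {a b} → a ≤ b → [ r <? a ] ≤ [ r <? b ]
      mono r {a} {b} a≤b with r <? a
      ... | no _ = z≤n
      ... | yes r<a = ≤-reflexive (sym ([]-yes (r <? b) (<-≤-trans r<a a≤b)))
      Alternative : Set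
      Alternative = B ≤ d ⊎ (B ≤ suc d × r₁ < ρ × r₂ < ρ)
      B≤d+ : Alternative → B ≤ d + ([ r₁ <? ρ ] + [ r₂ <? ρ ])
      B≤d+ (inj₁ B≤d) = ≤-trans B≤d (m≤m+n d _)
      B≤d+ (inj₂ (B≤1+d , r₁<ρ , _)) rewrite []-yes (r₁ <? ρ) r₁<ρ = ≤-trans B≤1+d (≤-trans (m≤m+n (suc d) [ r₂ <? ρ ]) (≤-reflexive (sym (+-suc d _))))
      not-both : ρ ≡ κ + λ′ → [ r₁ <? κ ] + [ r₂ <? λ′ ] ≤ 1
      not-both ρ≡ with r₁ <? κ | r₂ <? λ′
      ... | no _ | q = []≤1 q
      ... | yes _ | no _ = ≤-refl
      ... | yes p | yes q = ⊥-elim (<⇒≱ (m%n<n (3 * τ + ε) m) (≤-trans (≤-reflexive (trans (sym r₁+r₂) (solve 2 (λ a b → con 2 :+ (a :+ b) := con 1 :+ a :+ (con 1 :+ b)) refl r₁ r₂))) (≤-trans (+-mono-≤ p q) (≤-reflexive (sym ρ≡)))))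
      no-carry : ρ ≡ κ + λ′ → Alternative → B + ([ r₁ <? κ ] + [ r₂ <? λ′ ]) ≤ d + ([ r₁ <? ρ ] + [ r₂ <? ρ ])
      no-carry ρ≡ (inj₁ B≤d) = +-mono-≤ B≤d (+-mono-≤ (mono r₁ (≤-trans (m≤m+n κ λ′) (≤-reflexive (sym ρ≡)))) (mono r₂ (≤-trans (m≤n+m λ′ κ) (≤-reflexive (sym ρ≡)))))
      no-carry ρ≡ (inj₂ (B≤1+d , r₁<ρ , r₂<ρ)) = ≤-trans (+-mono-≤ B≤1+d (not-both ρ≡))
        (≤-reflexive (trans (sym (+-suc d 1)) (cong (d +_) (sym (cong₂ _+_ ([]-yes (r₁ <? ρ) r₁<ρ) ([]-yes (r₂ <? ρ) r₂<ρ))))))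
      core : (N ≡ K + L × ρ ≡ κ + λ′) ⊎ (N ≡ suc (K + L)) → B + ([ r₁ <? κ ] + [ r₂ <? λ′ ]) + 2 * (K + L) ≤ d + 2 * N + ([ r₁ <? ρ ] + [ r₂ <? ρ ])
      core (inj₂ N≡) = ≤-trans (certify 0 (+-mono-≤ (B≤d+ B≤) (+-mono-≤ ([]≤1 (r₁ <? κ)) ([]≤1 (r₂ <? λ′))))
          (solve 8 (λ B a b K L d x y → B :+ (a :+ b) :+ con 2 :* (K :+ L) :+ (d :+ (x :+ y) :+ (con 1 :+ con 1)) :+ con 0
             := d :+ con 2 :* (con 1 :+ (K :+ L)) :+ (x :+ y) :+ (B :+ (a :+ b))) refl B ([ r₁ <? κ ]) ([ r₂ <? λ′ ]) K L d ([ r₁ <? ρ ]) ([ r₂ <? ρ ])))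
          (≤-reflexive (cong (λ N → d + 2 * N + ([ r₁ <? ρ ] + [ r₂ <? ρ ])) (sym N≡)))
      core (inj₁ (N≡ , ρ≡)) = ≤-trans (+-monoˡ-≤ (2 * (K + L)) (no-carry ρ≡ B≤))
        (≤-reflexive (trans (solve 3 (λ d x y → d :+ x :+ y := d :+ y :+ x) refl d ([ r₁ <? ρ ] + [ r₂ <? ρ ]) (2 * (K + L)))
          (cong (λ N → d + 2 * N + ([ r₁ <? ρ ] + [ r₂ <? ρ ])) (sym N≡))))
      main : 2 * t + B + t + K + L ≤ σ (λ i → [ m ∣? suc i ]) (k + l) + X + Y
      main = certify 0 (+-mono-≤ (core carry) (≤-reflexive (cong₂ _+_ X-eq Y-eq))) (trans
        (solve 12 (λ t B K L N X Y d x y a b →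
           con 2 :* t :+ B :+ t :+ K :+ L :+ (d :+ con 2 :* N :+ (x :+ y) :+ (K :+ a :+ X :+ (L :+ b :+ Y))) :+ con 0
           := con 3 :* t :+ d :+ X :+ Y :+ (B :+ (a :+ b) :+ con 2 :* (K :+ L) :+ (N :+ x :+ (N :+ y)))) refl t B K L N X Y d ([ r₁ <? ρ ]) ([ r₂ <? ρ ]) ([ r₁ <? κ ]) ([ r₂ <? λ′ ]))
        (cong (λ z → z + X + Y + (B + ([ r₁ <? κ ] + [ r₂ <? λ′ ]) + 2 * (K + L) + (N + [ r₁ <? ρ ] + (N + [ r₂ <? ρ ])))) (sym σn)))

-- A common factor of all coefficients of one degree

module CommonFactors where
  open Coefficients
  open PrimeCounting
  open import Data.Nat.Base
  open import Data.Nat.Properties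
  open import Data.Nat.Divisibility
  open import Data.Nat.DivMod using (m≡m%n+[m/n]*n; m%n<n)
  open import Data.Nat.Primality
  open import Data.Nat.Solver using (module +-*-Solver)
  open import Data.Product using (_×_; _,_; ∃)
  open import Data.Sum using (inj₁; inj₂)
  open import Data.Empty using (⊥-elim)
  open import Relation.Nullary using (yes; no)
  open import Relation.Binary.PropositionalEquality hiding ([_])
  open +-*-Solver

  CountingInequality : ℕ → ℕ → ℕ → ℕ → ℕ → Set
  CountingInequality m s ε k l =
    σ (λ i → [ m ∣? suc (2 * i) ]) (2 * s + ε) + σ (λ i → [ m ∣? suc i ]) s + σ (λ i → [ m ∣? suc i ]) k + σ (λ i → [ m ∣? suc i ]) l
    ≤ σ (λ i → [ m ∣? suc i ]) (k + l) + σ (λ i → [ m ∣? 4 * (k + i) + 3 ]) l + σ (λ i → [ m ∣? 4 * (l + i) + 5 ]) k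

  -- For m = 4q + 1 the residues are r₁ = 3q and r₂ = q - 1, for m = 4q + 3 they are r₁ = q and r₂ =
  -- 3q + 1. The multiples 4r₁ + 3 and 4r₂ + 5 are m and 3m in one order or the other.
  counting-odd : ∀ m s ε k l → 1 < m → 2 ∤ m → ε ≤ 1 → k + l ≡ 3 * s + ε → CountingInequality m s ε k l
  counting-odd m s ε k l 1<m 2∤m ε≤1 n≡ = residue (m % 4) (m / 4) (m%n<n m 4) (m≡m%n+[m/n]*n m 4)
    where
    residue : ∀ ρ q → ρ < 4 → m ≡ ρ + q * 4 → CountingInequality m s ε k l
    residue 0 q _ eq = ⊥-elim (2∤m (subst (2 ∣_) (sym eq) (divides (q * 2) (sym (*-assoc q 2 2)))))
    residue 2 q _ eq = ⊥-elim (2∤m (subst (2 ∣_) (sym eq) (divides (1 + q * 2) (cong (2 +_) (sym (*-assoc q 2 2))))))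
    residue (suc (suc (suc (suc _)))) q (s≤s (s≤s (s≤s (s≤s ())))) eq
    residue 1 zero _ eq = ⊥-elim (<⇒≢ 1<m (sym eq))
    residue 1 (suc q) _ eq = subst (λ m → CountingInequality m s ε k l) (sym (trans eq m-eq))
      (Residues.counting (2 * suc q) (3 * suc q) q
        (solve 1 (λ q → con 2 :+ (con 3 :* (con 1 :+ q) :+ q) := con 1 :+ con 2 :* (con 2 :* (con 1 :+ q))) refl q)
        (divides 3 (solve 1 (λ q → con 4 :* (con 3 :* (con 1 :+ q)) :+ con 3 := con 3 :* (con 1 :+ con 2 :* (con 2 :* (con 1 :+ q)))) refl q))
        (divides 1 (solve 1 (λ q → con 4 :* q :+ con 5 := con 1 :* (con 1 :+ con 2 :* (con 2 :* (con 1 :+ q)))) refl q))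
        (≤-reflexive (solve 1 (λ q → con 4 :* (con 3 :* (con 1 :+ q)) :+ con 3 := con 3 :* (con 1 :+ con 2 :* (con 2 :* (con 1 :+ q)))) refl q))
        (≤-trans (m≤m+n (4 * q + 5) (8 * q + 10)) (≤-reflexive (solve 1 (λ q → con 4 :* q :+ con 5 :+ (con 8 :* q :+ con 10) := con 3 :* (con 1 :+ con 2 :* (con 2 :* (con 1 :+ q)))) refl q)))
        s ε k l ε≤1 n≡)
      where
      m-eq : 1 + suc q * 4 ≡ suc (2 * (2 * suc q))
      m-eq = solve 1 (λ q → con 1 :+ (con 1 :+ q) :* con 4 := con 1 :+ con 2 :* (con 2 :* (con 1 :+ q))) refl q
    residue 3 q _ eq = subst (λ m → CountingInequality m s ε k l) (sym (trans eq m-eq))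
      (Residues.counting (1 + 2 * q) q (1 + 3 * q)
        (solve 1 (λ q → con 2 :+ (q :+ (con 1 :+ con 3 :* q)) := con 1 :+ con 2 :* (con 1 :+ con 2 :* q)) refl q)
        (divides 1 (solve 1 (λ q → con 4 :* q :+ con 3 := con 1 :* (con 1 :+ con 2 :* (con 1 :+ con 2 :* q))) refl q))
        (divides 3 (solve 1 (λ q → con 4 :* (con 1 :+ con 3 :* q) :+ con 5 := con 3 :* (con 1 :+ con 2 :* (con 1 :+ con 2 :* q))) refl q))
        (≤-trans (m≤m+n (4 * q + 3) (8 * q + 6)) (≤-reflexive (solve 1 (λ q → con 4 :* q :+ con 3 :+ (con 8 :* q :+ con 6) := con 3 :* (con 1 :+ con 2 :* (con 1 :+ con 2 :* q))) refl q)))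
        (≤-reflexive (solve 1 (λ q → con 4 :* (con 1 :+ con 3 :* q) :+ con 5 := con 3 :* (con 1 :+ con 2 :* (con 1 :+ con 2 :* q))) refl q))
        s ε k l ε≤1 n≡)
      where
      m-eq : 3 + q * 4 ≡ suc (2 * (1 + 2 * q))
      m-eq = solve 1 (λ q → con 3 :+ q :* con 4 := con 1 :+ con 2 :* (con 1 :+ con 2 :* q)) refl q

  Π-! : ∀ n → Π suc n ≡ n !
  Π-! zero = refl
  Π-! (suc n) = trans (*-comm (Π suc n) (suc n)) (cong (suc n *_) (Π-! n))

  Π-!! : ∀ n → Π (λ i → suc (2 * i)) n ≡ n !!
  Π-!! zero = refl
  Π-!! (suc n) = trans (*-comm (Π (λ i → suc (2 * i)) n) (suc (2 * n))) (cong (suc (2 * n) *_) (Π-!! n))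

  Π-rise⁻ : ∀ k l → Π (λ i → 4 * (k + i) + 3) l ≡ rise⁻ k l
  Π-rise⁻ k zero = refl
  Π-rise⁻ k (suc l) = trans (*-comm (Π (λ i → 4 * (k + i) + 3) l) _) (cong ((4 * (k + l) + 3) *_) (Π-rise⁻ k l))

  Π-rise⁺ : ∀ l k → Π (λ i → 4 * (l + i) + 5) k ≡ rise⁺ l k
  Π-rise⁺ l zero = refl
  Π-rise⁺ l (suc k) = trans (*-comm (Π (λ i → 4 * (l + i) + 5) k) _) (cong ((4 * (l + k) + 5) *_) (Π-rise⁺ l k))

  module _ (p : ℕ) (prime : Prime p) (p≢2 : p ≢ 2) (s ε k l : ℕ) (ε≤1 : ε ≤ 1) (n≡ : k + l ≡ 3 * s + ε) where
    open Valuation p prime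

    private
      h₀ H : ℕ
      h₀ = 2 * s + ε
      -- Large enough for the exact valuations of (2s + ε)!!, s!, k! and l!. The factors 4i + 3 and
      -- 4i + 5 may exceed it, but for them a lower bound suffices.
      H = 2 * h₀ + (s + (k + l))

      ν : (ℕ → ℕ) → ℕ → ℕ
      ν f n = σ (λ i → count H (f i)) n

      2∤p^ : ∀ e → 2 ∤ p ^ e
      2∤p^ zero d = 2≢1 (∣1⇒≡1 d)
        where
        2≢1 : 2 ≢ 1
        2≢1 ()
      2∤p^ (suc e) d with euclidsLemma p (p ^ e) prime[2] d
      ... | inj₂ d′ = 2∤p^ e d′
      ... | inj₁ 2∣p with prime⇒irreducible prime 2∣p
      ...   | inj₂ 2≡p = p≢2 (sym 2≡p)

      1<p^ : ∀ e → 1 < p ^ suc e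
      1<p^ e = ≤-trans (nonTrivial⇒n>1 p {{prime⇒nonTrivial prime}}) (m≤m*n p (p ^ e) {{m^n≢0 p e {{prime⇒nonZero prime}}}})

      total : ν (λ i → suc (2 * i)) h₀ + ν suc s + ν suc k + ν suc l
        ≤ ν suc (k + l) + ν (λ i → 4 * (k + i) + 3) l + ν (λ i → 4 * (l + i) + 5) k
      total = subst₂ _≤_
        (trans (σ-+ H _ _) (cong₂ _+_ (trans (σ-+ H _ _) (cong₂ _+_ (trans (σ-+ H _ _) (cong₂ _+_ (swap (λ i → suc (2 * i)) h₀) (swap suc s))) (swap suc k))) (swap suc l)))
        (trans (σ-+ H _ _) (cong₂ _+_ (trans (σ-+ H _ _) (cong₂ _+_ (swap suc (k + l)) (swap (λ i → 4 * (k + i) + 3) l))) (swap (λ i → 4 * (l + i) + 5) k)))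
        (σ-mono H (λ e → counting-odd (p ^ suc e) s ε k l (1<p^ e) (2∤p^ (suc e)) ε≤1 n≡))
        where
        swap : ∀ f n → σ (λ e → σ (λ i → [ p ^ suc e ∣? f i ]) n) H ≡ ν f n
        swap f n = sym (σ-swap n H (λ i e → [ p ^ suc e ∣? f i ]))

      factorial-exact : ∀ n → n ≤ H → Exactly (n !) (ν suc n)
      factorial-exact n n≤H = subst (λ a → Exactly a (ν suc n)) (Π-! n) (Π-exact H n suc (λ i i<n → _ , ≤-trans i<n n≤H))

      !!-exact : Exactly (h₀ !!) (ν (λ i → suc (2 * i)) h₀)
      !!-exact = subst (λ a → Exactly a (ν (λ i → suc (2 * i)) h₀)) (Π-!! h₀)
        (Π-exact H h₀ (λ i → suc (2 * i)) (λ i i<h → _ , ≤-trans (≤-trans (n≤1+n _) (≤-trans (≤-reflexive (sym (*-suc 2 i))) (*-monoʳ-≤ 2 i<h))) (m≤m+n (2 * h₀) _)))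

      J-exact : Exactly (h₀ !! * s !) (ν (λ i → suc (2 * i)) h₀ + ν suc s)
      J-exact = Exactly-* {v = ν (λ i → suc (2 * i)) h₀} {w = ν suc s} !!-exact
        (factorial-exact s (≤-trans (m≤m+n s _) (m≤n+m _ (2 * h₀))))

      denominator-exact : Exactly (k ! * l !) (ν suc k + ν suc l)
      denominator-exact = Exactly-* {v = ν suc k} {w = ν suc l}
        (factorial-exact k (≤-trans (m≤m+n k l) (≤-trans (m≤n+m _ s) (m≤n+m _ (2 * h₀)))))
        (factorial-exact l (≤-trans (m≤n+m l k) (≤-trans (m≤n+m _ s) (m≤n+m _ (2 * h₀)))))

      numerator-∣ : p ^ (ν suc (k + l) + ν (λ i → 4 * (k + i) + 3) l + ν (λ i → 4 * (l + i) + 5) k) ∣ coef k l * (k ! * l !)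
      numerator-∣ = subst₂ _∣_
        (trans (cong (_* p ^ ν (λ i → 4 * (l + i) + 5) k) (sym (^-distribˡ-+-* p (ν suc (k + l)) _))) (sym (^-distribˡ-+-* p (ν suc (k + l) + ν (λ i → 4 * (k + i) + 3) l) _)))
        (trans (*-assoc ((k + l) !) _ _) (sym (coef-! k l)))
        (*-pres-∣ (*-pres-∣ (subst (p ^ ν suc (k + l) ∣_) (Π-! (k + l)) (Π-∣ H (k + l) suc))
          (subst (p ^ ν (λ i → 4 * (k + i) + 3) l ∣_) (Π-rise⁻ k l) (Π-∣ H l _))) (subst (p ^ ν (λ i → 4 * (l + i) + 5) k ∣_) (Π-rise⁺ l k) (Π-∣ H k _)))

    -- In `coef-!` the right side contains at least the power of p found in (2s + ε)!! s! k! l!, by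
    -- summing `counting-odd` over the powers of p. The share of k! l! is known exactly and cancels.
    odd-prime-power-∣ : ∀ e → p ^ e ∣ h₀ !! * s ! → p ^ e ∣ coef k l
    odd-prime-power-∣ e d = ∣-trans (^-∣ {e} {ν (λ i → suc (2 * i)) h₀ + ν suc s} (Exactly-max {v = ν (λ i → suc (2 * i)) h₀ + ν suc s} e J-exact d)) J∣
      where
      ^-∣ : ∀ {a b} → a ≤ b → p ^ a ∣ p ^ b
      ^-∣ {a} a≤b with m≤n⇒∃[o]m+o≡n a≤b
      ... | c , refl = subst (p ^ a ∣_) (sym (^-distribˡ-+-* p a c)) (m∣m*n (p ^ c))
      J∣ : p ^ (ν (λ i → suc (2 * i)) h₀ + ν suc s) ∣ coef k l
      J∣ with denominator-exact
      ... | u , eq , p∤u = p^∣-cancel (ν (λ i → suc (2 * i)) h₀ + ν suc s) u (coef k l) p∤u (*-cancelˡ-∣ (p ^ w) {{m^n≢0 p w {{prime⇒nonZero prime}}}}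
          (subst₂ _∣_ (^-distribˡ-+-* p w (ν (λ i → suc (2 * i)) h₀ + ν suc s))
            (trans (cong (coef k l *_) eq) (solve 3 (λ c P u → c :* (P :* u) := P :* (u :* c)) refl (coef k l) (p ^ w) u))
            (∣-trans (^-∣ (≤-trans (≤-reflexive (solve 4 (λ a b c d → c :+ d :+ (a :+ b) := a :+ b :+ c :+ d) refl (ν (λ i → suc (2 * i)) h₀) (ν suc s) (ν suc k) (ν suc l))) total)) numerator-∣)))
        where
        w : ℕ
        w = ν suc k + ν suc l

  odd-* : ∀ a b → suc (2 * a) * suc (2 * b) ≡ suc (2 * (a + b + 2 * a * b))
  odd-* = solve 2 (λ a b → (con 1 :+ con 2 :* a) :* (con 1 :+ con 2 :* b) := con 1 :+ con 2 :* (a :+ b :+ con 2 :* a :* b)) refl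

  !!-odd : ∀ n → ∃ λ x → n !! ≡ suc (2 * x)
  !!-odd zero = 0 , refl
  !!-odd (suc n) with !!-odd n
  ... | x , eq = n + x + 2 * n * x , trans (cong (suc (2 * n) *_) eq) (odd-* n x)

  double-! : ∀ m → (2 * m) ! ≡ 2 ^ m * m ! * m !!
  double-! zero = refl
  double-! (suc m) = begin
    (2 * suc m) ! ≡⟨ cong _! (*-suc 2 m) ⟩
    suc (suc (2 * m)) * (suc (2 * m) * (2 * m) !) ≡⟨ cong (λ x → suc (suc (2 * m)) * (suc (2 * m) * x)) (double-! m) ⟩
    suc (suc (2 * m)) * (suc (2 * m) * (2 ^ m * m ! * m !!))
      ≡⟨ solve 4 (λ m p f d → (con 2 :+ con 2 :* m) :* ((con 1 :+ con 2 :* m) :* (p :* f :* d)) := con 2 :* p :* ((con 1 :+ m) :* f) :* ((con 1 :+ con 2 :* m) :* d)) refl m (2 ^ m) (m !) (m !!) ⟩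
    2 ^ suc m * suc m ! * suc m !! ∎
    where open ≡-Reasoning

  -- (2m)! = 2ᵐ m! m!! with m!! odd, so halving s adds m to the exponent v of m!, and m + v ≤ 2m.
  !-2-part : ∀ s → ∃ λ v → ∃ λ x → s ! ≡ 2 ^ v * suc (2 * x) × v ≤ s
  !-2-part s = go s s ≤-refl
    where
    go : ∀ N s → s ≤ N → ∃ λ v → ∃ λ x → s ! ≡ 2 ^ v * suc (2 * x) × v ≤ s
    go N zero _ = 0 , 0 , refl , z≤n
    go (suc N) s@(suc _) s≤ = half (s % 2) (s / 2) (m%n<n s 2) (m≡m%n+[m/n]*n s 2)
      where
      even : ∀ m → m ≤ N → ∃ λ v → ∃ λ x → (2 * m) ! ≡ 2 ^ v * suc (2 * x) × v ≤ 2 * m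
      even m m≤N with go N m m≤N | !!-odd m
      ... | v , x , eq , v≤m | y , eq′ = m + v , x + y + 2 * x * y , (begin
        (2 * m) ! ≡⟨ double-! m ⟩
        2 ^ m * m ! * m !! ≡⟨ cong₂ (λ a b → 2 ^ m * a * b) eq eq′ ⟩
        2 ^ m * (2 ^ v * suc (2 * x)) * suc (2 * y) ≡⟨ solve 4 (λ a b c d → a :* (b :* c) :* d := a :* b :* (c :* d)) refl (2 ^ m) (2 ^ v) (suc (2 * x)) (suc (2 * y)) ⟩
        2 ^ m * 2 ^ v * (suc (2 * x) * suc (2 * y)) ≡⟨ cong₂ _*_ (sym (^-distribˡ-+-* 2 m v)) (odd-* x y) ⟩
        2 ^ (m + v) * suc (2 * (x + y + 2 * x * y)) ∎) , +-monoʳ-≤ m (≤-trans v≤m (≤-reflexive (sym (+-identityʳ m))))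
        where open ≡-Reasoning
      half : ∀ ρ q → ρ < 2 → s ≡ ρ + q * 2 → ∃ λ v → ∃ λ x → s ! ≡ 2 ^ v * suc (2 * x) × v ≤ s
      half 0 q _ eq with even q (≤-pred (<-≤-trans (below q eq) s≤))
        where
        below : ∀ q → s ≡ q * 2 → q < s
        below (suc q) e = subst (suc q <_) (sym e) (s≤s (≤-trans (m≤m+n (suc q) q) (≤-reflexive (solve 1 (λ q → con 1 :+ q :+ q := con 1 :+ q :* con 2) refl q))))
      ... | v , x , e , v≤ = v , x , trans (cong _! (trans eq (*-comm q 2))) e , ≤-trans v≤ (≤-reflexive (sym (trans eq (*-comm q 2))))
      half 1 q _ eq with even q (≤-pred (≤-trans (s≤s (≤-trans (m≤m*n q 2) ≤-refl)) (≤-trans (≤-reflexive (sym eq)) s≤)))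
      ... | v , x , e , v≤ = v , q + x + 2 * q * x , (begin
        s ! ≡⟨ cong _! (trans eq (cong suc (*-comm q 2))) ⟩
        suc (2 * q) * (2 * q) ! ≡⟨ cong (suc (2 * q) *_) e ⟩
        suc (2 * q) * (2 ^ v * suc (2 * x)) ≡⟨ solve 3 (λ a b c → a :* (b :* c) := b :* (a :* c)) refl (suc (2 * q)) (2 ^ v) (suc (2 * x)) ⟩
        2 ^ v * (suc (2 * q) * suc (2 * x)) ≡⟨ cong (2 ^ v *_) (odd-* q x) ⟩
        2 ^ v * suc (2 * (q + x + 2 * q * x)) ∎) , ≤-trans v≤ (≤-trans (n≤1+n _) (≤-reflexive (sym (trans eq (cong suc (*-comm q 2))))))
        where open ≡-Reasoning
      half (suc (suc _)) q (s≤s (s≤s ())) eq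

  -- Only the odd part is claimed as a divisor, since `Z-divisible` takes odd factors. The bound v ≤
  -- s limits the loss to 2 to the power s.
  coef-content : ∀ s ε → ε ≤ 1 → ∃ λ v → ∃ λ x → (2 * s + ε) !! * s ! ≡ 2 ^ v * suc (2 * x) × v ≤ s
    × (∀ k l → k + l ≡ 3 * s + ε → suc (2 * x) ∣ coef k l)
  coef-content s ε ε≤1 with !-2-part s | !!-odd (2 * s + ε)
  ... | v , x , eq , v≤s | y , eq′ = v , y + x + 2 * y * x , J-eq , v≤s , λ k l n≡ → ∣-by-prime-powers (suc (2 * (y + x + 2 * y * x))) (coef k l) (power k l n≡)
    where
    J-eq : (2 * s + ε) !! * s ! ≡ 2 ^ v * suc (2 * (y + x + 2 * y * x))
    J-eq = trans (cong₂ _*_ eq′ eq) (trans (solve 3 (λ a b c → a :* (b :* c) := b :* (a :* c)) refl (suc (2 * y)) (2 ^ v) (suc (2 * x))) (cong (2 ^ v *_) (odd-* y x)))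
    power : ∀ k l → k + l ≡ 3 * s + ε → ∀ p e → Prime p → p ^ e ∣ suc (2 * (y + x + 2 * y * x)) → p ^ e ∣ coef k l
    power k l n≡ p zero pr d = 1∣ coef k l
    power k l n≡ p (suc e) pr d with p ≟ 2
    ... | yes refl = ⊥-elim (2∤odd (y + x + 2 * y * x) (∣-trans (m∣m*n (2 ^ e)) d))
      where
      2∤odd : ∀ a → 2 ∤ suc (2 * a)
      2∤odd a d with ∣1⇒≡1 (∣m+n∣m⇒∣n (subst (2 ∣_) (+-comm 1 (2 * a)) d) (m∣m*n a))
      ... | ()
    ... | no p≢2 = odd-prime-power-∣ p pr p≢2 s ε k l ε≤1 n≡ (suc e) (subst (p ^ suc e ∣_) (sym J-eq) (∣n⇒∣m*n (2 ^ v) d))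

-- Size of the common factor

module Density where
  open Numerals
  open Coefficients
  open Estimates using (K-≤; K-nonZero; certify)
  open import Data.Nat.Base
  open import Data.Nat.Properties
  open import Relation.Binary.PropositionalEquality hiding (J)
  open KSolver
  open ≤-Reasoning

  -- The number whose odd part divides all coefficients of degree 3s: `coef-content` with ε = 0.
  J : ℕ → ℕ
  J s = (2 * s) !! * s !

  -- (6s+1)(6s+3)(6s+5) / ((4s+1)(4s+3)(s+1)) ≤ 27/2
  density : ∀ j → K 4 * (K 2 ^ (3 + j) * (3 * (3 + j)) !!) ≤ K 27 ^ (3 + j) * J (3 + j)
  -- s = 3 is the first value for which the factor 4 fits. Here 34459425 = 9 !! and 62370 = 6 !! ·
  -- 3!.
  density zero = begin
    K 4 * (K 2 ^ 3 * 34459425) ≡⟨ cong (λ x → K 4 * (K 2 ^ 3 * x)) (sym (K≡ 34459425)) ⟩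
    K 4 * (K 2 ^ 3 * K 34459425) ≡⟨ solve 0 (con 4 :* (con 2 :^ 3 :* con 34459425) := con (4 * 2 ^ 3 * 34459425) :* con 1) refl ⟩
    K (4 * 2 ^ 3 * 34459425) * K 1 ≤⟨ *-monoˡ-≤ (K 1) (K-≤ (≤ᵇ⇒≤ (4 * 2 ^ 3 * 34459425) (27 ^ 3 * 62370) _)) ⟩
    K (27 ^ 3 * 62370) * K 1 ≡⟨ solve 0 (con (27 ^ 3 * 62370) :* con 1 := con 27 :^ 3 :* con 62370) refl ⟩
    K 27 ^ 3 * K 62370 ≡⟨ cong (K 27 ^ 3 *_) (K≡ 62370) ⟩
    K 27 ^ 3 * 62370 ∎
  density (suc j) = begin
    K 4 * (K 2 * p * (3 * suc s) !!) ≡⟨ cong (λ m → K 4 * (K 2 * p * m !!)) (*-suc 3 s) ⟩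
    K 4 * (K 2 * p * (suc (2 * (2 + 3 * s)) * (suc (2 * (1 + 3 * s)) * (suc (2 * (3 * s)) * D))))
      ≡⟨ cong (λ a → K 4 * (K 2 * p * (a * D₃))) (n₁) ⟩
    K 4 * (K 2 * p * ((K 6 * s + K 5) * (suc (2 * (1 + 3 * s)) * (suc (2 * (3 * s)) * D)))) ≡⟨ cong₂ (λ a b → K 4 * (K 2 * p * ((K 6 * s + K 5) * (a * (b * D))))) n₂ n₃ ⟩
    K 4 * (K 2 * p * ((K 6 * s + K 5) * ((K 6 * s + K 3) * ((K 6 * s + K 1) * D))))
      ≡⟨ solve 3 (λ s p D → con 4 :* (con 2 :* p :* ((con 6 :* s :+ con 5) :* ((con 6 :* s :+ con 3) :* ((con 6 :* s :+ con 1) :* D))))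
           := con 2 :* ((con 6 :* s :+ con 5) :* ((con 6 :* s :+ con 3) :* (con 6 :* s :+ con 1))) :* (con 4 :* (p :* D))) refl s p D ⟩
    K 2 * ((K 6 * s + K 5) * ((K 6 * s + K 3) * (K 6 * s + K 1))) * (K 4 * (p * D)) ≤⟨ *-mono-≤ step (density j) ⟩
    K 27 * ((K 4 * s + K 3) * (K 4 * s + K 1) * (s + K 1)) * (q * ((2 * s) !! * s !))
      ≡⟨ solve 4 (λ s q d f → con 27 :* ((con 4 :* s :+ con 3) :* (con 4 :* s :+ con 1) :* (s :+ con 1)) :* (q :* (d :* f))
           := con 27 :* q :* ((con 4 :* s :+ con 3) :* ((con 4 :* s :+ con 1) :* d) :* ((s :+ con 1) :* f))) refl s q ((2 * s) !!) (s !) ⟩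
    K 27 * q * ((K 4 * s + K 3) * ((K 4 * s + K 1) * (2 * s) !!) * ((s + K 1) * s !))
      ≡⟨ cong₂ (λ a f → K 27 * q * (a * (f * s !))) (cong₂ (λ a b → a * (b * (2 * s) !!)) (sym m₁) (sym m₂)) (trans (cong (s +_) (K≡ 1)) (+-comm s 1)) ⟩
    K 27 * q * (suc (2 * (1 + 2 * s)) * (suc (2 * (2 * s)) * (2 * s) !!) * (suc s * s !)) ≡⟨ cong (λ m → K 27 * q * (m !! * (suc s * s !))) (sym (*-suc 2 s)) ⟩
    K 27 ^ (4 + j) * J (4 + j) ∎
    where
    s p q D D₃ : ℕ
    s = 3 + j
    p = K 2 ^ s
    q = K 27 ^ s
    D = (3 * s) !!
    D₃ = suc (2 * (1 + 3 * s)) * (suc (2 * (3 * s)) * D)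
    open import Data.Nat.Solver using (module +-*-Solver)
    module S = +-*-Solver
    n₁ : suc (2 * (2 + 3 * s)) ≡ K 6 * s + K 5
    n₁ = trans (S.solve 1 (λ s → S.con 1 S.:+ S.con 2 S.:* (S.con 2 S.:+ S.con 3 S.:* s) S.:= S.con 6 S.:* s S.:+ S.con 5) refl s) (sym (cong₂ (λ a b → a * s + b) (K≡ 6) (K≡ 5)))
    n₂ : suc (2 * (1 + 3 * s)) ≡ K 6 * s + K 3
    n₂ = trans (S.solve 1 (λ s → S.con 1 S.:+ S.con 2 S.:* (S.con 1 S.:+ S.con 3 S.:* s) S.:= S.con 6 S.:* s S.:+ S.con 3) refl s) (sym (cong₂ (λ a b → a * s + b) (K≡ 6) (K≡ 3)))
    n₃ : suc (2 * (3 * s)) ≡ K 6 * s + K 1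
    n₃ = trans (S.solve 1 (λ s → S.con 1 S.:+ S.con 2 S.:* (S.con 3 S.:* s) S.:= S.con 6 S.:* s S.:+ S.con 1) refl s) (sym (cong₂ (λ a b → a * s + b) (K≡ 6) (K≡ 1)))
    m₁ : suc (2 * (1 + 2 * s)) ≡ K 4 * s + K 3
    m₁ = trans (S.solve 1 (λ s → S.con 1 S.:+ S.con 2 S.:* (S.con 1 S.:+ S.con 2 S.:* s) S.:= S.con 4 S.:* s S.:+ S.con 3) refl s) (sym (cong₂ (λ a b → a * s + b) (K≡ 4) (K≡ 3)))
    m₂ : suc (2 * (2 * s)) ≡ K 4 * s + K 1
    m₂ = trans (S.solve 1 (λ s → S.con 1 S.:+ S.con 2 S.:* (S.con 2 S.:* s) S.:= S.con 4 S.:* s S.:+ S.con 1) refl s) (sym (cong₂ (λ a b → a * s + b) (K≡ 4) (K≡ 1)))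
    step : K 2 * ((K 6 * s + K 5) * ((K 6 * s + K 3) * (K 6 * s + K 1))) ≤ K 27 * ((K 4 * s + K 3) * (K 4 * s + K 1) * (s + K 1))
    step = certify (K 216 * (s * s) + K 237 * s + K 51) (≤-refl {K 0})
      (solve 1 (λ s → con 2 :* ((con 6 :* s :+ con 5) :* ((con 6 :* s :+ con 3) :* (con 6 :* s :+ con 1))) :+ con 0 :+ (con 216 :* (s :* s) :+ con 237 :* s :+ con 51)
         := con 27 :* ((con 4 :* s :+ con 3) :* (con 4 :* s :+ con 1) :* (s :+ con 1)) :+ con 0) refl s)

-- Covering every size of y by pairs of consecutive indices

module Windows where
  open Numerals
  open Coefficients using (*-nonZero; ^-distrib-*)
  open Estimates using (K-≤; K-nonZero; n<4^n)
  open import Data.Nat.Base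
  open import Data.Nat.Properties
  open import Data.Empty using (⊥)
  open import Relation.Nullary using (yes; no)
  open import Relation.Binary.PropositionalEquality
  open KSolver
  open ≤-Reasoning

  K-^ : ∀ m n → K (m ^ n) ≡ K m ^ n
  K-^ m zero = K≡ 1
  K-^ m (suc n) = trans (K-* m (m ^ n)) (cong (K m *_) (K-^ m n))

  ^-mono : ∀ {a b} n → a ≤ b → a ^ n ≤ b ^ n
  ^-mono n = ^-monoˡ-≤ n

  cube-mono : ∀ {a b} → a ≤ b → a * a * a ≤ b * b * b
  cube-mono le = *-mono-≤ (*-mono-≤ le le) le

  -- `V n α β` stands for: if Y_{n+2} ≠ 0, then α ((n + 2)!!)² ≤ β N(Y_{n+2}). Of the two
  -- inequalities in `vanish` the first makes Z negligible and the second the perturbation. Each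
  -- window applies `vanish` to two consecutive indices, which `nondegenerate` forbids.
  module _ (T Y : ℕ) (T-large : K 10000 ≤ T) {{_ : NonZero Y}}
    (V : ℕ → ℕ → ℕ → Set) (Zero : ℕ → Set)
    (vanish : ∀ {n α β} → V n α β →
      K 4 * β * (K 446 * K 17 ^ n) * Y < α * T ^ (2 + n) →
      K 64000 * β * (K 21 * T) ^ (1 + n) ≤ K 975 * α * K 20 ^ (1 + n) * (T * T * T * (Y * Y * Y)) →
      Zero (2 + n))
    (nondegenerate : ∀ n → Zero n → Zero (suc n) → ⊥)
    (v₂ : V 0 (K 1) (K 1)) (v₃ : V 1 (K 1) (K 25)) (v₅ : V 3 (K 1) (K 9)) (v₆ : V 4 (K 1) (K 1089))
    (v₀ : ∀ j → V (7 + 3 * j) (K 16) (K 729 ^ (3 + j))) (v₁ : ∀ j → V (8 + 3 * j) (K 16) (K 9 * K 729 ^ (3 + j)))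
    where

    private
      T^-large : ∀ i → K (10000 ^ i) ≤ T ^ i
      T^-large i = ≤-trans (≤-reflexive (K-^ 10000 i)) (^-mono i T-large)

      instance
        T≢0 : NonZero T
        T≢0 = >-nonZero (≤-trans (subst (_≤ K 10000) (K≡ 1) (K-≤ (≤ᵇ⇒≤ _ _ _))) T-large)

      1≤Y³ : 1 ≤ Y * Y * Y
      1≤Y³ = *-mono-≤ (*-mono-≤ (>-nonZero⁻¹ Y) (>-nonZero⁻¹ Y)) (>-nonZero⁻¹ Y)

      -- c T^i ≤ d T^(i+j) as soon as c ≤ d 10000^j.
      absorb : ∀ c d j {x} → c ≤ d * 10000 ^ j → K c * x ≤ K d * (T ^ j * x)
      absorb c d j {x} le = begin
        K c * x ≤⟨ *-monoˡ-≤ x (K-≤ le) ⟩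
        K (d * 10000 ^ j) * x ≡⟨ cong (_* x) (K-* d (10000 ^ j)) ⟩
        K d * K (10000 ^ j) * x ≤⟨ *-monoˡ-≤ x (*-monoʳ-≤ (K d) (T^-large j)) ⟩
        K d * T ^ j * x ≡⟨ *-assoc (K d) (T ^ j) x ⟩
        K d * (T ^ j * x) ∎

    -- 1784 = 4 · 446 is the condition for index 2. Index 3 costs another 425 = 25 · 17 and gains T
    -- ≥ 10000. The lower conditions follow from Y ≥ 1.
    initial : K 1784 * Y < T ^ 2 → ⊥
    initial lt = nondegenerate 2 (vanish v₂ U₂ L₂) (vanish v₃ U₃ L₃)
      where
      U₂ : K 4 * K 1 * (K 446 * K 17 ^ 0) * Y < K 1 * T ^ 2
      U₂ = subst₂ _<_ (trans (solve 1 (λ y → con 1784 :* y := con 4 :* con 1 :* (con 446 :* con 1) :* y) refl Y) (cong (λ o → K 4 * K 1 * (K 446 * o) * Y) (K≡ 1)))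
        (trans (sym (*-identityˡ _)) (cong (_* T ^ 2) (sym (K≡ 1)))) lt
      U₃ : K 4 * K 25 * (K 446 * K 17 ^ 1) * Y < K 1 * T ^ 3
      U₃ = begin-strict
        K 4 * K 25 * (K 446 * K 17 ^ 1) * Y ≡⟨ solve 1 (λ y → con 4 :* con 25 :* (con 446 :* con 17 :^ 1) :* y := con 425 :* (con 1784 :* y)) refl Y ⟩
        K 425 * (K 1784 * Y) <⟨ *-monoʳ-< (K 425) lt ⟩
        K 425 * T ^ 2 ≤⟨ absorb 425 1 1 (≤ᵇ⇒≤ _ _ _) ⟩
        K 1 * (T ^ 1 * T ^ 2) ≡⟨ cong (K 1 *_) (sym (^-distribˡ-+-* T 1 2)) ⟩
        K 1 * T ^ 3 ∎
      L₂ : K 64000 * K 1 * (K 21 * T) ^ 1 ≤ K 975 * K 1 * K 20 ^ 1 * (T * T * T * (Y * Y * Y))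
      L₂ = begin
        K 64000 * K 1 * (K 21 * T) ^ 1 ≡⟨ solve 1 (λ T → con 64000 :* con 1 :* (con 21 :* T) :^ 1 := con 1344000 :* T) refl T ⟩
        K 1344000 * T ≤⟨ absorb 1344000 19500 2 (≤ᵇ⇒≤ _ _ _) ⟩
        K 19500 * (T ^ 2 * T) ≡⟨ *-identityʳ _ ⟨
        K 19500 * (T ^ 2 * T) * 1 ≤⟨ *-monoʳ-≤ (K 19500 * (T ^ 2 * T)) 1≤Y³ ⟩
        K 19500 * (T ^ 2 * T) * (Y * Y * Y) ≡⟨ solve 2 (λ T Y → con 19500 :* (T :^ 2 :* T) :* (Y :* Y :* Y) := con 975 :* con 1 :* con 20 :^ 1 :* (T :* T :* T :* (Y :* Y :* Y))) refl T Y ⟩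
        K 975 * K 1 * K 20 ^ 1 * (T * T * T * (Y * Y * Y)) ∎
      L₃ : K 64000 * K 25 * (K 21 * T) ^ 2 ≤ K 975 * K 1 * K 20 ^ 2 * (T * T * T * (Y * Y * Y))
      L₃ = begin
        K 64000 * K 25 * (K 21 * T) ^ 2 ≡⟨ solve 1 (λ T → con 64000 :* con 25 :* (con 21 :* T) :^ 2 := con 705600000 :* (T :* T)) refl T ⟩
        K 705600000 * (T * T) ≤⟨ absorb 705600000 390000 1 (≤ᵇ⇒≤ _ _ _) ⟩
        K 390000 * (T ^ 1 * (T * T)) ≡⟨ *-identityʳ _ ⟨
        K 390000 * (T ^ 1 * (T * T)) * 1 ≤⟨ *-monoʳ-≤ (K 390000 * (T ^ 1 * (T * T))) 1≤Y³ ⟩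
        K 390000 * (T ^ 1 * (T * T)) * (Y * Y * Y) ≡⟨ solve 2 (λ T Y → con 390000 :* (T :^ 1 :* (T :* T)) :* (Y :* Y :* Y) := con 975 :* con 1 :* con 20 :^ 2 :* (T :* T :* T :* (Y :* Y :* Y))) refl T Y ⟩
        K 975 * K 1 * K 20 ^ 2 * (T * T * T * (Y * Y * Y)) ∎

    -- 78883128 = 4 · 9 · 446 · 17³ is the condition for index 5. The failure of the first window,
    -- cubed, supplies the Y³ of the lower conditions; 5677858304 = 1784³.
    second : T ^ 2 ≤ K 1784 * Y → K 78883128 * Y < T ^ 5 → ⊥
    second ge lt = nondegenerate 5 (vanish v₅ U₅ L₅) (vanish v₆ U₆ L₆)
      where
      U₅ : K 4 * K 9 * (K 446 * K 17 ^ 3) * Y < K 1 * T ^ 5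
      U₅ = subst₂ _<_ (solve 1 (λ y → con 78883128 :* y := con 4 :* con 9 :* (con 446 :* con 17 :^ 3) :* y) refl Y)
        (trans (sym (*-identityˡ _)) (cong (_* T ^ 5) (sym (K≡ 1)))) lt
      U₆ : K 4 * K 1089 * (K 446 * K 17 ^ 4) * Y < K 1 * T ^ 6
      U₆ = begin-strict
        K 4 * K 1089 * (K 446 * K 17 ^ 4) * Y ≡⟨ solve 1 (λ y → con 4 :* con 1089 :* (con 446 :* con 17 :^ 4) :* y := con 2057 :* (con 78883128 :* y)) refl Y ⟩
        K 2057 * (K 78883128 * Y) <⟨ *-monoʳ-< (K 2057) lt ⟩
        K 2057 * T ^ 5 ≤⟨ absorb 2057 1 1 (≤ᵇ⇒≤ _ _ _) ⟩
        K 1 * (T ^ 1 * T ^ 5) ≡⟨ cong (K 1 *_) (sym (^-distribˡ-+-* T 1 5)) ⟩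
        K 1 * T ^ 6 ∎
      Y³ : T ^ 2 * T ^ 2 * T ^ 2 ≤ K 5677858304 * (Y * Y * Y)
      Y³ = ≤-trans (cube-mono ge) (≤-reflexive (solve 1 (λ y → con 1784 :* y :* (con 1784 :* y) :* (con 1784 :* y) := con (1784 * 1784 * 1784) :* (y :* y :* y)) refl Y))
      L₅ : K 64000 * K 9 * (K 21 * T) ^ 4 ≤ K 975 * K 1 * K 20 ^ 4 * (T * T * T * (Y * Y * Y))
      L₅ = *-cancelˡ-≤ (K 5677858304) (begin
        K 5677858304 * (K 64000 * K 9 * (K 21 * T) ^ 4)
          ≡⟨ solve 1 (λ T → con 5677858304 :* (con 64000 :* con 9 :* (con 21 :* T) :^ 4) := con (5677858304 * 64000 * 9 * 21 ^ 4) :* T :^ 4) refl T ⟩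
        K (5677858304 * 64000 * 9 * 21 ^ 4) * T ^ 4 ≤⟨ absorb (5677858304 * 64000 * 9 * 21 ^ 4) (975 * 20 ^ 4) 5 (≤ᵇ⇒≤ _ _ _) ⟩
        K (975 * 20 ^ 4) * (T ^ 5 * T ^ 4) ≡⟨ solve 1 (λ T → con (975 * 20 ^ 4) :* (T :^ 5 :* T :^ 4) := con (975 * 20 ^ 4) :* (T :* T :* T) :* (T :^ 2 :* T :^ 2 :* T :^ 2)) refl T ⟩
        K (975 * 20 ^ 4) * (T * T * T) * (T ^ 2 * T ^ 2 * T ^ 2) ≤⟨ *-monoʳ-≤ (K (975 * 20 ^ 4) * (T * T * T)) Y³ ⟩
        K (975 * 20 ^ 4) * (T * T * T) * (K 5677858304 * (Y * Y * Y))
          ≡⟨ solve 2 (λ T Y → con (975 * 20 ^ 4) :* (T :* T :* T) :* (con 5677858304 :* (Y :* Y :* Y)) := con 5677858304 :* (con 975 :* con 1 :* con 20 :^ 4 :* (T :* T :* T :* (Y :* Y :* Y)))) refl T Y ⟩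
        K 5677858304 * (K 975 * K 1 * K 20 ^ 4 * (T * T * T * (Y * Y * Y))) ∎)
      L₆ : K 64000 * K 1089 * (K 21 * T) ^ 5 ≤ K 975 * K 1 * K 20 ^ 5 * (T * T * T * (Y * Y * Y))
      L₆ = *-cancelˡ-≤ (K 5677858304) (begin
        K 5677858304 * (K 64000 * K 1089 * (K 21 * T) ^ 5)
          ≡⟨ solve 1 (λ T → con 5677858304 :* (con 64000 :* con 1089 :* (con 21 :* T) :^ 5) := con (5677858304 * 64000 * 1089 * 21 ^ 5) :* T :^ 5) refl T ⟩
        K (5677858304 * 64000 * 1089 * 21 ^ 5) * T ^ 5 ≤⟨ absorb (5677858304 * 64000 * 1089 * 21 ^ 5) (975 * 20 ^ 5) 4 (≤ᵇ⇒≤ _ _ _) ⟩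
        K (975 * 20 ^ 5) * (T ^ 4 * T ^ 5) ≡⟨ solve 1 (λ T → con (975 * 20 ^ 5) :* (T :^ 4 :* T :^ 5) := con (975 * 20 ^ 5) :* (T :* T :* T) :* (T :^ 2 :* T :^ 2 :* T :^ 2)) refl T ⟩
        K (975 * 20 ^ 5) * (T * T * T) * (T ^ 2 * T ^ 2 * T ^ 2) ≤⟨ *-monoʳ-≤ (K (975 * 20 ^ 5) * (T * T * T)) Y³ ⟩
        K (975 * 20 ^ 5) * (T * T * T) * (K 5677858304 * (Y * Y * Y))
          ≡⟨ solve 2 (λ T Y → con (975 * 20 ^ 5) :* (T :* T :* T) :* (con 5677858304 :* (Y :* Y :* Y)) := con 5677858304 :* (con 975 :* con 1 :* con 20 :^ 5 :* (T :* T :* T :* (Y :* Y :* Y)))) refl T Y ⟩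
        K 5677858304 * (K 975 * K 1 * K 20 ^ 5 * (T * T * T * (Y * Y * Y))) ∎)

    private
      -- The constants of the indices 9 + 3j and 10 + 3j with the j-th powers split off: 1784 = 4 ·
      -- 446, 576000 = 64000 · 9 and 15600 = 975 · 16, while 729, 17³, 21³ and 8000 = 20³ are what
      -- each further j contributes.
      c₀ k₀ k₁ Q G : ℕ
      c₀ = 1784 * 729 ^ 3 * 17 ^ 7
      k₀ = 576000 * 729 ^ 3 * 21 ^ 9
      k₁ = 15600 * 20 ^ 9
      Q = 729 * 17 ^ 3
      G = 729 * 21 ^ 3

      -- `Upper` is the first condition at index 9 + 3j, `Lower` the second at index 10 + 3j. Each
      -- is the harder one of its pair and implies the other.
      Upper Lower : ℕ → Set
      Upper j = K c₀ * K Q ^ j * Y < K 16 * (T ^ 9 * (T ^ 3) ^ j)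
      Lower j = K k₀ * K G ^ j * (T ^ 9 * (T ^ 3) ^ j) ≤ K k₁ * K 8000 ^ j * (T * T * T * (Y * Y * Y))

      power : ∀ a i j → a ^ (i + 3 * j) ≡ a ^ i * (a ^ 3) ^ j
      power a i j = trans (^-distribˡ-+-* a i (3 * j)) (cong (a ^ i *_) (sym (^-*-assoc a 3 j)))

      K-cube : ∀ m → K m ^ 3 ≡ K (m ^ 3)
      K-cube m = sym (K-^ m 3)

      pair : ∀ j → Upper j → Lower j → ⊥
      pair j up low = nondegenerate (9 + 3 * j) (vanish (v₀ j) U₀ L₀) (vanish (v₁ j) U₁ L₁)
        where
        p q t : ℕ
        p = K 729 ^ j
        q = K (17 ^ 3) ^ j
        t = (T ^ 3) ^ j
        17^ : ∀ i → K 17 ^ (i + 3 * j) ≡ K 17 ^ i * q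
        17^ i = trans (power (K 17) i j) (cong (λ x → K 17 ^ i * x ^ j) (K-cube 17))
        Q^ : K Q ^ j ≡ p * q
        Q^ = trans (cong (_^ j) (K-* 729 (17 ^ 3))) (^-distrib-* (K 729) (K (17 ^ 3)) j)
        up′ : K c₀ * (p * q) * Y < K 16 * (T ^ 9 * t)
        up′ = subst (λ x → K c₀ * x * Y < K 16 * (T ^ 9 * t)) Q^ up
        U₀ : K 4 * K 729 ^ (3 + j) * (K 446 * K 17 ^ (7 + 3 * j)) * Y < K 16 * T ^ (9 + 3 * j)
        U₀ = subst₂ _<_
          (trans (solve 3 (λ p q Y → con c₀ :* (p :* q) :* Y := con 4 :* (con 729 :^ 3 :* p) :* (con 446 :* (con 17 :^ 7 :* q)) :* Y) refl p q Y)
            (cong₂ (λ x w → K 4 * x * (K 446 * w) * Y) (sym (^-distribˡ-+-* (K 729) 3 j)) (sym (17^ 7))))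
          (cong (K 16 *_) (sym (power T 9 j))) up′
        U₁ : K 4 * (K 9 * K 729 ^ (3 + j)) * (K 446 * K 17 ^ (8 + 3 * j)) * Y < K 16 * T ^ (10 + 3 * j)
        U₁ = begin-strict
          K 4 * (K 9 * K 729 ^ (3 + j)) * (K 446 * K 17 ^ (8 + 3 * j)) * Y
            ≡⟨ solve 3 (λ x w Y → con 4 :* (con 9 :* x) :* (con 446 :* (con 17 :* w)) :* Y := con 153 :* (con 4 :* x :* (con 446 :* w) :* Y)) refl (K 729 ^ (3 + j)) (K 17 ^ (7 + 3 * j)) Y ⟩
          K 153 * (K 4 * K 729 ^ (3 + j) * (K 446 * K 17 ^ (7 + 3 * j)) * Y) <⟨ *-monoʳ-< (K 153) U₀ ⟩
          K 153 * (K 16 * T ^ (9 + 3 * j)) ≤⟨ *-monoˡ-≤ (K 16 * T ^ (9 + 3 * j)) (≤-trans (K-≤ (≤ᵇ⇒≤ 153 10000 _)) T-large) ⟩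
          T * (K 16 * T ^ (9 + 3 * j)) ≡⟨ solve 2 (λ T x → T :* (con 16 :* x) := con 16 :* (T :* x)) refl T (T ^ (9 + 3 * j)) ⟩
          K 16 * T ^ (10 + 3 * j) ∎
        21T^ : (K 21 * T) ^ (9 + 3 * j) ≡ K 21 ^ 9 * K (21 ^ 3) ^ j * (T ^ 9 * t)
        21T^ = trans (^-distrib-* (K 21) T (9 + 3 * j)) (cong₂ _*_ (trans (power (K 21) 9 j) (cong (λ x → K 21 ^ 9 * x ^ j) (K-cube 21))) (power T 9 j))
        20^ : K 20 ^ (9 + 3 * j) ≡ K 20 ^ 9 * K 8000 ^ j
        20^ = trans (power (K 20) 9 j) (cong (λ x → K 20 ^ 9 * x ^ j) (K-cube 20))
        L₁ : K 64000 * (K 9 * K 729 ^ (3 + j)) * (K 21 * T) ^ (9 + 3 * j) ≤ K 975 * K 16 * K 20 ^ (9 + 3 * j) * (T * T * T * (Y * Y * Y))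
        L₁ = begin
          K 64000 * (K 9 * K 729 ^ (3 + j)) * (K 21 * T) ^ (9 + 3 * j)
            ≡⟨ cong₂ (λ x w → K 64000 * (K 9 * x) * w) (^-distribˡ-+-* (K 729) 3 j) 21T^ ⟩
          K 64000 * (K 9 * (K 729 ^ 3 * p)) * (K 21 ^ 9 * K (21 ^ 3) ^ j * (T ^ 9 * t))
            ≡⟨ solve 3 (λ p g t → con 64000 :* (con 9 :* (con 729 :^ 3 :* p)) :* (con 21 :^ 9 :* g :* t) := con k₀ :* (p :* g) :* t) refl p (K (21 ^ 3) ^ j) (T ^ 9 * t) ⟩
          K k₀ * (p * K (21 ^ 3) ^ j) * (T ^ 9 * t) ≡⟨ cong (λ x → K k₀ * x * (T ^ 9 * t)) (trans (sym (^-distrib-* (K 729) (K (21 ^ 3)) j)) (cong (_^ j) (sym (K-* 729 (21 ^ 3))))) ⟩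
          K k₀ * K G ^ j * (T ^ 9 * t) ≤⟨ low ⟩
          K k₁ * K 8000 ^ j * (T * T * T * (Y * Y * Y))
            ≡⟨ solve 2 (λ e w → con k₁ :* e :* w := con 975 :* con 16 :* (con 20 :^ 9 :* e) :* w) refl (K 8000 ^ j) (T * T * T * (Y * Y * Y)) ⟩
          K 975 * K 16 * (K 20 ^ 9 * K 8000 ^ j) * (T * T * T * (Y * Y * Y)) ≡⟨ cong (λ x → K 975 * K 16 * x * (T * T * T * (Y * Y * Y))) (sym 20^) ⟩
          K 975 * K 16 * K 20 ^ (9 + 3 * j) * (T * T * T * (Y * Y * Y)) ∎
        L₀ : K 64000 * K 729 ^ (3 + j) * (K 21 * T) ^ (8 + 3 * j) ≤ K 975 * K 16 * K 20 ^ (8 + 3 * j) * (T * T * T * (Y * Y * Y))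
        L₀ = *-cancelˡ-≤ (K 20) (begin
          K 20 * (K 64000 * x * w) ≤⟨ *-monoˡ-≤ (K 64000 * x * w) (≤-trans (K-≤ (≤ᵇ⇒≤ 20 189 _)) (m≤m*n (K 189) T)) ⟩
          K 189 * T * (K 64000 * x * w) ≡⟨ solve 3 (λ T x w → con 189 :* T :* (con 64000 :* x :* w) := con 64000 :* (con 9 :* x) :* (con 21 :* T :* w)) refl T x w ⟩
          K 64000 * (K 9 * x) * (K 21 * T * w) ≤⟨ L₁ ⟩
          K 975 * K 16 * (K 20 * e) * z ≡⟨ solve 2 (λ e z → con 975 :* con 16 :* (con 20 :* e) :* z := con 20 :* (con 975 :* con 16 :* e :* z)) refl e z ⟩
          K 20 * (K 975 * K 16 * e * z) ∎)
          where
          x w e z : ℕ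
          x = K 729 ^ (3 + j)
          w = (K 21 * T) ^ (8 + 3 * j)
          e = K 20 ^ (8 + 3 * j)
          z = T * T * T * (Y * Y * Y)

      lower-zero : T ^ 5 ≤ K 78883128 * Y → Lower 0
      lower-zero ge = *-cancelˡ-≤ (K m³) (begin
        K m³ * (K k₀ * 1 * (T ^ 9 * 1)) ≡⟨ cong (λ o → K m³ * (K k₀ * o * (T ^ 9 * o))) (sym (K≡ 1)) ⟩
        K m³ * (K k₀ * K 1 * (T ^ 9 * K 1)) ≡⟨ solve 1 (λ T → con m³ :* (con k₀ :* con 1 :* (T :^ 9 :* con 1)) := con (m³ * k₀) :* T :^ 9) refl T ⟩
        K (m³ * k₀) * T ^ 9 ≤⟨ absorb (m³ * k₀) k₁ 9 (≤ᵇ⇒≤ _ _ _) ⟩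
        K k₁ * (T ^ 9 * T ^ 9) ≡⟨ solve 1 (λ T → con k₁ :* (T :^ 9 :* T :^ 9) := con k₁ :* (T :* T :* T) :* (T :^ 5 :* T :^ 5 :* T :^ 5)) refl T ⟩
        K k₁ * (T * T * T) * (T ^ 5 * T ^ 5 * T ^ 5) ≤⟨ *-monoʳ-≤ (K k₁ * (T * T * T)) (cube-mono ge) ⟩
        K k₁ * (T * T * T) * (K 78883128 * Y * (K 78883128 * Y) * (K 78883128 * Y))
          ≡⟨ solve 2 (λ T Y → con k₁ :* (T :* T :* T) :* (con 78883128 :* Y :* (con 78883128 :* Y) :* (con 78883128 :* Y)) := con m³ :* (con k₁ :* con 1 :* (T :* T :* T :* (Y :* Y :* Y)))) refl T Y ⟩
        K m³ * (K k₁ * K 1 * (T * T * T * (Y * Y * Y))) ≡⟨ cong (λ o → K m³ * (K k₁ * o * (T * T * T * (Y * Y * Y)))) (K≡ 1) ⟩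
        K m³ * (K k₁ * 1 * (T * T * T * (Y * Y * Y))) ∎)
        where
        m³ : ℕ
        m³ = 78883128 * 78883128 * 78883128

      -- If y is too large for window j, then Y is of order T^(9+3j) and T³Y³ of order T^(30+9j),
      -- against the T^(12+3j) asked for by window j + 1. Of the surplus, T¹⁸ absorbs the constants
      -- and T^(6j) the j-th powers.
      lower-suc : ∀ j → K 16 * (T ^ 9 * (T ^ 3) ^ j) ≤ K c₀ * K Q ^ j * Y → Lower (suc j)
      lower-suc j ge = *-cancelˡ-≤ (K c₀ * q * (K c₀ * q) * (K c₀ * q)) {{*-nonZero (*-nonZero cq≢0 cq≢0) cq≢0}} (begin
        K c₀ * q * (K c₀ * q) * (K c₀ * q) * (K k₀ * (K G * g) * (T ^ 9 * (T ^ 3 * t)))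
          ≡⟨ solve 4 (λ q g t T → con c₀ :* q :* (con c₀ :* q) :* (con c₀ :* q) :* (con k₀ :* (con G :* g) :* (T :^ 9 :* (T :^ 3 :* t)))
               := con (c₀ * c₀ * c₀ * k₀ * G) :* (g :* (q :* q :* q) :* (T :^ 12 :* t))) refl q g t T ⟩
        K (c₀ * c₀ * c₀ * k₀ * G) * (g * (q * q * q) * (T ^ 12 * t)) ≤⟨ absorb (c₀ * c₀ * c₀ * k₀ * G) (k₁ * 8000 * 16 * 16 * 16) 18 (≤ᵇ⇒≤ _ _ _) ⟩
        K (k₁ * 8000 * 16 * 16 * 16) * (T ^ 18 * (g * (q * q * q) * (T ^ 12 * t)))
          ≤⟨ *-monoʳ-≤ (K (k₁ * 8000 * 16 * 16 * 16)) (*-monoʳ-≤ (T ^ 18) (*-monoˡ-≤ (T ^ 12 * t) step)) ⟩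
        K (k₁ * 8000 * 16 * 16 * 16) * (T ^ 18 * (e * (t * t) * (T ^ 12 * t)))
          ≡⟨ solve 3 (λ e t T → con (k₁ * 8000 * 16 * 16 * 16) :* (T :^ 18 :* (e :* (t :* t) :* (T :^ 12 :* t)))
               := con k₁ :* (con 8000 :* e) :* (T :* T :* T) :* (con 16 :* (T :^ 9 :* t) :* (con 16 :* (T :^ 9 :* t)) :* (con 16 :* (T :^ 9 :* t)))) refl e t T ⟩
        K k₁ * (K 8000 * e) * (T * T * T) * (K 16 * (T ^ 9 * t) * (K 16 * (T ^ 9 * t)) * (K 16 * (T ^ 9 * t)))
          ≤⟨ *-monoʳ-≤ (K k₁ * (K 8000 * e) * (T * T * T)) (cube-mono ge) ⟩
        K k₁ * (K 8000 * e) * (T * T * T) * (K c₀ * q * Y * (K c₀ * q * Y) * (K c₀ * q * Y))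
          ≡⟨ solve 4 (λ q e T Y → con k₁ :* (con 8000 :* e) :* (T :* T :* T) :* (con c₀ :* q :* Y :* (con c₀ :* q :* Y) :* (con c₀ :* q :* Y))
               := con c₀ :* q :* (con c₀ :* q) :* (con c₀ :* q) :* (con k₁ :* (con 8000 :* e) :* (T :* T :* T :* (Y :* Y :* Y)))) refl q e T Y ⟩
        K c₀ * q * (K c₀ * q) * (K c₀ * q) * (K k₁ * (K 8000 * e) * (T * T * T * (Y * Y * Y))) ∎)
        where
        q g t e : ℕ
        q = K Q ^ j
        g = K G ^ j
        t = (T ^ 3) ^ j
        e = K 8000 ^ j
        cq≢0 : NonZero (K c₀ * q)
        cq≢0 = *-nonZero {K c₀} K-nonZero (m^n≢0 (K Q) j)
        step : g * (q * q * q) ≤ e * (t * t)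
        step = begin
          g * (q * q * q) ≡⟨ trans (cong (λ x → g * x) (trans (cong (_* q) (sym (^-distrib-* (K Q) (K Q) j))) (sym (^-distrib-* (K Q * K Q) (K Q) j)))) (sym (^-distrib-* (K G) (K Q * K Q * K Q) j)) ⟩
          (K G * (K Q * K Q * K Q)) ^ j ≤⟨ ^-mono j (begin
            K G * (K Q * K Q * K Q) ≡⟨ solve 0 (con G :* (con Q :* con Q :* con Q) := con (G * (Q * Q * Q)) :* con 1) refl ⟩
            K (G * (Q * Q * Q)) * K 1 ≤⟨ absorb (G * (Q * Q * Q)) 8000 6 (≤ᵇ⇒≤ _ _ _) ⟩
            K 8000 * (T ^ 6 * K 1) ≡⟨ solve 1 (λ T → con 8000 :* (T :^ 6 :* con 1) := con 8000 :* (T :^ 3 :* T :^ 3)) refl T ⟩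
            K 8000 * (T ^ 3 * T ^ 3) ∎) ⟩
          (K 8000 * (T ^ 3 * T ^ 3)) ^ j ≡⟨ trans (^-distrib-* (K 8000) (T ^ 3 * T ^ 3) j) (cong (e *_) (^-distrib-* (T ^ 3) (T ^ 3) j)) ⟩
          e * (t * t) ∎

      -- Y < 4^Y, and 4Q is below 10000³ ≤ T³, so the window j = Y cannot be missed from above; it
      -- bounds the search.
      upper-eventually : Upper Y
      upper-eventually = begin-strict
        K c₀ * K Q ^ Y * Y <⟨ *-monoʳ-< (K c₀ * K Q ^ Y) {{*-nonZero {K c₀} K-nonZero (m^n≢0 (K Q) Y)}} (n<4^n Y) ⟩
        K c₀ * K Q ^ Y * 4 ^ Y ≡⟨ trans (*-assoc (K c₀) _ _) (cong (K c₀ *_) (sym (^-distrib-* (K Q) 4 Y))) ⟩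
        K c₀ * (K Q * 4) ^ Y ≤⟨ *-monoʳ-≤ (K c₀) (^-mono Y (begin
          K Q * 4 ≡⟨ trans (cong (K Q *_) (sym (K≡ 4))) (sym (K-* Q 4)) ⟩
          K (Q * 4) ≤⟨ K-≤ (≤ᵇ⇒≤ (Q * 4) (10000 ^ 3) _) ⟩
          K (10000 ^ 3) ≤⟨ T^-large 3 ⟩
          T ^ 3 ∎)) ⟩
        K c₀ * (T ^ 3) ^ Y ≤⟨ absorb c₀ 16 9 (≤ᵇ⇒≤ _ _ _) ⟩
        K 16 * (T ^ 9 * (T ^ 3) ^ Y) ∎

      search : ∀ i j → i + j ≡ Y → Lower j → ⊥
      search i j eq low with K c₀ * K Q ^ j * Y <? K 16 * (T ^ 9 * (T ^ 3) ^ j)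
      ... | yes up = pair j up low
      search zero j refl low | no ¬up = ¬up upper-eventually
      search (suc i) j eq low | no ¬up = search i (suc j) (trans (+-suc i j) eq) (lower-suc j (≮⇒≥ ¬up))

    contradiction : ⊥
    contradiction with K 1784 * Y <? T ^ 2
    ... | yes lt = initial lt
    ... | no ¬lt with K 78883128 * Y <? T ^ 5
    ...   | yes lt = second (≮⇒≥ ¬lt) lt
    ...   | no ¬lt′ = search Y 0 (+-identityʳ Y) (lower-zero (≮⇒≥ ¬lt′))

-- Consequences of U being close to tV

module Localising where
  open Numerals
  open Coefficients using (*-nonZero)
  open Estimates using (K-≤; K-nonZero; certify; ratio; sq)
  open import Data.Nat.Base
  open import Data.Nat.Properties
  open import Relation.Binary.PropositionalEquality
  open KSolver
  open ≤-Reasoning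

  -- D is the squared size of U - tV. From U(U - tV) = 4V² + F_t and the lower bound on U it follows
  -- that D is tiny, so that x is close to ty and b = UV has squared size close to T³Y⁴.
  module Localisation (T X Y U D A : ℕ) {{Y≢0 : NonZero Y}}
    (T-large : K 10000 ≤ T) (Y≤X : Y ≤ X) (U-large : T * (X * Y) ≤ K 7 * U)
    (UD : U * D ≤ K 2 * (K 16 * (X * Y * (X * Y)) + K 16))
    (TV : K 300 * (T * (X * Y)) ≤ K 301 * (U + K 300 * D))
    (U-small : ∀ k → K k * U ≤ K (suc k) * (X * X + K k * (Y * Y)))
    (TB : K 1000 * (T * (X * Y * U)) ≤ K 1001 * (A + K 1000 * K 16))
    where

    private
      V B : ℕ
      V = X * Y
      B = V * U
      1≤Y : 1 ≤ Y
      1≤Y = >-nonZero⁻¹ Y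
      instance
        X≢0 : NonZero X
        X≢0 = >-nonZero (≤-trans 1≤Y Y≤X)
        V≢0 : NonZero V
        V≢0 = *-nonZero X≢0 Y≢0

      K1≤VV : K 1 ≤ V * V
      K1≤VV = subst (_≤ V * V) (sym (K≡ 1)) (*-mono-≤ (>-nonZero⁻¹ V) (>-nonZero⁻¹ V))

      -- 448 = 7 · 2 · (16 + 16), with XY ≥ 1 absorbing the size of F_t.
      TD : T * D ≤ K 448 * V
      TD = *-cancelˡ-≤ V (begin
        V * (T * D) ≡⟨ solve 3 (λ V T D → V :* (T :* D) := T :* V :* D) refl V T D ⟩
        T * V * D ≤⟨ *-monoˡ-≤ D U-large ⟩
        K 7 * U * D ≡⟨ *-assoc (K 7) U D ⟩
        K 7 * (U * D) ≤⟨ *-monoʳ-≤ (K 7) UD ⟩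
        K 7 * (K 2 * (K 16 * (V * V) + K 16)) ≤⟨ certify (K 0) (*-monoʳ-≤ (K 224) K1≤VV)
           (solve 1 (λ V → con 7 :* (con 2 :* (con 16 :* (V :* V) :+ con 16)) :+ con 224 :* (V :* V) :+ con 0 := V :* (con 448 :* V) :+ con 224 :* con 1) refl V) ⟩
        V * (K 448 * V) ∎)

      D-small : K 100000000 * D ≤ K 448 * (T * V)
      D-small = begin
        K 100000000 * D ≡⟨ solve 1 (λ D → con 100000000 :* D := con 10000 :* (con 10000 :* D)) refl D ⟩
        K 10000 * (K 10000 * D) ≤⟨ *-monoʳ-≤ (K 10000) (*-monoˡ-≤ D T-large) ⟩
        K 10000 * (T * D) ≤⟨ *-mono-≤ T-large TD ⟩
        T * (K 448 * V) ≡⟨ solve 2 (λ T V → T :* (con 448 :* V) := con 448 :* (T :* V)) refl T V ⟩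
        K 448 * (T * V) ∎

      U≥ : K 995 * (T * V) ≤ K 1000 * U
      U≥ = ratio 29959545600 30100000000 995 1000 (certify (K 0) (+-mono-≤ (*-monoʳ-≤ (K 100000000) TV) (*-monoʳ-≤ (K 90300) D-small))
        (solve 3 (λ W U D → con 29959545600 :* W :+ (con 100000000 :* (con 301 :* (U :+ con 300 :* D)) :+ con 90300 :* (con 448 :* W)) :+ con 0
           := con 30100000000 :* U :+ (con 100000000 :* (con 300 :* W) :+ con 90300 :* (con 100000000 :* D))) refl (T * V) U D)) (≤ᵇ⇒≤ _ _ _)

      -- A first comparison of x with ty that knows only Y ≤ X. It yields `2000Y≤X`, after which y²
      -- is negligible in U and the constant improves to that of `99TY≤100X`.
      995TY : K 995 * (T * Y) ≤ K 4000 * X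
      995TY = *-cancelˡ-≤ X (begin
        X * (K 995 * (T * Y)) ≡⟨ solve 3 (λ X T Y → X :* (con 995 :* (T :* Y)) := con 995 :* (T :* (X :* Y))) refl X T Y ⟩
        K 995 * (T * V) ≤⟨ U≥ ⟩
        K 1000 * U ≡⟨ solve 1 (λ U → con 1000 :* U := con 1000 :* (con 1 :* U)) refl U ⟩
        K 1000 * (K 1 * U) ≤⟨ *-monoʳ-≤ (K 1000) (U-small 1) ⟩
        K 1000 * (K 2 * (X * X + K 1 * (Y * Y))) ≤⟨ *-monoʳ-≤ (K 1000) (*-monoʳ-≤ (K 2) (+-monoʳ-≤ (X * X) (*-monoʳ-≤ (K 1) (sq Y≤X)))) ⟩
        K 1000 * (K 2 * (X * X + K 1 * (X * X))) ≡⟨ solve 1 (λ X → con 1000 :* (con 2 :* (X :* X :+ con 1 :* (X :* X))) := X :* (con 4000 :* X)) refl X ⟩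
        X * (K 4000 * X) ∎)

    2000Y≤X : K 2000 * Y ≤ K 1 * X
    2000Y≤X = ratio 9950000 4000 2000 1 (begin
      K 9950000 * Y ≡⟨ solve 1 (λ Y → con 9950000 :* Y := con 995 :* (con 10000 :* Y)) refl Y ⟩
      K 995 * (K 10000 * Y) ≤⟨ *-monoʳ-≤ (K 995) (*-monoˡ-≤ Y T-large) ⟩
      K 995 * (T * Y) ≤⟨ 995TY ⟩
      K 4000 * X ∎) (≤ᵇ⇒≤ _ _ _)

    private
      U≤ : K 4000000 * U ≤ K 4005001 * (X * X)
      U≤ = certify (K 0) (+-mono-≤ (*-monoʳ-≤ (K 4000) (U-small 1000)) (*-monoʳ-≤ (K 1001) (sq 2000Y≤X)))
        (solve 3 (λ U X Y → con 4000000 :* U :+ (con 4000 :* (con 1001 :* (X :* X :+ con 1000 :* (Y :* Y))) :+ con 1001 :* (con 1 :* X :* (con 1 :* X))) :+ con 0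
           := con 4005001 :* (X :* X) :+ (con 4000 :* (con 1000 :* U) :+ con 1001 :* (con 2000 :* Y :* (con 2000 :* Y)))) refl U X Y)

    99TY≤100X : K 99 * (T * Y) ≤ K 100 * X
    99TY≤100X = ratio 3980000 4005001 99 100 (*-cancelˡ-≤ X (begin
      X * (K 3980000 * (T * Y)) ≡⟨ solve 3 (λ X T Y → X :* (con 3980000 :* (T :* Y)) := con 4000 :* (con 995 :* (T :* (X :* Y)))) refl X T Y ⟩
      K 4000 * (K 995 * (T * V)) ≤⟨ *-monoʳ-≤ (K 4000) U≥ ⟩
      K 4000 * (K 1000 * U) ≡⟨ solve 1 (λ U → con 4000 :* (con 1000 :* U) := con 4000000 :* U) refl U ⟩
      K 4000000 * U ≤⟨ U≤ ⟩
      K 4005001 * (X * X) ≡⟨ solve 1 (λ X → con 4005001 :* (X :* X) := X :* (con 4005001 :* X)) refl X ⟩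
      X * (K 4005001 * X) ∎)) (≤ᵇ⇒≤ _ _ _)

    private
      B≥ : K 995 * (T * (V * V)) ≤ K 1000 * B
      B≥ = begin
        K 995 * (T * (V * V)) ≡⟨ solve 2 (λ T V → con 995 :* (T :* (V :* V)) := V :* (con 995 :* (T :* V))) refl T V ⟩
        V * (K 995 * (T * V)) ≤⟨ *-monoʳ-≤ V U≥ ⟩
        V * (K 1000 * U) ≡⟨ solve 2 (λ V U → V :* (con 1000 :* U) := con 1000 :* (V :* U)) refl V U ⟩
        K 1000 * B ∎

    -- 0.995 · 0.99² > 0.975, from U close to tV once and x close to ty twice.
    B-large : K 975 * (T * T * T * (Y * Y * Y * Y)) ≤ K 1000 * B
    B-large = ratio 9751995 10000000 975 1000 (begin
      K 9751995 * (T * T * T * (Y * Y * Y * Y))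
        ≡⟨ solve 2 (λ T Y → con 9751995 :* (T :* T :* T :* (Y :* Y :* Y :* Y)) := con 995 :* (T :* (Y :* Y)) :* (con 99 :* (T :* Y) :* (con 99 :* (T :* Y)))) refl T Y ⟩
      K 995 * (T * (Y * Y)) * (K 99 * (T * Y) * (K 99 * (T * Y))) ≤⟨ *-monoʳ-≤ (K 995 * (T * (Y * Y))) (sq 99TY≤100X) ⟩
      K 995 * (T * (Y * Y)) * (K 100 * X * (K 100 * X))
        ≡⟨ solve 3 (λ T X Y → con 995 :* (T :* (Y :* Y)) :* (con 100 :* X :* (con 100 :* X)) := con 10000 :* (con 995 :* (T :* (X :* Y :* (X :* Y))))) refl T X Y ⟩
      K 10000 * (K 995 * (T * (V * V))) ≤⟨ *-monoʳ-≤ (K 10000) B≥ ⟩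
      K 10000 * (K 1000 * B) ≡⟨ solve 1 (λ B → con 10000 :* (con 1000 :* B) := con 10000000 :* B) refl B ⟩
      K 10000000 * B ∎) (≤ᵇ⇒≤ _ _ _)

    private
      K10⁶≤B : K 1000000 ≤ B
      K10⁶≤B = *-cancelˡ-≤ (K 1000) (begin
        K 1000 * K 1000000 ≡⟨ solve 0 (con 1000 :* con 1000000 := con 1000000000 :* con 1) refl ⟩
        K 1000000000 * K 1 ≤⟨ *-monoˡ-≤ (K 1) (K-≤ (≤ᵇ⇒≤ 1000000000 (975 * (10000 * 10000 * 10000)) _)) ⟩
        K (975 * (10000 * 10000 * 10000)) * K 1 ≡⟨ solve 0 (con (975 * (10000 * 10000 * 10000)) :* con 1 := con 975 :* (con 10000 :* con 10000 :* con 10000 :* con 1)) refl ⟩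
        K 975 * (K 10000 * K 10000 * K 10000 * K 1) ≤⟨ *-monoʳ-≤ (K 975) (*-mono-≤ (*-mono-≤ (*-mono-≤ T-large T-large) T-large)
           (subst (_≤ Y * Y * Y * Y) (sym (K≡ 1)) (*-mono-≤ (*-mono-≤ (*-mono-≤ 1≤Y 1≤Y) 1≤Y) 1≤Y))) ⟩
        K 975 * (T * T * T * (Y * Y * Y * Y)) ≤⟨ B-large ⟩
        K 1000 * B ∎)

    instance
      B≢0 : NonZero B
      B≢0 = >-nonZero (≤-trans (subst (_≤ K 1000000) (K≡ 1) (K-≤ (≤ᵇ⇒≤ _ _ _))) K10⁶≤B)

    A-large : K 998 * (T * B) ≤ K 1000 * A
    A-large = ratio 999 1001 998 1000 (certify (K 0) (+-mono-≤ TB small)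
      (solve 2 (λ W A → con 999 :* W :+ (con 1001 :* (A :+ con 1000 :* con 16) :+ W) :+ con 0 := con 1001 :* A :+ (con 1000 :* W :+ con 16016000)) refl (T * B) A)) (≤ᵇ⇒≤ _ _ _)
      where
      small : K 16016000 ≤ T * B
      small = ≤-trans (K-≤ (≤ᵇ⇒≤ 16016000 (10000 * 1000000) _)) (≤-trans (≤-reflexive (K-* 10000 1000000)) (*-mono-≤ T-large K10⁶≤B))

    q : ℕ
    q = K 1048576 * (Y * Y * ((X + Y) * (X + Y)))

    instance
      q≢0 : NonZero q
      q≢0 = *-nonZero {K 1048576} K-nonZero (*-nonZero (*-nonZero Y≢0 Y≢0) (*-nonZero X+Y≢0 X+Y≢0))
        where
        X+Y≢0 : NonZero (X + Y)
        X+Y≢0 = >-nonZero (≤-trans 1≤Y (m≤n+m Y X))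

    -- With X + Y replaced by 2X, q is at most 2²² X²Y², and A is about T²X²Y². At T = 10000 the
    -- inequality compares about 4.2 · 10⁸ with 5.9 · 10⁸, so |t| ≥ 100 leaves little room here.
    q-small : K 100 * q ≤ K 6 * A
    q-small = *-cancelˡ-≤ (K 1000000) (begin
      K 1000000 * (K 100 * (K 1048576 * (Y * Y * ((X + Y) * (X + Y)))))
        ≤⟨ *-monoʳ-≤ (K 1000000) (*-monoʳ-≤ (K 100) (*-monoʳ-≤ (K 1048576) (*-monoʳ-≤ (Y * Y) (sq (+-monoʳ-≤ X Y≤X))))) ⟩
      K 1000000 * (K 100 * (K 1048576 * (Y * Y * ((X + X) * (X + X)))))
        ≡⟨ solve 2 (λ X Y → con 1000000 :* (con 100 :* (con 1048576 :* (Y :* Y :* ((X :+ X) :* (X :+ X))))) := con 419430400000000 :* (X :* Y :* (X :* Y))) refl X Y ⟩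
      K 419430400000000 * (V * V) ≤⟨ *-monoˡ-≤ (V * V) (K-≤ (≤ᵇ⇒≤ 419430400000000 (5958060 * 10000 * 10000) _)) ⟩
      K (5958060 * 10000 * 10000) * (V * V) ≡⟨ solve 1 (λ w → con (5958060 * 10000 * 10000) :* w := con 5958060 :* con 10000 :* con 10000 :* w) refl (V * V) ⟩
      K 5958060 * K 10000 * K 10000 * (V * V) ≤⟨ *-monoˡ-≤ (V * V) (*-mono-≤ (*-monoʳ-≤ (K 5958060) T-large) T-large) ⟩
      K 5958060 * T * T * (V * V) ≡⟨ solve 2 (λ T w → con 5958060 :* T :* T :* w := con 5988 :* T :* (con 995 :* (T :* w))) refl T (V * V) ⟩
      K 5988 * T * (K 995 * (T * (V * V))) ≤⟨ *-monoʳ-≤ (K 5988 * T) B≥ ⟩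
      K 5988 * T * (K 1000 * B) ≡⟨ solve 2 (λ T B → con 5988 :* T :* (con 1000 :* B) := con 6000 :* (con 998 :* (T :* B))) refl T B ⟩
      K 6000 * (K 998 * (T * B)) ≤⟨ *-monoʳ-≤ (K 6000) A-large ⟩
      K 6000 * (K 1000 * A) ≡⟨ solve 1 (λ A → con 6000 :* (con 1000 :* A) := con 1000000 :* (con 6 :* A)) refl A ⟩
      K 1000000 * (K 6 * A) ∎)

    instance
      A≢0 : NonZero A
      A≢0 = ≢-nonZero λ A≡0 → <⇒≱ (>-nonZero⁻¹ (K 100 * q) {{*-nonZero {K 100} K-nonZero q≢0}})
        (≤-trans q-small (≤-reflexive (trans (cong (K 6 *_) A≡0) (*-zeroʳ (K 6)))))

-- The contradiction when x is close to ty

module CoreContradiction where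
  open Algebras
  open Numerals
  open Coefficients
  open GaussianExtension
  open IntegralMultiples
  open CoefficientBounds
  open CrudeBound
  open Estimates using (o; c; o-suc; K-≤; K-nonZero; sq; module Decay)
  open CommonFactors
  open Density
  open import Data.Nat.Base as ℕ using (ℕ; zero; suc; _≤_; _<_; z≤n; s≤s; NonZero; _+_; _*_; _^_; _!)
  open import Data.Nat.Properties
  open import Data.Nat.Divisibility using (_∣_; m%n≡0⇒n∣m)
  open import Data.Integer.Base as ℤ using () renaming (+_ to pos)
  open import Data.Product using (_×_; _,_; ∃)
  open import Data.Empty using (⊥; ⊥-elim)
  open import Relation.Nullary using (yes; no)
  open import Relation.Binary.PropositionalEquality hiding (J)
  open KSolver using (solve; con; _:+_; _:*_; _:=_)

  opaque
    unfolding coef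

    -- The degrees 2, 3, 5 and 6 lie below the range of `density`; explicit odd divisors are checked
    -- by evaluating the coefficients.
    content₂ : ∀ k l → k + l ≡ 2 → 3 ∣ coef k l
    content₂ 0 l refl = m%n≡0⇒n∣m _ 3 refl
    content₂ 1 l refl = m%n≡0⇒n∣m _ 3 refl
    content₂ 2 l refl = m%n≡0⇒n∣m _ 3 refl

    content₃ : ∀ k l → k + l ≡ 3 → 3 ∣ coef k l
    content₃ 0 l refl = m%n≡0⇒n∣m _ 3 refl
    content₃ 1 l refl = m%n≡0⇒n∣m _ 3 refl
    content₃ 2 l refl = m%n≡0⇒n∣m _ 3 refl
    content₃ 3 l refl = m%n≡0⇒n∣m _ 3 refl

    content₅ : ∀ k l → k + l ≡ 5 → 315 ∣ coef k l
    content₅ 0 l refl = m%n≡0⇒n∣m _ 315 refl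
    content₅ 1 l refl = m%n≡0⇒n∣m _ 315 refl
    content₅ 2 l refl = m%n≡0⇒n∣m _ 315 refl
    content₅ 3 l refl = m%n≡0⇒n∣m _ 315 refl
    content₅ 4 l refl = m%n≡0⇒n∣m _ 315 refl
    content₅ 5 l refl = m%n≡0⇒n∣m _ 315 refl

    content₆ : ∀ k l → k + l ≡ 6 → 315 ∣ coef k l
    content₆ 0 l refl = m%n≡0⇒n∣m _ 315 refl
    content₆ 1 l refl = m%n≡0⇒n∣m _ 315 refl
    content₆ 2 l refl = m%n≡0⇒n∣m _ 315 refl
    content₆ 3 l refl = m%n≡0⇒n∣m _ 315 refl
    content₆ 4 l refl = m%n≡0⇒n∣m _ 315 refl
    content₆ 5 l refl = m%n≡0⇒n∣m _ 315 refl
    content₆ 6 l refl = m%n≡0⇒n∣m _ 315 refl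


  module Contradiction (A : ℤAlgebra) (𝒩 : Norm A) where
    open ℤAlgebra A using (Carrier; ι; 0#; 1#; ι-1; module Solver; zeroʳ)
      renaming (*-identityˡ to ·-identityˡ; *-identityʳ to ·-identityʳ; +-identityˡ to ⊹-identityˡ; _+_ to _⊹_; _*_ to _·_; -_ to ⁻_; _-_ to _−_; _^_ to _⋆_)
    open Norm 𝒩
    open Adjoin A using (Z)
    open Integrality A using (Z-divisible)
    open ExactParameter A 𝒩
    private module S = Solver

    triangle : ∀ k z w → K k * N (z ⊹ w) ≤ K (suc k) * (N z + K k * N w)
    triangle k z w = subst (λ s → K k * N (z ⊹ w) ≤ s * (N z + K k * N w)) (trans (cong suc (K≡ k)) (sym (K≡ (suc k)))) (N-triangle (K k) z w)

    N-numeral : ∀ n z → N (ι (pos n) · z) ≡ n * n * N z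
    N-numeral n z = trans (N-* _ _) (cong (_* N z) (N-ι (pos n)))

    N-minus : ∀ z w → N (z − w) ≡ N (w − z)
    N-minus z w = trans (cong N (S.solve 2 (λ z w → z S.:- w S.:= S.:- (w S.:- z)) refl z w)) (N-neg _)

    Z-three-term : ∀ a b x y k n →
      k * (o (suc n) * o (suc n) * N a * N (Z a b x y (suc n))) ≤ suc k * (c n * c n * (N b * N b) * N (Z a b x y n) + k * N (Z a b x y (suc (suc n))))
    Z-three-term a b x y k n = subst₂ (λ l r → k * l ≤ suc k * (r + k * N z₂))
      (trans (cong N (S.solve 2 (λ P E → P S.:- (P S.:- E) S.:= E) refl P E)) (trans (N-numeral (2 * n + 3) _) (trans (cong (e * e *_) (N-* a z₁)) (trans (sym (*-assoc (e * e) (N a) (N z₁))) (cong (λ e → e * e * N a * N z₁) (sym (o-suc n)))))))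
      (trans (N-numeral (c n) _) (trans (cong (c n * c n *_) (trans (N-* (b · b) z₀) (cong (_* N z₀) (N-* b b)))) (sym (*-assoc (c n * c n) _ _))))
      (subst (λ w → k * N (P ⊹ ⁻ z₂) ≤ suc k * (N P + k * w)) (N-neg z₂) (N-triangle k P (⁻ z₂)))
      where
      e : ℕ
      e = 2 * n + 3
      z₀ z₁ z₂ P E : Carrier
      z₀ = Z a b x y n
      z₁ = Z a b x y (suc n)
      z₂ = Z a b x y (suc (suc n))
      P = ι (pos (c n)) · (b · b · z₀)
      E = ι (pos e) · (a · z₁)

    module _ (t x y : Carrier) {{y≢0 : NonZero (N y)}} (t-large : K 10000 ≤ N t) (y≤x : N y ≤ N x)
      (U-large : N t * (N x * N y) ≤ K 7 * N (x · x − y · y))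
      (μ-small : N (quartic x y − t · cross x y) ≤ K 16) where

      private
        a b U V μ : Carrier
        a = quartic x y
        b = cross x y
        U = x · x − y · y
        V = x · y
        μ = a − t · b

        T X Y D B : ℕ
        T = N t
        X = N x
        Y = N y
        D = N (U − t · V)
        B = X * Y * N U

        N-b : N b ≡ B
        N-b = trans (N-* V U) (cong (_* N U) (N-* x y))

        N-tV : N (t · V) ≡ T * (X * Y)
        N-tV = trans (N-* t V) (cong (T *_) (N-* x y))

        UD : N U * D ≤ K 2 * (K 16 * (X * Y * (X * Y)) + K 16)
        UD = begin
          N U * D ≡⟨ N-* U (U − t · V) ⟨
          N (U · (U − t · V)) ≡⟨ cong N (S.solve 3 (λ t x y →
              let U = x S.:* x S.:- y S.:* y in
              U S.:* (U S.:- t S.:* (x S.:* y)) S.:= S.con (pos 4) S.:* (x S.:* y S.:* (x S.:* y)) S.:+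
                (x S.:* x S.:* x S.:* x S.:- S.con (pos 6) S.:* (x S.:* x S.:* (y S.:* y)) S.:+ y S.:* y S.:* y S.:* y S.:- t S.:* (x S.:* y S.:* U))) refl t x y) ⟩
          N (ι (pos 4) · (V · V) ⊹ μ) ≡⟨ trans (sym (*-identityˡ _)) (cong (_* N (ι (pos 4) · (V · V) ⊹ μ)) (sym (K≡ 1))) ⟩
          K 1 * N (ι (pos 4) · (V · V) ⊹ μ) ≤⟨ triangle 1 _ _ ⟩
          K 2 * (N (ι (pos 4) · (V · V)) + K 1 * N μ) ≡⟨ cong₂ (λ p q → K 2 * (p + q)) (trans (N-numeral 4 (V · V)) (cong₂ _*_ (sym (K≡ 16)) (trans (N-* V V) (cong₂ _*_ (N-* x y) (N-* x y))))) (trans (cong (_* N μ) (K≡ 1)) (*-identityˡ _)) ⟩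
          K 2 * (K 16 * (X * Y * (X * Y)) + N μ) ≤⟨ *-monoʳ-≤ (K 2) (+-monoʳ-≤ (K 16 * (X * Y * (X * Y))) μ-small) ⟩
          K 2 * (K 16 * (X * Y * (X * Y)) + K 16) ∎
          where open ≤-Reasoning

        TV : K 300 * (T * (X * Y)) ≤ K 301 * (N U + K 300 * D)
        TV = subst₂ (λ l d → K 300 * l ≤ K 301 * (N U + K 300 * d))
          (trans (cong N (S.solve 2 (λ U W → U S.:+ (W S.:- U) S.:= W) refl U (t · V))) N-tV) (N-minus (t · V) U) (triangle 300 U (t · V − U))

        U-small : ∀ k → K k * N U ≤ K (suc k) * (X * X + K k * (Y * Y))
        U-small k = subst₂ (λ p q → K k * N U ≤ K (suc k) * (p + K k * q)) (N-* x x) (trans (N-neg (y · y)) (N-* y y)) (triangle k (x · x) (⁻ (y · y)))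

        TB : K 1000 * (T * B) ≤ K 1001 * (N a + K 1000 * K 16)
        TB = ≤-trans (≤-reflexive (cong (K 1000 *_) (trans (cong (T *_) (sym N-b)) (trans (sym (N-* t b)) (cong N (S.solve 2 (λ a w → w S.:= a S.:+ S.:- (a S.:- w)) refl a (t · b)))))))
          (≤-trans (triangle 1000 a (⁻ μ)) (*-monoʳ-≤ (K 1001) (+-monoʳ-≤ (N a) (*-monoʳ-≤ (K 1000) (≤-trans (≤-reflexive (N-neg μ)) μ-small)))))

      open Localising.Localisation T X Y (N U) D (N a) t-large y≤x U-large UD TV U-small TB

      private
        z w : ℕ → ℕ
        z n = N (Z a b x y n)
        Ŷ Y′ Δ : ℕ → Carrier
        Ŷ = Z a b x y
        Y′ = Z t 1# x y
        Δ n = b ⋆ n · Y′ n − Ŷ n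
        w n = N (Δ n)

        3y≤x : 3 * Y ≤ X
        3y≤x = ≤-trans (*-monoˡ-≤ Y (subst (3 ≤_) (sym (K≡ 2000)) (ℕ.s≤s (s≤s (s≤s z≤n)))))
          (≤-trans 2000Y≤X (≤-reflexive (trans (cong (_* X) (K≡ 1)) (*-identityˡ X))))

      module Dec = Decay z (N a) B Y T q refl
        (λ k n → subst (λ B → k * (o (suc n) * o (suc n) * N a * z (suc n)) ≤ suc k * (c n * c n * (B * B) * z n + k * z (suc (suc n)))) N-b (Z-three-term a b x y k n))
        (λ n → crude-bound x y n 3y≤x) q-small t-large A-large

      -- Substitute a = tb + μ: the difference obeys the recurrence with tb in place of a, and μ
      -- Z_{n+1} is its inhomogeneous term.
      Δ-suc : ∀ n → Δ (suc (suc n)) ≡ ⁻ (ι (pos (2 * n + 3)) · (t · b · Δ (suc n))) ⊹ (ι (pos (c n)) · (b · b · Δ n) ⊹ ι (pos (2 * n + 3)) · (μ · Ŷ (suc n)))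
      Δ-suc n = trans (cong (λ p → b · (b · b ⋆ n) · (ι (pos (c n)) · p − ι (pos (2 * n + 3)) · (t · Y′ (suc n))) − Ŷ (suc (suc n)))
          (trans (cong (_· Y′ n) (·-identityˡ 1#)) (·-identityˡ (Y′ n))))
        (S.solve 10 (λ t a b p C e Y₀ Y₁ z₀ z₁ →
           b S.:* (b S.:* p) S.:* (C S.:* Y₀ S.:- e S.:* (t S.:* Y₁)) S.:- (C S.:* (b S.:* b S.:* z₀) S.:- e S.:* (a S.:* z₁))
           S.:= S.:- (e S.:* (t S.:* b S.:* (b S.:* p S.:* Y₁ S.:- z₁))) S.:+ (C S.:* (b S.:* b S.:* (p S.:* Y₀ S.:- z₀)) S.:+ e S.:* ((a S.:- t S.:* b) S.:* z₁)))
           refl t a b (b ⋆ n) (ι (pos (c n))) (ι (pos (2 * n + 3))) (Y′ n) (Y′ (suc n)) (Ŷ n) (Ŷ (suc n)))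

      w-0 : w 0 ≡ 0
      w-0 = trans (cong N (trans (cong (_− y) (·-identityˡ y)) (S.solve 1 (λ y → y S.:- y S.:= S.con (pos 0)) refl y))) (N-ι (pos 0))

      w-1 : w 1 ≤ K 16 * Y
      w-1 = ≤-trans (≤-reflexive (trans (cong N (trans (cong₂ (λ p q → p · (q − t · y) − (b · x − a · y)) (·-identityʳ b) (·-identityˡ x))
          (S.solve 5 (λ t a b x y → b S.:* (x S.:- t S.:* y) S.:- (b S.:* x S.:- a S.:* y) S.:= (a S.:- t S.:* b) S.:* y) refl t a b x y))) (N-* μ y)))
        (*-monoˡ-≤ Y μ-small)

      w-recurrence : ∀ n → K 100 * w (suc (suc n)) ≤ K 101 * (o (suc n) * o (suc n) * (T * B) * w (suc n)
          + K 100 * (K 2 * (c n * c n * (B * B) * w n + K 16 * (o (suc n) * o (suc n)) * z (suc n))))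
      w-recurrence n = begin
        K 100 * w (suc (suc n)) ≡⟨ cong (λ d → K 100 * N d) (Δ-suc n) ⟩
        K 100 * N (⁻ M ⊹ (P ⊹ Q)) ≤⟨ triangle 100 (⁻ M) (P ⊹ Q) ⟩
        K 101 * (N (⁻ M) + K 100 * N (P ⊹ Q)) ≤⟨ *-monoʳ-≤ (K 101) (+-mono-≤ (≤-reflexive M-eq) (*-monoʳ-≤ (K 100) rest)) ⟩
        K 101 * (o (suc n) * o (suc n) * (T * B) * w (suc n) + K 100 * (K 2 * (c n * c n * (B * B) * w n + K 16 * (o (suc n) * o (suc n)) * z (suc n)))) ∎
        where
        open ≤-Reasoning
        e : ℕ
        e = 2 * n + 3
        M P Q : Carrier
        M = ι (pos e) · (t · b · Δ (suc n))
        P = ι (pos (c n)) · (b · b · Δ n)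
        Q = ι (pos e) · (μ · Ŷ (suc n))
        M-eq : N (⁻ M) ≡ o (suc n) * o (suc n) * (T * B) * w (suc n)
        M-eq = trans (N-neg M) (trans (N-numeral e _) (trans (cong₂ (λ e w → e * e * w) (sym (o-suc n)) (trans (N-* (t · b) (Δ (suc n))) (cong (_* w (suc n)) (trans (N-* t b) (cong (T *_) N-b)))))
          (sym (*-assoc (o (suc n) * o (suc n)) (T * B) (w (suc n))))))
        P-eq : N P ≡ c n * c n * (B * B) * w n
        P-eq = trans (N-numeral (c n) _) (trans (cong (c n * c n *_) (trans (N-* (b · b) (Δ n)) (cong (_* w n) (trans (N-* b b) (cong₂ _*_ N-b N-b))))) (sym (*-assoc (c n * c n) (B * B) (w n))))
        Q≤ : N Q ≤ K 16 * (o (suc n) * o (suc n)) * z (suc n)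
        Q≤ = begin
          N Q ≡⟨ trans (N-numeral e _) (cong₂ (λ e w → e * e * w) (sym (o-suc n)) (N-* μ (Ŷ (suc n)))) ⟩
          o (suc n) * o (suc n) * (N μ * z (suc n)) ≤⟨ *-monoʳ-≤ (o (suc n) * o (suc n)) (*-monoˡ-≤ (z (suc n)) μ-small) ⟩
          o (suc n) * o (suc n) * (K 16 * z (suc n)) ≡⟨ solve 2 (λ e z → e :* (con 16 :* z) := con 16 :* e :* z) refl (o (suc n) * o (suc n)) (z (suc n)) ⟩
          K 16 * (o (suc n) * o (suc n)) * z (suc n) ∎
        rest : N (P ⊹ Q) ≤ K 2 * (c n * c n * (B * B) * w n + K 16 * (o (suc n) * o (suc n)) * z (suc n))
        rest = begin
          N (P ⊹ Q) ≡⟨ trans (sym (*-identityˡ _)) (cong (_* N (P ⊹ Q)) (sym (K≡ 1))) ⟩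
          K 1 * N (P ⊹ Q) ≤⟨ triangle 1 P Q ⟩
          K 2 * (N P + K 1 * N Q) ≡⟨ cong (λ q → K 2 * (N P + q)) (trans (cong (_* N Q) (K≡ 1)) (*-identityˡ _)) ⟩
          K 2 * (N P + N Q) ≤⟨ *-monoʳ-≤ (K 2) (+-mono-≤ (≤-reflexive P-eq) Q≤) ⟩
          K 2 * (c n * c n * (B * B) * w n + K 16 * (o (suc n) * o (suc n)) * z (suc n)) ∎

      module Per = Dec.Perturbation w w-0 w-1 w-recurrence

      -- The index is shifted by 2 because `z-bound-17` starts at 2.
      Valid : ℕ → ℕ → ℕ → Set
      Valid n α β = N (Y′ (2 + n)) ≢ 0 → α * ((2 + n) !! * (2 + n) !!) ≤ β * N (Y′ (2 + n))

      Zero : ℕ → Set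
      Zero n = N (Y′ n) ≡ 0

      N-⋆ : ∀ n → N (b ⋆ n) ≡ B ^ n
      N-⋆ zero = trans (cong N (sym ι-1)) (N-ι (pos 1))
      N-⋆ (suc n) = trans (N-* b (b ⋆ n)) (cong₂ _*_ N-b (N-⋆ n))

      total : ∀ n → B ^ n * N (Y′ n) ≤ K 2 * (w n + z n)
      total n = begin
        B ^ n * N (Y′ n) ≡⟨ trans (cong (_* N (Y′ n)) (sym (N-⋆ n))) (sym (N-* (b ⋆ n) (Y′ n))) ⟩
        N (b ⋆ n · Y′ n) ≡⟨ cong N (S.solve 2 (λ p q → p S.:= p S.:- q S.:+ q) refl (b ⋆ n · Y′ n) (Ŷ n)) ⟩
        N (Δ n ⊹ Ŷ n) ≡⟨ trans (sym (*-identityˡ _)) (cong (_* N (Δ n ⊹ Ŷ n)) (sym (K≡ 1))) ⟩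
        K 1 * N (Δ n ⊹ Ŷ n) ≤⟨ triangle 1 (Δ n) (Ŷ n) ⟩
        K 2 * (w n + K 1 * z n) ≡⟨ cong (λ q → K 2 * (w n + q)) (trans (cong (_* z n) (K≡ 1)) (*-identityˡ _)) ⟩
        K 2 * (w n + z n) ∎
        where open ≤-Reasoning

      -- If Y_m ≠ 0, its large divisor gives R ≤ 2β(w + z), so it is enough that 4βw ≤ R and 4βz <
      -- R. The second follows from `upper` after multiplication by Tᵐ. The first follows from
      -- `lower`, where `B-large` exchanges T³Y⁴ for one factor B.
      vanish : ∀ {n α β} → Valid n α β →
        K 4 * β * (K 446 * K 17 ^ n) * Y < α * T ^ (2 + n) →
        K 64000 * β * (K 21 * T) ^ (1 + n) ≤ K 975 * α * K 20 ^ (1 + n) * (T * T * T * (Y * Y * Y)) →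
        Zero (2 + n)
      vanish {n} {α} {β} valid upper lower with N (Y′ (2 + n)) ≟ 0
      ... | yes eq = eq
      ... | no ≢0 = ⊥-elim (<-irrefl refl (begin-strict
        K 2 * R ≤⟨ *-monoʳ-≤ (K 2) R≤ ⟩
        K 2 * (β * (K 2 * (w m + z m))) ≡⟨ solve 3 (λ β w z → con 2 :* (β :* (con 2 :* (w :+ z))) := con 4 :* β :* w :+ con 4 :* β :* z) refl β (w m) (z m) ⟩
        K 4 * β * w m + K 4 * β * z m <⟨ +-mono-≤-< w-part z-part ⟩
        R + R ≡⟨ trans (cong (R +_) (sym (+-identityʳ R))) (cong (_* R) (sym (K≡ 2))) ⟩
        K 2 * R ∎))
        where
        open ≤-Reasoning
        m DD R : ℕ
        m = 2 + n
        DD = m !! * m !!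
        R = α * DD * B ^ m
        instance
          T≢0 : NonZero T
          T≢0 = ℕ.>-nonZero (≤-trans (subst (_≤ K 10000) (K≡ 1) (K-≤ (≤ᵇ⇒≤ _ _ _))) t-large)
          DD≢0 : NonZero DD
          DD≢0 = *-nonZero (!!-nonZero m) (!!-nonZero m)
        R≤ : R ≤ β * (K 2 * (w m + z m))
        R≤ = begin
          α * DD * B ^ m ≤⟨ *-monoˡ-≤ (B ^ m) (valid ≢0) ⟩
          β * N (Y′ m) * B ^ m ≡⟨ trans (*-assoc β _ _) (cong (β *_) (*-comm (N (Y′ m)) (B ^ m))) ⟩
          β * (B ^ m * N (Y′ m)) ≤⟨ *-monoʳ-≤ β (total m) ⟩
          β * (K 2 * (w m + z m)) ∎
        z-part : K 4 * β * z m < R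
        z-part = *-cancelˡ-< (T ^ m) _ _ (begin-strict
          T ^ m * (K 4 * β * z m) ≡⟨ solve 3 (λ t β z → t :* (con 4 :* β :* z) := con 4 :* β :* (t :* z)) refl (T ^ m) β (z m) ⟩
          K 4 * β * (T ^ m * z m) ≤⟨ *-monoʳ-≤ (K 4 * β) (Dec.z-bound-17 n) ⟩
          K 4 * β * (K 446 * K 17 ^ n * DD * B ^ m * Y)
            ≡⟨ solve 5 (λ β s d p y → con 4 :* β :* (con 446 :* s :* d :* p :* y) := con 4 :* β :* (con 446 :* s) :* y :* (d :* p)) refl β (K 17 ^ n) DD (B ^ m) Y ⟩
          K 4 * β * (K 446 * K 17 ^ n) * Y * (DD * B ^ m) <⟨ *-monoˡ-< (DD * B ^ m) {{*-nonZero DD≢0 (m^n≢0 B m)}} upper ⟩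
          α * T ^ m * (DD * B ^ m) ≡⟨ solve 4 (λ α t d p → α :* t :* (d :* p) := t :* (α :* d :* p)) refl α (T ^ m) DD (B ^ m) ⟩
          T ^ m * R ∎)
        w-part : K 4 * β * w m ≤ R
        w-part = *-cancelˡ-≤ (K 1000 * K 20 ^ (1 + n)) {{*-nonZero {K 1000} K-nonZero (m^n≢0 (K 20) (1 + n))}} (begin
          K 1000 * p * (K 4 * β * w m) ≡⟨ solve 3 (λ p β w → con 1000 :* p :* (con 4 :* β :* w) := con 4000 :* β :* (p :* w)) refl p β (w m) ⟩
          K 4000 * β * (p * w m) ≤⟨ *-monoʳ-≤ (K 4000 * β) (Per.w-bound (suc n)) ⟩
          K 4000 * β * (DD * (K 16 * Y) * (K 21 * (T * B)) ^ (1 + n))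
            ≡⟨ cong (λ x → K 4000 * β * (DD * (K 16 * Y) * x)) (trans (cong (_^ (1 + n)) (sym (*-assoc (K 21) T B))) (^-distrib-* (K 21 * T) B (1 + n))) ⟩
          K 4000 * β * (DD * (K 16 * Y) * ((K 21 * T) ^ (1 + n) * B ^ (1 + n)))
            ≡⟨ solve 5 (λ β d y t p → con 4000 :* β :* (d :* (con 16 :* y) :* (t :* p)) := con 64000 :* β :* t :* (d :* y :* p)) refl β DD Y ((K 21 * T) ^ (1 + n)) (B ^ (1 + n)) ⟩
          K 64000 * β * (K 21 * T) ^ (1 + n) * (DD * Y * B ^ (1 + n)) ≤⟨ *-monoˡ-≤ (DD * Y * B ^ (1 + n)) lower ⟩
          K 975 * α * p * (T * T * T * (Y * Y * Y)) * (DD * Y * B ^ (1 + n))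
            ≡⟨ solve 6 (λ α p T Y d b → con 975 :* α :* p :* (T :* T :* T :* (Y :* Y :* Y)) :* (d :* Y :* b) := α :* p :* d :* b :* (con 975 :* (T :* T :* T :* (Y :* Y :* Y :* Y)))) refl α p T Y DD (B ^ (1 + n)) ⟩
          α * p * DD * B ^ (1 + n) * (K 975 * (T * T * T * (Y * Y * Y * Y))) ≤⟨ *-monoʳ-≤ (α * p * DD * B ^ (1 + n)) B-large ⟩
          α * p * DD * B ^ (1 + n) * (K 1000 * B) ≡⟨ solve 5 (λ α p d b B → α :* p :* d :* b :* (con 1000 :* B) := con 1000 :* p :* (α :* d :* (B :* b))) refl α p DD (B ^ (1 + n)) B ⟩
          K 1000 * p * R ∎)
          where
          p : ℕ
          p = K 20 ^ (1 + n)

      -- With b = 1 and `c n` ≠ 0 the recurrence runs backwards, so two consecutive zeros lead down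
      -- to Y_0 = y ≠ 0.
      nondegenerate : ∀ n → Zero n → Zero (suc n) → ⊥
      nondegenerate zero N0 _ = ℕ.≢-nonZero⁻¹ Y N0
      nondegenerate (suc n) N1 N2 = nondegenerate n Nn N1
        where
        Nn : N (Y′ n) ≡ 0
        Nn = n≤0⇒n≡0 (*-cancelˡ-≤ (c n * c n) {{*-nonZero cn≢0 cn≢0}} (≤-trans (≤-reflexive (begin
          c n * c n * N (Y′ n) ≡⟨ N-numeral (c n) (Y′ n) ⟨
          N (ι (pos (c n)) · Y′ n) ≡⟨ cong N (trans (S.solve 3 (λ P e q → P S.:= P S.:- e S.:* q S.:+ e S.:* q) refl (ι (pos (c n)) · Y′ n) (ι (pos (2 * n + 3))) (t · Y′ (suc n)))
              (cong₂ (λ p q → p ⊹ ι (pos (2 * n + 3)) · q)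
                (trans (cong (λ p → ι (pos (c n)) · p − ι (pos (2 * n + 3)) · (t · Y′ (suc n))) (sym (trans (cong (_· Y′ n) (·-identityˡ 1#)) (·-identityˡ (Y′ n))))) (N≡0⇒≡0 (Y′ (suc (suc n))) N2))
                (trans (cong (t ·_) (N≡0⇒≡0 (Y′ (suc n)) N1)) (zeroʳ t)))) ⟩
          N (0# ⊹ ι (pos (2 * n + 3)) · 0#) ≡⟨ cong N (trans (⊹-identityˡ _) (zeroʳ _)) ⟩
          N 0# ≡⟨ N-0 ⟩
          0 ∎)) z≤n))
          where
          open ≡-Reasoning
          cn≢0 : NonZero (c n)
          cn≢0 = *-nonZero (+suc-nonZero (4 * n)) (+suc-nonZero (4 * n))

      odd-divisor : ∀ m n → (∀ k l → k + l ≡ n → suc (2 * m) ∣ coef k l) → N (Y′ n) ≢ 0 → suc (2 * m) * suc (2 * m) ≤ N (Y′ n)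
      odd-divisor m n dvd ≢0 = multiple (Z-divisible m n dvd t 1# x y)
        where
        multiple : (∃ λ v → Y′ n ≡ ι (pos (suc (2 * m))) · v) → suc (2 * m) * suc (2 * m) ≤ N (Y′ n)
        multiple (v , eq) = ≤-trans (m≤m*n (suc (2 * m) * suc (2 * m)) (N v) {{ℕ.≢-nonZero Nv≢0}}) (≤-reflexive (sym N-eq))
          where
          N-eq : N (Y′ n) ≡ suc (2 * m) * suc (2 * m) * N v
          N-eq = trans (cong N eq) (N-numeral (suc (2 * m)) v)
          Nv≢0 : N v ≢ 0
          Nv≢0 Nv≡0 = ≢0 (trans N-eq (trans (cong (suc (2 * m) * suc (2 * m) *_) Nv≡0) (*-zeroʳ (suc (2 * m) * suc (2 * m)))))

      valid-small : ∀ n α β m → (∀ k l → k + l ≡ 2 + n → suc (2 * m) ∣ coef k l) → α * ((2 + n) !! * (2 + n) !!) ≤ β * (suc (2 * m) * suc (2 * m)) → Valid n (K α) (K β)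
      valid-small n α β m dvd le ≢0 = subst₂ (λ α β → α * ((2 + n) !! * (2 + n) !!) ≤ β * N (Y′ (2 + n))) (sym (K≡ α)) (sym (K≡ β))
        (≤-trans le (*-monoʳ-≤ β (odd-divisor m (2 + n) dvd ≢0)))

      content-bound : ∀ s ε → ε ≤ 1 → N (Y′ (3 * s + ε)) ≢ 0 → ((2 * s + ε) !! * s !) * ((2 * s + ε) !! * s !) ≤ K 2 ^ s * K 2 ^ s * N (Y′ (3 * s + ε))
      content-bound s ε ε≤1 ≢0 = bound (coef-content s ε ε≤1)
        where
        open ≤-Reasoning
        bound : (∃ λ v → ∃ λ m → (2 * s + ε) !! * s ! ≡ 2 ^ v * suc (2 * m) × v ≤ s × (∀ k l → k + l ≡ 3 * s + ε → suc (2 * m) ∣ coef k l)) →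
          ((2 * s + ε) !! * s !) * ((2 * s + ε) !! * s !) ≤ K 2 ^ s * K 2 ^ s * N (Y′ (3 * s + ε))
        bound (v , m , eq , v≤s , dvd) = begin
          ((2 * s + ε) !! * s !) * ((2 * s + ε) !! * s !) ≡⟨ cong₂ _*_ eq eq ⟩
          2 ^ v * suc (2 * m) * (2 ^ v * suc (2 * m)) ≡⟨ solve 2 (λ a b → a :* b :* (a :* b) := a :* a :* (b :* b)) refl (2 ^ v) (suc (2 * m)) ⟩
          2 ^ v * 2 ^ v * (suc (2 * m) * suc (2 * m)) ≤⟨ *-mono-≤ (sq (^-monoʳ-≤ 2 v≤s)) (odd-divisor m (3 * s + ε) dvd ≢0) ⟩
          2 ^ s * 2 ^ s * N (Y′ (3 * s + ε)) ≡⟨ cong (λ k → k ^ s * k ^ s * N (Y′ (3 * s + ε))) (sym (K≡ 2)) ⟩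
          K 2 ^ s * K 2 ^ s * N (Y′ (3 * s + ε)) ∎

      private
        Dense : ℕ → ℕ → ℕ → Set
        Dense m α β = N (Y′ m) ≢ 0 → α * (m !! * m !!) ≤ β * N (Y′ m)

        27² : ∀ s → K 27 ^ s * K 27 ^ s ≡ K 729 ^ s
        27² s = trans (sym (^-distrib-* (K 27) (K 27) s)) (cong (_^ s) (sym (K-* 27 27)))

        -- Square the density estimate and eliminate the common factor: 2 to the power 2s cancels,
        -- and 27² = 729 remains.
        from-density : ∀ s β {D Jₛ M} → K 4 * (K 2 ^ s * D) ≤ K 27 ^ s * (β * Jₛ) → Jₛ * Jₛ ≤ K 2 ^ s * K 2 ^ s * M →
          K 16 * (D * D) ≤ β * β * K 729 ^ s * M
        from-density s β {D} {Jₛ} {M} dense content = *-cancelˡ-≤ (p * p) {{*-nonZero (m^n≢0 (K 2) s) (m^n≢0 (K 2) s)}} (begin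
          p * p * (K 16 * (D * D)) ≡⟨ solve 2 (λ p D → p :* p :* (con 16 :* (D :* D)) := con 4 :* (p :* D) :* (con 4 :* (p :* D))) refl p D ⟩
          K 4 * (p * D) * (K 4 * (p * D)) ≤⟨ sq dense ⟩
          r * (β * Jₛ) * (r * (β * Jₛ)) ≡⟨ solve 3 (λ r β J → r :* (β :* J) :* (r :* (β :* J)) := β :* β :* (r :* r) :* (J :* J)) refl r β Jₛ ⟩
          β * β * (r * r) * (Jₛ * Jₛ) ≤⟨ *-monoʳ-≤ (β * β * (r * r)) content ⟩
          β * β * (r * r) * (p * p * M) ≡⟨ cong (λ x → β * β * x * (p * p * M)) (27² s) ⟩
          β * β * K 729 ^ s * (p * p * M) ≡⟨ solve 3 (λ b p M → b :* (p :* p :* M) := p :* p :* (b :* M)) refl (β * β * K 729 ^ s) p M ⟩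
          p * p * (β * β * K 729 ^ s * M) ∎)
          where
          open ≤-Reasoning
          p r : ℕ
          p = K 2 ^ s
          r = K 27 ^ s

        dense₀ : ∀ j → Dense (3 * (3 + j) + 0) (K 16) (K 729 ^ (3 + j))
        dense₀ j ≢0 = subst₂ _≤_ (cong (λ m → K 16 * (m !! * m !!)) (sym (+-identityʳ (3 * s))))
          (cong (_* N (Y′ (3 * s + 0))) (*-identityˡ (K 729 ^ s)))
          (from-density s 1 (≤-trans (density j) (≤-reflexive (cong (K 27 ^ s *_) (trans (cong (λ m → m !! * s !) (sym (+-identityʳ (2 * s)))) (sym (*-identityˡ _))))))
            (content-bound s 0 z≤n ≢0))
          where
          s : ℕ
          s = 3 + j

        -- From degree 3s to 3s + 1 the double factorial gains 6s + 1 and the common factor 4s + 1,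
        -- a quotient of at most 3; squared, this is the 9.
        dense₁ : ∀ j → Dense (3 * (3 + j) + 1) (K 16) (K 9 * K 729 ^ (3 + j))
        dense₁ j ≢0 = subst₂ _≤_ (cong (λ m → K 16 * (m !! * m !!)) (+-comm 1 (3 * s)))
          (cong (λ x → x * K 729 ^ s * N (Y′ (3 * s + 1))) (sym (K-* 3 3)))
          (from-density s (K 3) (begin
            K 4 * (K 2 ^ s * (suc (2 * (3 * s)) * (3 * s) !!)) ≡⟨ solve 3 (λ p a D → con 4 :* (p :* (a :* D)) := a :* (con 4 :* (p :* D))) refl (K 2 ^ s) (suc (2 * (3 * s))) ((3 * s) !!) ⟩
            suc (2 * (3 * s)) * (K 4 * (K 2 ^ s * (3 * s) !!)) ≤⟨ *-mono-≤ growth (density j) ⟩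
            K 3 * suc (2 * (2 * s)) * (K 27 ^ s * ((2 * s) !! * s !)) ≡⟨ solve 4 (λ a p d f → con 3 :* a :* (p :* (d :* f)) := p :* (con 3 :* (a :* d :* f))) refl (suc (2 * (2 * s))) (K 27 ^ s) ((2 * s) !!) (s !) ⟩
            K 27 ^ s * (K 3 * (suc (2 * s) !! * s !)) ≡⟨ cong (λ m → K 27 ^ s * (K 3 * (m !! * s !))) (+-comm 1 (2 * s)) ⟩
            K 27 ^ s * (K 3 * ((2 * s + 1) !! * s !)) ∎) (content-bound s 1 ≤-refl ≢0))
          where
          open ≤-Reasoning
          s : ℕ
          s = 3 + j
          growth : suc (2 * (3 * s)) ≤ K 3 * suc (2 * (2 * s))
          growth = subst (λ k → suc (2 * (3 * s)) ≤ k * suc (2 * (2 * s))) (sym (K≡ 3))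
            (≤-trans (m≤m+n (suc (2 * (3 * s))) (6 * s + 2)) (≤-reflexive (E.solve 1 (λ s → E.con 1 E.:+ E.con 2 E.:* (E.con 3 E.:* s) E.:+ (E.con 6 E.:* s E.:+ E.con 2) E.:= E.con 3 E.:* (E.con 1 E.:+ E.con 2 E.:* (E.con 2 E.:* s))) refl s)))
            where
            open import Data.Nat.Solver using (module +-*-Solver)
            module E = +-*-Solver

      core-contradiction : ⊥
      core-contradiction = Windows.contradiction T Y t-large Valid Zero (λ {n} → vanish {n}) nondegenerate
        -- β is the square of n !! over the divisor: 3/3 = 1, 15/3 = 5, 945/315 = 3 and 10395/315 =
        -- 33. The divisors are entered as 2 · 1 + 1 = 3 and 2 · 157 + 1 = 315.
        (valid-small 0 1 1 1 content₂ (≤ᵇ⇒≤ _ _ _)) (valid-small 1 1 25 1 content₃ (≤ᵇ⇒≤ _ _ _))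
        (valid-small 3 1 9 157 content₅ (≤ᵇ⇒≤ _ _ _)) (valid-small 4 1 1089 157 content₆ (≤ᵇ⇒≤ _ _ _))
        (λ j → subst (λ m → Dense m (K 16) (K 729 ^ (3 + j))) (trans (+-identityʳ _) (*-distribˡ-+ 3 3 j)) (dense₀ j))
        (λ j → subst (λ m → Dense m (K 16) (K 9 * K 729 ^ (3 + j))) (trans (cong (_+ 1) (*-distribˡ-+ 3 3 j)) (+-comm (9 + 3 * j) 1)) (dense₁ j))

-- Reduction to x close to ty; roots of quadratic cyclotomic polynomials

module Reductions where
  open Algebras
  open Numerals
  open Coefficients using (*-nonZero)
  open Estimates using (K-≤; K-nonZero; certify; ratio)
  open CoefficientBounds
  open CrudeBound
  open CoreContradiction
  open import Data.Nat.Base as ℕ using (ℕ; _≤_; _<_; NonZero; _+_; _*_)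
  open import Data.Nat.Properties
  open import Data.Integer.Base as ℤ using () renaming (+_ to pos)
  open import Data.Sum using (inj₁; inj₂)
  open import Data.Empty using (⊥)
  open import Relation.Binary.PropositionalEquality
  open KSolver using (solve; con; _:+_; _:*_; _:=_)

  module CyclotomicRoots (A : ℤAlgebra) where
    open ℤAlgebra A using (Carrier; ι; 0#; 1#; ι-0; ι-1; module Solver)
      renaming (_+_ to _⊹_; _*_ to _·_; _-_ to _−_; _^_ to _⋆_)
    open Solver using () renaming (solve to solveA; con to conA; _:+_ to _⊕_; _:-_ to _⊖_; _:*_ to _⊗_; _:=_ to _⊜_)

    private
      1ι : Carrier
      1ι = ι (pos 1)

      -- Applied with w = zⁿ and m a factor of zⁿ - 1 that vanishes at z; c is the complementary
      -- factor, given explicitly each time.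
      vanishing : ∀ {w m c} → m ≡ 0# → w ≡ 1ι ⊹ m · c → w ≡ 1ι
      vanishing {w} {m} {c} m≡0 eq = trans eq (trans (cong (λ m → 1ι ⊹ m · c) (trans m≡0 (sym ι-0)))
        (solveA 1 (λ c → conA (pos 1) ⊕ conA (pos 0) ⊗ c ⊜ conA (pos 1)) refl c))

    private
      to-⋆ : (f : Carrier → Carrier) → f 1ι ≡ 1ι → f 1# ≡ 1#
      to-⋆ f = subst (λ u → f u ≡ u) ι-1

    root-1 : ∀ z → z − 1ι ≡ 0# → z ⋆ 2 ≡ 1#
    root-1 z eq = to-⋆ (λ u → z · (z · u)) (vanishing {c = z ⊹ 1ι} eq (solveA 1 (λ z → let 1p = conA (pos 1) in z ⊗ (z ⊗ 1p) ⊜ 1p ⊕ (z ⊖ 1p) ⊗ (z ⊕ 1p)) refl z))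

    root-2 : ∀ z → z ⊹ 1ι ≡ 0# → z ⋆ 2 ≡ 1#
    root-2 z eq = to-⋆ (λ u → z · (z · u)) (vanishing {c = z − 1ι} eq (solveA 1 (λ z → let 1p = conA (pos 1) in z ⊗ (z ⊗ 1p) ⊜ 1p ⊕ (z ⊕ 1p) ⊗ (z ⊖ 1p)) refl z))

    root-3 : ∀ z → (z · z − ι ℤ.-1ℤ · z) ⊹ 1ι ≡ 0# → z ⋆ 3 ≡ 1#
    root-3 z eq = to-⋆ (λ u → z · (z · (z · u))) (vanishing {c = z − 1ι} eq (solveA 1 (λ z → let 1p = conA (pos 1) in
      z ⊗ (z ⊗ (z ⊗ 1p)) ⊜ 1p ⊕ ((z ⊗ z ⊖ conA ℤ.-1ℤ ⊗ z) ⊕ 1p) ⊗ (z ⊖ 1p)) refl z))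

    root-4 : ∀ z → (z · z − ι (pos 0) · z) ⊹ 1ι ≡ 0# → z ⋆ 4 ≡ 1#
    root-4 z eq = to-⋆ (λ u → z · (z · (z · (z · u)))) (vanishing {c = z · z − 1ι} eq (solveA 1 (λ z → let 1p = conA (pos 1) in
      z ⊗ (z ⊗ (z ⊗ (z ⊗ 1p))) ⊜ 1p ⊕ ((z ⊗ z ⊖ conA (pos 0) ⊗ z) ⊕ 1p) ⊗ (z ⊗ z ⊖ 1p)) refl z))

    root-6 : ∀ z → (z · z − 1ι · z) ⊹ 1ι ≡ 0# → z ⋆ 6 ≡ 1#
    root-6 z eq = to-⋆ (λ u → z · (z · (z · (z · (z · (z · u)))))) (vanishing {c = z · z · z · z ⊹ z · z · z − z − 1ι} eq (solveA 1 (λ z → let 1p = conA (pos 1) in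
      z ⊗ (z ⊗ (z ⊗ (z ⊗ (z ⊗ (z ⊗ 1p))))) ⊜ 1p ⊕ ((z ⊗ z ⊖ 1p ⊗ z) ⊕ 1p) ⊗ (z ⊗ z ⊗ z ⊗ z ⊕ z ⊗ z ⊗ z ⊖ z ⊖ 1p)) refl z))

    double-1 : ∀ z → (z − 1ι) · (z − 1ι) ≡ (z · z − ι (pos 2) · z) ⊹ 1ι
    double-1 = solveA 1 (λ z → let 1p = conA (pos 1) in (z ⊖ 1p) ⊗ (z ⊖ 1p) ⊜ (z ⊗ z ⊖ conA (pos 2) ⊗ z) ⊕ 1p) refl

    double-2 : ∀ z → (z ⊹ 1ι) · (z ⊹ 1ι) ≡ (z · z − ι (ℤ.- pos 2) · z) ⊹ 1ι
    double-2 = solveA 1 (λ z → let 1p = conA (pos 1) in (z ⊕ 1p) ⊗ (z ⊕ 1p) ⊜ (z ⊗ z ⊖ conA (ℤ.- pos 2) ⊗ z) ⊕ 1p) refl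

  module Reduction (A : ℤAlgebra) (𝒩 : Norm A) where
    open ℤAlgebra A using (Carrier; ι; 0#; ι-1; module Solver)
      renaming (_+_ to _⊹_; _*_ to _·_; -_ to ⁻_; _-_ to _−_; _^_ to _⋆_)
    open Norm 𝒩
    open ExactParameter A 𝒩
    open Contradiction A 𝒩 using (triangle; N-numeral; N-minus; core-contradiction)
    private module S = Solver

    private
      FS : ∀ {n} → S.Polynomial n → S.Polynomial n → S.Polynomial n → S.Polynomial n
      FS t x y = x S.:* x S.:* x S.:* x S.:- S.con (pos 6) S.:* (x S.:* x S.:* (y S.:* y)) S.:+ y S.:* y S.:* y S.:* y
        S.:- t S.:* (x S.:* y S.:* (x S.:* x S.:- y S.:* y))

    thue : Carrier → Carrier → Carrier → Carrier
    thue t x y = quartic x y − t · cross x y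

    thue-powers : ∀ t x y →
      ((x ⋆ 4 − t · (x ⋆ 3 · y)) − ι (pos 6) · (x ⋆ 2 · y ⋆ 2)) ⊹ (t · (x · y ⋆ 3) ⊹ y ⋆ 4) ≡ thue t x y
    thue-powers t x y = trans (cong (λ u →
        ((x · (x · (x · (x · u))) − t · (x · (x · (x · u)) · y)) − ι (pos 6) · (x · (x · u) · (y · (y · u))))
          ⊹ (t · (x · (y · (y · (y · u)))) ⊹ y · (y · (y · (y · u))))) (sym ι-1))
      (S.solve 3 (λ t x y → let 1p = S.con (pos 1) in
      ((x S.:* (x S.:* (x S.:* (x S.:* 1p))) S.:- t S.:* (x S.:* (x S.:* (x S.:* 1p)) S.:* y)) S.:- S.con (pos 6) S.:* (x S.:* (x S.:* 1p) S.:* (y S.:* (y S.:* 1p))))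
        S.:+ (t S.:* (x S.:* (y S.:* (y S.:* (y S.:* 1p)))) S.:+ y S.:* (y S.:* (y S.:* (y S.:* 1p)))) S.:= FS t x y) refl t x y)

    thue-0ʳ : ∀ t x → thue t x (ι (pos 0)) ≡ x · x · x · x
    thue-0ʳ = S.solve 2 (λ t x → FS t x (S.con (pos 0)) S.:= x S.:* x S.:* x S.:* x) refl

    thue-0ˡ : ∀ t y → thue t (ι (pos 0)) y ≡ y · y · y · y
    thue-0ˡ = S.solve 2 (λ t y → FS t (S.con (pos 0)) y S.:= y S.:* y S.:* y S.:* y) refl

    thue-rotate : ∀ t x y → thue t (⁻ y) x ≡ thue t x y
    thue-rotate = S.solve 3 (λ t x y → FS t (S.:- y) x S.:= FS t x y) refl

    thue-diagonal : ∀ t x y → thue t (x − y) (x ⊹ y) ≡ ⁻ (ι (pos 4) · thue t x y)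
    thue-diagonal = S.solve 3 (λ t x y → FS t (x S.:- y) (x S.:+ y) S.:= S.:- (S.con (pos 4) S.:* FS t x y)) refl

    module _ (t : Carrier) (t-large : K 10000 ≤ N t) where

      -- Rotation changes only the signs of U and V, so Y ≤ X may be assumed. The bound 16 leaves
      -- room for the diagonal substitution, which multiplies N(F_t) by 16.
      no-steep-solution : ∀ x y → NonZero (N x) → NonZero (N y) → N t * (N x * N y) ≤ K 7 * N (x · x − y · y) → N (thue t x y) ≤ K 16 → ⊥
      no-steep-solution x y x≢0 y≢0 steep small with ≤-total (N y) (N x)
      ... | inj₁ y≤x = core-contradiction t x y {{y≢0}} t-large y≤x steep small
      ... | inj₂ x≤y = core-contradiction t (⁻ y) x {{x≢0}} t-large (≤-trans x≤y (≤-reflexive (sym (N-neg y))))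
        (subst₂ _≤_ (cong (N t *_) (trans (*-comm (N x) (N y)) (cong (_* N x) (sym (N-neg y)))))
          (cong (K 7 *_) (cong N (S.solve 2 (λ x y → x S.:* x S.:- y S.:* y S.:= S.:- ((S.:- y) S.:* (S.:- y) S.:- x S.:* x)) refl x y) ∙ N-neg _)) steep)
        (subst (_≤ K 16) (cong N (sym (thue-rotate t x y))) small)
        where
        _∙_ : ∀ {a b c : ℕ} → a ≡ b → b ≡ c → a ≡ c
        _∙_ = trans

      -- If U is not large against tV, then U - tV is, and U(U - tV) = 4V² + F_t forces U to be
      -- about as small as 4V/t. After the diagonal substitution this is the steep case.
      no-solution : ∀ x y → NonZero (N x) → NonZero (N y) → N (thue t x y) ≤ K 1 → ⊥
      no-solution x y x≢0 y≢0 small with ≤-total (T * (X * Y)) (K 7 * N U)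
        where
        U : Carrier
        U = x · x − y · y
        T X Y : ℕ
        T = N t
        X = N x
        Y = N y
      ... | inj₁ steep = no-steep-solution x y x≢0 y≢0 steep (≤-trans small (K-≤ (≤ᵇ⇒≤ 1 16 _)))
      ... | inj₂ flat = no-steep-solution (x − y) (x ⊹ y)
            (m*n≢0⇒m≢0 (N (x − y)) {{U′≢0}}) (m*n≢0⇒n≢0 (N (x − y)) {{U′≢0}}) steep′
            (≤-trans (≤-reflexive (trans (cong N (thue-diagonal t x y)) (trans (N-neg _) (trans (N-numeral 4 μ) (cong (_* N μ) (sym (K≡ 16)))))))
              (≤-trans (*-monoʳ-≤ (K 16) small) (≤-reflexive (trans (cong (K 16 *_) (K≡ 1)) (*-identityʳ (K 16))))))
        where
        U V μ : Carrier
        U = x · x − y · y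
        V = x · y
        μ = thue t x y
        T X Y D W : ℕ
        T = N t
        X = N x
        Y = N y
        W = X * Y
        D = N (U − t · V)
        instance
          W≢0 : NonZero W
          W≢0 = *-nonZero x≢0 y≢0
          T≢0 : NonZero T
          T≢0 = ℕ.>-nonZero (≤-trans (subst (_≤ K 10000) (K≡ 1) (K-≤ (≤ᵇ⇒≤ _ _ _))) t-large)
        open ≤-Reasoning
        product : U · (U − t · V) ≡ ι (pos 4) · (V · V) ⊹ μ
        product = S.solve 3 (λ t x y →
          let U = x S.:* x S.:- y S.:* y in
          U S.:* (U S.:- t S.:* (x S.:* y)) S.:= S.con (pos 4) S.:* (x S.:* y S.:* (x S.:* y)) S.:+ FS t x y) refl t x y
        N-4VV : N (ι (pos 4) · (V · V)) ≡ K 16 * (W * W)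
        N-4VV = trans (N-numeral 4 (V · V)) (cong₂ _*_ (sym (K≡ 16)) (trans (N-* V V) (cong₂ _*_ (N-* x y) (N-* x y))))
        K1≤WW : K 1 ≤ W * W
        K1≤WW = subst (_≤ W * W) (sym (K≡ 1)) (*-mono-≤ (ℕ.>-nonZero⁻¹ W) (ℕ.>-nonZero⁻¹ W))
        K1* : ∀ {a b} → K 1 * a ≤ b → a ≤ b
        K1* {a} {b} = subst (_≤ b) (trans (cong (_* a) (K≡ 1)) (*-identityˡ a))
        UD : N U * D ≤ K 34 * (W * W)
        UD = begin
          N U * D ≡⟨ trans (sym (N-* U (U − t · V))) (cong N product) ⟩
          N (ι (pos 4) · (V · V) ⊹ μ) ≤⟨ K1* (triangle 1 _ μ) ⟩
          K 2 * (N (ι (pos 4) · (V · V)) + K 1 * N μ) ≤⟨ *-monoʳ-≤ (K 2) (+-mono-≤ (≤-reflexive N-4VV) (*-monoʳ-≤ (K 1) (≤-trans small K1≤WW))) ⟩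
          K 2 * (K 16 * (W * W) + K 1 * (W * W)) ≡⟨ solve 1 (λ w → con 2 :* (con 16 :* w :+ con 1 :* w) := con 34 :* w) refl (W * W) ⟩
          K 34 * (W * W) ∎
        TW : T * W ≤ K 2 * (N U + D)
        TW = begin
          T * W ≡⟨ trans (cong (T *_) (sym (N-* x y))) (trans (sym (N-* t V)) (cong N (S.solve 2 (λ U W → W S.:= U S.:+ (W S.:- U)) refl U (t · V)))) ⟩
          N (U ⊹ (t · V − U)) ≤⟨ K1* (triangle 1 U (t · V − U)) ⟩
          K 2 * (N U + K 1 * N (t · V − U)) ≡⟨ cong (λ d → K 2 * (N U + d)) (trans (cong (_* N (t · V − U)) (K≡ 1)) (trans (*-identityˡ _) (N-minus (t · V) U))) ⟩
          K 2 * (N U + D) ∎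
        D-large : K 5 * (T * W) ≤ K 14 * D
        D-large = certify (K 0) (+-mono-≤ (*-monoʳ-≤ (K 7) TW) (*-monoʳ-≤ (K 2) flat))
          (solve 3 (λ w u d → con 5 :* w :+ (con 7 :* (con 2 :* (u :+ d)) :+ con 2 :* w) :+ con 0 := con 14 :* d :+ (con 7 :* w :+ con 2 :* (con 7 :* u))) refl (T * W) (N U) D)
        TU : K 5 * (T * N U) ≤ K 476 * W
        TU = *-cancelˡ-≤ W (begin
          W * (K 5 * (T * N U)) ≡⟨ solve 3 (λ w t u → w :* (con 5 :* (t :* u)) := u :* (con 5 :* (t :* w))) refl W T (N U) ⟩
          N U * (K 5 * (T * W)) ≤⟨ *-monoʳ-≤ (N U) D-large ⟩
          N U * (K 14 * D) ≡⟨ solve 2 (λ u d → u :* (con 14 :* d) := con 14 :* (u :* d)) refl (N U) D ⟩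
          K 14 * (N U * D) ≤⟨ *-monoʳ-≤ (K 14) UD ⟩
          K 14 * (K 34 * (W * W)) ≡⟨ solve 1 (λ w → con 14 :* (con 34 :* (w :* w)) := w :* (con 476 :* w)) refl W ⟩
          W * (K 476 * W) ∎)
        N-U′ : N (x − y) * N (x ⊹ y) ≡ N U
        N-U′ = trans (sym (N-* (x − y) (x ⊹ y))) (cong N (S.solve 2 (λ x y → (x S.:- y) S.:* (x S.:+ y) S.:= x S.:* x S.:- y S.:* y) refl x y))
        -- Neither x - y nor x + y may vanish in the steep case. U = 0 would give 4V² = -F_t, of
        -- squared sizes at least 16 and at most 1.
        U≢0 : N U ≢ 0
        U≢0 U≡0 = <⇒≱ (K16>1) (begin
          K 16 ≤⟨ ≤-trans (≤-reflexive (sym (*-identityʳ (K 16)))) (*-monoʳ-≤ (K 16) (subst (_≤ W * W) (K≡ 1) K1≤WW)) ⟩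
          K 16 * (W * W) ≡⟨ N-4VV ⟨
          N (ι (pos 4) · (V · V)) ≡⟨ cong N (trans (S.solve 2 (λ p m → p S.:= p S.:+ m S.:- m) refl (ι (pos 4) · (V · V)) μ) (cong (_− μ) zero-sum)) ⟩
          N (0# − μ) ≡⟨ trans (cong N (ℤAlgebra.+-identityˡ A _)) (N-neg μ) ⟩
          N μ ≤⟨ small ⟩
          K 1 ∎)
          where
          K16>1 : K 1 < K 16
          K16>1 = subst₂ _<_ (sym (K≡ 1)) (sym (K≡ 16)) (≤ᵇ⇒≤ 2 16 _)
          zero-sum : ι (pos 4) · (V · V) ⊹ μ ≡ 0#
          zero-sum = N≡0⇒≡0 _ (trans (cong N (sym product)) (trans (N-* U _) (cong (_* D) U≡0)))
        U′≢0 : NonZero (N (x − y) * N (x ⊹ y))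
        U′≢0 = ℕ.≢-nonZero λ eq → U≢0 (trans (sym N-U′) eq)
        steep′ : T * (N (x − y) * N (x ⊹ y)) ≤ K 7 * N ((x − y) · (x − y) − (x ⊹ y) · (x ⊹ y))
        steep′ = begin
          T * (N (x − y) * N (x ⊹ y)) ≡⟨ cong (T *_) N-U′ ⟩
          -- 14 · 34/5 = 476/5 is below 112 = 7 · 16, so the threshold 7 that separates the two
          -- cases is met again after the substitution.
          T * N U ≤⟨ K1* (ratio 5 476 1 112 TU (≤ᵇ⇒≤ _ _ _)) ⟩
          K 112 * W ≡⟨ solve 1 (λ w → con 112 :* w := con 7 :* (con 16 :* w)) refl W ⟩
          K 7 * (K 16 * W) ≡⟨ cong (λ k → K 7 * (k * W)) (K≡ 16) ⟩
          K 7 * (16 * W) ≡⟨ cong (K 7 *_) (trans (cong (16 *_) (sym (N-* x y))) (trans (sym (N-numeral 4 V)) (trans (sym (N-neg _)) (cong N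
               (S.solve 2 (λ x y → S.:- (S.con (pos 4) S.:* (x S.:* y)) S.:= (x S.:- y) S.:* (x S.:- y) S.:- (x S.:+ y) S.:* (x S.:+ y)) refl x y))))) ⟩
          K 7 * N ((x − y) · (x − y) − (x ⊹ y) · (x ⊹ y)) ∎

-- The ring of integers and its norm

module QuadraticRing where
  open import Defs
  open Algebras
  open CoefficientBounds using (Norm)
  open import Data.Nat.Base as ℕ using (ℕ; zero; suc; z≤n)
  import Data.Nat.Properties as ℕ
  open import Data.Nat.DivMod using (m≡m%n+[m/n]*n; m*n/n≡m)
  open import Data.Integer.Base as ℤ using (+_; -[1+_]; ∣_∣; _+_; _*_; _-_; -_; _≤_; +≤+)
  import Data.Integer.Properties as ℤ
  open import Data.Integer.Solver using (module +-*-Solver)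
  open import Data.Bool.Base using (true; false; T)
  open import Data.Product using (_,_; ∃; proj₁; proj₂)
  open import Relation.Binary.PropositionalEquality
  open import Relation.Binary.PropositionalEquality.Algebra using (isMagma)
  open import Algebra.Structures using (IsCommutativeRing)
  open +-*-Solver

  private
    pair : ∀ {a b c e} → a ≡ c → b ≡ e → (a + b ω) ≡ (c + e ω)
    pair = cong₂ _+_ω

  module Ring (d : ℕ) where
    private
      mulO-comm : ∀ x y → mulO d x y ≡ mulO d y x
      mulO-comm (a + b ω) (c + e ω) = pair
        (solve 5 (λ a b c e n → a :* c :- b :* e :* n := c :* a :- e :* b :* n) refl a b c e (nm d))
        (solve 5 (λ a b c e r → a :* e :+ b :* c :+ b :* e :* r := c :* b :+ e :* a :+ e :* b :* r) refl a b c e (tr d))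

      mulO-identityˡ : ∀ x → mulO d oneO x ≡ x
      mulO-identityˡ (a + b ω) = pair
        (solve 3 (λ a b n → con (+ 1) :* a :- con (+ 0) :* b :* n := a) refl a b (nm d))
        (solve 3 (λ a b r → con (+ 1) :* b :+ con (+ 0) :* a :+ con (+ 0) :* b :* r := b) refl a b (tr d))

      mulO-distribˡ : ∀ x y z → mulO d x (addO y z) ≡ addO (mulO d x y) (mulO d x z)
      mulO-distribˡ (a + b ω) (c + e ω) (f + g ω) = pair
        (solve 7 (λ a b c e f g n → a :* (c :+ f) :- b :* (e :+ g) :* n := a :* c :- b :* e :* n :+ (a :* f :- b :* g :* n)) refl a b c e f g (nm d))
        (solve 7 (λ a b c e f g r → a :* (e :+ g) :+ b :* (c :+ f) :+ b :* (e :+ g) :* r := a :* e :+ b :* c :+ b :* e :* r :+ (a :* g :+ b :* f :+ b :* g :* r)) refl a b c e f g (tr d))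

      mulO-assoc : ∀ x y z → mulO d (mulO d x y) z ≡ mulO d x (mulO d y z)
      mulO-assoc (a + b ω) (c + e ω) (f + g ω) = pair
        (solve 8 (λ a b c e f g n r →
          (a :* c :- b :* e :* n) :* f :- (a :* e :+ b :* c :+ b :* e :* r) :* g :* n
          := a :* (c :* f :- e :* g :* n) :- b :* (c :* g :+ e :* f :+ e :* g :* r) :* n) refl a b c e f g (nm d) (tr d))
        (solve 8 (λ a b c e f g n r →
          (a :* c :- b :* e :* n) :* g :+ (a :* e :+ b :* c :+ b :* e :* r) :* f :+ (a :* e :+ b :* c :+ b :* e :* r) :* g :* r
          := a :* (c :* g :+ e :* f :+ e :* g :* r) :+ b :* (c :* f :- e :* g :* n) :+ b :* (c :* g :+ e :* f :+ e :* g :* r) :* r) refl a b c e f g (nm d) (tr d))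

    -- Opaque copies of the operations of Defs: record η would otherwise expand every product into coordinates.
    opaque
      infixl 6 _⊞_
      infixl 7 _⊠_
      infix 8 ⊟_
      _⊞_ _⊠_ : 𝒪 → 𝒪 → 𝒪
      _⊞_ = addO
      _⊠_ = mulO d
      ⊟_ : 𝒪 → 𝒪
      ⊟_ = negO

      addO≡⊞ : ∀ x y → addO x y ≡ x ⊞ y
      addO≡⊞ x y = refl

      mulO≡⊠ : ∀ x y → mulO d x y ≡ x ⊠ y
      mulO≡⊠ x y = refl

      negO≡⊟ : ∀ x → negO x ≡ ⊟ x
      negO≡⊟ x = refl

      isCommutativeRing : IsCommutativeRing _≡_ _⊞_ _⊠_ ⊟_ zeroO oneO
      isCommutativeRing = record
        { isRing = record
          { +-isAbelianGroup = record
            { isGroup = record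
              { isMonoid = record
                { isSemigroup = record
                  { isMagma = isMagma addO
                  ; assoc = λ x y z → pair (ℤ.+-assoc (re x) (re y) (re z)) (ℤ.+-assoc (im x) (im y) (im z)) }
                ; identity = (λ x → pair (ℤ.+-identityˡ (re x)) (ℤ.+-identityˡ (im x))) , (λ x → pair (ℤ.+-identityʳ (re x)) (ℤ.+-identityʳ (im x))) }
              ; inverse = (λ x → pair (ℤ.+-inverseˡ (re x)) (ℤ.+-inverseˡ (im x))) , (λ x → pair (ℤ.+-inverseʳ (re x)) (ℤ.+-inverseʳ (im x)))
              ; ⁻¹-cong = cong negO }
            ; comm = λ x y → pair (ℤ.+-comm (re x) (re y)) (ℤ.+-comm (im x) (im y)) }
          ; *-cong = cong₂ (mulO d)
          ; *-assoc = mulO-assoc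
          ; *-identity = mulO-identityˡ , (λ x → trans (mulO-comm x oneO) (mulO-identityˡ x))
          ; distrib = mulO-distribˡ , (λ x y z → trans (mulO-comm (addO y z) x) (trans (mulO-distribˡ x y z) (cong₂ addO (mulO-comm x y) (mulO-comm x z)))) }
        ; *-comm = mulO-comm }

      fromℤ-+ : ∀ m n → fromℤ (m + n) ≡ fromℤ m ⊞ fromℤ n
      fromℤ-+ m n = refl

      fromℤ-* : ∀ m n → fromℤ (m * n) ≡ fromℤ m ⊠ fromℤ n
      fromℤ-* m n = pair (solve 3 (λ m n k → m :* n := m :* n :- con (+ 0) :* con (+ 0) :* k) refl m n (nm d))
        (solve 3 (λ m n k → con (+ 0) := m :* con (+ 0) :+ con (+ 0) :* n :+ con (+ 0) :* con (+ 0) :* k) refl m n (tr d))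

      fromℤ-neg : ∀ m → fromℤ (- m) ≡ ⊟ fromℤ m
      fromℤ-neg m = refl

    𝒪A : ℤAlgebra
    𝒪A = record
      { Carrier = 𝒪 ; _+_ = _⊞_ ; _*_ = _⊠_ ; -_ = ⊟_ ; 0# = zeroO ; 1# = oneO
      ; isCommutativeRing = isCommutativeRing
      ; ι = fromℤ ; ι-+ = fromℤ-+ ; ι-* = fromℤ-* ; ι-neg = fromℤ-neg ; ι-0 = refl ; ι-1 = refl }

  -- 4 nm - tr² is d or 4d, minus the discriminant of the minimal polynomial of ω. Its positivity
  -- makes the norm form definite.
  discriminant : ∀ d → 1 ℕ.≤ d → ∃ λ δ → + 4 * nm d - tr d * tr d ≡ + suc δ
  discriminant d@(suc d′) _ with d ℕ.% 4 ℕ.≡ᵇ 3 in eq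
  ... | false = d′ ℕ.+ 3 ℕ.* d , trans (ℤ.+-identityʳ (+ 4 * + d)) (sym (ℤ.pos-* 4 d))
  ... | true = d′ , (begin
      + 4 * + ((d ℕ.+ 1) ℕ./ 4) - + 1 ≡⟨ cong (_- + 1) (sym (ℤ.pos-* 4 ((d ℕ.+ 1) ℕ./ 4))) ⟩
      + (4 ℕ.* ((d ℕ.+ 1) ℕ./ 4)) - + 1 ≡⟨ cong (λ n → + n - + 1) quarter ⟩
      + (d ℕ.+ 1) - + 1 ≡⟨ cong (λ n → + n - + 1) (ℕ.+-comm d 1) ⟩
      + suc d - + 1 ≡⟨⟩
      + d ∎)
    where
    open ≡-Reasoning
    d%4 : d ℕ.% 4 ≡ 3
    d%4 = ℕ.≡ᵇ⇒≡ (d ℕ.% 4) 3 (subst T (sym eq) _)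
    d+1 : d ℕ.+ 1 ≡ suc (d ℕ./ 4) ℕ.* 4
    d+1 = trans (cong (ℕ._+ 1) (trans (m≡m%n+[m/n]*n d 4) (cong (ℕ._+ d ℕ./ 4 ℕ.* 4) d%4))) (ℕ.+-comm (3 ℕ.+ d ℕ./ 4 ℕ.* 4) 1)
    quarter : 4 ℕ.* ((d ℕ.+ 1) ℕ./ 4) ≡ d ℕ.+ 1
    quarter = trans (ℕ.*-comm 4 ((d ℕ.+ 1) ℕ./ 4)) (trans (cong (ℕ._* 4) (trans (cong (ℕ._/ 4) d+1) (m*n/n≡m (suc (d ℕ./ 4)) 4))) (sym d+1))

  module NormForm (d : ℕ) (1≤d : 1 ℕ.≤ d) where
    open Ring d using (𝒪A; addO≡⊞; mulO≡⊠; negO≡⊟)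

    δ : ℕ
    δ = proj₁ (discriminant d 1≤d)

    complete-square : ∀ a b → + 4 * absSq d (a + b ω) ≡ (+ 2 * a + tr d * b) * (+ 2 * a + tr d * b) + + suc δ * (b * b)
    complete-square a b = trans
      (solve 4 (λ a b r n → con (+ 4) :* (a :* a :+ r :* a :* b :+ n :* b :* b)
         := (con (+ 2) :* a :+ r :* b) :* (con (+ 2) :* a :+ r :* b) :+ (con (+ 4) :* n :- r :* r) :* (b :* b)) refl a b (tr d) (nm d))
      (cong (λ D → (+ 2 * a + tr d * b) * (+ 2 * a + tr d * b) + D * (b * b)) (proj₂ (discriminant d 1≤d)))

    square-abs : ∀ i → i * i ≡ + (∣ i ∣ ℕ.* ∣ i ∣)
    square-abs (+ n) = sym (ℤ.pos-* n n)
    square-abs -[1+ n ] = refl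

    four-absSq : ∀ a b → + 4 * absSq d (a + b ω) ≡ + (∣ + 2 * a + tr d * b ∣ ℕ.* ∣ + 2 * a + tr d * b ∣ ℕ.+ suc δ ℕ.* (∣ b ∣ ℕ.* ∣ b ∣))
    four-absSq a b = trans (complete-square a b) (cong₂ _+_ (square-abs (+ 2 * a + tr d * b)) (trans (cong (+ suc δ *_) (square-abs b)) (sym (ℤ.pos-* (suc δ) (∣ b ∣ ℕ.* ∣ b ∣)))))

    absSq≥0 : ∀ z → + 0 ≤ absSq d z
    absSq≥0 (a + b ω) = ℤ.*-cancelˡ-≤-pos (+ 0) (absSq d (a + b ω)) (+ 4) (subst (+ 0 ≤_) (sym (four-absSq a b)) (+≤+ z≤n))

    N : 𝒪 → ℕ
    N z = ∣ absSq d z ∣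

    N-absSq : ∀ z → + N z ≡ absSq d z
    N-absSq z = ℤ.0≤i⇒+∣i∣≡i (absSq≥0 z)

    absSq-* : ∀ x y → absSq d (mulO d x y) ≡ absSq d x * absSq d y
    absSq-* (a + b ω) (c + e ω) = solve 6 (λ a b c e r n →
      let p = a :* c :- b :* e :* n
          q = a :* e :+ b :* c :+ b :* e :* r in
      p :* p :+ r :* p :* q :+ n :* q :* q := (a :* a :+ r :* a :* b :+ n :* b :* b) :* (c :* c :+ r :* c :* e :+ n :* e :* e)) refl a b c e (tr d) (nm d)

    -- The defect in the weighted triangle inequality is the norm of x - ky; k = 1 is the
    -- parallelogram law.
    parallelogram : ∀ k x y → + k * absSq d (addO x y) + absSq d ((re x - + k * re y) + (im x - + k * im y) ω)
      ≡ + suc k * (absSq d x + + k * absSq d y)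
    parallelogram k (a + b ω) (c + e ω) = solve 7 (λ k a b c e r n →
      let f = λ p q → p :* p :+ r :* p :* q :+ n :* q :* q in
      k :* f (a :+ c) (b :+ e) :+ f (a :- k :* c) (b :- k :* e) := (con (+ 1) :+ k) :* (f a b :+ k :* f c e)) refl (+ k) a b c e (tr d) (nm d)

    norm : Norm 𝒪A
    norm = record
      { N = N
      ; N-* = λ x y → trans (cong N (sym (mulO≡⊠ x y))) (trans (cong ∣_∣ (absSq-* x y)) (ℤ.abs-* (absSq d x) (absSq d y)))
      ; N-ι = λ n → trans (cong ∣_∣ (solve 3 (λ n r m → n :* n :+ r :* n :* con (+ 0) :+ m :* con (+ 0) :* con (+ 0) := n :* n) refl n (tr d) (nm d))) (ℤ.abs-* n n)
      ; N-neg = λ z → trans (cong N (sym (negO≡⊟ z))) (cong ∣_∣ (solve 4 (λ a b r n → (:- a) :* (:- a) :+ r :* (:- a) :* (:- b) :+ n :* (:- b) :* (:- b) := a :* a :+ r :* a :* b :+ n :* b :* b) refl (re z) (im z) (tr d) (nm d)))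
      ; N≡0⇒≡0 = zero-norm
      ; N-triangle = λ k x y → subst (λ z → k ℕ.* N z ℕ.≤ suc k ℕ.* (N x ℕ.+ k ℕ.* N y)) (addO≡⊞ x y) (triangle k x y) }
      where
      zero-norm : ∀ z → N z ≡ 0 → z ≡ zeroO
      zero-norm (a + b ω) N≡0 = pair a≡0 b≡0
        where
        s t : ℕ
        s = ∣ + 2 * a + tr d * b ∣
        t = ∣ b ∣
        sum≡0 : s ℕ.* s ℕ.+ suc δ ℕ.* (t ℕ.* t) ≡ 0
        sum≡0 = ℤ.+-injective (trans (sym (four-absSq a b)) (trans (cong (+ 4 *_) (ℤ.∣i∣≡0⇒i≡0 N≡0)) refl))
        square≡0 : ∀ n → n ℕ.* n ≡ 0 → n ≡ 0
        square≡0 zero _ = refl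
        t≡0 : t ≡ 0
        t≡0 = square≡0 t (ℕ.m+n≡0⇒m≡0 (t ℕ.* t) (ℕ.m+n≡0⇒n≡0 (s ℕ.* s) sum≡0))
        s≡0 : s ≡ 0
        s≡0 = square≡0 s (ℕ.m+n≡0⇒m≡0 (s ℕ.* s) sum≡0)
        b≡0 : b ≡ + 0
        b≡0 = ℤ.∣i∣≡0⇒i≡0 t≡0
        a≡0 : a ≡ + 0
        a≡0 = ℤ.*-cancelˡ-≡ (+ 2) a (+ 0) (trans (sym (trans (cong (λ b → + 2 * a + tr d * b) b≡0)
          (solve 2 (λ a r → con (+ 2) :* a :+ r :* con (+ 0) := con (+ 2) :* a) refl a (tr d)))) (ℤ.∣i∣≡0⇒i≡0 s≡0))
      triangle : ∀ k x y → k ℕ.* N (addO x y) ℕ.≤ suc k ℕ.* (N x ℕ.+ k ℕ.* N y)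
      triangle k x y = ℤ.drop‿+≤+ (ℤ.≤-trans (ℤ.≤-trans (ℤ.≤-reflexive lhs) (ℤ.≤-trans (ℤ.≤-reflexive (sym (ℤ.+-identityʳ _))) (ℤ.+-monoʳ-≤ (+ k * absSq d (addO x y)) (absSq≥0 rest)))) (ℤ.≤-reflexive (trans (parallelogram k x y) (sym rhs))))
        where
        rest : 𝒪
        rest = (re x - + k * re y) + (im x - + k * im y) ω
        lhs : + (k ℕ.* N (addO x y)) ≡ + k * absSq d (addO x y)
        lhs = trans (ℤ.pos-* k (N (addO x y))) (cong (+ k *_) (N-absSq (addO x y)))
        rhs : + (suc k ℕ.* (N x ℕ.+ k ℕ.* N y)) ≡ + suc k * (absSq d x + + k * absSq d y)
        rhs = trans (ℤ.pos-* (suc k) (N x ℕ.+ k ℕ.* N y)) (cong (+ suc k *_) (cong₂ _+_ (N-absSq x) (trans (ℤ.pos-* k (N y)) (cong (+ k *_) (N-absSq y)))))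

-- Units of norm one and the trivial solutions

module Classification where
  open import Defs
  open Algebras
  open Numerals
  open CoefficientBounds using (module Norm)
  open Reductions
  open QuadraticRing
  open import Data.Nat.Base as ℕ using (ℕ; zero; suc; z≤n; s≤s)
  import Data.Nat.Properties as ℕ
  open import Data.Integer.Base as ℤ using (ℤ; +_; -[1+_]; ∣_∣; _≤_)
  import Data.Integer.Properties as ℤ
  open import Data.Integer.Solver using (module +-*-Solver)
  open import Data.Product using (_,_)
  open import Data.Sum using (inj₁; inj₂)
  open import Data.Empty using (⊥; ⊥-elim)
  open import Relation.Nullary using (Dec; yes; no)
  open import Relation.Binary.PropositionalEquality

  module _ (d : ℕ) (1≤d : 1 ℕ.≤ d) where
    open Ring d
    open NormForm d 1≤d
    private module R = ℤAlgebra 𝒪A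
    open Reduction 𝒪A norm using (thue; thue-powers; thue-0ˡ; thue-0ʳ; no-solution)
    open CyclotomicRoots 𝒪A

    private
      addᵒ : ∀ {a b a′ b′} → a ≡ a′ → b ≡ b′ → addO a b ≡ a′ R.+ b′
      addᵒ refl refl = addO≡⊞ _ _

      mulᵒ : ∀ {a b a′ b′} → a ≡ a′ → b ≡ b′ → mulO d a b ≡ a′ R.* b′
      mulᵒ refl refl = mulO≡⊠ _ _

      subᵒ : ∀ {a b a′ b′} → a ≡ a′ → b ≡ b′ → subO a b ≡ a′ R.- b′
      subᵒ p refl = addᵒ p (negO≡⊟ _)

    powO≡ : ∀ x n → powO d x n ≡ x R.^ n
    powO≡ x zero = refl
    powO≡ x (suc n) = mulᵒ refl (powO≡ x n)

    F≡thue : ∀ t x y → F d t x y ≡ thue t x y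
    F≡thue t x y = trans
      (addᵒ (subᵒ (subᵒ (powO≡ x 4) (mulᵒ refl (mulᵒ (powO≡ x 3) refl))) (mulᵒ refl (mulᵒ (powO≡ x 2) (powO≡ y 2))))
        (addᵒ (mulᵒ refl (mulᵒ refl (powO≡ y 3))) (powO≡ y 4)))
      (thue-powers t x y)

    trace : 𝒪 → ℤ
    trace (a + b ω) = + 2 ℤ.* a ℤ.+ tr d ℤ.* b

    characteristic : ∀ z → (z R.* z R.- R.ι (trace z) R.* z) R.+ R.ι (absSq d z) ≡ R.0#
    characteristic z@(a + b ω) = trans (sym (addᵒ (subᵒ (mulO≡⊠ z z) (mulO≡⊠ (fromℤ (trace z)) z)) refl)) (cong₂ _+_ω
      (Z.solve 4 (λ a b r n → let τ = Z.con (+ 2) Z.:* a Z.:+ r Z.:* b in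
        a Z.:* a Z.:- b Z.:* b Z.:* n Z.:+ Z.:- (τ Z.:* a Z.:- Z.con (+ 0) Z.:* b Z.:* n) Z.:+ (a Z.:* a Z.:+ r Z.:* a Z.:* b Z.:+ n Z.:* b Z.:* b) Z.:= Z.con (+ 0)) refl a b (tr d) (nm d))
      (Z.solve 3 (λ a b r → let τ = Z.con (+ 2) Z.:* a Z.:+ r Z.:* b in
        a Z.:* b Z.:+ b Z.:* a Z.:+ b Z.:* b Z.:* r Z.:+ Z.:- (τ Z.:* b Z.:+ Z.con (+ 0) Z.:* a Z.:+ Z.con (+ 0) Z.:* b Z.:* r) Z.:+ Z.con (+ 0) Z.:= Z.con (+ 0)) refl a b (tr d)))
      where module Z = +-*-Solver

    double-root : ∀ z → z R.* z ≡ R.0# → z ≡ R.0#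
    double-root z eq = Norm.N≡0⇒≡0 norm z (square≡0 (N z) (trans (sym (Norm.N-* norm z z)) (trans (cong N eq) (Norm.N-0 norm))))
      where
      square≡0 : ∀ n → n ℕ.* n ≡ 0 → n ≡ 0
      square≡0 zero _ = refl

    -- Norm 1 in `four-absSq` bounds the square of the trace τ by 4. Hence z² - τz + 1 = 0 with |τ|
    -- ≤ 2: order 4, 6 or 3 for τ = 0, 1 or -1, and (z ∓ 1)² = 0 for τ = ±2, where definiteness of
    -- the norm gives z = ±1.
    unit⇒rootOfUnity : ∀ z → N z ≡ 1 → RootOfUnity d z
    unit⇒rootOfUnity z N≡1 = by-trace (trace z) refl
      where
      absSq≡1 : absSq d z ≡ + 1
      absSq≡1 = trans (sym (N-absSq z)) (cong +_ N≡1)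

      equation : ∀ τ → trace z ≡ τ → (z R.* z R.- R.ι τ R.* z) R.+ R.ι (+ 1) ≡ R.0#
      equation τ refl = trans (cong (λ n → (z R.* z R.- R.ι (trace z) R.* z) R.+ R.ι n) (sym absSq≡1)) (characteristic z)

      small-trace : ∣ trace z ∣ ℕ.* ∣ trace z ∣ ℕ.≤ 4
      small-trace = ℕ.≤-trans (ℕ.m≤m+n (∣ trace z ∣ ℕ.* ∣ trace z ∣) (suc δ ℕ.* (∣ im z ∣ ℕ.* ∣ im z ∣))) (ℕ.≤-reflexive (ℤ.+-injective (trans (sym (four-absSq (re z) (im z))) (cong (+ 4 ℤ.*_) absSq≡1))))

      by-trace : ∀ τ → trace z ≡ τ → RootOfUnity d z
      by-trace (+ 0) e = 4 , s≤s z≤n , trans (powO≡ z 4) (root-4 z (equation (+ 0) e))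
      by-trace (+ 1) e = 6 , s≤s z≤n , trans (powO≡ z 6) (root-6 z (equation (+ 1) e))
      by-trace (-[1+ 0 ]) e = 3 , s≤s z≤n , trans (powO≡ z 3) (root-3 z (equation -[1+ 0 ] e))
      by-trace (+ 2) e = 2 , s≤s z≤n , trans (powO≡ z 2) (root-1 z (double-root (z R.- R.ι (+ 1)) (trans (double-1 z) (equation (+ 2) e))))
      by-trace (-[1+ 1 ]) e = 2 , s≤s z≤n , trans (powO≡ z 2) (root-2 z (double-root (z R.+ R.ι (+ 1)) (trans (double-2 z) (equation -[1+ 1 ] e))))
      by-trace (+ suc (suc (suc n))) e = ⊥-elim (large (subst (λ τ → ∣ τ ∣ ℕ.* ∣ τ ∣ ℕ.≤ 4) e small-trace))
        where
        large : (3 ℕ.+ n) ℕ.* (3 ℕ.+ n) ℕ.≤ 4 → ⊥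
        large le with ℕ.≤-trans (ℕ.*-mono-≤ (ℕ.m≤m+n 3 n) (ℕ.m≤m+n 3 n)) le
        ... | s≤s (s≤s (s≤s (s≤s ())))
      by-trace (-[1+ suc (suc n) ]) e = ⊥-elim (large (subst (λ τ → ∣ τ ∣ ℕ.* ∣ τ ∣ ℕ.≤ 4) e small-trace))
        where
        large : (3 ℕ.+ n) ℕ.* (3 ℕ.+ n) ℕ.≤ 4 → ⊥
        large le with ℕ.≤-trans (ℕ.*-mono-≤ (ℕ.m≤m+n 3 n) (ℕ.m≤m+n 3 n)) le
        ... | s≤s (s≤s (s≤s (s≤s ())))

    fourth-power : ∀ z → N (z R.* z R.* z R.* z) ℕ.≤ 1 → N z ≢ 0 → N z ≡ 1
    fourth-power z le = unit (N z) (subst (ℕ._≤ 1) (trans (Norm.N-* norm _ z) (cong (ℕ._* N z) (trans (Norm.N-* norm _ z) (cong (ℕ._* N z) (Norm.N-* norm z z))))) le)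
      where
      unit : ∀ n → n ℕ.* n ℕ.* n ℕ.* n ℕ.≤ 1 → n ≢ 0 → n ≡ 1
      unit zero _ n≢0 = ⊥-elim (n≢0 refl)
      unit (suc zero) _ _ = refl
      unit (suc (suc n)) le _ with ℕ.≤-trans (ℕ.*-mono-≤ (ℕ.*-mono-≤ (ℕ.*-mono-≤ 2≤ 2≤) 2≤) 2≤) le
        where
        2≤ : 2 ℕ.≤ 2 ℕ.+ n
        2≤ = ℕ.m≤m+n 2 n
      ... | s≤s ()

    solutions-trivial : ∀ t → + 10000 ≤ absSq d t → ∀ x y → absSq d (F d t x y) ≤ + 1 → Trivial d x y
    solutions-trivial t large x y small = by-cases (N x ℕ.≟ 0) (N y ℕ.≟ 0)
      where
      N-F : N (thue t x y) ℕ.≤ 1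
      N-F = ℤ.drop‿+≤+ (subst (_≤ + 1) (trans (sym (N-absSq (F d t x y))) (cong (λ w → + N w) (F≡thue t x y))) small)
      N-t : K 10000 ℕ.≤ N t
      N-t = subst (ℕ._≤ N t) (sym (K≡ 10000)) (ℤ.drop‿+≤+ (subst (+ 10000 ≤_) (sym (N-absSq t)) large))
      vanish : ∀ {z} → N z ≡ 0 → z ≡ zeroO
      vanish {z} = Norm.N≡0⇒≡0 norm z
      by-cases : Dec (N x ≡ 0) → Dec (N y ≡ 0) → Trivial d x y
      by-cases (yes x0) (yes y0) = inj₁ (vanish x0 , vanish y0)
      by-cases (no x≢0) (yes y0) = inj₂ (inj₁ (unit⇒rootOfUnity x (fourth-power x
        (subst (λ w → N w ℕ.≤ 1) (trans (cong (thue t x) (vanish y0)) (thue-0ʳ t x)) N-F) x≢0) , vanish y0))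
      by-cases (yes x0) (no y≢0) = inj₂ (inj₂ (vanish x0 , unit⇒rootOfUnity y (fourth-power y
        (subst (λ w → N w ℕ.≤ 1) (trans (cong (λ x → thue t x y) (vanish x0)) (thue-0ˡ t y)) N-F) y≢0)))
      by-cases (no x≢0) (no y≢0) = ⊥-elim (no-solution t N-t x y (ℕ.≢-nonZero x≢0) (ℕ.≢-nonZero y≢0) (ℕ.≤-trans N-F (ℕ.≤-reflexive (sym (K≡ 1)))))

open import Defs
open import Data.Nat as ℕ using (ℕ)
open import Data.Integer using (+_; _≤_)

theorem2p1 : (d : ℕ) → 1 ℕ.≤ d → SquareFree d → (t : 𝒪)
    → + 10000 ≤ absSq d t
    → (x y : 𝒪) → absSq d (F d t x y) ≤ + 1
    → Trivial d x y
theorem2p1 d 1≤d _ = Classification.solutions-trivial d 1≤d
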